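{- Let $a$ and $b$ be positive integers such that $a\not\equiv 0 \pmod 4$, $b$ is squarefree, and $\mathcal{D}$ is squarefree, where $\mathcal{D}=a^2+4b$ if $a$ is odd and $\mathcal{D}=(a/2)^2+b$ if $a$ is even. Let $f(x)=x^2-ax-b\in\mathbb{Z}[x]$. Let $s\ge 1$ be an integer such that $\gcd(b,s)=1$, $\delta_p\ne 1$ for each prime divisor $p\ge 3$ of $s$, and $\delta_3=-1$ if $3\mid s$, where $\delta_p=\left(\frac{\mathcal{D}}{p}\right)$ is the Legendre symbol. For any integer $n\ge 1$, define $\mathcal{F}_n(x)=f(x^{s^n})=x^{2s^n}-ax^{s^n}-b$. Then $\mathcal{F}_n(x)$ is monogenic if and only if no prime divisor of $s$ is an $(a,b)$-Wall-Sun-Sun prime.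
   Context: Let $[U_n]$ be the Lucas sequence defined by $U_0=0$, $U_1=1$, $U_n=aU_{n-1}+bU_{n-2}$ for $n\ge 2$. For an integer $m\ge 2$ with $\gcd(b,m)=1$, the sequence $[U_n]$ is periodic modulo $m$, and $\pi(m)$ denotes the length of its period modulo $m$. An $(a,b)$-Wall-Sun-Sun prime is a prime $p$ with $\gcd(b,p)=1$ such that $\pi(p^2)=\pi(p)$. A monic polynomial $g(x)\in\mathbb{Z}[x]$ of degree $N$ is monogenic if it is irreducible over $\mathbb{Q}$ and $\{1,\theta,\ldots,\theta^{N-1}\}$ is a basis for the ring of integers of $\mathbb{Q}(\theta)$, where $g(\theta)=0$. -}

module Defs where

open import Data.Nat as ℕ using (ℕ; zero; suc; _≤_; _<_; _∸_; _≡ᵇ_)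
open import Data.Nat.DivMod using (_%_; _/_)
open import Data.Nat.Divisibility using (_∣_)
open import Data.Nat.Primality using (Prime)
open import Data.Nat.Coprimality using (Coprime)
open import Data.Integer as ℤ using (ℤ; +_)
import Data.Integer.Divisibility as ℤᵈ
open import Data.Rational as ℚ using (ℚ; 0ℚ; 1ℚ)
open import Data.Fin using (Fin; toℕ)
open import Data.Fin.Properties using (any?)
open import Data.Bool using (if_then_else_)
open import Data.Product using (Σ; ∃; _×_; _,_)
open import Relation.Nullary using (¬_; yes; no)
open import Relation.Binary.PropositionalEquality using (_≡_; _≢_)
open import Function.Bundles using (_⇔_)

SquareFree : ℕ → Set
SquareFree n = ∀ m → m ℕ.* m ∣ n → m ≡ 1

𝒟 : ℕ → ℕ → ℕ
𝒟 a b with a % 2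
... | zero  = (a / 2) ℕ.* (a / 2) ℕ.+ b
... | suc _ = a ℕ.* a ℕ.+ 4 ℕ.* b

-- Legendre symbol (D / p) for an (odd prime) p:
--   0 if p ∣ D, 1 if D is a nonzero square mod p, -1 otherwise.
-- (The value at p = 0 is irrelevant and set to 0.)
legendre : ℕ → ℕ → ℤ
legendre D zero = + 0
legendre D (suc q) with D % suc q ≡ᵇ 0
... | Data.Bool.true = + 0
... | Data.Bool.false with any? (λ (x : Fin (suc q)) →
                           (toℕ x ℕ.* toℕ x) % suc q ℕ.≟ D % suc q)
...   | yes _ = + 1
...   | no  _ = ℤ.- (+ 1)

U : ℤ → ℤ → ℕ → ℤ
U a b zero = + 0
U a b (suc zero) = + 1
U a b (suc (suc n)) = a ℤ.* U a b (suc n) ℤ.+ b ℤ.* U a b n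

IsPeriod : ℤ → ℤ → ℕ → ℕ → Set
IsPeriod a b m k = ∀ n → (+ m) ℤᵈ.∣ (U a b (n ℕ.+ k) ℤ.- U a b n)

IsPi : ℤ → ℤ → ℕ → ℕ → Set
IsPi a b m k = 1 ≤ k × IsPeriod a b m k × (∀ j → 1 ≤ j → IsPeriod a b m j → k ≤ j)

WallSunSun : ℕ → ℕ → ℕ → Set
WallSunSun a b p =
  Prime p × Coprime b p ×
  Σ ℕ (λ k → IsPi (+ a) (+ b) (p ℕ.* p) k × IsPi (+ a) (+ b) p k)

-- Polynomials, as coefficient functions ℕ → R (coefficient of xⁱ)

ℤ→ℚ : ℤ → ℚ
ℤ→ℚ z = z ℚ./ 1

sumTo : (ℕ → ℚ) → ℕ → ℚ
sumTo f zero = f 0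
sumTo f (suc k) = sumTo f k ℚ.+ f (suc k)

FinSupp : (ℕ → ℚ) → Set
FinSupp h = Σ ℕ (λ d → ∀ m → d < m → h m ≡ 0ℚ)

_⊛_ : (ℕ → ℚ) → (ℕ → ℚ) → (ℕ → ℚ)
(f ⊛ g) k = sumTo (λ i → f i ℚ.* g (k ∸ i)) k

_⊕_ : (ℕ → ℚ) → (ℕ → ℚ) → (ℕ → ℚ)
(f ⊕ g) k = f k ℚ.+ g k

scale : ℚ → (ℕ → ℚ) → (ℕ → ℚ)
scale c f k = c ℚ.* f k

one : ℕ → ℚ
one zero = 1ℚ
one (suc _) = 0ℚ

pow : (ℕ → ℚ) → ℕ → (ℕ → ℚ)
pow f zero = one
pow f (suc e) = f ⊛ pow f e

IsConstant : (ℕ → ℚ) → Set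
IsConstant h = ∀ m → 1 ≤ m → h m ≡ 0ℚ

toℚPoly : (ℕ → ℤ) → (ℕ → ℚ)
toℚPoly g k = ℤ→ℚ (g k)

IrreducibleQ : ℕ → (ℕ → ℤ) → Set
IrreducibleQ N g =
  1 ≤ N ×
  (∀ h k → FinSupp h → FinSupp k → (∀ m → (h ⊛ k) m ≡ toℚPoly g m) →
     IsConstant h Data.Sum.⊎ IsConstant k)
  where import Data.Sum

-- Elements of ℚ(θ) ≅ ℚ[x]/(g), written α = Σ_{i<N} cᵢ θⁱ.
elem : (N : ℕ) → (Fin N → ℚ) → (ℕ → ℚ)
elem N c k with k ℕ.<? N
... | yes k<N = c (Data.Fin.fromℕ< k<N)
... | no  _   = 0ℚ

DividesQ : (ℕ → ℚ) → (ℕ → ℚ) → Set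
DividesQ g P = Σ (ℕ → ℚ) (λ q → FinSupp q × (∀ m → (g ⊛ q) m ≡ P m))

IsAlgInt : (N : ℕ) → (ℕ → ℤ) → (Fin N → ℚ) → Set
IsAlgInt N g c =
  Σ ℕ (λ e → Σ (Fin e → ℤ) (λ h →
    DividesQ (toℚPoly g)
      (pow α e ⊕ sumLow e h)))
  where
  α = elem N c
  sumLow : (e : ℕ) → (Fin e → ℤ) → (ℕ → ℚ)
  sumLow zero h k = 0ℚ
  sumLow (suc e) h = scale (ℤ→ℚ (h Data.Fin.zero)) one
                     ⊕ (α ⊛ sumLow e (λ i → h (Data.Fin.suc i)))

IsIntegerQ : ℚ → Set
IsIntegerQ q = Σ ℤ (λ z → ℤ→ℚ z ≡ q)

-- g(x) monic of degree N in ℤ[x] is monogenic: irreducible over ℚ and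
-- {1, θ, …, θ^{N-1}} is a ℤ-basis of the ring of integers of ℚ(θ),
-- i.e. an element Σ cᵢθⁱ of ℚ(θ) is an algebraic integer iff all cᵢ ∈ ℤ.
Monogenic : ℕ → (ℕ → ℤ) → Set
Monogenic N g =
  IrreducibleQ N g ×
  (∀ (c : Fin N → ℚ) → IsAlgInt N g c ⇔ (∀ i → IsIntegerQ (c i)))

ℱ : ℕ → ℕ → ℕ → ℕ → (ℕ → ℤ)
ℱ a b s n k =
  if k ≡ᵇ 2 ℕ.* (s ℕ.^ n) then + 1
  else if k ≡ᵇ s ℕ.^ n then ℤ.- (+ a)
  else if k ≡ᵇ 0 then ℤ.- (+ b)
  else + 0

{-# OPTIONS --safe #-}
-- Let M = s^n, A = ℤ[x]/(f(x^M)) = ℤ[θ] and ω = θ^M, a root of f.  Suppose that for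
-- every prime p there are π, w, u in A with π^E w = p u, where u and w are
-- non-zero-divisors modulo (π, p) and the quotients by (π, p) and (w, p) are reduced.
-- Then divisibility by p in the integral closure implies divisibility by p in A (one
-- factor π at a time), so A is integrally closed.  Reducedness holds because a power
-- of Frobenius fixes θ.  At an inert prime p of s, with M = m q and q the largest
-- power of p dividing M, take π = θ^m - ω^q; then π^q = p u, where u is a unit modulo
-- (π, p) exactly when ω^(p²) ≢ ω modulo p², that is, when p is not a Wall-Sun-Sun
-- prime.  At a Wall-Sun-Sun prime, with M = m p, (θ^m - ω^p)^(p-1) / p is integral
-- but not in A.
--
-- Irreducibility of f(x^M) is deduced from A having no nontrivial idempotents.  If ε
-- is one, ε = ε^(p^j) for all j shows that only exponents divisible by p occur in ε;
-- repeating this for the primes p ∣ M puts ε in ℤ[ω].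
module Submission where

open import Defs
open import Level using (0ℓ)
open import Algebra.Bundles using (CommutativeRing)
import Algebra.Solver.Ring
import Algebra.Solver.Ring.AlmostCommutativeRing as ACR
import Algebra.Properties.CommutativeSemiring.Exp
import Algebra.Properties.CommutativeSemiring.Binomial
import Algebra.Properties.Semiring.Mult.TCOptimised
import Algebra.Properties.Semiring.Sum
import Algebra.Properties.Ring
import Algebra.Properties.AbelianGroup
open import Data.Nat as ℕ using (ℕ; zero; suc; z≤n; s≤s)
import Data.Nat.Properties as ℕₚ
open import Data.Nat.Divisibility as ℕᵈ using (divides)
import Data.Nat.DivMod as ℕᵐ
open import Data.Nat.Primality as Prm using (Prime)
open import Data.Nat.Combinatorics using (_C_; nCn≡1; nC1≡n; nCk≡n!/k![n-k]!; k![n∸k]!∣n!)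
open import Data.Nat.Primality.Factorisation using (PrimeFactorisation; factorise)
import Data.Nat.Coprimality as Cop
open import Data.Nat.GCD using (module Bézout)
open import Data.Nat.Induction using (<-rec)
open import Data.Integer as ℤ using (ℤ; +_; -[1+_])
import Data.Integer.Properties as ℤₚ
import Data.Integer.Divisibility.Signed as ℤˢ
import Data.Integer.Solver
import Data.Nat.Solver
import Data.Integer.DivMod as ℤᵐ
open import Data.Rational as ℚ using (ℚ; 0ℚ; 1ℚ)
import Data.Rational.Properties as ℚₚ
open import Data.Rational.Unnormalised as ℚᵘ using (mkℚᵘ; *≡*)
import Data.Rational.Unnormalised.Properties as ℚᵘₚ
open import Data.Fin as Fin using (Fin; toℕ; fromℕ; fromℕ<)
import Data.Fin.Properties as Finₚ
open import Data.Bool using (Bool; true; false; if_then_else_)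
open import Data.List using (List; []; _∷_; _++_)
open import Data.Nat.ListAction using (product)
open import Data.List.Relation.Unary.All using (All; []; _∷_)
open import Data.List.Relation.Unary.Any using (here; there)
open import Data.List.Membership.Propositional using (_∈_)
import Data.List.Membership.Propositional.Properties as ∈ₚ
open import Data.Unit using (tt)
open import Data.Empty using (⊥; ⊥-elim)
open import Data.Sum using (_⊎_; inj₁; inj₂)
open import Data.Maybe.Base using (Maybe; just; nothing)
open import Data.Product using (Σ; _×_; _,_; proj₁; proj₂)
open import Function.Bundles using (_⇔_; mk⇔; module Equivalence)
open import Relation.Nullary using (¬_; Dec; yes; no; recompute)
open import Relation.Binary.PropositionalEquality as ≡ using (_≡_; _≢_)

-- While `A` is shown to be integrally closed it is not known to be a domain, because irreducibility
-- is deduced from closedness. So nothing may rest on valuations or a fraction field: the arguments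
-- use cancellation of integers, computations modulo `(π, p)`, and bounded denominators of the
-- powers of an element. The Lucas sequence enters through `ω ^ (n + 1) = b U_n + U_(n+1) ω`: the
-- periods of `U` modulo an integer are the exponents `k` with `ω ^ k ≡ 1` in `ℤ[ω]`. For `p` prime
-- to `b` and to `Δ = a² + 4b` one has `ω ^ (p²) ≡ ω` modulo `p`, and the periods modulo `p` and
-- `p²` agree exactly when `p` divides `μ = (ω ^ (p²) - ω) / p`. At an inert `p` the only
-- alternative is that `μ` is a unit modulo `p`. A prime dividing `Δ` but not `b` gets the
-- uniformizer `θ ^ m - r`, where the integer `r` has a power that is a double root modulo `p`. Such
-- a prime of `s` is never a Wall-Sun-Sun prime: `4 ∤ a` settles `p = 2`, the condition on `δ_3`
-- excludes `p = 3`, and a computation modulo `p²` settles `p ≥ 5`.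

CRing : Set₁
CRing = CommutativeRing 0ℓ 0ℓ

ℤ-ring : CRing
ℤ-ring = ℤₚ.+-*-commutativeRing

-- Powers and multiples of 1 depend on the operations only, so that they are
-- definitionally the same in a ring and in its quotients.
powerBy : {A : Set} → (A → A → A) → A → A → ℕ → A
powerBy _∙_ ε x zero = ε
powerBy _∙_ ε x (suc n) = x ∙ powerBy _∙_ ε x n

multipleOf1 : {A : Set} → (A → A → A) → A → A → ℕ → A
multipleOf1 _∙_ ε u zero = ε
multipleOf1 _∙_ ε u (suc zero) = u
multipleOf1 _∙_ ε u (suc (suc n)) = multipleOf1 _∙_ ε u (suc n) ∙ u

fromℤ : {A : Set} → (A → A → A) → (A → A) → A → A → ℤ → A
fromℤ _∙_ inv ε u (+ n) = multipleOf1 _∙_ ε u n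
fromℤ _∙_ inv ε u -[1+ n ] = inv (multipleOf1 _∙_ ε u (suc n))

-- Toolkit for a commutative ring: powers, the map from ℤ, a ring solver, divisibility

module Kit (R : CRing) where
  open CommutativeRing R public using
    ( Carrier; _≈_; _+_; _*_; -_; _-_; 0#; 1#; refl; sym; trans; reflexive; setoid
    ; +-cong; +-congˡ; +-congʳ; +-assoc; +-comm; +-identityˡ; +-identityʳ
    ; *-cong; *-congˡ; *-congʳ; *-assoc; *-comm; *-identityˡ; *-identityʳ
    ; distribˡ; distribʳ; zeroˡ; zeroʳ; -‿cong; -‿inverseˡ; -‿inverseʳ )
  open CommutativeRing R using (ring; +-abelianGroup; semiring; commutativeSemiring)
  private
    module Exp = Algebra.Properties.CommutativeSemiring.Exp commutativeSemiring
    module Mult = Algebra.Properties.Semiring.Mult.TCOptimised semiring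
    module Rp = Algebra.Properties.Ring ring
    module Gp = Algebra.Properties.AbelianGroup +-abelianGroup

  module ≈R where
    infix 1 begin_
    infixr 2 _≈⟨_⟩_ _≈⟨_⟨_ _≡⟨_⟩_ _≡⟨_⟨_
    infix 3 _∎

    begin_ : ∀ {x y} → x ≈ y → x ≈ y
    begin e = e

    _≈⟨_⟩_ : ∀ x {y z} → x ≈ y → y ≈ z → x ≈ z
    x ≈⟨ e ⟩ f = trans e f

    _≈⟨_⟨_ : ∀ x {y z} → y ≈ x → y ≈ z → x ≈ z
    x ≈⟨ e ⟨ f = trans (sym e) f

    _≡⟨_⟩_ : ∀ x {y z} → x ≡ y → y ≈ z → x ≈ z
    x ≡⟨ ≡.refl ⟩ f = f

    _≡⟨_⟨_ : ∀ x {y z} → y ≡ x → y ≈ z → x ≈ z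
    x ≡⟨ ≡.refl ⟨ f = f

    _∎ : ∀ x → x ≈ x
    x ∎ = refl

  infixr 8 _^_
  _^_ : Carrier → ℕ → Carrier
  _^_ = powerBy _*_ 1#

  private
    ^≡ : ∀ x n → x ^ n ≡ x Exp.^ n
    ^≡ x zero = ≡.refl
    ^≡ x (suc n) = ≡.cong (x *_) (^≡ x n)

  ^-congˡ : ∀ n {x y} → x ≈ y → x ^ n ≈ y ^ n
  ^-congˡ zero _ = refl
  ^-congˡ (suc n) e = *-cong e (^-congˡ n e)

  ^-homo-* : ∀ x m n → x ^ (m ℕ.+ n) ≈ x ^ m * x ^ n
  ^-homo-* x m n rewrite ^≡ x (m ℕ.+ n) | ^≡ x m | ^≡ x n = Exp.^-homo-* x m n

  ^-assocʳ : ∀ x m n → (x ^ m) ^ n ≈ x ^ (m ℕ.* n)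
  ^-assocʳ x m n rewrite ^≡ (x ^ m) n | ^≡ x m | ^≡ x (m ℕ.* n) = Exp.^-assocʳ x m n

  ^-distrib-* : ∀ x y n → (x * y) ^ n ≈ x ^ n * y ^ n
  ^-distrib-* x y n rewrite ^≡ (x * y) n | ^≡ x n | ^≡ y n = Exp.^-distrib-* x y n

  -- The unique ring map from ℤ. As coefficient morphism of the solver it lets identities with
  -- numerals be checked in every ring, quotients included.
  ι : ℤ → Carrier
  ι = fromℤ _+_ -_ 0# 1#

  private
    nat : ℕ → Carrier
    nat = multipleOf1 _+_ 0# 1#

    nat≡ : ∀ n → nat n ≡ n Mult.× 1#
    nat≡ zero = ≡.refl
    nat≡ (suc zero) = ≡.refl
    nat≡ (suc (suc n)) = ≡.cong (_+ 1#) (nat≡ (suc n))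

    nat-suc : ∀ n → nat (suc n) ≈ 1# + nat n
    nat-suc n rewrite nat≡ (suc n) | nat≡ n = Mult.1+× n 1#

    nat-+ : ∀ m n → nat (m ℕ.+ n) ≈ nat m + nat n
    nat-+ m n rewrite nat≡ (m ℕ.+ n) | nat≡ m | nat≡ n = Mult.×-homo-+ 1# m n

    nat-* : ∀ m n → nat (m ℕ.* n) ≈ nat m * nat n
    nat-* m n rewrite nat≡ (m ℕ.* n) | nat≡ m | nat≡ n = Mult.×1-homo-* m n

  private
    ι-⊖ : ∀ m n → ι (m ℤ.⊖ n) ≈ nat m - nat n
    ι-⊖ m zero = sym (trans (+-congˡ Gp.ε⁻¹≈ε) (+-identityʳ _))
    ι-⊖ zero (suc n) = sym (+-identityˡ _)
    ι-⊖ (suc m) (suc n) = begin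
      ι (suc m ℤ.⊖ suc n) ≡⟨ ≡.cong ι (ℤₚ.[1+m]⊖[1+n]≡m⊖n m n) ⟩
      ι (m ℤ.⊖ n) ≈⟨ ι-⊖ m n ⟩
      nat m - nat n ≈⟨ shift (nat m) (nat n) ⟩
      (1# + nat m) - (1# + nat n)
        ≈⟨ +-cong (nat-suc m) (-‿cong (nat-suc n)) ⟨
      nat (suc m) - nat (suc n) ∎
      where
      open ≈R
      shift : ∀ x y → x - y ≈ (1# + x) - (1# + y)
      shift x y = begin
        x - y ≈⟨ +-congʳ (+-identityˡ x) ⟨
        (0# + x) - y ≈⟨ +-congʳ (+-congʳ (-‿inverseʳ 1#)) ⟨
        ((1# - 1#) + x) - y ≈⟨ +-congʳ (+-assoc _ _ _) ⟩
        (1# + (- 1# + x)) - y ≈⟨ +-congʳ (+-congˡ (+-comm _ _)) ⟩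
        (1# + (x - 1#)) - y ≈⟨ +-congʳ (+-assoc _ _ _) ⟨
        ((1# + x) - 1#) - y ≈⟨ +-assoc _ _ _ ⟩
        (1# + x) + (- 1# - y) ≈⟨ +-congˡ (Gp.⁻¹-∙-comm 1# y) ⟩
        (1# + x) - (1# + y) ∎

  ι-+ : ∀ x y → ι (x ℤ.+ y) ≈ ι x + ι y
  ι-+ (+ m) (+ n) = nat-+ m n
  ι-+ (+ m) -[1+ n ] = ι-⊖ m (suc n)
  ι-+ -[1+ m ] (+ n) = trans (ι-⊖ n (suc m)) (+-comm _ _)
  ι-+ -[1+ m ] -[1+ n ] = begin
    - nat (suc (suc (m ℕ.+ n))) ≡⟨ ≡.cong (λ k → - nat (suc k)) (≡.sym (ℕₚ.+-suc m n)) ⟩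
    - nat (suc m ℕ.+ suc n) ≈⟨ -‿cong (nat-+ (suc m) (suc n)) ⟩
    - (nat (suc m) + nat (suc n)) ≈⟨ Gp.⁻¹-∙-comm _ _ ⟨
    - nat (suc m) - nat (suc n) ∎
    where open ≈R

  ι-neg : ∀ x → ι (ℤ.- x) ≈ - ι x
  ι-neg (+ zero) = sym Gp.ε⁻¹≈ε
  ι-neg (+ suc n) = refl
  ι-neg -[1+ n ] = sym (Gp.⁻¹-involutive _)

  private
    ι-*ₙ : ∀ m x → ι (+ m ℤ.* x) ≈ ι (+ m) * ι x
    ι-*ₙ m (+ n) = trans (reflexive (≡.cong ι (≡.sym (ℤₚ.pos-* m n)))) (nat-* m n)
    ι-*ₙ m -[1+ n ] = begin
      ι (+ m ℤ.* -[1+ n ]) ≡⟨ ≡.cong ι (≡.sym (ℤₚ.neg-distribʳ-* (+ m) (+ suc n))) ⟩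
      ι (ℤ.- (+ m ℤ.* + suc n)) ≈⟨ ι-neg (+ m ℤ.* + suc n) ⟩
      - ι (+ m ℤ.* + suc n) ≈⟨ -‿cong (ι-*ₙ m (+ suc n)) ⟩
      - (ι (+ m) * ι (+ suc n)) ≈⟨ Rp.-‿distribʳ-* _ _ ⟩
      ι (+ m) * - ι (+ suc n) ∎
      where open ≈R

  ι-* : ∀ x y → ι (x ℤ.* y) ≈ ι x * ι y
  ι-* (+ m) y = ι-*ₙ m y
  ι-* -[1+ m ] y = begin
    ι (-[1+ m ] ℤ.* y) ≡⟨ ≡.cong ι (≡.sym (ℤₚ.neg-distribˡ-* (+ suc m) y)) ⟩
    ι (ℤ.- (+ suc m ℤ.* y)) ≈⟨ ι-neg (+ suc m ℤ.* y) ⟩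
    - ι (+ suc m ℤ.* y) ≈⟨ -‿cong (ι-*ₙ (suc m) y) ⟩
    - (ι (+ suc m) * ι y) ≈⟨ Rp.-‿distribˡ-* _ _ ⟩
    - ι (+ suc m) * ι y ∎
    where open ≈R

  private
    ι≟ : ∀ x y → Maybe (ι x ≈ ι y)
    ι≟ x y with x ℤ.≟ y
    ... | yes x≡y = just (reflexive (≡.cong ι x≡y))
    ... | no _ = nothing

  private
    ι-morphism : CommutativeRing.rawRing ℤ-ring ACR.-Raw-AlmostCommutative⟶ ACR.fromCommutativeRing R
    ι-morphism = record { ⟦_⟧ = ι ; +-homo = ι-+ ; *-homo = ι-* ; -‿homo = ι-neg ; 0-homo = refl ; 1-homo = refl }

    module Solve = Algebra.Solver.Ring (CommutativeRing.rawRing ℤ-ring) (ACR.fromCommutativeRing R) ι-morphism ι≟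
  open Solve public using (solve; _:=_; _:+_; _:*_; _:-_; :-_; con; _:^_)

  infix 4 _∣_
  _∣_ : Carrier → Carrier → Set
  x ∣ y = Σ Carrier λ q → y ≈ x * q

  ∣-resp : ∀ {x y z} → y ≈ z → x ∣ y → x ∣ z
  ∣-resp y≈z (q , e) = q , trans (sym y≈z) e

  ∣-+ : ∀ {x y z} → x ∣ y → x ∣ z → x ∣ y + z
  ∣-+ {x} (q , e) (q' , e') = q + q' , trans (+-cong e e') (sym (distribˡ x q q'))

  ∣-neg : ∀ {x y} → x ∣ y → x ∣ - y
  ∣-neg {x} (q , e) = - q , trans (-‿cong e) (Rp.-‿distribʳ-* x q)

  ∣-*ʳ : ∀ {x y} z → x ∣ y → x ∣ y * z
  ∣-*ʳ {x} z (q , e) = q * z , trans (*-congʳ e) (*-assoc x q z)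

  ∣-*ˡ : ∀ {x y} z → x ∣ y → x ∣ z * y
  ∣-*ˡ z d = ∣-resp (*-comm _ z) (∣-*ʳ z d)

  ∣-refl : ∀ {x} → x ∣ x
  ∣-refl = 1# , sym (*-identityʳ _)

  ∣-self : ∀ {x} y → x ∣ x * y
  ∣-self y = y , refl

  ∣-trans : ∀ {x y z} → x ∣ y → y ∣ z → x ∣ z
  ∣-trans {x} (q , e) (q' , e') = q * q' , trans e' (trans (*-congʳ e) (*-assoc x q q'))

  ∣-0 : ∀ {x} → x ∣ 0#
  ∣-0 {x} = 0# , sym (zeroʳ x)

  1∣ : ∀ x → 1# ∣ x
  1∣ x = x , sym (*-identityˡ x)

  ∣-*-mono : ∀ {x y u v} → x ∣ u → y ∣ v → x * y ∣ u * v
  ∣-*-mono {x} {y} (q , e) (q' , e') = q * q' ,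
    trans (*-cong e e')
      (solve 4 (λ x y q q' → (x :* q) :* (y :* q') := (x :* y) :* (q :* q')) refl x y q q')

  ^-∣ : ∀ x {m n} → m ℕ.≤ n → x ^ m ∣ x ^ n
  ^-∣ x {m} m≤n with ℕₚ.m≤n⇒∃[o]m+o≡n m≤n
  ... | o , ≡.refl = x ^ o , ^-homo-* x m o

  ^-∣-^ : ∀ {x y} n → x ∣ y → x ^ n ∣ y ^ n
  ^-∣-^ zero _ = ∣-refl
  ^-∣-^ (suc n) d = ∣-*-mono d (^-∣-^ n d)

  1^ : ∀ n → 1# ^ n ≈ 1#
  1^ zero = refl
  1^ (suc n) = trans (*-identityˡ _) (1^ n)

  ^-expand : ∀ x y n → Σ Carrier λ z → (x + y) ^ n ≈ x ^ n + y * z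
  ^-expand x y zero = 0# , sym (trans (+-congˡ (zeroʳ y)) (+-identityʳ 1#))
  ^-expand x y (suc n) with ^-expand x y n
  ... | z , e = x * z + (x ^ n + y * z) , trans (*-congˡ e)
    (solve 4 (λ x y z t → (x :+ y) :* (t :+ y :* z) := x :* t :+ y :* (x :* z :+ (t :+ y :* z)))
      refl x y z (x ^ n))

  ^-pos : ∀ x {n} → 1 ℕ.≤ n → Σ Carrier λ z → x ^ n ≈ x * z
  ^-pos x {suc n} _ = x ^ n , refl

  x-y≈0⇒x≈y : ∀ {x y} → x - y ≈ 0# → x ≈ y
  x-y≈0⇒x≈y = Gp.x∙y⁻¹≈ε⇒x≈y _ _

  x≈y⇒x-y≈0 : ∀ {x y} → x ≈ y → x - y ≈ 0#
  x≈y⇒x-y≈0 = Gp.x≈y⇒x∙y⁻¹≈ε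

-- Quotients by a principal ideal

record Congruent (R : CRing) (a x y : CommutativeRing.Carrier R) : Set where
  constructor by
  open Kit R
  field
    quotient : Carrier
    equality : x ≈ y + a * quotient

-- Carrier and operations are kept and only the equality is coarsened. Elements pass to a quotient
-- without a map, and a quotient by two elements is an iterated `Quot`.
Quot : (R : CRing) → CommutativeRing.Carrier R → CRing
Quot R a = record
  { Carrier = Carrier
  ; _≈_ = Congruent R a
  ; _+_ = _+_ ; _*_ = _*_ ; -_ = -_ ; 0# = 0# ; 1# = 1#
  ; isCommutativeRing = record
    { isRing = record
      { +-isAbelianGroup = record
        { isGroup = record
          { isMonoid = record
            { isSemigroup = record
              { isMagma = record
                { isEquivalence = record { refl = emb refl ; sym = qsym ; trans = qtrans }
                ; ∙-cong = λ { {x} {y} {u} {v} (by q e) (by r f) → by (q + r) (trans (+-cong e f)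
                    (solve 5 (λ y v a q r → (y :+ a :* q) :+ (v :+ a :* r) := (y :+ v) :+ a :* (q :+ r)) refl y v a q r)) } }
              ; assoc = λ x y z → emb (+-assoc x y z) }
            ; identity = (λ x → emb (+-identityˡ x)) , (λ x → emb (+-identityʳ x)) }
          ; inverse = (λ x → emb (-‿inverseˡ x)) , (λ x → emb (-‿inverseʳ x))
          ; ⁻¹-cong = λ { {x} {y} (by q e) → by (- q) (trans (-‿cong e)
              (solve 3 (λ y a q → :- (y :+ a :* q) := (:- y) :+ a :* (:- q)) refl y a q)) } }
        ; comm = λ x y → emb (+-comm x y) }
      ; *-cong = λ { {x} {y} {u} {v} (by q e) (by r f) → by (q * v + y * r + a * q * r) (trans (*-cong e f)
          (solve 5 (λ y v a q r → (y :+ a :* q) :* (v :+ a :* r)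
                     := (y :* v) :+ a :* (q :* v :+ y :* r :+ a :* q :* r)) refl y v a q r)) }
      ; *-assoc = λ x y z → emb (*-assoc x y z)
      ; *-identity = (λ x → emb (*-identityˡ x)) , (λ x → emb (*-identityʳ x))
      ; distrib = (λ x y z → emb (distribˡ x y z)) , (λ x y z → emb (distribʳ x y z)) }
    ; *-comm = λ x y → emb (*-comm x y) } }
  where
  open Kit R
  emb : ∀ {x y} → x ≈ y → Congruent R a x y
  emb {x} {y} e = by 0# (trans e (sym (trans (+-congˡ (zeroʳ a)) (+-identityʳ y))))
  qsym : ∀ {x y} → Congruent R a x y → Congruent R a y x
  qsym {x} {y} (by q e) = by (- q) (trans
    (solve 3 (λ y a q → y := (y :+ a :* q) :+ a :* (:- q)) refl y a q) (+-congʳ (sym e)))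
  qtrans : ∀ {x y z} → Congruent R a x y → Congruent R a y z → Congruent R a x z
  qtrans {x} {y} {z} (by q e) (by r f) = by (r + q) (trans e (trans (+-congʳ f)
    (solve 4 (λ z a q r → (z :+ a :* r) :+ a :* q := z :+ a :* (r :+ q)) refl z a q r)))

module Congruence (R : CRing) (a : CommutativeRing.Carrier R) where
  open Kit R

  ≈⇒≈/ : ∀ {x y} → x ≈ y → Congruent R a x y
  ≈⇒≈/ {x} {y} e = by 0# (trans e (sym (trans (+-congˡ (zeroʳ a)) (+-identityʳ y))))

  ≈/0⇒∣ : ∀ {x} → Congruent R a x 0# → a ∣ x
  ≈/0⇒∣ (by q e) = q , trans e (+-identityˡ _)

  ∣⇒≈/0 : ∀ {x} → a ∣ x → Congruent R a x 0#
  ∣⇒≈/0 (q , e) = by q (trans e (sym (+-identityˡ _)))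

  ≈/⇒∣- : ∀ {x y} → Congruent R a x y → a ∣ x - y
  ≈/⇒∣- {x} {y} (by q e) = q , trans (+-congʳ e) (solve 2 (λ y t → (y :+ t) :- y := t) refl y (a * q))

  a≈/0 : Congruent R a a 0#
  a≈/0 = ∣⇒≈/0 ∣-refl

module QuotKit (R : CRing) (a : CommutativeRing.Carrier R) where
  open Congruence R a public
  module Q = Kit (Quot R a)

-- Ring homomorphisms

record Hom (R S : CRing) : Set where
  private
    module R = Kit R
    module S = Kit S
  field
    ⟦_⟧ : R.Carrier → S.Carrier
    cong : ∀ {x y} → x R.≈ y → ⟦ x ⟧ S.≈ ⟦ y ⟧
    +-hom : ∀ x y → ⟦ x R.+ y ⟧ S.≈ ⟦ x ⟧ S.+ ⟦ y ⟧
    *-hom : ∀ x y → ⟦ x R.* y ⟧ S.≈ ⟦ x ⟧ S.* ⟦ y ⟧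
    1-hom : ⟦ R.1# ⟧ S.≈ S.1#

  0-hom : ⟦ R.0# ⟧ S.≈ S.0#
  0-hom = S.trans (S.sym (S.+-identityʳ _)) (S.trans (S.+-congˡ (S.sym (S.-‿inverseʳ ⟦ R.0# ⟧)))
    (S.trans (S.sym (S.+-assoc _ _ _)) (S.trans (S.+-congʳ (S.trans (S.sym (+-hom R.0# R.0#))
      (cong (R.+-identityʳ R.0#)))) (S.-‿inverseʳ _))))

  neg-hom : ∀ x → ⟦ R.- x ⟧ S.≈ S.- ⟦ x ⟧
  neg-hom x = S.x-y≈0⇒x≈y (S.trans
    (S.solve 2 (λ u v → u S.:- (S.:- v) S.:= v S.:+ u) S.refl ⟦ R.- x ⟧ ⟦ x ⟧)
    (S.trans (S.sym (+-hom x (R.- x))) (S.trans (cong (R.-‿inverseʳ x)) 0-hom)))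

  ^-hom : ∀ x n → ⟦ x R.^ n ⟧ S.≈ ⟦ x ⟧ S.^ n
  ^-hom x zero = 1-hom
  ^-hom x (suc n) = S.trans (*-hom x (x R.^ n)) (S.*-congˡ (^-hom x n))

  ι-hom : ∀ z → ⟦ R.ι z ⟧ S.≈ S.ι z
  ι-hom (+ zero) = 0-hom
  ι-hom (+ suc n) = suc-case n
    where
    suc-case : ∀ n → ⟦ R.ι (+ suc n) ⟧ S.≈ S.ι (+ suc n)
    suc-case zero = 1-hom
    suc-case (suc n) = S.trans (cong (R.ι-+ (+ 1) (+ suc n))) (S.trans (+-hom _ _)
      (S.trans (S.+-cong 1-hom (suc-case n)) (S.sym (S.ι-+ (+ 1) (+ suc n)))))
  ι-hom -[1+ n ] = S.trans (neg-hom _) (S.-‿cong (ι-hom (+ suc n)))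

-- `ι` builds a numeral by repeated addition of 1, so over ℤ it agrees with the identity by
-- induction and not by computation.
ι-ℤ : ∀ z → Kit.ι ℤ-ring z ≡ z
ι-ℤ (+ zero) = ≡.refl
ι-ℤ (+ suc n) = go n
  where
  go : ∀ n → Kit.ι ℤ-ring (+ suc n) ≡ + suc n
  go zero = ≡.refl
  go (suc n) = ≡.trans (Kit.ι-+ ℤ-ring (+ 1) (+ suc n)) (≡.cong (ℤ._+_ (+ 1)) (go n))
ι-ℤ -[1+ n ] = ≡.cong ℤ.-_ (ι-ℤ (+ suc n))

-- Integers modulo a prime

infix 4 _∣ᶻ_
_∣ᶻ_ : ℤ → ℤ → Set
_∣ᶻ_ = ℤˢ._∣_

∣ᶻ⇒∣ : ∀ {m z} → + m ∣ᶻ z → m ℕᵈ.∣ ℤ.∣ z ∣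
∣ᶻ⇒∣ = ℤˢ.∣⇒∣ᵤ

∣⇒∣ᶻ : ∀ {m z} → m ℕᵈ.∣ ℤ.∣ z ∣ → + m ∣ᶻ z
∣⇒∣ᶻ = ℤˢ.∣ᵤ⇒∣

_∣ᶻ?_ : ∀ m z → Dec (+ m ∣ᶻ z)
m ∣ᶻ? z with m ℕᵈ.∣? ℤ.∣ z ∣
... | yes d = yes (∣⇒∣ᶻ d)
... | no ¬d = no λ d → ¬d (∣ᶻ⇒∣ d)

prime>1 : ∀ {p} → Prime p → 2 ℕ.≤ p
prime>1 {zero} pp = ⊥-elim (Prm.¬prime[0] pp)
prime>1 {suc zero} pp = ⊥-elim (Prm.¬prime[1] pp)
prime>1 {suc (suc p)} pp = s≤s (s≤s z≤n)

euclidᶻ : ∀ {p} → Prime p → ∀ x y → + p ∣ᶻ x ℤ.* y → + p ∣ᶻ x ⊎ + p ∣ᶻ y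
euclidᶻ pp x y d with Prm.euclidsLemma ℤ.∣ x ∣ ℤ.∣ y ∣ pp (≡.subst (_ ℕᵈ.∣_) (ℤₚ.abs-* x y) (∣ᶻ⇒∣ d))
... | inj₁ e = inj₁ (∣⇒∣ᶻ e)
... | inj₂ e = inj₂ (∣⇒∣ᶻ e)

prime∤1 : ∀ {p} → Prime p → ¬ (+ p ∣ᶻ + 1)
prime∤1 pp d = Prm.¬prime[1] (≡.subst Prime (ℕᵈ.∣1⇒≡1 (∣ᶻ⇒∣ {z = + 1} d)) pp)

prime∤⇒coprime : ∀ {p} n → Prime p → ¬ (p ℕᵈ.∣ n) → Cop.Coprime p n
prime∤⇒coprime n pp p∤n (d∣p , d∣n) with Prm.prime⇒irreducible pp d∣p
... | inj₁ d≡1 = d≡1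
... | inj₂ ≡.refl = ⊥-elim (p∤n d∣n)

coprime⇒inverse : ∀ {m n} → Cop.Coprime m n → Σ ℤ λ u → + m ∣ᶻ + n ℤ.* u ℤ.- + 1
coprime⇒inverse {m} {n} c with Cop.coprime-Bézout c
... | Bézout.+- x y eq = ℤ.- + y , ℤˢ.divides (ℤ.- + x) (begin
    + n ℤ.* (ℤ.- + y) ℤ.- + 1
      ≡⟨ solve 2 (λ n y → n :* (:- y) :- con (+ 1) := :- (con (+ 1) :+ y :* n)) ≡.refl (+ n) (+ y) ⟩
    ℤ.- (+ 1 ℤ.+ + y ℤ.* + n) ≡⟨ ≡.cong (λ t → ℤ.- (+ 1 ℤ.+ t)) (ℤₚ.pos-* y n) ⟨
    ℤ.- (+ (1 ℕ.+ y ℕ.* n)) ≡⟨ ≡.cong (λ t → ℤ.- + t) eq ⟩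
    ℤ.- (+ (x ℕ.* m)) ≡⟨ ≡.cong ℤ.-_ (ℤₚ.pos-* x m) ⟩
    ℤ.- (+ x ℤ.* + m) ≡⟨ solve 2 (λ x m → :- (x :* m) := (:- x) :* m) ≡.refl (+ x) (+ m) ⟩
    (ℤ.- + x) ℤ.* + m ∎)
  where
  open ≡.≡-Reasoning
  open Data.Integer.Solver.+-*-Solver
... | Bézout.-+ x y eq = + y , ℤˢ.divides (+ x) (begin
    + n ℤ.* + y ℤ.- + 1 ≡⟨ ≡.cong (ℤ._- + 1) (≡.trans (ℤₚ.*-comm (+ n) (+ y)) (≡.sym (ℤₚ.pos-* y n))) ⟩
    + (y ℕ.* n) ℤ.- + 1 ≡⟨ ≡.cong (λ t → + t ℤ.- + 1) eq ⟨
    + (1 ℕ.+ x ℕ.* m) ℤ.- + 1 ≡⟨ ≡.cong (λ t → + 1 ℤ.+ t ℤ.- + 1) (ℤₚ.pos-* x m) ⟩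
    + 1 ℤ.+ + x ℤ.* + m ℤ.- + 1
      ≡⟨ solve 2 (λ x m → con (+ 1) :+ x :* m :- con (+ 1) := x :* m) ≡.refl (+ x) (+ m) ⟩
    + x ℤ.* + m ∎)
  where
  open ≡.≡-Reasoning
  open Data.Integer.Solver.+-*-Solver

inverse-mod-prime : ∀ {p} → Prime p → ∀ z → ¬ (+ p ∣ᶻ z) → Σ ℤ λ u → + p ∣ᶻ z ℤ.* u ℤ.- + 1
inverse-mod-prime pp (+ n) p∤z = coprime⇒inverse (prime∤⇒coprime n pp λ d → p∤z (∣⇒∣ᶻ d))
inverse-mod-prime pp z@(-[1+ n ]) p∤z
  with coprime⇒inverse (prime∤⇒coprime (suc n) pp λ d → p∤z (∣⇒∣ᶻ d))
... | u , ℤˢ.divides q e = ℤ.- u , ℤˢ.divides q (≡.trans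
      (solve 2 (λ z u → (:- z) :* (:- u) :- con (+ 1) := z :* u :- con (+ 1)) ≡.refl (+ suc n) u) e)
  where open Data.Integer.Solver.+-*-Solver

-- The product `(p C k) k! (p - k)! = p!` is divisible by `p`, while the factorial of a number below
-- `p` is not.
prime∣pCk : ∀ {p k} → Prime p → 1 ℕ.≤ k → k ℕ.< p → p ℕᵈ.∣ p C k
prime∣pCk {p} {k} pp 1≤k k<p = elim (Prm.euclidsLemma (p C k) (k ℕ.! ℕ.* (p ℕ.∸ k) ℕ.!) pp
    (≡.subst (p ℕᵈ.∣_) (≡.sym C*≡p!) (p∣p! p (ℕₚ.<-trans (s≤s z≤n) (prime>1 pp)))))
  where
  instance
    _ : ℕ.NonZero (k ℕ.! ℕ.* (p ℕ.∸ k) ℕ.!)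
    _ = k ℕₚ.!* (p ℕ.∸ k) !≢0
  C*≡p! : (p C k) ℕ.* (k ℕ.! ℕ.* (p ℕ.∸ k) ℕ.!) ≡ p ℕ.!
  C*≡p! = ≡.trans (≡.cong (ℕ._* (k ℕ.! ℕ.* (p ℕ.∸ k) ℕ.!)) (nCk≡n!/k![n-k]! (ℕₚ.<⇒≤ k<p)))
    (ℕᵐ.m/n*n≡m (k![n∸k]!∣n! (ℕₚ.<⇒≤ k<p)))
  p∣p! : ∀ n → 1 ℕ.≤ n → n ℕᵈ.∣ n ℕ.!
  p∣p! (suc n) _ = ℕᵈ.m∣m*n (n ℕ.!)
  p∤j! : ∀ j → j ℕ.< p → ¬ (p ℕᵈ.∣ j ℕ.!)
  p∤j! zero _ d = prime∤1 pp (∣⇒∣ᶻ d)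
  p∤j! (suc j) j<p d with Prm.euclidsLemma (suc j) (j ℕ.!) pp d
  ... | inj₁ e = ℕₚ.<⇒≱ j<p (ℕᵈ.∣⇒≤ e)
  ... | inj₂ e = p∤j! j (ℕₚ.<-trans (ℕₚ.n<1+n j) j<p) e
  elim : (p ℕᵈ.∣ p C k) ⊎ (p ℕᵈ.∣ k ℕ.! ℕ.* (p ℕ.∸ k) ℕ.!) → p ℕᵈ.∣ p C k
  elim (inj₁ d) = d
  elim (inj₂ d) with Prm.euclidsLemma (k ℕ.!) ((p ℕ.∸ k) ℕ.!) pp d
  ... | inj₁ e = ⊥-elim (p∤j! k k<p e)
  ... | inj₂ e = ⊥-elim (p∤j! (p ℕ.∸ k) (ℕₚ.∸-monoʳ-< 1≤k (ℕₚ.<⇒≤ k<p)) e)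

-- The p-th power of a sum, and its iterates

module Frobenius (R : CRing) {p : ℕ} (pp : Prime p) where
  open Kit R
  private
    open CommutativeRing R using (semiring; commutativeSemiring; +-rawMonoid)
    module Bin = Algebra.Properties.CommutativeSemiring.Binomial commutativeSemiring using (theorem; binomialTerm)
    module Exp = Algebra.Properties.CommutativeSemiring.Exp commutativeSemiring using (_^_)
    module Sum = Algebra.Properties.Semiring.Sum semiring using (sum-init-last)
    open import Algebra.Definitions.RawMonoid +-rawMonoid using () renaming (_×_ to _×ᵣ_; sum to Σᵣ)

    ^≡ : ∀ x n → x Exp.^ n ≡ x ^ n
    ^≡ x zero = ≡.refl
    ^≡ x (suc n) = ≡.cong (x *_) (^≡ x n)

    ×≈ : ∀ n x → n ×ᵣ x ≈ ι (+ n) * x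
    ×≈ zero x = sym (zeroˡ x)
    ×≈ (suc n) x = trans (+-congˡ (×≈ n x)) (trans (+-congʳ (sym (*-identityˡ x)))
      (trans (sym (distribʳ x 1# (ι (+ n)))) (*-congʳ (sym (ι-+ (+ 1) (+ n))))))

  p̂ : Carrier
  p̂ = ι (+ p)

  -- Besides `x ^ p`, the term linear in `x` is kept exactly and the other middle terms are
  -- collected as a multiple of `p x²`. This precision serves at ramified primes, where `x²` is
  -- itself a multiple of `p` and only the linear term survives modulo `p²`.
  binomial : ∀ x y → Σ Carrier λ z →
    (x + y) ^ p ≈ y ^ p + p̂ * (x * y ^ (p ℕ.∸ 1)) + p̂ * (x * (x * z)) + x ^ p
  binomial x y = go p pp ≡.refl
    where
    -- Matching on a copy `n` of the module parameter `p` makes `p ∸ 1` and the binomial sum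
    -- compute.
    go : ∀ n → Prime n → p ≡ n → Σ Carrier λ z →
      (x + y) ^ n ≈ y ^ n + ι (+ n) * (x * y ^ (n ℕ.∸ 1)) + ι (+ n) * (x * (x * z)) + x ^ n
    go zero nn _ = ⊥-elim (Prm.¬prime[0] nn)
    go (suc zero) nn _ = ⊥-elim (Prm.¬prime[1] nn)
    go n@(suc (suc m)) nn _ = proj₁ mid , (begin
      (x + y) ^ n ≡⟨ ^≡ (x + y) n ⟨
      (x + y) Exp.^ n ≈⟨ Bin.theorem n x y ⟩
      t₀ + (t₁ + Σᵣ rest) ≈⟨ +-congˡ (+-congˡ (Sum.sum-init-last rest)) ⟩
      t₀ + (t₁ + (Σᵣ ini + lst)) ≈⟨ +-cong t₀≈ (+-cong t₁≈ (+-cong (proj₂ mid) lst≈)) ⟩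
      y ^ n + (ι (+ n) * (x * y ^ (n ℕ.∸ 1)) + (ι (+ n) * (x * (x * proj₁ mid)) + x ^ n))
        ≈⟨ solve 4 (λ a b c d → a :+ (b :+ (c :+ d)) := a :+ b :+ c :+ d) refl _ _ _ _ ⟩
      y ^ n + ι (+ n) * (x * y ^ (n ℕ.∸ 1)) + ι (+ n) * (x * (x * proj₁ mid)) + x ^ n ∎)
      where
      open ≈R
      term : Fin (suc n) → Carrier
      term = Bin.binomialTerm x y n
      t₀ = term Fin.zero
      t₁ = term (Fin.suc Fin.zero)
      rest : Fin (suc m) → Carrier
      rest i = term (Fin.suc (Fin.suc i))
      ini : Fin m → Carrier
      ini i = rest (Fin.inject₁ i)
      lst = rest (fromℕ m)
      t₀≈ : t₀ ≈ y ^ n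
      t₀≈ = begin
        1 ×ᵣ (1# * y Exp.^ n) ≈⟨ +-identityʳ _ ⟩
        1# * y Exp.^ n ≈⟨ *-identityˡ _ ⟩
        y Exp.^ n ≡⟨ ^≡ y n ⟩
        y ^ n ∎
      t₁≈ : t₁ ≈ ι (+ n) * (x * y ^ suc m)
      t₁≈ = begin
        (n C 1) ×ᵣ ((x * 1#) * y Exp.^ suc m) ≡⟨ ≡.cong₂ (λ c t → c ×ᵣ ((x * 1#) * t)) (nC1≡n n) (^≡ y (suc m)) ⟩
        n ×ᵣ ((x * 1#) * y ^ suc m) ≈⟨ ×≈ n _ ⟩
        ι (+ n) * ((x * 1#) * y ^ suc m) ≈⟨ *-congˡ (*-congʳ (*-identityʳ x)) ⟩
        ι (+ n) * (x * y ^ suc m) ∎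
      lst≈ : lst ≈ x ^ n
      lst≈ = begin
        (n C suc (suc (toℕ (fromℕ m)))) ×ᵣ (x Exp.^ suc (suc (toℕ (fromℕ m))) * y Exp.^ (m ℕ.∸ toℕ (fromℕ m)))
          ≡⟨ ≡.cong (λ j → (n C suc (suc j)) ×ᵣ (x Exp.^ suc (suc j) * y Exp.^ (m ℕ.∸ j))) (Finₚ.toℕ-fromℕ m) ⟩
        (n C n) ×ᵣ (x Exp.^ n * y Exp.^ (m ℕ.∸ m))
          ≡⟨ ≡.cong₂ (λ c j → c ×ᵣ (x Exp.^ n * y Exp.^ j)) (nCn≡1 n) (ℕₚ.n∸n≡0 m) ⟩
        1 ×ᵣ (x Exp.^ n * 1#) ≈⟨ +-identityʳ _ ⟩
        x Exp.^ n * 1# ≈⟨ *-identityʳ _ ⟩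
        x Exp.^ n ≡⟨ ^≡ x n ⟩
        x ^ n ∎
      Good : Carrier → Set
      Good t = Σ Carrier λ z → t ≈ ι (+ n) * (x * (x * z))
      sum-good : ∀ k (f : Fin k → Carrier) → (∀ i → Good (f i)) → Good (Σᵣ f)
      sum-good zero f g = 0# , sym (trans (*-congˡ (trans (*-congˡ (zeroʳ x)) (zeroʳ x))) (zeroʳ _))
      sum-good (suc k) f g with g Fin.zero | sum-good k (λ i → f (Fin.suc i)) (λ i → g (Fin.suc i))
      ... | z , e | z' , e' = z + z' , trans (+-cong e e')
        (solve 4 (λ c x z z' → c :* (x :* (x :* z)) :+ c :* (x :* (x :* z')) := c :* (x :* (x :* (z :+ z')))) refl _ x z z')
      ini-good : ∀ i → Good (ini i)
      ini-good i with prime∣pCk {n} {suc (suc (toℕ (Fin.inject₁ i)))} nn (s≤s z≤n)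
                        (s≤s (s≤s (≡.subst (ℕ._< m) (≡.sym (Finₚ.toℕ-inject₁ i)) (Finₚ.toℕ<n i))))
      ... | divides c e = ι (+ c) * (x Exp.^ j * yy) , (begin
          (n C suc (suc j)) ×ᵣ (x Exp.^ suc (suc j) * yy) ≈⟨ ×≈ (n C suc (suc j)) _ ⟩
          ι (+ (n C suc (suc j))) * (x Exp.^ suc (suc j) * yy) ≡⟨ ≡.cong (λ t → ι (+ t) * (x Exp.^ suc (suc j) * yy)) e ⟩
          ι (+ (c ℕ.* n)) * (x Exp.^ suc (suc j) * yy) ≈⟨ *-congʳ (trans (reflexive (≡.cong ι (ℤₚ.pos-* c n))) (ι-* (+ c) (+ n))) ⟩
          (ι (+ c) * ι (+ n)) * ((x * (x * x Exp.^ j)) * yy)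
            ≈⟨ solve 5 (λ c n x t y → (c :* n) :* ((x :* (x :* t)) :* y) := n :* (x :* (x :* (c :* (t :* y))))) refl _ _ x _ yy ⟩
          ι (+ n) * (x * (x * (ι (+ c) * (x Exp.^ j * yy)))) ∎)
        where
        j = toℕ (Fin.inject₁ i)
        yy = y Exp.^ (m ℕ.∸ j)
      mid = sum-good m ini ini-good

  -- The error term carries a factor `x` besides `p`. Applied with `x = π`, it becomes `p` times an
  -- element of `(π)`, and so does not disturb the class of `u` modulo `(π, p)` in an equation
  -- `π ^ E = p u`.
  frobenius : ∀ x y → Σ Carrier λ z → (x + y) ^ p ≈ x ^ p + y ^ p + p̂ * (x * z)
  frobenius x y = let z , e = binomial x y in y ^ (p ℕ.∸ 1) + x * z , trans e
    (solve 6 (λ x yp xp pp t z → yp :+ pp :* (x :* t) :+ pp :* (x :* (x :* z)) :+ xp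
               := xp :+ yp :+ pp :* (x :* (t :+ x :* z))) refl x (y ^ p) (x ^ p) p̂ (y ^ (p ℕ.∸ 1)) z)

  private
    ^-*p : ∀ x k → x ^ (p ℕ.^ suc k) ≈ (x ^ (p ℕ.^ k)) ^ p
    ^-*p x k = trans (reflexive (≡.cong (x ^_) (ℕₚ.*-comm p (p ℕ.^ k)))) (sym (^-assocʳ x (p ℕ.^ k) p))

  frobenius^ : ∀ k x y → Σ Carrier λ z →
    (x + y) ^ (p ℕ.^ k) ≈ x ^ (p ℕ.^ k) + y ^ (p ℕ.^ k) + p̂ * (x * z)
  frobenius^ zero x y = 0# ,
    solve 3 (λ x y pp → (x :+ y) :* con (+ 1) := x :* con (+ 1) :+ y :* con (+ 1) :+ pp :* (x :* con (+ 0))) refl x y p̂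
  frobenius^ (suc k) x y =
    let z , e = frobenius^ k x y
        z₁ , e₁ = ^-expand (x ^ (p ℕ.^ k) + y ^ (p ℕ.^ k)) (p̂ * (x * z)) p
        z₂ , e₂ = frobenius (x ^ (p ℕ.^ k)) (y ^ (p ℕ.^ k))
        z₃ , e₃ = ^-pos x {p ℕ.^ k} (ℕₚ.m^n>0 p {{Prm.prime⇒nonZero pp}} k)
    in z₃ * z₂ + z * z₁ , (begin
    (x + y) ^ (p ℕ.^ suc k) ≈⟨ ^-*p (x + y) k ⟩
    ((x + y) ^ (p ℕ.^ k)) ^ p ≈⟨ ^-congˡ p e ⟩
    (X + Y + p̂ * (x * z)) ^ p ≈⟨ e₁ ⟩
    (X + Y) ^ p + p̂ * (x * z) * z₁ ≈⟨ +-congʳ e₂ ⟩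
    (X ^ p + Y ^ p + p̂ * (X * z₂)) + p̂ * (x * z) * z₁ ≈⟨ +-congʳ (+-congˡ (*-congˡ (*-congʳ e₃))) ⟩
    (X ^ p + Y ^ p + p̂ * (x * z₃ * z₂)) + p̂ * (x * z) * z₁
      ≈⟨ collect (X ^ p + Y ^ p) p̂ x z₃ z₂ z z₁ ⟩
    X ^ p + Y ^ p + p̂ * (x * (z₃ * z₂ + z * z₁)) ≈⟨ +-congʳ (+-cong (^-*p x k) (^-*p y k)) ⟨
    x ^ (p ℕ.^ suc k) + y ^ (p ℕ.^ suc k) + p̂ * (x * (z₃ * z₂ + z * z₁)) ∎)
    where
    open ≈R
    X = x ^ (p ℕ.^ k)
    Y = y ^ (p ℕ.^ k)
    collect : ∀ a c x z₃ z₂ z z₁ → a + c * (x * z₃ * z₂) + c * (x * z) * z₁ ≈ a + c * (x * (z₃ * z₂ + z * z₁))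
    collect = solve 7 (λ a c x z₃ z₂ z z₁ → a :+ c :* (x :* z₃ :* z₂) :+ c :* (x :* z) :* z₁
                   := a :+ c :* (x :* (z₃ :* z₂ :+ z :* z₁))) refl

  -- A p-th power gains one factor `p` in a congruence: the mixed terms contain a further `p`, and
  -- the pure power of `p̂ ^ suc i * y` contains the square of `p̂ ^ suc i`, since `p ≥ 2`.
  ^p-lift : ∀ i x y → Σ Carrier λ z →
    (x + p̂ ^ suc i * y) ^ p ≈ x ^ p + p̂ ^ suc (suc i) * z
  ^p-lift i x y =
    let z , e = frobenius (p̂ ^ suc i * y) x in
    t z , (begin
    (x + P * y) ^ p ≈⟨ ^-congˡ p (+-comm x _) ⟩
    (P * y + x) ^ p ≈⟨ e ⟩
    (P * y) ^ p + x ^ p + p̂ * (P * y * z) ≈⟨ +-congʳ (+-congʳ pow-p) ⟩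
    (P * y * (P * y * w)) + x ^ p + p̂ * (P * y * z)
      ≈⟨ solve 6 (λ q h y w z s → (q :* h :* y :* (q :* h :* y :* w)) :+ s :+ q :* (q :* h :* y :* z)
                 := s :+ q :* (q :* h) :* (y :* h :* y :* w :+ y :* z)) refl p̂ (p̂ ^ i) y w z (x ^ p) ⟩
    x ^ p + p̂ * P * t z ∎)
    where
    open ≈R
    P = p̂ ^ suc i
    w = proj₁ (^-pos (p̂ ^ suc i * y) {p ℕ.∸ 1} (ℕₚ.∸-monoˡ-≤ 1 (prime>1 pp)))
    t = λ z → y * p̂ ^ i * y * w + y * z
    pow-p : (P * y) ^ p ≈ P * y * (P * y * w)
    pow-p = trans (reflexive (≡.cong ((P * y) ^_) (≡.sym (ℕₚ.m+[n∸m]≡n {1} {p} (ℕₚ.<⇒≤ (prime>1 pp))))))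
      (*-congˡ (proj₂ (^-pos (P * y) {p ℕ.∸ 1} (ℕₚ.∸-monoˡ-≤ 1 (prime>1 pp)))))

  ^p^-lift : ∀ i j x y → Σ Carrier λ z →
    (x + p̂ ^ suc i * y) ^ (p ℕ.^ j) ≈ x ^ (p ℕ.^ j) + p̂ ^ suc (j ℕ.+ i) * z
  ^p^-lift i zero x y = y , trans (*-identityʳ _) (+-congʳ (sym (*-identityʳ x)))
  ^p^-lift i (suc j) x y =
    let z , e = ^p^-lift i j x y
        w , f = ^p-lift (j ℕ.+ i) (x ^ (p ℕ.^ j)) z
    in w , trans (^-*p _ j) (trans (^-congˡ p e) (trans f (+-congʳ (sym (^-*p x j)))))

-- Rings of characteristic p
module CharP (R : CRing) {p : ℕ} (pp : Prime p) (p≈0 : Kit._≈_ R (Kit.ι R (+ p)) (Kit.0# R)) where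
  open Kit R
  open Frobenius R pp

  +-^p^ : ∀ k x y → (x + y) ^ (p ℕ.^ k) ≈ x ^ (p ℕ.^ k) + y ^ (p ℕ.^ k)
  +-^p^ k x y = let z , e = frobenius^ k x y in trans e (trans (+-congˡ (trans (*-congʳ p≈0) (zeroˡ _))) (+-identityʳ _))

  Fixed : ℕ → Carrier → Set
  Fixed k x = x ^ (p ℕ.^ k) ≈ x

  fixed-resp : ∀ k {x y} → x ≈ y → Fixed k x → Fixed k y
  fixed-resp k e f = trans (^-congˡ (p ℕ.^ k) (sym e)) (trans f e)

  fixed-+ : ∀ k {x y} → Fixed k x → Fixed k y → Fixed k (x + y)
  fixed-+ k {x} {y} e f = trans (+-^p^ k x y) (+-cong e f)

  fixed-* : ∀ k {x y} → Fixed k x → Fixed k y → Fixed k (x * y)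
  fixed-* k {x} {y} e f = trans (^-distrib-* x y (p ℕ.^ k)) (*-cong e f)

  fixed-0 : ∀ k → Fixed k 0#
  fixed-0 k with p ℕ.^ k | ℕₚ.m^n>0 p {{Prm.prime⇒nonZero pp}} k
  ... | suc n | _ = zeroˡ _

  -- Additivity of the Frobenius map gives `(-x) ^ q + x ^ q = 0 ^ q`, which treats `p = 2` and odd
  -- `p` alike.
  fixed-neg : ∀ k {x} → Fixed k x → Fixed k (- x)
  fixed-neg k {x} e = x-y≈0⇒x≈y (trans (+-congˡ (solve 1 (λ x → :- (:- x) := x) refl x))
    (trans (+-congˡ (sym e)) (trans (sym (+-^p^ k (- x) x))
      (trans (^-congˡ (p ℕ.^ k) (-‿inverseˡ x)) (fixed-0 k)))))

  -- Fermat's little theorem: the fixed elements contain 1 and are closed under addition and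
  -- negation.
  fixed-ι : ∀ k z → Fixed k (ι z)
  fixed-ι k (+ zero) = fixed-0 k
  fixed-ι k (+ suc n) = pos n
    where
    pos : ∀ n → Fixed k (ι (+ suc n))
    pos zero = 1^ (p ℕ.^ k)
    pos (suc n) = fixed-+ k (pos n) (1^ (p ℕ.^ k))
  fixed-ι k -[1+ n ] = fixed-neg k (fixed-ι k (+ suc n))

-- An elementary substitute for "A is integrally closed at p": π is a local
-- uniformizer with ramification index E, and w is supported away from (π, p).

module LocalCriterion (A : CRing) {p : ℕ} (pp : Prime p) where
  open Kit A
  p̂ : Carrier
  p̂ = ι (+ p)

  infix 4 _∈[_]
  _∈[_] : Carrier → Carrier → Set
  x ∈[ π ] = Σ Carrier λ s → Σ Carrier λ t → x ≈ π * s + p̂ * t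

  record LocalData : Set where
    field
      π w u : Carrier
      E : ℕ
      π^E*w≈p*u : π ^ E * w ≈ p̂ * u
      reduced-π : ∀ g k → g ^ k ∈[ π ] → g ∈[ π ]
      reduced-w : ∀ g k → g ^ k ∈[ w ] → g ∈[ w ]
      u-regular : ∀ g → u * g ∈[ π ] → g ∈[ π ]
      w-regular : ∀ g → w * g ∈[ π ] → g ∈[ π ]

  module Maximal (p-cancel : ∀ {x y} → p̂ * x ≈ p̂ * y → x ≈ y) (L : LocalData) where
    open LocalData L
    open ≈R

    p^-cancel : ∀ n {x y} → p̂ ^ n * x ≈ p̂ ^ n * y → x ≈ y
    p^-cancel zero e = trans (sym (*-identityˡ _)) (trans e (*-identityˡ _))
    p^-cancel (suc n) {x} {y} e = p^-cancel n (p-cancel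
      (trans (sym (*-assoc _ _ _)) (trans e (*-assoc _ _ _))))

    w^-regular : ∀ n g → w ^ n * g ∈[ π ] → g ∈[ π ]
    w^-regular zero g (s , t , e) = s , t , trans (sym (*-identityˡ g)) e
    w^-regular (suc n) g (s , t , e) =
      w^-regular n g (w-regular (w ^ n * g) (s , t , trans (sym (*-assoc _ _ _)) e))

    -- The hypothesis `bounded` says that all powers of `γ / p` have denominator at most `p ^ m`.
    -- This trace of the integrality of `γ / p` can be stated inside `A`, and it is all that the
    -- criterion uses.
    module _ (γ : Carrier) (m : ℕ) (bounded : ∀ k → p̂ ^ k ∣ p̂ ^ m * γ ^ k) where

      -- Taking `k = m + 1` in `bounded` and cancelling `p ^ m` shows that `p` divides
      -- `γ ^ (m + 1)`; since the quotient by `(w, p)` is reduced, `γ` lies in `(w, p)`.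
      base : Σ Carrier λ δ → Σ Carrier λ η → γ ≈ π ^ 0 * w * δ + p̂ * η
      base =
        let x , e = bounded (suc m)
            γ^≈ : γ ^ suc m ≈ p̂ * x
            γ^≈ = p^-cancel m (trans e (trans (*-congʳ (*-comm p̂ (p̂ ^ m))) (*-assoc _ _ _)))
            δ , η , f = reduced-w γ (suc m) (0# , x , trans γ^≈ (sym (trans (+-congʳ (zeroʳ w)) (+-identityˡ _))))
        in δ , η , trans f (+-congʳ (*-congʳ (sym (*-identityˡ w))))

      -- Multiplying `γ` by `π ^ (E - j)` completes `π ^ j w` to `π ^ E w = p u`, so
      -- `ε = π ^ (E - j) γ / p` lies in `A`. The powers of `ε` still have denominators bounded by
      -- `p ^ m`, but now with a high power of `π` as a factor.
      module Step (j o : ℕ) (E≡ : E ≡ suc o ℕ.+ j) (δ η : Carrier) (γ≈ : γ ≈ π ^ j * w * δ + p̂ * η) where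
        ρ : Carrier
        ρ = π ^ o
        ε : Carrier
        ε = u * δ + π ^ suc o * η
        pε≈ : p̂ * ε ≈ π ^ suc o * γ
        pε≈ = sym (begin
          π ^ suc o * γ ≈⟨ *-congˡ γ≈ ⟩
          π ^ suc o * (π ^ j * w * δ + p̂ * η)
            ≈⟨ solve 6 (λ a b w d p n → a :* (b :* w :* d :+ p :* n) := (a :* b :* w) :* d :+ p :* (a :* n))
                 refl (π ^ suc o) (π ^ j) w δ p̂ η ⟩
          (π ^ suc o * π ^ j * w) * δ + p̂ * (π ^ suc o * η) ≈⟨ +-congʳ (*-congʳ (*-congʳ (^-homo-* π (suc o) j))) ⟨
          (π ^ (suc o ℕ.+ j) * w) * δ + p̂ * (π ^ suc o * η) ≡⟨ ≡.cong (λ e → (π ^ e * w) * δ + p̂ * (π ^ suc o * η)) E≡ ⟨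
          (π ^ E * w) * δ + p̂ * (π ^ suc o * η) ≈⟨ +-congʳ (*-congʳ π^E*w≈p*u) ⟩
          (p̂ * u) * δ + p̂ * (π ^ suc o * η)
            ≈⟨ solve 4 (λ p u d n → (p :* u) :* d :+ p :* n := p :* (u :* d :+ n)) refl p̂ u δ (π ^ suc o * η) ⟩
          p̂ * ε ∎)

        p^ε^ : ∀ k → Σ Carrier λ x → p̂ ^ m * ε ^ k ≈ (π ^ suc o) ^ k * x
        p^ε^ k =
          let x , e = bounded k in x , p^-cancel k (begin
          p̂ ^ k * (p̂ ^ m * ε ^ k) ≈⟨ solve 3 (λ a b c → a :* (b :* c) := b :* (a :* c)) refl (p̂ ^ k) (p̂ ^ m) (ε ^ k) ⟩
          p̂ ^ m * (p̂ ^ k * ε ^ k) ≈⟨ *-congˡ (^-distrib-* p̂ ε k) ⟨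
          p̂ ^ m * (p̂ * ε) ^ k ≈⟨ *-congˡ (^-congˡ k pε≈) ⟩
          p̂ ^ m * (π ^ suc o * γ) ^ k ≈⟨ *-congˡ (^-distrib-* (π ^ suc o) γ k) ⟩
          p̂ ^ m * ((π ^ suc o) ^ k * γ ^ k)
            ≈⟨ solve 3 (λ a b c → a :* (b :* c) := b :* (a :* c)) refl (p̂ ^ m) ((π ^ suc o) ^ k) (γ ^ k) ⟩
          (π ^ suc o) ^ k * (p̂ ^ m * γ ^ k) ≈⟨ *-congˡ e ⟩
          (π ^ suc o) ^ k * (p̂ ^ k * x)
            ≈⟨ solve 3 (λ a b c → a :* (b :* c) := b :* (a :* c)) refl ((π ^ suc o) ^ k) (p̂ ^ k) x ⟩
          p̂ ^ k * ((π ^ suc o) ^ k * x) ∎)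

        -- `p̂ ^ m * ε ^ K` is a multiple of `π ^ K`. Together with `w ^ m`, the `E * m` factors `π`
        -- turn into `(p̂ * u) ^ m` and cancel `p̂ ^ m`; the extra 1 leaves a factor `π`.
        K : ℕ
        K = suc (E ℕ.* m)

        ε^K∈ : ε ^ K ∈[ π ]
        ε^K∈ = w^-regular m (ε ^ K) (y , 0# , p^-cancel m (begin
          p̂ ^ m * (w ^ m * ε ^ K) ≈⟨ solve 3 (λ a b c → a :* (b :* c) := b :* (a :* c)) refl (p̂ ^ m) (w ^ m) (ε ^ K) ⟩
          w ^ m * (p̂ ^ m * ε ^ K) ≈⟨ *-congˡ (proj₂ (p^ε^ K)) ⟩
          w ^ m * ((π * ρ) ^ K * x) ≈⟨ *-congˡ (*-congʳ (^-distrib-* π ρ K)) ⟩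
          w ^ m * ((π * π ^ (E ℕ.* m)) * ρ ^ K * x) ≈⟨ *-congˡ (*-congʳ (*-congʳ (*-congˡ (^-assocʳ π E m)))) ⟨
          w ^ m * ((π * (π ^ E) ^ m) * ρ ^ K * x)
            ≈⟨ solve 5 (λ a b c d x → a :* ((b :* c) :* d :* x) := (c :* a) :* (b :* d :* x)) refl (w ^ m) π ((π ^ E) ^ m) (ρ ^ K) x ⟩
          ((π ^ E) ^ m * w ^ m) * (π * ρ ^ K * x) ≈⟨ *-congʳ (^-distrib-* (π ^ E) w m) ⟨
          (π ^ E * w) ^ m * (π * ρ ^ K * x) ≈⟨ *-congʳ (^-congˡ m π^E*w≈p*u) ⟩
          (p̂ * u) ^ m * (π * ρ ^ K * x) ≈⟨ *-congʳ (^-distrib-* p̂ u m) ⟩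
          (p̂ ^ m * u ^ m) * (π * ρ ^ K * x)
            ≈⟨ solve 6 (λ a b c d x p → (a :* b) :* (c :* d :* x) := a :* (c :* (b :* d :* x) :+ p :* con (+ 0))) refl (p̂ ^ m) (u ^ m) π (ρ ^ K) x p̂ ⟩
          p̂ ^ m * (π * y + p̂ * 0#) ∎))
          where
          x = proj₁ (p^ε^ K)
          y = u ^ m * ρ ^ K * x

        -- Because the exponent `suc o` is positive, `ε` and `u δ` agree modulo `π`, and `u` is
        -- regular modulo `(π, p)`.
        δ∈ : ε ∈[ π ] → δ ∈[ π ]
        δ∈ (s , t , e) = u-regular δ (s - ρ * η , t , (begin
          u * δ ≈⟨ solve 2 (λ a b → a := (a :+ b) :- b) refl (u * δ) (π ^ suc o * η) ⟩
          ε - π ^ suc o * η ≈⟨ +-congʳ e ⟩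
          (π * s + p̂ * t) - (π * ρ) * η
            ≈⟨ solve 6 (λ π s p t r n → (π :* s :+ p :* t) :- (π :* r) :* n := π :* (s :- r :* n) :+ p :* t) refl π s p̂ t ρ η ⟩
          π * (s - ρ * η) + p̂ * t ∎))

        next : δ ∈[ π ] → Σ Carrier λ δ' → Σ Carrier λ η' → γ ≈ π ^ suc j * w * δ' + p̂ * η'
        next (s , t , e) = s , π ^ j * w * t + η , (begin
          γ ≈⟨ γ≈ ⟩
          π ^ j * w * δ + p̂ * η ≈⟨ +-congʳ (*-congˡ e) ⟩
          π ^ j * w * (π * s + p̂ * t) + p̂ * η
            ≈⟨ solve 7 (λ a w π s p t n → a :* w :* (π :* s :+ p :* t) :+ p :* n := π :* a :* w :* s :+ p :* (a :* w :* t :+ n))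
                 refl (π ^ j) w π s p̂ t η ⟩
          π ^ suc j * w * s + p̂ * (π ^ j * w * t + η) ∎)

      -- Each step pulls one more factor `π` out of `δ`. At `j = E` the first summand becomes
      -- `p u δ`, so that `p` divides `γ`.
      filtration : ∀ j → j ℕ.≤ E → Σ Carrier λ δ → Σ Carrier λ η → γ ≈ π ^ j * w * δ + p̂ * η
      filtration zero _ = base
      filtration (suc j) j<E =
        let δ , η , e = filtration j (ℕₚ.<⇒≤ j<E)
            open Step j (E ℕ.∸ suc j) (≡.sym (≡.trans (≡.cong suc (≡.sym (ℕₚ.+-∸-comm j j<E))) (eq j E j<E))) δ η e using (next; δ∈; ε; K; ε^K∈)
        in next (δ∈ (reduced-π ε K ε^K∈))
        where
        eq : ∀ j E → suc j ℕ.≤ E → suc (E ℕ.+ j ℕ.∸ suc j) ≡ E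
        eq j (suc E) (s≤s j≤E) = ≡.cong suc (ℕₚ.m+n∸n≡m E j)

      p∣γ : p̂ ∣ γ
      p∣γ = let δ , η , e = filtration E ℕₚ.≤-refl in
        u * δ + η , trans e (trans (+-congʳ (*-congʳ π^E*w≈p*u))
          (solve 4 (λ p u d n → (p :* u) :* d :+ p :* n := p :* (u :* d :+ n)) refl p̂ u δ η))

-- γ ^ e + low d γ e h is a monic integer polynomial in γ / d, multiplied by d ^ e.

module Descent (A : CRing) where
  open Kit A
  open ≈R

  low : Carrier → Carrier → (e : ℕ) → (Fin e → ℤ) → Carrier
  low d γ zero h = 0#
  low d γ (suc e) h = ι (h Fin.zero) * d ^ suc e + γ * low d γ e (λ i → h (Fin.suc i))

  low-cong : ∀ {d d' γ γ'} e h → d ≈ d' → γ ≈ γ' → low d γ e h ≈ low d' γ' e h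
  low-cong zero h _ _ = refl
  low-cong (suc e) h d≈ γ≈ = +-cong (*-congˡ (^-congˡ (suc e) d≈)) (*-cong γ≈ (low-cong e _ d≈ γ≈))

  low-scale : ∀ c d γ e h → low (c * d) (c * γ) e h ≈ c ^ e * low d γ e h
  low-scale c d γ zero h = sym (zeroʳ _)
  low-scale c d γ (suc e) h = begin
    ι (h Fin.zero) * (c * d) ^ suc e + c * γ * low (c * d) (c * γ) e h'
      ≈⟨ +-cong (*-congˡ (^-distrib-* c d (suc e))) (*-congˡ (low-scale c d γ e h')) ⟩
    ι (h Fin.zero) * (c ^ suc e * d ^ suc e) + c * γ * (c ^ e * low d γ e h')
      ≈⟨ solve 6 (λ a c d e g l → a :* (c :* e :* d) :+ c :* g :* (e :* l) := c :* e :* (a :* d :+ g :* l))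
           refl (ι (h Fin.zero)) c (d ^ suc e) (c ^ e) γ (low d γ e h') ⟩
    c ^ suc e * low d γ (suc e) h ∎
    where h' = λ i → h (Fin.suc i)

  -- The relation makes `γ / (c d)` integral, hence also `γ / c`. For `k > e` it rewrites `γ ^ k` by
  -- terms `γ ^ i (c d) ^ (k - i)` with `i < k`: the induction hypothesis supplies `c ^ i` and the
  -- second factor the missing `c ^ (k - i)`.
  bounded-powers : ∀ c d γ e h → γ ^ e + low (c * d) γ e h ≈ 0# → ∀ k → c ^ k ∣ c ^ e * γ ^ k
  bounded-powers c d γ e h rel = <-rec _ go
    where
    P : ℕ → Set
    P k = c ^ k ∣ c ^ e * γ ^ k
    on-low : ∀ e' (h' : Fin e' → ℤ) j → (∀ {i} → i ℕ.< j ℕ.+ e' → P i) →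
             c ^ (j ℕ.+ e') ∣ c ^ e * (γ ^ j * low (c * d) γ e' h')
    on-low zero h' j ih = ∣-resp (sym (trans (*-congˡ (zeroʳ _)) (zeroʳ _))) ∣-0
    on-low (suc e') h' j ih = ∣-resp (sym (split)) (∣-+ first second)
      where
      L = low (c * d) γ e' (λ i → h' (Fin.suc i))
      split : c ^ e * (γ ^ j * low (c * d) γ (suc e') h') ≈
              (c ^ e * γ ^ j) * (c * d) ^ suc e' * ι (h' Fin.zero) + c ^ e * (γ ^ suc j * L)
      split = solve 6 (λ a b h D g l → a :* (b :* (h :* D :+ g :* l)) := (a :* b) :* D :* h :+ a :* (g :* b :* l))
                refl (c ^ e) (γ ^ j) (ι (h' Fin.zero)) ((c * d) ^ suc e') γ L
      first : c ^ (j ℕ.+ suc e') ∣ (c ^ e * γ ^ j) * (c * d) ^ suc e' * ι (h' Fin.zero)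
      first = ∣-*ʳ _ (∣-trans (1# , factor) (∣-*-mono (ih (ℕₚ.m<m+n j (s≤s z≤n))) (^-∣-^ (suc e') (∣-self d))))
        where
        factor : c ^ j * c ^ suc e' ≈ c ^ (j ℕ.+ suc e') * 1#
        factor = trans (sym (^-homo-* c j (suc e'))) (sym (*-identityʳ _))
      second : c ^ (j ℕ.+ suc e') ∣ c ^ e * (γ ^ suc j * L)
      second = ≡.subst (λ n → c ^ n ∣ c ^ e * (γ ^ suc j * L)) (≡.sym (ℕₚ.+-suc j e'))
        (on-low e' _ (suc j) λ {i} i< → ih {i} (≡.subst (i ℕ.<_) (≡.sym (ℕₚ.+-suc j e')) i<))
    go : ∀ k → (∀ {i} → i ℕ.< k → P i) → P k
    go k ih with k ℕ.≤? e
    ... | yes k≤e = ∣-*ʳ _ (^-∣ c k≤e)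
    ... | no k≰e with ℕₚ.m≤n⇒∃[o]m+o≡n (ℕₚ.<⇒≤ (ℕₚ.≰⇒> k≰e))
    ... | j , ≡.refl = ≡.subst P (ℕₚ.+-comm j e) (∣-resp γ^≈ (∣-neg (on-low e h j
            λ {i} i< → ih {i} (≡.subst (i ℕ.<_) (ℕₚ.+-comm j e) i<))))
      where
      L = low (c * d) γ e h
      γ^≈ : - (c ^ e * (γ ^ j * L)) ≈ c ^ e * γ ^ (j ℕ.+ e)
      γ^≈ = begin
        - (c ^ e * (γ ^ j * L)) ≈⟨ solve 4 (λ a b g l → :- (a :* (b :* l)) := a :* (b :* g) :- a :* b :* (g :+ l)) refl (c ^ e) (γ ^ j) (γ ^ e) L ⟩
        c ^ e * (γ ^ j * γ ^ e) - c ^ e * γ ^ j * (γ ^ e + L) ≈⟨ +-cong (*-congˡ (sym (^-homo-* γ j e))) (-‿cong (trans (*-congˡ rel) (zeroʳ _))) ⟩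
        c ^ e * γ ^ (j ℕ.+ e) - 0# ≈⟨ solve 1 (λ x → x :- con (+ 0) := x) refl _ ⟩
        c ^ e * γ ^ (j ℕ.+ e) ∎

  module _ (cancel : ∀ d → 1 ℕ.≤ d → ∀ {x y} → ι (+ d) * x ≈ ι (+ d) * y → x ≈ y)
           (local : ∀ {p} (pp : Prime p) → LocalCriterion.LocalData A pp) where

    private
      -- Removes one prime from the denominator: the local criterion gives `γ = p γ'`, and dividing
      -- the homogeneous relation by `p ^ e` leaves one for `γ'` over `d` with the same integers
      -- `h`.
      descend : ∀ {p} → Prime p → ∀ d γ e h → γ ^ e + low (ι (+ p) * d) γ e h ≈ 0# →
        Σ Carrier λ γ' → γ ≈ ι (+ p) * γ' × (γ' ^ e + low d γ' e h ≈ 0#)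
      descend {p} pp d γ e h rel =
        let γ' , γ≈ = Cr.p∣γ γ e (bounded-powers (ι (+ p)) d γ e h rel)
        in γ' , γ≈ , Cr.p^-cancel e (begin
          ι (+ p) ^ e * (γ' ^ e + low d γ' e h) ≈⟨ distribˡ _ _ _ ⟩
          ι (+ p) ^ e * γ' ^ e + ι (+ p) ^ e * low d γ' e h
            ≈⟨ +-cong (^-distrib-* (ι (+ p)) γ' e) (low-scale (ι (+ p)) d γ' e h) ⟨
          (ι (+ p) * γ') ^ e + low (ι (+ p) * d) (ι (+ p) * γ') e h
            ≈⟨ +-cong (^-congˡ e γ≈) (low-cong e h refl γ≈) ⟨
          γ ^ e + low (ι (+ p) * d) γ e h ≈⟨ rel ⟩
          0# ≈⟨ zeroʳ _ ⟨
          ι (+ p) ^ e * 0# ∎)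
        where
        module Cr = LocalCriterion.Maximal A pp (cancel p (ℕₚ.<⇒≤ (prime>1 pp))) (local pp) using (p∣γ; p^-cancel)

      integral-list : ∀ ps → All Prime ps → ∀ γ e h →
        γ ^ e + low (ι (+ product ps)) γ e h ≈ 0# → ι (+ product ps) ∣ γ
      integral-list [] [] γ e h rel = 1∣ γ
      integral-list (p ∷ ps) (pp ∷ pps) γ e h rel =
        let d≈ : ι (+ (p ℕ.* product ps)) ≈ ι (+ p) * ι (+ product ps)
            d≈ = trans (reflexive (≡.cong ι (ℤₚ.pos-* p (product ps)))) (ι-* (+ p) (+ product ps))
            γ' , γ≈ , rel' = descend pp (ι (+ product ps)) γ e h
              (trans (+-congˡ (low-cong e h (sym d≈) refl)) rel)
            δ , γ'≈ = integral-list ps pps γ' e h rel'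
        in δ , trans γ≈ (trans (*-congˡ γ'≈) (trans (sym (*-assoc _ _ _)) (*-congʳ (sym d≈))))

    integral⇒divisible : ∀ d → 1 ℕ.≤ d → ∀ γ e h → γ ^ e + low (ι (+ d)) γ e h ≈ 0# → ι (+ d) ∣ γ
    integral⇒divisible (suc d) _ γ e h rel =
      ≡.subst (λ n → ι (+ n) ∣ γ) (≡.sym isF) (integral-list factors factorsPrime γ e h
        (≡.subst (λ n → γ ^ e + low (ι (+ n)) γ e h ≈ 0#) isF rel))
      where
      open PrimeFactorisation (factorise (suc d)) renaming (isFactorisation to isF)

-- Power series and polynomials, as coefficient functions

-- convBy is a function of the operations only, so that a product of series is
-- the same function over a ring and over its quotients.
convBy : {A : Set} → (A → A → A) → (A → A → A) → (ℕ → A) → (ℕ → A) → ℕ → A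
convBy _+_ _*_ f g zero = f 0 * g 0
convBy _+_ _*_ f g (suc n) = (f 0 * g (suc n)) + convBy _+_ _*_ (λ i → f (suc i)) g n

module Series (R : CRing) where
  open Kit R
  open ≈R

  Seq : Set
  Seq = ℕ → Carrier

  infix 4 _≋_
  _≋_ : Seq → Seq → Set
  f ≋ g = ∀ n → f n ≈ g n

  tail : Seq → Seq
  tail f n = f (suc n)

  infixl 7 _⋆_
  _⋆_ : Seq → Seq → Seq
  _⋆_ = convBy _+_ _*_

  zeroₛ oneₛ : Seq
  zeroₛ _ = 0#
  oneₛ zero = 1#
  oneₛ (suc _) = 0#

  ⋆-cong : ∀ {f f' g g'} → f ≋ f' → g ≋ g' → f ⋆ g ≋ f' ⋆ g'
  ⋆-cong e e' zero = *-cong (e 0) (e' 0)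
  ⋆-cong e e' (suc n) = +-cong (*-cong (e 0) (e' (suc n))) (⋆-cong (λ i → e (suc i)) e' n)

  ⋆-zeroˡ : ∀ {f} g → f ≋ zeroₛ → f ⋆ g ≋ zeroₛ
  ⋆-zeroˡ g e zero = trans (*-congʳ (e 0)) (zeroˡ _)
  ⋆-zeroˡ g e (suc n) = trans (+-cong (trans (*-congʳ (e 0)) (zeroˡ _)) (⋆-zeroˡ g (λ i → e (suc i)) n)) (+-identityʳ _)

  ⋆-distribʳ : ∀ g f f' → (λ i → f i + f' i) ⋆ g ≋ (λ n → (f ⋆ g) n + (f' ⋆ g) n)
  ⋆-distribʳ g f f' zero = distribʳ _ _ _
  ⋆-distribʳ g f f' (suc n) = trans (+-cong (distribʳ _ _ _) (⋆-distribʳ g (tail f) (tail f') n))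
    (solve 4 (λ a b c d → (a :+ b) :+ (c :+ d) := (a :+ c) :+ (b :+ d)) refl _ _ _ _)

  ⋆-scaleˡ : ∀ c f g → (λ i → c * f i) ⋆ g ≋ (λ n → c * (f ⋆ g) n)
  ⋆-scaleˡ c f g zero = *-assoc _ _ _
  ⋆-scaleˡ c f g (suc n) = trans (+-cong (*-assoc _ _ _) (⋆-scaleˡ c (tail f) g n)) (sym (distribˡ _ _ _))

  ⋆-sucʳ : ∀ f g n → (f ⋆ g) (suc n) ≈ f (suc n) * g 0 + (f ⋆ tail g) n
  ⋆-sucʳ f g zero = +-comm _ _
  ⋆-sucʳ f g (suc n) = trans (+-congˡ (⋆-sucʳ (tail f) g n))
    (solve 3 (λ a b c → a :+ (b :+ c) := b :+ (a :+ c)) refl _ _ _)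

  ⋆-comm : ∀ f g → f ⋆ g ≋ g ⋆ f
  ⋆-comm f g zero = *-comm _ _
  ⋆-comm f g (suc n) = trans (+-cong (*-comm _ _) (⋆-comm (tail f) g n)) (sym (⋆-sucʳ g f n))

  ⋆-assoc : ∀ f g h → (f ⋆ g) ⋆ h ≋ f ⋆ (g ⋆ h)
  ⋆-assoc f g h zero = *-assoc _ _ _
  ⋆-assoc f g h (suc n) = begin
    (f 0 * g 0) * h (suc n) + ((λ i → f 0 * g (suc i) + (tail f ⋆ g) i) ⋆ h) n
      ≈⟨ +-congˡ (⋆-distribʳ h (λ i → f 0 * g (suc i)) (tail f ⋆ g) n) ⟩
    (f 0 * g 0) * h (suc n) + (((λ i → f 0 * g (suc i)) ⋆ h) n + ((tail f ⋆ g) ⋆ h) n)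
      ≈⟨ +-congˡ (+-cong (⋆-scaleˡ (f 0) (tail g) h n) (⋆-assoc (tail f) g h n)) ⟩
    (f 0 * g 0) * h (suc n) + (f 0 * (tail g ⋆ h) n + (tail f ⋆ (g ⋆ h)) n)
      ≈⟨ solve 5 (λ a b c d e → (a :* b) :* c :+ (a :* d :+ e) := a :* (b :* c :+ d) :+ e) refl _ _ _ _ _ ⟩
    f 0 * (g ⋆ h) (suc n) + (tail f ⋆ (g ⋆ h)) n ∎

  ⋆-identityˡ : ∀ g → oneₛ ⋆ g ≋ g
  ⋆-identityˡ g zero = *-identityˡ _
  ⋆-identityˡ g (suc n) = trans (+-cong (*-identityˡ _) (⋆-zeroˡ g (λ _ → refl) n)) (+-identityʳ _)

  sumTo' : Seq → ℕ → Carrier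
  sumTo' f zero = f 0
  sumTo' f (suc k) = sumTo' f k + f (suc k)

  sumTo'-cong : ∀ {f g} k → (∀ i → i ℕ.≤ k → f i ≈ g i) → sumTo' f k ≈ sumTo' g k
  sumTo'-cong zero e = e 0 z≤n
  sumTo'-cong (suc k) e = +-cong (sumTo'-cong k (λ i i≤k → e i (ℕₚ.m≤n⇒m≤1+n i≤k))) (e (suc k) ℕₚ.≤-refl)

  sumTo'-shift : ∀ f k → sumTo' f (suc k) ≈ f 0 + sumTo' (tail f) k
  sumTo'-shift f zero = refl
  sumTo'-shift f (suc k) = trans (+-congʳ (sumTo'-shift f k)) (+-assoc _ _ _)

  ⋆-sum : ∀ f g n → (f ⋆ g) n ≈ sumTo' (λ i → f i * g (n ℕ.∸ i)) n
  ⋆-sum f g zero = refl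
  ⋆-sum f g (suc n) = trans (+-congˡ (⋆-sum (tail f) g n)) (sym (sumTo'-shift (λ i → f i * g (suc n ℕ.∸ i)) n))

  Bounded : ℕ → Seq → Set
  Bounded d f = ∀ m → d ℕ.< m → f m ≈ 0#

  bounded-tail : ∀ {d f} → Bounded (suc d) f → Bounded d (tail f)
  bounded-tail bf m d<m = bf (suc m) (s≤s d<m)

  bounded-0-tail : ∀ {f} → Bounded 0 f → tail f ≋ zeroₛ
  bounded-0-tail bf n = bf (suc n) (s≤s z≤n)

  ⋆-bounded : ∀ {d e f g} → Bounded d f → Bounded e g → Bounded (d ℕ.+ e) (f ⋆ g)
  ⋆-bounded {zero} {f = f} {g} bf bg (suc n) (s≤s e≤n) = trans
    (+-cong (trans (*-congˡ (bg (suc n) (s≤s e≤n))) (zeroʳ _)) (⋆-zeroˡ g (bounded-0-tail bf) n)) (+-identityʳ _)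
  ⋆-bounded {suc d} {e} {f} {g} bf bg (suc n) (s≤s l) = trans
    (+-cong (trans (*-congˡ (bg (suc n) (ℕₚ.≤-trans (s≤s (ℕₚ.m≤n+m e (suc d))) (s≤s l)))) (zeroʳ _))
      (⋆-bounded (bounded-tail bf) bg n l)) (+-identityʳ _)

  ⋆-top : ∀ {d e f g} → Bounded d f → Bounded e g → (f ⋆ g) (d ℕ.+ e) ≈ f d * g e
  ⋆-top {zero} {zero} bf bg = refl
  ⋆-top {zero} {suc e} {f} {g} bf bg = trans (+-congˡ (⋆-zeroˡ g (bounded-0-tail bf) e)) (+-identityʳ _)
  ⋆-top {suc d} {e} {f} {g} bf bg = trans
    (+-cong (trans (*-congˡ (bg (suc (d ℕ.+ e)) (s≤s (ℕₚ.m≤n+m e d)))) (zeroʳ _))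
      (⋆-top (bounded-tail bf) bg)) (+-identityˡ _)

  -- The derivation `x d/dx`. Unlike `d/dx` it acts on each coefficient separately, without a shift
  -- of indices.
  euler : Seq → Seq
  euler f n = ι (+ n) * f n

  euler-tail : ∀ f n → euler f (suc n) ≈ euler (tail f) n + tail f n
  euler-tail f n = trans (*-congʳ (ι-+ (+ 1) (+ n)))
    (solve 2 (λ a b → (con (+ 1) :+ a) :* b := a :* b :+ b) refl (ι (+ n)) (f (suc n)))

  euler-⋆ : ∀ f g n → euler (f ⋆ g) n ≈ (euler f ⋆ g) n + (f ⋆ euler g) n
  euler-⋆ f g zero = solve 2 (λ a b → con (+ 0) :* (a :* b) := (con (+ 0) :* a) :* b :+ a :* (con (+ 0) :* b)) refl _ _
  euler-⋆ f g (suc n) = begin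
    euler (f ⋆ g) (suc n) ≈⟨ *-congʳ (ι-+ (+ 1) (+ n)) ⟩
    (1# + ι (+ n)) * (f 0 * g (suc n) + (tail f ⋆ g) n)
      ≈⟨ solve 4 (λ k a b c → (con (+ 1) :+ k) :* (a :* b :+ c) := a :* ((con (+ 1) :+ k) :* b) :+ (k :* c :+ c)) refl _ (f 0) (g (suc n)) ((tail f ⋆ g) n) ⟩
    f 0 * ((1# + ι (+ n)) * g (suc n)) + (euler (tail f ⋆ g) n + (tail f ⋆ g) n)
      ≈⟨ +-cong (*-congˡ (*-congʳ (sym (ι-+ (+ 1) (+ n))))) (+-congʳ (euler-⋆ (tail f) g n)) ⟩
    f 0 * euler g (suc n) + (((euler (tail f) ⋆ g) n + (tail f ⋆ euler g) n) + (tail f ⋆ g) n)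
      ≈⟨ solve 5 (λ a b c d e → a :+ ((b :+ c) :+ d) := ((con (+ 0) :* e) :+ (b :+ d)) :+ (a :+ c)) refl _ _ _ _ _ ⟩
    ((0# * (f 0 * g (suc n))) + ((euler (tail f) ⋆ g) n + (tail f ⋆ g) n)) + (f ⋆ euler g) (suc n)
      ≈⟨ +-congʳ (+-cong (*-assoc _ _ _) (⋆-distribʳ g (euler (tail f)) (tail f) n)) ⟨
    (((0# * f 0) * g (suc n)) + ((λ i → euler (tail f) i + tail f i) ⋆ g) n) + (f ⋆ euler g) (suc n)
      ≈⟨ +-congʳ (+-congˡ (⋆-cong (euler-tail f) (λ _ → refl) n)) ⟨
    (euler f ⋆ g) (suc n) + (f ⋆ euler g) (suc n) ∎

-- The bound is irrelevant, so that polynomials are compared by coefficients and degree bound only.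
record Polynomial (R : CRing) : Set where
  constructor poly
  field
    coeff : ℕ → CommutativeRing.Carrier R
    degree : ℕ
    .bounded-degree : Series.Bounded R degree coeff
open Polynomial public using (coeff; degree)

record SamePoly (R : CRing) (f g : Polynomial R) : Set where
  constructor same
  field at : ∀ n → CommutativeRing._≈_ R (coeff f n) (coeff g n)
open SamePoly public

module _ (R : CRing) where
  open Kit R
  open Series R

  Poly : CRing
  Poly = record
    { Carrier = Polynomial R
    ; _≈_ = SamePoly R
    ; _+_ = λ { (poly f d bf) (poly g e bg) → poly (λ n → f n + g n) (d ℕ.⊔ e)
        λ m l → trans (+-cong (bf m (ℕₚ.≤-<-trans (ℕₚ.m≤m⊔n d e) l))
                              (bg m (ℕₚ.≤-<-trans (ℕₚ.m≤n⊔m d e) l))) (+-identityʳ _) }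
    ; _*_ = λ { (poly f d bf) (poly g e bg) → poly (f ⋆ g) (d ℕ.+ e) (⋆-bounded bf bg) }
    ; -_ = λ { (poly f d bf) → poly (λ n → - f n) d λ m l →
        trans (-‿cong (bf m l)) (solve 0 (:- con (+ 0) := con (+ 0)) refl) }
    ; 0# = poly zeroₛ 0 λ _ _ → refl
    ; 1# = poly oneₛ 0 λ { (suc _) _ → refl }
    ; isCommutativeRing = record
      { isRing = record
        { +-isAbelianGroup = record
          { isGroup = record
            { isMonoid = record
              { isSemigroup = record
                { isMagma = record
                  { isEquivalence = record
                    { refl = same λ _ → refl ; sym = λ e → same λ n → sym (at e n) ; trans = λ e f → same λ n → trans (at e n) (at f n) }
                  ; ∙-cong = λ e f → same λ n → +-cong (at e n) (at f n) }
                ; assoc = λ f g h → same λ n → +-assoc _ _ _ }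
              ; identity = (λ f → same λ n → +-identityˡ _) , (λ f → same λ n → +-identityʳ _) }
            ; inverse = (λ f → same λ n → -‿inverseˡ _) , (λ f → same λ n → -‿inverseʳ _)
            ; ⁻¹-cong = λ e → same λ n → -‿cong (at e n) }
          ; comm = λ f g → same λ n → +-comm _ _ }
        ; *-cong = λ e f → same (⋆-cong (at e) (at f))
        ; *-assoc = λ f g h → same (⋆-assoc (coeff f) (coeff g) (coeff h))
        ; *-identity = (λ f → same (⋆-identityˡ (coeff f)))
            , (λ f → same λ n → trans (⋆-comm (coeff f) oneₛ n) (⋆-identityˡ (coeff f) n))
        ; distrib = (λ f g h → same λ n → trans (⋆-comm (coeff f) _ n) (trans (⋆-distribʳ (coeff f) (coeff g) (coeff h) n)
                       (+-cong (⋆-comm (coeff g) (coeff f) n) (⋆-comm (coeff h) (coeff f) n))))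
            , (λ f g h → same (⋆-distribʳ (coeff f) (coeff g) (coeff h))) }
      ; *-comm = λ f g → same (⋆-comm (coeff f) (coeff g)) } }

-- `stable` turns an irrelevant proof of `x ≈ 0` back into an ordinary one, so that the degree bound
-- of a polynomial becomes usable. Decidable equality supplies it for ℤ and ℚ.
module PolyKit (R : CRing) (stable : ∀ x → .(Kit._≈_ R x (Kit.0# R)) → Kit._≈_ R x (Kit.0# R)) where
  private
    module R = Kit R
    module S = Series R
  open Kit (Poly R)

  bounded : (f : Carrier) → S.Bounded (degree f) (coeff f)
  bounded (poly f d bf) m l = stable (f m) (bf m l)

  const : R.Carrier → Carrier
  const c = poly (λ { zero → c ; (suc _) → R.0# }) 0 λ { (suc _) _ → R.refl }

  x̂ : Carrier
  x̂ = poly (λ { (suc zero) → R.1# ; _ → R.0# }) 1 λ { (suc zero) (s≤s ()) ; (suc (suc _)) _ → R.refl }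

  const-* : ∀ c f n → coeff (const c * f) n R.≈ c R.* coeff f n
  const-* c f zero = R.refl
  const-* c f (suc n) = R.trans (R.+-congˡ (S.⋆-zeroˡ (coeff f) (λ _ → R.refl) n)) (R.+-identityʳ _)

  const-hom : Hom R (Poly R)
  const-hom = record
    { ⟦_⟧ = const
    ; cong = λ e → same λ { zero → e ; (suc n) → R.refl }
    ; +-hom = λ x y → same λ { zero → R.refl ; (suc n) → R.sym (R.+-identityʳ _) }
    ; *-hom = λ x y → same λ { zero → R.refl ; (suc n) → R.sym (R.trans (const-* x (const y) (suc n)) (R.zeroʳ _)) }
    ; 1-hom = same λ { zero → R.refl ; (suc n) → R.refl } }

  ι≈const : ∀ z → ι z ≈ const (R.ι z)
  ι≈const z = sym (Hom.ι-hom const-hom z)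

  ι-coeff : ∀ z f n → coeff (ι z * f) n R.≈ R.ι z R.* coeff f n
  ι-coeff z f n = R.trans (at (*-congʳ {f} (ι≈const z)) n) (const-* (R.ι z) f n)

  x̂*-zero : ∀ f → coeff (x̂ * f) 0 R.≈ R.0#
  x̂*-zero f = R.zeroˡ _

  x̂*-suc : ∀ f n → coeff (x̂ * f) (suc n) R.≈ coeff f n
  x̂*-suc f n = R.trans (R.+-congʳ (R.zeroˡ _)) (R.trans (R.+-identityˡ _)
    (R.trans (S.⋆-cong {g = coeff f} (λ { zero → R.refl ; (suc i) → R.refl }) (λ _ → R.refl) n) (S.⋆-identityˡ (coeff f) n)))

  x^-top : ∀ k → coeff (x̂ ^ k) k R.≈ R.1#
  x^-top zero = R.refl
  x^-top (suc k) = R.trans (x̂*-suc (x̂ ^ k) k) (x^-top k)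

  x^-other : ∀ k n → k ≢ n → coeff (x̂ ^ k) n R.≈ R.0#
  x^-other zero zero ne = ⊥-elim (ne ≡.refl)
  x^-other zero (suc n) ne = R.refl
  x^-other (suc k) zero ne = x̂*-zero (x̂ ^ k)
  x^-other (suc k) (suc n) ne = R.trans (x̂*-suc (x̂ ^ k) n) (x^-other k n (λ e → ne (≡.cong suc e)))

  shift : Carrier → Carrier
  shift (poly f d bf) = poly (S.tail f) d λ m l → bf (suc m) (ℕₚ.m≤n⇒m≤1+n l)

  decompose : ∀ f → f ≈ const (coeff f 0) + x̂ * shift f
  decompose f = same λ
    { zero → R.sym (R.trans (R.+-congˡ (x̂*-zero (shift f))) (R.+-identityʳ _))
    ; (suc n) → R.sym (R.trans (R.+-congˡ (x̂*-suc (shift f) n)) (R.+-identityˡ _)) }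

  induction : (P : Carrier → Set) → (∀ {f g} → f ≈ g → P f → P g) → (∀ c → P (const c)) →
    (∀ {f g} → P f → P g → P (f + g)) → (∀ {f} → P f → P (x̂ * f)) → ∀ f → P f
  induction P resp P-const P-+ P-x f = go (degree f) f (bounded f)
    where
    go : ∀ d f → S.Bounded d (coeff f) → P f
    go zero f bf = resp (same λ { zero → R.refl ; (suc n) → R.sym (bf (suc n) (s≤s z≤n)) }) (P-const (coeff f 0))
    go (suc d) f bf = resp (sym (decompose f)) (P-+ (P-const _) (P-x (go d (shift f) (S.bounded-tail bf))))

  MonicOf : ℕ → Carrier → Set
  MonicOf d f = S.Bounded d (coeff f) × coeff f d R.≈ R.1#

  monic-* : ∀ {d e f g} → MonicOf d f → MonicOf e g → MonicOf (d ℕ.+ e) (f * g)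
  monic-* (bf , tf) (bg , tg) = S.⋆-bounded bf bg ,
    R.trans (S.⋆-top bf bg) (R.trans (R.*-cong tf tg) (R.*-identityˡ _))

  monic-^ : ∀ {d f} n → MonicOf d f → MonicOf (n ℕ.* d) (f ^ n)
  monic-^ zero m = bounded 1# , R.refl
  monic-^ {f = f} (suc n) m = monic-* {f = f} {g = f ^ n} m (monic-^ n m)

-- Integer polynomials modulo a monic polynomial

ℤ-stable : ∀ x → .(x ≡ + 0) → x ≡ + 0
ℤ-stable x e = recompute (x ℤ.≟ + 0) e

module P = Kit (Poly ℤ-ring)
module PolyZ = PolyKit ℤ-ring ℤ-stable
module SZ = Series ℤ-ring

module MonicDivision {N : ℕ} {F : Polynomial ℤ-ring} (monic : PolyZ.MonicOf N F) where
  open P using (_*_)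

  -- Modulo `D` the leading coefficient of `F` is still 1, so a top coefficient of `ζ` that survives
  -- modulo `D` would reappear in `F ζ` in some degree at least `N`. The degree bound of `ζ` modulo
  -- `D` therefore descends to nothing.
  cofactor-divisible : ∀ D ζ → (∀ i → N ℕ.≤ i → + D ∣ᶻ coeff (F * ζ) i) → ∀ i → + D ∣ᶻ coeff ζ i
  cofactor-divisible D ζ high i = go (suc (degree ζ)) (λ m l → ≡.subst (+ D ∣ᶻ_) (≡.sym (PolyZ.bounded ζ m l)) (ℤˢ.divides (+ 0) ≡.refl)) i z≤n
    where
    module Qt = Congruence ℤ-ring (+ D)
    module QD = CommutativeRing (Quot ℤ-ring (+ D)) using (_≈_; trans; sym)
    module SQ = Series (Quot ℤ-ring (+ D)) using (⋆-top)
    toQ : ∀ {z} → + D ∣ᶻ z → z QD.≈ + 0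
    toQ (ℤˢ.divides q e) = by q (≡.trans e (≡.trans (ℤₚ.*-comm q (+ D)) (≡.sym (ℤₚ.+-identityˡ _))))
    fromQ : ∀ {z} → z QD.≈ + 0 → + D ∣ᶻ z
    fromQ (by q e) = ℤˢ.divides q (≡.trans e (≡.trans (ℤₚ.+-identityˡ _) (ℤₚ.*-comm (+ D) q)))
    go : ∀ e → (∀ m → e ℕ.≤ m → + D ∣ᶻ coeff ζ m) → ∀ m → 0 ℕ.≤ m → + D ∣ᶻ coeff ζ m
    go zero h = h
    go (suc e) h = go e λ m e≤m → step m (ℕₚ.m≤n⇒m<n∨m≡n e≤m)
      where
      top : coeff (F * ζ) (N ℕ.+ e) QD.≈ coeff F N ℤ.* coeff ζ e
      top = SQ.⋆-top {N} {e} {coeff F} {coeff ζ} (λ m l → Qt.≈⇒≈/ (proj₁ monic m l)) (λ m l → toQ (h m l))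
      step : ∀ m → e ℕ.< m ⊎ e ≡ m → + D ∣ᶻ coeff ζ m
      step m (inj₁ l) = h m l
      step m (inj₂ ≡.refl) = fromQ (QD.trans (Qt.≈⇒≈/ (≡.sym (≡.trans (≡.cong (ℤ._* coeff ζ e) (proj₂ monic)) (ℤₚ.*-identityˡ _))))
        (QD.trans (QD.sym top) (toQ (high (N ℕ.+ e) (ℕₚ.m≤m+n N e)))))

-- Periods and Wall-Sun-Sun primes

module _ {P : ℕ → Set} (P? : ∀ n → Dec (P n)) where

  private
    NoneUpTo : ℕ → Set
    NoneUpTo n = ∀ j → 1 ℕ.≤ j → P j → n ℕ.< j

    search : ∀ n → (Σ ℕ λ k → 1 ℕ.≤ k × P k × (∀ j → 1 ℕ.≤ j → P j → k ℕ.≤ j)) ⊎ NoneUpTo n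
    search zero = inj₂ λ j 1≤j _ → 1≤j
    search (suc n) with search n
    ... | inj₁ found = inj₁ found
    ... | inj₂ none with P? (suc n)
    ... | yes Pn = inj₁ (suc n , s≤s z≤n , Pn , none)
    ... | no ¬Pn = inj₂ λ j 1≤j Pj → ℕₚ.≤∧≢⇒< (none j 1≤j Pj) λ e → ¬Pn (≡.subst P (≡.sym e) Pj)

  least : ∀ T → 1 ℕ.≤ T → P T → Σ ℕ λ k → 1 ℕ.≤ k × P k × (∀ j → 1 ℕ.≤ j → P j → k ℕ.≤ j)
  least T 1≤T PT with search T
  ... | inj₁ found = found
  ... | inj₂ none = ⊥-elim (ℕₚ.<-irrefl ≡.refl (none T 1≤T PT))

prime-parity : ∀ {p} → Prime p → p ≡ 2 ⊎ Σ ℕ λ h → p ≡ suc (h ℕ.+ h)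
prime-parity {p} pp with p ℕᵐ.% 2 in r | ℕᵐ.m%n<n p 2 | ℕᵐ.m≡m%n+[m/n]*n p 2
... | zero | _ | e with Prm.prime⇒irreducible pp {2} (ℕᵈ.m%n≡0⇒n∣m p 2 r)
... | inj₁ ()
... | inj₂ e' = inj₁ (≡.sym e')
prime-parity {p} pp | suc zero | _ | e = inj₂ (p ℕᵐ./ 2 , ≡.trans e (≡.cong suc (≡.trans (ℕₚ.*-comm (p ℕᵐ./ 2) 2) (≡.cong (p ℕᵐ./ 2 ℕ.+_) (ℕₚ.+-identityʳ _)))))
prime-parity {p} pp | suc (suc _) | s≤s (s≤s ()) | _

-- A root ω of X² - aX - b in a ring of characteristic p
module RootModP (R : CRing) {p : ℕ} (pp : Prime p) (p≈0 : Kit._≈_ R (Kit.ι R (+ p)) (Kit.0# R))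
  (a b : ℤ) (ω : CommutativeRing.Carrier R)
  (root : Kit._≈_ R (Kit._*_ R ω ω) (Kit._+_ R (Kit._*_ R (Kit.ι R a) ω) (Kit.ι R b))) where
  open Kit R
  open CharP R pp p≈0
  open ≈R

  ι∣≈0 : ∀ {z} → + p ∣ᶻ z → ι z ≈ 0#
  ι∣≈0 {z} (ℤˢ.divides q e) = trans (reflexive (≡.cong ι e)) (trans (ι-* q (+ p)) (trans (*-congˡ p≈0) (zeroʳ _)))

  ι-unit : ∀ z → ¬ (+ p ∣ᶻ z) → Σ ℤ λ u → ι z * ι u ≈ 1#
  ι-unit z p∤z with inverse-mod-prime pp z p∤z
  ... | u , d = u , x-y≈0⇒x≈y (trans (+-cong (sym (ι-* z u)) (sym (ι-neg (+ 1))))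
      (trans (sym (ι-+ (z ℤ.* u) (ℤ.- + 1))) (ι∣≈0 d)))

  -- Since `ω (ω - a) = b`, the inverse of `ω` is `(ω - a) / b`.
  ω-unit : ¬ (+ p ∣ᶻ b) → Σ Carrier λ v → ω * v ≈ 1#
  ω-unit p∤b = let u , e = ι-unit b p∤b in (ω - ι a) * ι u , (begin
    ω * ((ω - ι a) * ι u) ≈⟨ solve 3 (λ w a u → w :* ((w :- a) :* u) := (w :* w :- a :* w) :* u) refl ω (ι a) (ι u) ⟩
    (ω * ω - ι a * ω) * ι u ≈⟨ *-congʳ (+-congʳ root) ⟩
    (ι a * ω + ι b - ι a * ω) * ι u ≈⟨ solve 3 (λ t b u → (t :+ b :- t) :* u := b :* u) refl (ι a * ω) (ι b) (ι u) ⟩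
    ι b * ι u ≈⟨ e ⟩
    1# ∎)

  unit-cancel : ∀ {u v x y} → u * v ≈ 1# → u * x ≈ u * y → x ≈ y
  unit-cancel {u} {v} {x} {y} uv≈1 e = begin
    x ≈⟨ *-identityˡ x ⟨
    1# * x ≈⟨ *-congʳ uv≈1 ⟨
    u * v * x ≈⟨ solve 3 (λ u v x → u :* v :* x := v :* (u :* x)) refl u v x ⟩
    v * (u * x) ≈⟨ *-congˡ e ⟩
    v * (u * y) ≈⟨ solve 3 (λ u v x → u :* v :* x := v :* (u :* x)) refl u v y ⟨
    u * v * y ≈⟨ *-congʳ uv≈1 ⟩
    1# * y ≈⟨ *-identityˡ y ⟩
    y ∎

  unit-^ : ∀ {u v} n → u * v ≈ 1# → u ^ n * v ^ n ≈ 1#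
  unit-^ {u} {v} n e = trans (sym (^-distrib-* u v n)) (trans (^-congˡ n e) (1^ n))

  ω^-cancel : ¬ (+ p ∣ᶻ b) → ∀ n {x y} → ω ^ n * x ≈ ω ^ n * y → x ≈ y
  ω^-cancel p∤b n = unit-cancel (unit-^ n (proj₂ (ω-unit p∤b)))

  ι^-cancel : ∀ z → ¬ (+ p ∣ᶻ z) → ∀ n {x y} → ι z ^ n * x ≈ ι z ^ n * y → x ≈ y
  ι^-cancel z p∤z n = unit-cancel (unit-^ n (proj₂ (ι-unit z p∤z)))

  private
    Δ : ℤ
    Δ = a ℤ.* a ℤ.+ + 4 ℤ.* b
    ρ : Carrier
    ρ = ι (+ 2) * ω - ι a

  ρ²≈Δ : ρ * ρ ≈ ι Δ
  ρ²≈Δ = begin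
    ρ * ρ ≈⟨ solve 2 (λ w a → (con (+ 2) :* w :- a) :* (con (+ 2) :* w :- a) := con (+ 4) :* (w :* w) :+ a :* a :- con (+ 4) :* (a :* w)) refl ω (ι a) ⟩
    ι (+ 4) * (ω * ω) + ι a * ι a - ι (+ 4) * (ι a * ω) ≈⟨ +-congʳ (+-congʳ (*-congˡ root)) ⟩
    ι (+ 4) * (ι a * ω + ι b) + ι a * ι a - ι (+ 4) * (ι a * ω)
      ≈⟨ solve 3 (λ w a b → con (+ 4) :* (a :* w :+ b) :+ a :* a :- con (+ 4) :* (a :* w) := a :* a :+ con (+ 4) :* b) refl ω (ι a) (ι b) ⟩
    ι a * ι a + ι (+ 4) * ι b ≈⟨ +-cong (ι-* a a) (ι-* (+ 4) b) ⟨
    ι (a ℤ.* a) + ι (+ 4 ℤ.* b) ≈⟨ ι-+ (a ℤ.* a) (+ 4 ℤ.* b) ⟨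
    ι Δ ∎

  module _ (p∤b : ¬ (+ p ∣ᶻ b)) (p∤Δ : ¬ (+ p ∣ᶻ a ℤ.* a ℤ.+ + 4 ℤ.* b)) where

    private
      -- For `p = 2h + 1` the inverse of 2 is `h + 1`, so `ω = (h + 1) (ρ + a)`. As `ρ² = Δ`, the
      -- power `ρ ^ (p²)` is `ρ Δ ^ t` with `t = (p² - 1) / 2 = 2h (h + 1)`, and `Δ ^ (2h) = 1` by
      -- Fermat.
      odd-case : ∀ h → p ≡ suc (h ℕ.+ h) → Fixed 2 ω
      odd-case h p≡ = fixed-resp 2 half (fixed-* 2 (fixed-ι 2 (+ suc h)) (fixed-+ 2 ρ-fixed (fixed-ι 2 a)))
        where
        half : ι (+ suc h) * (ρ + ι a) ≈ ω
        half = begin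
          ι (+ suc h) * (ρ + ι a) ≈⟨ *-congʳ (ι-+ (+ 1) (+ h)) ⟩
          (1# + ι (+ h)) * (ρ + ι a)
            ≈⟨ solve 3 (λ h w a → (con (+ 1) :+ h) :* (con (+ 2) :* w :- a :+ a) := w :+ (con (+ 1) :+ (h :+ h)) :* w) refl (ι (+ h)) ω (ι a) ⟩
          ω + (1# + (ι (+ h) + ι (+ h))) * ω ≈⟨ +-congˡ (*-congʳ (trans (ι-+ (+ 1) (+ (h ℕ.+ h))) (+-congˡ (ι-+ (+ h) (+ h))))) ⟨
          ω + ι (+ suc (h ℕ.+ h)) * ω ≡⟨ ≡.cong (λ n → ω + ι (+ n) * ω) p≡ ⟨
          ω + ι (+ p) * ω ≈⟨ +-congˡ (trans (*-congʳ p≈0) (zeroˡ ω)) ⟩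
          ω + 0# ≈⟨ +-identityʳ ω ⟩
          ω ∎
        t : ℕ
        t = (h ℕ.+ h) ℕ.* suc h
        p²≡ : p ℕ.^ 2 ≡ suc (t ℕ.+ t)
        p²≡ = ≡.trans (≡.cong (ℕ._^ 2) p≡) (NS.solve 1 (λ h → (NS.con 1 NS.:+ (h NS.:+ h)) NS.:* ((NS.con 1 NS.:+ (h NS.:+ h)) NS.:* NS.con 1)
          NS.:= NS.con 1 NS.:+ ((h NS.:+ h) NS.:* (NS.con 1 NS.:+ h) NS.:+ (h NS.:+ h) NS.:* (NS.con 1 NS.:+ h))) ≡.refl h)
          where module NS = Data.Nat.Solver.+-*-Solver
        Δ^2h≈1 : ι Δ ^ (h ℕ.+ h) ≈ 1#
        Δ^2h≈1 = let u , e = ι-unit Δ p∤Δ in unit-cancel e (begin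
          ι Δ ^ suc (h ℕ.+ h) ≡⟨ ≡.cong (ι Δ ^_) (≡.trans (≡.sym p≡) (≡.sym (ℕₚ.*-identityʳ p))) ⟩
          ι Δ ^ (p ℕ.^ 1) ≈⟨ fixed-ι 1 Δ ⟩
          ι Δ ≈⟨ *-identityʳ _ ⟨
          ι Δ * 1# ∎)
        ρ-fixed : Fixed 2 ρ
        ρ-fixed = begin
          ρ ^ (p ℕ.^ 2) ≡⟨ ≡.cong (ρ ^_) p²≡ ⟩
          ρ * ρ ^ (t ℕ.+ t) ≈⟨ *-congˡ (trans (^-homo-* ρ t t) (sym (^-distrib-* ρ ρ t))) ⟩
          ρ * (ρ * ρ) ^ t ≈⟨ *-congˡ (^-congˡ t ρ²≈Δ) ⟩
          ρ * ι Δ ^ t ≈⟨ *-congˡ (^-assocʳ (ι Δ) (h ℕ.+ h) (suc h)) ⟨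
          ρ * (ι Δ ^ (h ℕ.+ h)) ^ suc h ≈⟨ *-congˡ (trans (^-congˡ (suc h) Δ^2h≈1) (1^ (suc h))) ⟩
          ρ * 1# ≈⟨ *-identityʳ ρ ⟩
          ρ ∎

      odd≈1 : p ≡ 2 → ∀ z → ¬ (+ p ∣ᶻ z) → ι z ≈ 1#
      odd≈1 ≡.refl z 2∤z = trans (reflexive (≡.cong ι (ℤᵐ.a≡a%n+[a/n]*n z (+ 2))))
        (trans (ι-+ (+ r) (q ℤ.* + 2)) (trans (+-cong r≈1 (ι∣≈0 (ℤˢ.divides q ≡.refl))) (+-identityʳ _)))
        where
        r = z ℤᵐ.% (+ 2)
        q = z ℤᵐ./ (+ 2)
        r≈1 : ι (+ r) ≈ 1#
        r≈1 with r in e | ℤᵐ.n%d<d z (+ 2)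
        ... | zero | _ = ⊥-elim (2∤z (ℤˢ.divides q (≡.trans (ℤᵐ.a≡a%n+[a/n]*n z (+ 2))
            (≡.trans (≡.cong (λ k → + k ℤ.+ q ℤ.* + 2) e) (ℤₚ.+-identityˡ _)))))
        ... | suc zero | _ = refl
        ... | suc (suc _) | s≤s (s≤s ())

      -- Here `a` and `b` are odd, so `ω² = ω + 1`, the equation of the field with four elements,
      -- whose solutions satisfy `ω ^ 4 = ω`.
      even-case : p ≡ 2 → Fixed 2 ω
      even-case p≡2 = begin
        ω ^ (p ℕ.^ 2) ≡⟨ ≡.cong (λ n → ω ^ (n ℕ.^ 2)) p≡2 ⟩
        ω ^ 4 ≈⟨ solve 1 (λ w → w :* (w :* (w :* (w :* con (+ 1)))) := (w :* w) :* (w :* w)) refl ω ⟩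
        (ω * ω) * (ω * ω) ≈⟨ *-cong ω² ω² ⟩
        (ω + 1#) * (ω + 1#) ≈⟨ solve 1 (λ w → (w :+ con (+ 1)) :* (w :+ con (+ 1)) := w :* w :+ (con (+ 2) :* w :+ con (+ 1))) refl ω ⟩
        ω * ω + (ι (+ 2) * ω + 1#) ≈⟨ +-congʳ ω² ⟩
        (ω + 1#) + (ι (+ 2) * ω + 1#) ≈⟨ solve 1 (λ w → (w :+ con (+ 1)) :+ (con (+ 2) :* w :+ con (+ 1)) := w :+ con (+ 2) :* (w :+ con (+ 1))) refl ω ⟩
        ω + ι (+ 2) * (ω + 1#) ≈⟨ +-congˡ (trans (*-congʳ two≈0) (zeroˡ _)) ⟩
        ω + 0# ≈⟨ +-identityʳ ω ⟩
        ω ∎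
        where
        two≈0 : ι (+ 2) ≈ 0#
        two≈0 = trans (reflexive (≡.cong (λ n → ι (+ n)) (≡.sym p≡2))) p≈0
        p∤a : ¬ (+ p ∣ᶻ a)
        p∤a d = p∤Δ (ℤˢ.∣m∣n⇒∣m+n (ℤˢ.∣m⇒∣m*n a d) (ℤˢ.∣m⇒∣m*n b (≡.subst (λ n → + n ∣ᶻ + 4) (≡.sym p≡2) (ℤˢ.divides (+ 2) ≡.refl))))
        ω² : ω * ω ≈ ω + 1#
        ω² = trans root (+-cong (trans (*-congʳ (odd≈1 p≡2 a p∤a)) (*-identityˡ ω)) (odd≈1 p≡2 b p∤b))

    -- Frobenius at most exchanges the two roots, so its square fixes them. No distinction between
    -- split and inert `p` is made.
    ω-fixed : Fixed 2 ω
    ω-fixed with prime-parity pp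
    ... | inj₁ p≡2 = even-case p≡2
    ... | inj₂ (h , p≡) = odd-case h p≡

    ω^[p²-1]≈1 : ω ^ (p ℕ.^ 2 ℕ.∸ 1) ≈ 1#
    ω^[p²-1]≈1 = let v , e = ω-unit p∤b in unit-cancel e (begin
      ω ^ suc (p ℕ.^ 2 ℕ.∸ 1) ≡⟨ ≡.cong (ω ^_) (ℕₚ.m+[n∸m]≡n {1} (ℕₚ.m^n>0 p {{Prm.prime⇒nonZero pp}} 2)) ⟩
      ω ^ (p ℕ.^ 2) ≈⟨ ω-fixed ⟩
      ω ≈⟨ *-identityʳ ω ⟨
      ω * 1# ∎)

-- The quadratic order ℤ[ω], ω² = aω + b, as pairs (c , d) = c + dω

module Quadratic (a b : ℤ) where
  open Data.Integer.Solver.+-*-Solver using (solve; _:=_; _:+_; _:*_; _:-_; :-_; con)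

  Quad : CRing
  Quad = record
    { Carrier = ℤ × ℤ
    ; _≈_ = _≡_
    ; _+_ = λ { (c , d) (c' , d') → c ℤ.+ c' , d ℤ.+ d' }
    ; _*_ = λ { (c , d) (c' , d') → c ℤ.* c' ℤ.+ b ℤ.* (d ℤ.* d') , (c ℤ.* d' ℤ.+ d ℤ.* c') ℤ.+ a ℤ.* (d ℤ.* d') }
    ; -_ = λ { (c , d) → ℤ.- c , ℤ.- d }
    ; 0# = + 0 , + 0
    ; 1# = + 1 , + 0
    ; isCommutativeRing = record
      { isRing = record
        { +-isAbelianGroup = record
          { isGroup = record
            { isMonoid = record
              { isSemigroup = record
                { isMagma = record { isEquivalence = ≡.isEquivalence ; ∙-cong = λ { ≡.refl ≡.refl → ≡.refl } }
                ; assoc = λ { (c , d) (c' , d') (c'' , d'') → ≡.cong₂ _,_ (ℤₚ.+-assoc c c' c'') (ℤₚ.+-assoc d d' d'') } }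
              ; identity = (λ { (c , d) → ≡.cong₂ _,_ (ℤₚ.+-identityˡ c) (ℤₚ.+-identityˡ d) })
                         , (λ { (c , d) → ≡.cong₂ _,_ (ℤₚ.+-identityʳ c) (ℤₚ.+-identityʳ d) }) }
            ; inverse = (λ { (c , d) → ≡.cong₂ _,_ (ℤₚ.+-inverseˡ c) (ℤₚ.+-inverseˡ d) })
                      , (λ { (c , d) → ≡.cong₂ _,_ (ℤₚ.+-inverseʳ c) (ℤₚ.+-inverseʳ d) })
            ; ⁻¹-cong = λ { ≡.refl → ≡.refl } }
          ; comm = λ { (c , d) (c' , d') → ≡.cong₂ _,_ (ℤₚ.+-comm c c') (ℤₚ.+-comm d d') } }
        ; *-cong = λ { ≡.refl ≡.refl → ≡.refl }
        ; *-assoc = λ { (c , d) (c' , d') (c'' , d'') → ≡.cong₂ _,_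
            (solve 8 (λ a b c d c' d' c'' d'' →
              (c :* c' :+ b :* (d :* d')) :* c'' :+ b :* (((c :* d' :+ d :* c') :+ a :* (d :* d')) :* d'')
              := c :* (c' :* c'' :+ b :* (d' :* d'')) :+ b :* (d :* ((c' :* d'' :+ d' :* c'') :+ a :* (d' :* d''))))
              ≡.refl a b c d c' d' c'' d'')
            (solve 8 (λ a b c d c' d' c'' d'' →
              ((c :* c' :+ b :* (d :* d')) :* d'' :+ ((c :* d' :+ d :* c') :+ a :* (d :* d')) :* c'')
                :+ a :* (((c :* d' :+ d :* c') :+ a :* (d :* d')) :* d'')
              := (c :* ((c' :* d'' :+ d' :* c'') :+ a :* (d' :* d'')) :+ d :* (c' :* c'' :+ b :* (d' :* d'')))
                :+ a :* (d :* ((c' :* d'' :+ d' :* c'') :+ a :* (d' :* d''))))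
              ≡.refl a b c d c' d' c'' d'') }
        ; *-identity = (λ { (c , d) → ≡.cong₂ _,_
              (solve 3 (λ b c d → con (+ 1) :* c :+ b :* (con (+ 0) :* d) := c) ≡.refl b c d)
              (solve 3 (λ a c d → (con (+ 1) :* d :+ con (+ 0) :* c) :+ a :* (con (+ 0) :* d) := d) ≡.refl a c d) })
            , (λ { (c , d) → ≡.cong₂ _,_
              (solve 3 (λ b c d → c :* con (+ 1) :+ b :* (d :* con (+ 0)) := c) ≡.refl b c d)
              (solve 3 (λ a c d → (c :* con (+ 0) :+ d :* con (+ 1)) :+ a :* (d :* con (+ 0)) := d) ≡.refl a c d) })
        ; distrib = (λ { (c , d) (c' , d') (c'' , d'') → ≡.cong₂ _,_
            (solve 7 (λ b c d c' d' c'' d'' → c :* (c' :+ c'') :+ b :* (d :* (d' :+ d''))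
              := (c :* c' :+ b :* (d :* d')) :+ (c :* c'' :+ b :* (d :* d''))) ≡.refl b c d c' d' c'' d'')
            (solve 7 (λ a c d c' d' c'' d'' → (c :* (d' :+ d'') :+ d :* (c' :+ c'')) :+ a :* (d :* (d' :+ d''))
              := ((c :* d' :+ d :* c') :+ a :* (d :* d')) :+ ((c :* d'' :+ d :* c'') :+ a :* (d :* d''))) ≡.refl a c d c' d' c'' d'') })
          , (λ { (c , d) (c' , d') (c'' , d'') → ≡.cong₂ _,_
            (solve 7 (λ b c d c' d' c'' d'' → (c' :+ c'') :* c :+ b :* ((d' :+ d'') :* d)
              := (c' :* c :+ b :* (d' :* d)) :+ (c'' :* c :+ b :* (d'' :* d))) ≡.refl b c d c' d' c'' d'')
            (solve 7 (λ a c d c' d' c'' d'' → ((c' :+ c'') :* d :+ (d' :+ d'') :* c) :+ a :* ((d' :+ d'') :* d)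
              := ((c' :* d :+ d' :* c) :+ a :* (d' :* d)) :+ ((c'' :* d :+ d'' :* c) :+ a :* (d'' :* d))) ≡.refl a c d c' d' c'' d'') }) }
      ; *-comm = λ { (c , d) (c' , d') → ≡.cong₂ _,_
            (solve 5 (λ b c d c' d' → c :* c' :+ b :* (d :* d') := c' :* c :+ b :* (d' :* d)) ≡.refl b c d c' d')
            (solve 5 (λ a c d c' d' → (c :* d' :+ d :* c') :+ a :* (d :* d') := (c' :* d :+ d' :* c) :+ a :* (d' :* d)) ≡.refl a c d c' d') } } }

  module B = Kit Quad

  ω : ℤ × ℤ
  ω = + 0 , + 1

  ℤ→Quad : Hom ℤ-ring Quad
  ℤ→Quad = record
    { ⟦_⟧ = λ z → z , + 0
    ; cong = ≡.cong (_, + 0)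
    ; +-hom = λ x y → ≡.refl
    ; *-hom = λ x y → ≡.cong₂ _,_ (solve 3 (λ b x y → x :* y := x :* y :+ b :* (con (+ 0) :* con (+ 0))) ≡.refl b x y)
        (solve 3 (λ a x y → con (+ 0) := (x :* con (+ 0) :+ con (+ 0) :* y) :+ a :* (con (+ 0) :* con (+ 0))) ≡.refl a x y)
    ; 1-hom = ≡.refl }

  ι≡ : ∀ z → B.ι z ≡ (z , + 0)
  ι≡ z = ≡.trans (≡.sym (Hom.ι-hom ℤ→Quad z)) (≡.cong (_, + 0) (ι-ℤ z))

  ι*≡ : ∀ z c d → B.ι z B.* (c , d) ≡ (z ℤ.* c , z ℤ.* d)
  ι*≡ z c d = ≡.trans (≡.cong (B._* (c , d)) (ι≡ z)) (≡.cong₂ _,_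
    (solve 4 (λ b z c d → z :* c :+ b :* (con (+ 0) :* d) := z :* c) ≡.refl b z c d)
    (solve 4 (λ a z c d → (z :* d :+ con (+ 0) :* c) :+ a :* (con (+ 0) :* d) := z :* d) ≡.refl a z c d))

  ι∣⇒ : ∀ {m c d} → B.ι m B.∣ (c , d) → (m ∣ᶻ c) × (m ∣ᶻ d)
  ι∣⇒ {m} {c} {d} ((q , r) , e) =
    ℤˢ.divides q (≡.trans (≡.cong proj₁ e') (ℤₚ.*-comm m q)) , ℤˢ.divides r (≡.trans (≡.cong proj₂ e') (ℤₚ.*-comm m r))
    where
    e' : (c , d) ≡ (m ℤ.* q , m ℤ.* r)
    e' = ≡.trans e (ι*≡ m q r)

  ⇒ι∣ : ∀ {m c d} → m ∣ᶻ c → m ∣ᶻ d → B.ι m B.∣ (c , d)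
  ⇒ι∣ {m} (ℤˢ.divides q e) (ℤˢ.divides r f) = (q , r) ,
    ≡.trans (≡.cong₂ _,_ (≡.trans e (ℤₚ.*-comm q m)) (≡.trans f (ℤₚ.*-comm r m))) (≡.sym (ι*≡ m q r))

  ι∣? : ∀ m x → Dec (B.ι (+ m) B.∣ x)
  ι∣? m (c , d) with m ∣ᶻ? c | m ∣ᶻ? d
  ... | yes p | yes q = yes (⇒ι∣ p q)
  ... | no ¬p | _ = no λ e → ¬p (proj₁ (ι∣⇒ {+ m} {c} {d} e))
  ... | yes _ | no ¬q = no λ e → ¬q (proj₂ (ι∣⇒ {+ m} {c} {d} e))

  ω-root : ω B.* ω ≡ B.ι a B.* ω B.+ B.ι b
  ω-root = ≡.sym (≡.trans (≡.cong₂ B._+_ (ι*≡ a (+ 0) (+ 1)) (ι≡ b)) (≡.cong₂ _,_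
    (solve 2 (λ a b → a :* con (+ 0) :+ b := con (+ 0) :* con (+ 0) :+ b :* (con (+ 1) :* con (+ 1))) ≡.refl a b)
    (solve 1 (λ a → a :* con (+ 1) :+ con (+ 0) := (con (+ 0) :* con (+ 1) :+ con (+ 1) :* con (+ 0)) :+ a :* (con (+ 1) :* con (+ 1))) ≡.refl a)))

  norm : ℤ → ℤ → ℤ
  norm c d = c ℤ.* c ℤ.+ a ℤ.* (c ℤ.* d) ℤ.- b ℤ.* (d ℤ.* d)

  -- The second factor is the conjugate of `c + d ω`, the conjugate of `ω` being `a - ω`.
  norm-* : ∀ c d → (c , d) B.* (c ℤ.+ a ℤ.* d , ℤ.- d) ≡ B.ι (norm c d)
  norm-* c d = ≡.trans (≡.cong₂ _,_
    (solve 4 (λ a b c d → c :* (c :+ a :* d) :+ b :* (d :* (:- d)) := c :* c :+ a :* (c :* d) :- b :* (d :* d)) ≡.refl a b c d)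
    (solve 4 (λ a b c d → (c :* (:- d) :+ d :* (c :+ a :* d)) :+ a :* (d :* (:- d)) := con (+ 0)) ≡.refl a b c d))
    (≡.sym (ι≡ (norm c d)))

  module Eval (A : CRing) (ωA : CommutativeRing.Carrier A)
    (root : Kit._≈_ A (Kit._*_ A ωA ωA) (Kit._+_ A (Kit._*_ A (Kit.ι A a) ωA) (Kit.ι A b))) where
    private module A = Kit A
    eval : Hom Quad A
    eval = record
      { ⟦_⟧ = λ { (c , d) → A.ι c A.+ A.ι d A.* ωA }
      ; cong = λ { ≡.refl → A.refl }
      ; +-hom = λ { (c , d) (c' , d') → A.trans (A.+-cong (A.ι-+ c c') (A.*-congʳ (A.ι-+ d d')))
          (A.solve 5 (λ c c' d d' w → (c A.:+ c') A.:+ (d A.:+ d') A.:* w A.:= (c A.:+ d A.:* w) A.:+ (c' A.:+ d' A.:* w)) A.refl _ _ _ _ ωA) }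
      ; *-hom = λ { (c , d) (c' , d') →
          let bdd' = A.trans (A.ι-* b (d ℤ.* d')) (A.*-congˡ (A.ι-* d d'))
              add' = A.trans (A.ι-* a (d ℤ.* d')) (A.*-congˡ (A.ι-* d d'))
          in A.trans (A.+-cong
            (A.trans (A.ι-+ (c ℤ.* c') (b ℤ.* (d ℤ.* d'))) (A.+-cong (A.ι-* c c') bdd'))
            (A.*-congʳ (A.trans (A.ι-+ (c ℤ.* d' ℤ.+ d ℤ.* c') (a ℤ.* (d ℤ.* d')))
              (A.+-cong (A.trans (A.ι-+ (c ℤ.* d') (d ℤ.* c')) (A.+-cong (A.ι-* c d') (A.ι-* d c'))) add'))))
          (A.trans (A.solve 7 (λ a b c c' d d' w →
              (c A.:* c' A.:+ b A.:* (d A.:* d')) A.:+ ((c A.:* d' A.:+ d A.:* c') A.:+ a A.:* (d A.:* d')) A.:* w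
              A.:= (c A.:* c' A.:+ (c A.:* d' A.:+ d A.:* c') A.:* w) A.:+ (d A.:* d') A.:* (a A.:* w A.:+ b)) A.refl _ _ _ _ _ _ ωA)
          (A.trans (A.+-congˡ (A.*-congˡ (A.sym root)))
            (A.solve 5 (λ c c' d d' w → (c A.:* c' A.:+ (c A.:* d' A.:+ d A.:* c') A.:* w) A.:+ (d A.:* d') A.:* (w A.:* w)
              A.:= (c A.:+ d A.:* w) A.:* (c' A.:+ d' A.:* w)) A.refl _ _ _ _ ωA))) }
      ; 1-hom = A.solve 1 (λ w → A.con (+ 1) A.:+ A.con (+ 0) A.:* w A.:= A.con (+ 1)) A.refl ωA }

    eval-ω : Hom.⟦ eval ⟧ ω A.≈ ωA
    eval-ω = A.solve 1 (λ w → A.con (+ 0) A.:+ A.con (+ 1) A.:* w A.:= w) A.refl ωA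

    open A
    open Hom eval

    power-eval : ∀ (p : ℕ) k μ → ω B.^ k ≡ ω B.+ B.ι (+ p) B.* μ → ωA ^ k ≈ ωA + ι (+ p) * ⟦ μ ⟧
    power-eval p k μ e = trans (^-congˡ k (sym eval-ω)) (trans (sym (^-hom ω k)) (trans (cong e)
      (trans (+-hom ω (B.ι (+ p) B.* μ)) (+-cong eval-ω (trans (*-hom (B.ι (+ p)) μ) (*-congʳ (ι-hom (+ p))))))))

    divisible-eval : ∀ (p : ℕ) μ q → μ ≡ B.ι (+ p) B.* q → ⟦ μ ⟧ ≈ ι (+ p) * ⟦ q ⟧
    divisible-eval p μ q e = trans (cong e) (trans (*-hom (B.ι (+ p)) q) (*-congʳ (ι-hom (+ p))))

    unit-eval : ∀ (p : ℕ) μ v → Congruent Quad (B.ι (+ p)) (μ B.* v) B.1# → ι (+ p) ∣ ⟦ μ ⟧ * ⟦ v ⟧ - 1#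
    unit-eval p μ v (by q e) = ⟦ q ⟧ , trans (+-congʳ (trans (sym (*-hom μ v)) (trans (cong e) (trans (+-hom B.1# (B.ι (+ p) B.* q))
      (+-cong 1-hom (divisible-eval p (B.ι (+ p) B.* q) q ≡.refl))))))
      (A.solve 1 (λ t → A.con (+ 1) A.:+ t A.:- A.con (+ 1) A.:= t) refl (ι (+ p) * ⟦ q ⟧))


  -- The bridge between the Lucas sequence and the quadratic order: multiplication by `ω` acts on
  -- coordinates by the recurrence.
  ω^-coeff : ∀ n → ω B.^ suc n ≡ (b ℤ.* U a b n , U a b (suc n))
  ω^-coeff zero = ≡.cong₂ _,_
    (solve 1 (λ b → con (+ 0) :* con (+ 1) :+ b :* (con (+ 1) :* con (+ 0)) := b :* con (+ 0)) ≡.refl b)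
    (solve 1 (λ a → (con (+ 0) :* con (+ 0) :+ con (+ 1) :* con (+ 1)) :+ a :* (con (+ 1) :* con (+ 0)) := con (+ 1)) ≡.refl a)
  ω^-coeff (suc n) = ≡.trans (≡.cong (ω B.*_) (ω^-coeff n)) (≡.cong₂ _,_
    (solve 3 (λ b u v → con (+ 0) :* (b :* u) :+ b :* (con (+ 1) :* v) := b :* v) ≡.refl b (U a b n) (U a b (suc n)))
    (solve 4 (λ a b u v → (con (+ 0) :* v :+ con (+ 1) :* (b :* u)) :+ a :* (con (+ 1) :* v) := a :* v :+ b :* u)
      ≡.refl a b (U a b n) (U a b (suc n))))

  ω^-second : ∀ n → proj₂ (ω B.^ n) ≡ U a b n
  ω^-second zero = ≡.refl
  ω^-second (suc n) = ≡.cong proj₂ (ω^-coeff n)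

  -- Only the first two instances of periodicity enter: they give `U_k ≡ 0` and `U_(k+1) ≡ 1`, hence
  -- `b U_(k-1) = U_(k+1) - a U_k ≡ 1`, and these are the two coordinates of `ω ^ k`.
  period⇒ω^≡1 : ∀ m k → IsPeriod a b m k → B.ι (+ m) B.∣ ω B.^ k B.- B.1#
  period⇒ω^≡1 m zero per = B.∣-resp {x = B.ι (+ m)} {y = B.0#} ≡.refl (B.∣-0 {B.ι (+ m)})
  period⇒ω^≡1 m (suc j) per = B.∣-resp {x = B.ι (+ m)} (≡.sym (≡.cong (B._- B.1#) (ω^-coeff j)))
    (⇒ι∣ (≡.subst (+ m ∣ᶻ_) e₁ (ℤˢ.∣m∣n⇒∣m-n d₁ (ℤˢ.∣n⇒∣m*n a d₀)))
         (≡.subst (+ m ∣ᶻ_) (solve 1 (λ u → u :- con (+ 0) := u :+ (:- con (+ 0))) ≡.refl (U a b (suc j))) d₀'))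
    where
    d₀' : + m ∣ᶻ U a b (suc j) ℤ.- + 0
    d₀' = ∣⇒∣ᶻ (per 0)
    d₀ : + m ∣ᶻ U a b (suc j)
    d₀ = ≡.subst (+ m ∣ᶻ_) (solve 1 (λ u → u :- con (+ 0) := u) ≡.refl (U a b (suc j))) d₀'
    d₁ : + m ∣ᶻ (a ℤ.* U a b (suc j) ℤ.+ b ℤ.* U a b j) ℤ.- + 1
    d₁ = ∣⇒∣ᶻ (per 1)
    e₁ : ((a ℤ.* U a b (suc j) ℤ.+ b ℤ.* U a b j) ℤ.- + 1) ℤ.- a ℤ.* U a b (suc j) ≡ b ℤ.* U a b j ℤ.- + 1
    e₁ = solve 4 (λ a b u v → ((a :* v :+ b :* u) :- con (+ 1)) :- a :* v := b :* u :- con (+ 1)) ≡.refl a b (U a b j) (U a b (suc j))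

  -- Multiply the congruence by `ω ^ n` and read off the coefficient of `ω`.
  ω^≡1⇒period : ∀ m k → B.ι (+ m) B.∣ ω B.^ k B.- B.1# → IsPeriod a b m k
  ω^≡1⇒period m k d n = ∣ᶻ⇒∣ (≡.subst (+ m ∣ᶻ_)
    (≡.cong₂ (λ u v → u ℤ.- v) (ω^-second (n ℕ.+ k)) (ω^-second n))
    (proj₂ (ι∣⇒ {+ m} {proj₁ y} {proj₂ y} (B.∣-resp {x = B.ι (+ m)} {z = y} eq (B.∣-*ˡ {x = B.ι (+ m)} (ω B.^ n) d)))))
    where
    y = ω B.^ (n ℕ.+ k) B.- ω B.^ n
    eq : ω B.^ n B.* (ω B.^ k B.- B.1#) ≡ y
    eq = ≡.trans (B.solve 2 (λ u v → u B.:* (v B.:- B.con (+ 1)) B.:= u B.:* v B.:- u) ≡.refl (ω B.^ n) (ω B.^ k))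
      (≡.cong (B._- ω B.^ n) (≡.sym (B.^-homo-* ω n k)))

  -- Periods modulo p and p² as orders of ω

  module AtPrime {p : ℕ} (pp : Prime p) where
    module Q₁ = QuotKit Quad (B.ι (+ p))
    module Q₂ = QuotKit Quad (B.ι (+ (p ℕ.* p)))
    module F = Frobenius Quad pp

    p²∣⇒p∣ : ∀ {x} → B.ι (+ (p ℕ.* p)) B.∣ x → B.ι (+ p) B.∣ x
    p²∣⇒p∣ {x} = B.∣-trans {B.ι (+ p)} {B.ι (+ (p ℕ.* p))} {x}
      (B.ι (+ p) , ≡.trans (≡.cong B.ι (ℤₚ.pos-* p p)) (B.ι-* (+ p) (+ p)))

    p̂²∣⇒p²∣ : ∀ {x} n → B.ι (+ p) B.^ suc (suc n) B.∣ x → B.ι (+ (p ℕ.* p)) B.∣ x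
    p̂²∣⇒p²∣ {x} n = B.∣-trans {B.ι (+ (p ℕ.* p))} {B.ι (+ p) B.^ suc (suc n)} {x}
      (B.ι (+ p) B.^ n , ≡.trans (≡.sym (B.*-assoc p̂ p̂ (p̂ B.^ n)))
        (≡.cong (B._* (p̂ B.^ n)) (≡.sym (≡.trans (≡.cong B.ι (ℤₚ.pos-* p p)) (B.ι-* (+ p) (+ p))))))
      where p̂ = B.ι (+ p)

    period-1 : ∀ {m k} → IsPeriod a b m k → QuotKit.Q._≈_ Quad (B.ι (+ m)) (ω B.^ k) B.1#
    period-1 {m} {k} per = Kit.x-y≈0⇒x≈y (Quot Quad (B.ι (+ m))) (Congruence.∣⇒≈/0 Quad (B.ι (+ m)) (period⇒ω^≡1 m k per))

    1-period : ∀ {m k} → QuotKit.Q._≈_ Quad (B.ι (+ m)) (ω B.^ k) B.1# → IsPeriod a b m k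
    1-period {m} {k} e = ω^≡1⇒period m k (Congruence.≈/⇒∣- Quad (B.ι (+ m)) e)

    EqualPeriods : Set
    EqualPeriods = Σ ℕ λ k → IsPi a b (p ℕ.* p) k × IsPi a b p k

    -- Minimality of the period `k` modulo `p` forces `k` to divide `T`, for otherwise the remainder
    -- would be a smaller period; and `ω ^ k ≡ 1` holds modulo `p²` as well.
    order-lifts : EqualPeriods → ∀ T → ω B.^ T Q₁.Q.≈ B.1# → ω B.^ T Q₂.Q.≈ B.1#
    order-lifts (suc k , (_ , per₂ , _) , (_ , per₁ , least₁)) T ω^T≈1 = go (T ℕᵐ.% suc k) ≡.refl
      where
      q = T ℕᵐ./ suc k
      power : ∀ r → T ℕᵐ.% suc k ≡ r → ω B.^ T ≡ ω B.^ r B.* (ω B.^ suc k) B.^ q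
      power r e = ≡.trans (≡.cong (ω B.^_) (≡.trans (ℕᵐ.m≡m%n+[m/n]*n T (suc k)) (≡.cong₂ ℕ._+_ e (ℕₚ.*-comm q (suc k)))))
        (≡.trans (B.^-homo-* ω r (suc k ℕ.* q)) (≡.cong (ω B.^ r B.*_) (≡.sym (B.^-assocʳ ω (suc k) q))))
      go : ∀ r → T ℕᵐ.% suc k ≡ r → ω B.^ T Q₂.Q.≈ B.1#
      go zero e = Q₂.Q.trans (Q₂.≈⇒≈/ (≡.trans (power zero e) (B.*-identityˡ _)))
        (Q₂.Q.trans (Q₂.Q.^-congˡ q (period-1 {p ℕ.* p} {suc k} per₂)) (Q₂.Q.1^ q))
      go (suc r) e = ⊥-elim (ℕₚ.<⇒≱ (≡.subst (ℕ._< suc k) e (ℕᵐ.m%n<n T (suc k)))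
        (least₁ (suc r) (s≤s z≤n) (1-period {p} {suc r} ω^r≈1)))
        where
        ω^r≈1 : ω B.^ suc r Q₁.Q.≈ B.1#
        ω^r≈1 = Q₁.Q.trans (Q₁.Q.sym (Q₁.Q.trans (Q₁.≈⇒≈/ (power (suc r) e))
          (Q₁.Q.trans (Q₁.Q.*-congˡ {ω B.^ suc r} (Q₁.Q.trans (Q₁.Q.^-congˡ q (period-1 {p} {suc k} per₁)) (Q₁.Q.1^ q)))
            (Q₁.Q.*-identityʳ (ω B.^ suc r))))) ω^T≈1

    -- Let `k` be the period modulo `p`; `T` only bounds the search for it. From `ω ^ k ≡ 1` modulo
    -- `p` follows `ω ^ (k p²) ≡ 1` modulo `p³`, while `ω ^ (k p²) ≡ ω ^ k` modulo `p²` by the last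
    -- hypothesis. So `k` is also a period modulo `p²`.
    equal-periods : ∀ T → 1 ℕ.≤ T → ω B.^ T Q₁.Q.≈ B.1# → ω B.^ (p ℕ.^ 2) Q₂.Q.≈ ω → EqualPeriods
    equal-periods T 1≤T ω^T≈1 ω^p²≈ω = k , (1≤k , 1-period {p ℕ.* p} {k} ω^k≈1 , λ j 1≤j per → min j 1≤j (down {j} per))
                                      , (1≤k , per , min)
      where
      period? : ∀ k → Dec (IsPeriod a b p k)
      period? k with ι∣? p (ω B.^ k B.- B.1#)
      ... | yes d = yes (ω^≡1⇒period p k d)
      ... | no ¬d = no λ per → ¬d (period⇒ω^≡1 p k per)
      found = least period? T 1≤T (1-period {p} {T} ω^T≈1)
      k = proj₁ found
      1≤k = proj₁ (proj₂ found)
      per = proj₁ (proj₂ (proj₂ found))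
      min = proj₂ (proj₂ (proj₂ found))
      down : ∀ {j} → IsPeriod a b (p ℕ.* p) j → IsPeriod a b p j
      down {j} per₂ = ω^≡1⇒period p j (p²∣⇒p∣ {ω B.^ j B.- B.1#} (period⇒ω^≡1 (p ℕ.* p) j per₂))
      p² = p ℕ.^ 2
      lifted : (ω B.^ k) B.^ p² Q₂.Q.≈ B.1#
      lifted =
        let by μ ω^k≡ = period-1 {p} {k} per
            z , e = F.^p^-lift 0 2 B.1# μ
        in Q₂.Q.trans (Q₂.≈⇒≈/ (≡.trans (≡.cong (B._^ p²) (≡.trans ω^k≡ (≡.cong (λ t → B.1# B.+ t B.* μ) (≡.sym (B.*-identityʳ F.p̂)))))
             (≡.trans e (≡.cong (B._+ (F.p̂ B.^ 3 B.* z)) (B.1^ p²)))))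
           (Q₂.Q.trans (Q₂.Q.+-congˡ {B.1#} (Q₂.∣⇒≈/0 (p̂²∣⇒p²∣ {F.p̂ B.^ 3 B.* z} 1 (B.∣-self {F.p̂ B.^ 3} z)))) (Q₂.Q.+-identityʳ B.1#))
      ω^k≈1 : ω B.^ k Q₂.Q.≈ B.1#
      ω^k≈1 = Q₂.Q.trans (Q₂.Q.sym (Q₂.Q.trans (Q₂.≈⇒≈/ (≡.trans (B.^-assocʳ ω k p²) (≡.trans (≡.cong (ω B.^_) (ℕₚ.*-comm k p²))
        (≡.sym (B.^-assocʳ ω p² k))))) (Q₂.Q.^-congˡ k ω^p²≈ω))) lifted

    Δ : ℤ
    Δ = a ℤ.* a ℤ.+ + 4 ℤ.* b

    module Root₁ = RootModP (Quot Quad (B.ι (+ p))) pp Q₁.a≈/0 a b ω (Q₁.≈⇒≈/ ω-root)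
    module C₁ = CharP (Quot Quad (B.ι (+ p))) pp Q₁.a≈/0

    private
      p̂ : ℤ × ℤ
      p̂ = B.ι (+ p)
      instance
        p≢0 : ℕ.NonZero p
        p≢0 = Prm.prime⇒nonZero pp

    p≤of∣ : ∀ n → 1 ℕ.≤ n → + p ∣ᶻ + n → p ℕ.≤ n
    p≤of∣ (suc n) _ d = ℕᵈ.∣⇒≤ (∣ᶻ⇒∣ d)

    p²∣p*⇒p∣ : ∀ {x} → B.ι (+ (p ℕ.* p)) B.∣ p̂ B.* x → p̂ B.∣ x
    p²∣p*⇒p∣ {c , d} ((q , r) , e) = ⇒ι∣ {+ p} {c} {d} (cancel q c (≡.cong proj₁ e')) (cancel r d (≡.cong proj₂ e'))
      where
      e' : (+ p ℤ.* c , + p ℤ.* d) ≡ (+ (p ℕ.* p) ℤ.* q , + (p ℕ.* p) ℤ.* r)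
      e' = ≡.trans (≡.sym (ι*≡ (+ p) c d)) (≡.trans e (ι*≡ (+ (p ℕ.* p)) q r))
      cancel : ∀ q c → + p ℤ.* c ≡ + (p ℕ.* p) ℤ.* q → + p ∣ᶻ c
      cancel q c e = ℤˢ.divides q (ℤₚ.*-cancelˡ-≡ (+ p) c (q ℤ.* + p) (≡.trans e (≡.trans (≡.cong (ℤ._* q) (ℤₚ.pos-* p p))
        (≡.trans (ℤₚ.*-assoc (+ p) (+ p) q) (≡.cong (+ p ℤ.*_) (ℤₚ.*-comm (+ p) q))))))

    -- The inverse is the conjugate divided by the norm, which is prime to `p` by inertness.
    unit-unless-divisible : (∀ c d → + p ∣ᶻ norm c d → (+ p ∣ᶻ c) × (+ p ∣ᶻ d)) →
      ∀ x → ¬ (p̂ B.∣ x) → Σ (ℤ × ℤ) λ v → x B.* v Q₁.Q.≈ B.1#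
    unit-unless-divisible inert x@(c , d) p∤x = go (p ∣ᶻ? norm c d)
      where
      go : Dec (+ p ∣ᶻ norm c d) → Σ (ℤ × ℤ) λ v → x B.* v Q₁.Q.≈ B.1#
      go (yes p∣n) = ⊥-elim (p∤x (⇒ι∣ {+ p} {c} {d} (proj₁ (inert c d p∣n)) (proj₂ (inert c d p∣n))))
      go (no p∤n) =
        let u , e = Root₁.ι-unit (norm c d) p∤n in
        (c ℤ.+ a ℤ.* d , ℤ.- d) B.* B.ι u ,
          Q₁.Q.trans (Q₁.≈⇒≈/ (≡.trans (≡.sym (B.*-assoc x (c ℤ.+ a ℤ.* d , ℤ.- d) (B.ι u)))
            (≡.cong (B._* B.ι u) (norm-* c d)))) e

    module Unramified (p∤b : ¬ (+ p ∣ᶻ b)) (p∤Δ : ¬ (+ p ∣ᶻ Δ)) where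

      T : ℕ
      T = p ℕ.^ 2 ℕ.∸ 1

      1≤T : 1 ℕ.≤ T
      1≤T = ℕₚ.∸-monoˡ-≤ {2} {p ℕ.^ 2} 1 (ℕₚ.≤-trans (prime>1 pp) (ℕₚ.≤-trans (ℕₚ.≤-reflexive (≡.sym (ℕₚ.*-identityʳ p)))
        (ℕₚ.^-monoʳ-≤ p {1} {2} (s≤s z≤n))))

      ω^T≈1 : ω B.^ T Q₁.Q.≈ B.1#
      ω^T≈1 = Root₁.ω^[p²-1]≈1 p∤b p∤Δ

      -- The analogue of a Fermat quotient, `(ω ^ (p²) - ω) / p`. Its divisibility by `p` is
      -- equivalent to equality of the two periods.
      μ : ℤ × ℤ
      μ = Congruent.quotient (Root₁.ω-fixed p∤b p∤Δ)

      ω^p²≡ : ω B.^ (p ℕ.^ 2) ≡ ω B.+ p̂ B.* μ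
      ω^p²≡ = Congruent.equality (Root₁.ω-fixed p∤b p∤Δ)

      equal-periods⇒p∣μ : EqualPeriods → p̂ B.∣ μ
      equal-periods⇒p∣μ per = p²∣p*⇒p∣ {μ} (Q₂.≈/0⇒∣ (Q₂.Q.trans (Q₂.≈⇒≈/
          (≡.trans (B.solve 2 (λ w t → t B.:= (w B.:+ t) B.:- w) ≡.refl ω (p̂ B.* μ)) (≡.cong (B._- ω) (≡.sym ω^p²≡))))
        (Q₂.Q.x≈y⇒x-y≈0 {ω B.^ (p ℕ.^ 2)} {ω} fixed₂)))
        where
        fixed₂ : ω B.^ (p ℕ.^ 2) Q₂.Q.≈ ω
        fixed₂ = Q₂.Q.trans (Q₂.≈⇒≈/ (≡.cong (ω B.^_) (≡.sym (ℕₚ.m+[n∸m]≡n {1} (ℕₚ.m^n>0 p 2)))))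
          (Q₂.Q.trans (Q₂.Q.*-congˡ {ω} (order-lifts per T ω^T≈1)) (Q₂.Q.*-identityʳ ω))

      p∣μ⇒equal-periods : p̂ B.∣ μ → EqualPeriods
      p∣μ⇒equal-periods d = equal-periods T 1≤T ω^T≈1 (Q₂.Q.trans (Q₂.≈⇒≈/ ω^p²≡)
        (Q₂.Q.trans (Q₂.Q.+-congˡ {ω} (Q₂.∣⇒≈/0 (p̂²∣⇒p²∣ {p̂ B.* μ} 0
          (B.∣-resp {p̂ B.^ 2} {p̂ B.* (p̂ B.* B.1#) B.* proj₁ d} (≡.trans
            (B.solve 2 (λ p q → p B.:* (p B.:* B.con (+ 1)) B.:* q B.:= p B.:* (p B.:* q)) ≡.refl p̂ (proj₁ d))
            (≡.cong (p̂ B.*_) (≡.sym (proj₂ d)))) (B.∣-self {p̂ B.^ 2} (proj₁ d)))))) (Q₂.Q.+-identityʳ ω)))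

      module _ (inert : ∀ c d → + p ∣ᶻ norm c d → (+ p ∣ᶻ c) × (+ p ∣ᶻ d)) (¬per : ¬ EqualPeriods) where

        μ-unit : Σ (ℤ × ℤ) λ v → μ B.* v Q₁.Q.≈ B.1#
        μ-unit = unit-unless-divisible inert μ λ d → ¬per (p∣μ⇒equal-periods d)

    -- Here `ω² - 1 = (b - 1) + a ω` is divisible by 2. Equal periods would lift this to
    -- divisibility by 4, and so `4 ∣ a`.
    ramified-2 : p ≡ 2 → + p ∣ᶻ a → + p ∣ᶻ b ℤ.- + 1 → ¬ (+ (p ℕ.* p) ∣ᶻ a) → ¬ EqualPeriods
    ramified-2 p≡2 p∣a p∣b-1 p²∤a per = p²∤a (proj₂ (ι∣⇒ {+ (p ℕ.* p)} {b ℤ.- + 1} {a}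
        (B.∣-resp {B.ι (+ (p ℕ.* p))} {ω B.^ 2 B.- B.1#} ω²-1≡ (Q₂.≈/⇒∣- (order-lifts per 2 ω²≈1)))))
      where
      open Data.Integer.Solver.+-*-Solver
      ω²-1≡ : ω B.^ 2 B.- B.1# ≡ (b ℤ.- + 1 , a)
      ω²-1≡ = ≡.trans (≡.cong (B._- B.1#) (ω^-coeff 1)) (≡.cong₂ _,_
        (solve 1 (λ b → b :* con (+ 1) :+ (:- con (+ 1)) := b :- con (+ 1)) ≡.refl b)
        (solve 2 (λ a b → (a :* con (+ 1) :+ b :* con (+ 0)) :+ (:- con (+ 0)) := a) ≡.refl a b))
      ω²≈1 : ω B.^ 2 Q₁.Q.≈ B.1#
      ω²≈1 = Q₁.Q.x-y≈0⇒x≈y {ω B.^ 2} {B.1#} (Q₁.∣⇒≈/0 (B.∣-resp {p̂} {b ℤ.- + 1 , a} {ω B.^ 2 B.- B.1#} (≡.sym ω²-1≡)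
        (⇒ι∣ {+ p} {b ℤ.- + 1} {a} p∣b-1 p∣a)))

    -- Write `2ω = a + ρ`, where `ρ² = Δ` is divisible by `p`. Modulo `p` the power `ω ^ p` is the
    -- integer `a / 2`, so `ω ^ (p (p - 1)) ≡ 1`; equal periods lift this to `p²` and give
    -- `(2ω) ^ (p²) ≡ (2ω) ^ p`. But modulo `p²` the right side is `a ^ p + p ρ a ^ (p - 1)` and the
    -- left side is `a ^ p`. Hence `p` divides `ρ`, whose coefficient of `ω` is 2.
    module RamifiedOdd (h : ℕ) (2≤h : 2 ℕ.≤ h) (p≡ : p ≡ suc (h ℕ.+ h)) (p∤b : ¬ (+ p ∣ᶻ b)) (p∣Δ : + p ∣ᶻ Δ) (per : EqualPeriods) where
      5≤p : 5 ℕ.≤ p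
      5≤p = ≡.subst (5 ℕ.≤_) (≡.sym p≡) (s≤s (ℕₚ.+-mono-≤ 2≤h 2≤h))

      p∤2 : ¬ (+ p ∣ᶻ + 2)
      p∤2 d = ℕₚ.<⇒≱ (ℕₚ.≤-trans (s≤s (s≤s (s≤s z≤n))) 5≤p) (p≤of∣ 2 (s≤s z≤n) d)

      p∤4 : ¬ (+ p ∣ᶻ + 4)
      p∤4 d = ℕₚ.<⇒≱ 5≤p (p≤of∣ 4 (s≤s z≤n) d)

      p∤a : ¬ (+ p ∣ᶻ a)
      p∤a d = split (euclidᶻ pp (+ 4) b (ℤˢ.∣m+n∣m⇒∣n p∣Δ (ℤˢ.∣m⇒∣m*n a d)))
        where
        split : + p ∣ᶻ + 4 ⊎ + p ∣ᶻ b → ⊥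
        split (inj₁ d4) = p∤4 d4
        split (inj₂ db) = p∤b db

      ρ A X : ℤ × ℤ
      ρ = ℤ.- a , + 2
      A = B.ι a
      X = B.ι (+ 2) B.* ω

      ρ+A≡X : ρ B.+ A ≡ X
      ρ+A≡X = ≡.trans (≡.cong (ρ B.+_) (ι≡ a)) (≡.trans (≡.cong₂ _,_ (ℤₚ.+-inverseˡ a) ≡.refl) (≡.sym (ι*≡ (+ 2) (+ 0) (+ 1))))

      v : ℤ
      v = ℤˢ.quotient p∣Δ

      ρ²≡ : ρ B.* ρ ≡ p̂ B.* B.ι v
      ρ²≡ = ≡.trans (≡.cong₂ _,_
          (solve 2 (λ a b → (:- a) :* (:- a) :+ b :* (con (+ 2) :* con (+ 2)) := a :* a :+ con (+ 4) :* b) ≡.refl a b)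
          (solve 1 (λ a → ((:- a) :* con (+ 2) :+ con (+ 2) :* (:- a)) :+ a :* (con (+ 2) :* con (+ 2)) := con (+ 0)) ≡.refl a))
        (≡.trans (≡.cong (_, + 0) (ℤˢ._∣_.equality p∣Δ)) (≡.trans (≡.sym (ι≡ (v ℤ.* + p)))
          (≡.trans (B.ι-* v (+ p)) (B.*-comm (B.ι v) p̂))))
        where open Data.Integer.Solver.+-*-Solver

      -- Both discarded terms are divisible by ρ⁴, hence by p²; this is where p ≥ 5 enters.
      X^p≈ : X B.^ p Q₂.Q.≈ A B.^ p B.+ p̂ B.* (ρ B.* A B.^ (p ℕ.∸ 1))
      X^p≈ =
        let z , e = F.binomial ρ A in
        Q₂.Q.trans (Q₂.≈⇒≈/ (≡.trans (≡.cong (B._^ p) (≡.sym ρ+A≡X)) e))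
          (Q₂.Q.trans (Q₂.Q.+-cong {main B.+ p̂ B.* (ρ B.* (ρ B.* z))} {main}
              (Q₂.Q.trans (Q₂.Q.+-congˡ {main} (Q₂.∣⇒≈/0 (p̂²∣⇒p²∣ {p̂ B.* (ρ B.* (ρ B.* z))} 0 (B.ι v B.* z , small z))))
                (Q₂.Q.+-identityʳ main))
              (Q₂.∣⇒≈/0 {ρ B.^ p} (p̂²∣⇒p²∣ {ρ B.^ p} 0 ρ^p-small)))
            (Q₂.Q.+-identityʳ main))
        where
        main = A B.^ p B.+ p̂ B.* (ρ B.* A B.^ (p ℕ.∸ 1))
        small : ∀ z → p̂ B.* (ρ B.* (ρ B.* z)) ≡ p̂ B.^ 2 B.* (B.ι v B.* z)
        small z = ≡.trans (≡.cong (p̂ B.*_) (≡.trans (≡.sym (B.*-assoc ρ ρ z)) (≡.cong (B._* z) ρ²≡)))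
          (B.solve 3 (λ p v z → p B.:* (p B.:* v B.:* z) B.:= p B.:* (p B.:* B.con (+ 1)) B.:* (v B.:* z)) ≡.refl p̂ (B.ι v) z)
        ρ^p-small : p̂ B.^ 2 B.∣ ρ B.^ p
        ρ^p-small = B.∣-resp {p̂ B.^ 2} {ρ B.* (p̂ B.* B.ι v) B.^ h}
          (≡.sym (≡.trans (≡.cong (ρ B.^_) p≡) (≡.cong (ρ B.*_) (≡.trans (B.^-homo-* ρ h h)
            (≡.trans (≡.sym (B.^-distrib-* ρ ρ h)) (≡.cong (B._^ h) ρ²≡))))))
          (B.∣-*ˡ {p̂ B.^ 2} {(p̂ B.* B.ι v) B.^ h} ρ (B.∣-trans {p̂ B.^ 2} {p̂ B.^ h} {(p̂ B.* B.ι v) B.^ h} (B.^-∣ p̂ 2≤h)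
            (B.^-∣-^ {p̂} {p̂ B.* B.ι v} h (B.∣-self {p̂} (B.ι v)))))

      fermat : ∀ z → B.ι z B.^ p Q₁.Q.≈ B.ι z
      fermat z = Q₁.Q.trans (Q₁.≈⇒≈/ (≡.cong (B.ι z B.^_) (≡.sym (ℕₚ.*-identityʳ p)))) (C₁.fixed-ι 1 z)

      fermat² : ∀ z → B.ι z B.^ (p ℕ.* p) Q₂.Q.≈ B.ι z B.^ p
      fermat² z =
        let by e z^p≡ = fermat z
            w , f = F.^p-lift 0 (B.ι z) e
        in Q₂.Q.trans (Q₂.≈⇒≈/ (≡.trans (≡.sym (B.^-assocʳ (B.ι z) p p))
             (≡.trans (≡.cong (B._^ p) (≡.trans z^p≡ (≡.cong (λ t → B.ι z B.+ t B.* e) (≡.sym (B.*-identityʳ p̂))))) f)))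
           (Q₂.Q.trans (Q₂.Q.+-congˡ {B.ι z B.^ p} (Q₂.∣⇒≈/0 (p̂²∣⇒p²∣ {p̂ B.^ 2 B.* w} 0 (B.∣-self {p̂ B.^ 2} w))))
             (Q₂.Q.+-identityʳ (B.ι z B.^ p)))

      module Half (u₂ : ℤ) (half : B.ι (+ 2) B.* B.ι u₂ Q₁.Q.≈ B.1#) where

        ω^p≈ : ω B.^ p Q₁.Q.≈ B.ι (a ℤ.* u₂)
        ω^p≈ = Root₁.unit-cancel {B.ι (+ 2)} {B.ι u₂} half (begin
          B.ι (+ 2) B.* ω B.^ p ≈⟨ Q₁.Q.*-congʳ {ω B.^ p} (fermat (+ 2)) ⟨
          B.ι (+ 2) B.^ p B.* ω B.^ p ≈⟨ Q₁.Q.^-distrib-* (B.ι (+ 2)) ω p ⟨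
          X B.^ p ≈⟨ to₁ X^p≈ ⟩
          A B.^ p B.+ p̂ B.* (ρ B.* A B.^ (p ℕ.∸ 1)) ≈⟨ by (ρ B.* A B.^ (p ℕ.∸ 1)) ≡.refl ⟩
          A B.^ p ≈⟨ fermat a ⟩
          A ≈⟨ Q₁.Q.*-identityʳ A ⟨
          A B.* B.1# ≈⟨ Q₁.Q.*-congˡ {A} half ⟨
          A B.* (B.ι (+ 2) B.* B.ι u₂) ≈⟨ Q₁.≈⇒≈/ (B.solve 3 (λ a t u → a B.:* (t B.:* u) B.:= t B.:* (a B.:* u)) ≡.refl A (B.ι (+ 2)) (B.ι u₂)) ⟩
          B.ι (+ 2) B.* (A B.* B.ι u₂) ≈⟨ Q₁.Q.*-congˡ {B.ι (+ 2)} (Q₁.≈⇒≈/ (B.ι-* a u₂)) ⟨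
          B.ι (+ 2) B.* B.ι (a ℤ.* u₂) ∎)
          where
          open Q₁.Q.≈R
          to₁ : ∀ {x y} → x Q₂.Q.≈ y → x Q₁.Q.≈ y
          to₁ {x} {y} e = Q₁.Q.x-y≈0⇒x≈y {x} {y} (Q₁.∣⇒≈/0 (p²∣⇒p∣ {x B.- y} (Q₂.≈/⇒∣- e)))

        T : ℕ
        T = p ℕ.* (p ℕ.∸ 1)

        p*p≡ : p ℕ.* p ≡ p ℕ.+ T
        p*p≡ = ≡.trans (≡.cong (p ℕ.*_) (≡.sym (ℕₚ.m+[n∸m]≡n {1} {p} (ℕₚ.<⇒≤ (prime>1 pp))))) (ℕₚ.*-suc p (p ℕ.∸ 1))

        ω^T≈1 : ω B.^ T Q₁.Q.≈ B.1#
        ω^T≈1 =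
          Root₁.ω^-cancel p∤b p {ω B.^ T} {B.1#} (begin
          ω B.^ p B.* ω B.^ T ≈⟨ Q₁.Q.^-homo-* ω p T ⟨
          ω B.^ (p ℕ.+ T) ≈⟨ Q₁.≈⇒≈/ (≡.cong (ω B.^_) p*p≡) ⟨
          ω B.^ (p ℕ.* p) ≈⟨ Q₁.Q.^-assocʳ ω p p ⟨
          (ω B.^ p) B.^ p ≈⟨ Q₁.Q.^-congˡ p ω^p≈ ⟩
          B.ι (a ℤ.* u₂) B.^ p ≈⟨ fermat (a ℤ.* u₂) ⟩
          B.ι (a ℤ.* u₂) ≈⟨ ω^p≈ ⟨
          ω B.^ p ≈⟨ Q₁.Q.*-identityʳ (ω B.^ p) ⟨
          ω B.^ p B.* B.1# ∎)
          where open Q₁.Q.≈R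

        impossible : ⊥
        impossible = p∤2 (proj₂ (ι∣⇒ {+ p} { ℤ.- a} {+ 2} (Q₁.≈/0⇒∣ ρ≈0)))
          where
          Y = ρ B.* A B.^ (p ℕ.∸ 1)
          X^p²≈ : (X B.^ p) B.^ p Q₂.Q.≈ X B.^ p
          X^p²≈ = begin
            (X B.^ p) B.^ p ≈⟨ Q₂.Q.^-assocʳ X p p ⟩
            X B.^ (p ℕ.* p) ≈⟨ Q₂.Q.^-distrib-* (B.ι (+ 2)) ω (p ℕ.* p) ⟩
            B.ι (+ 2) B.^ (p ℕ.* p) B.* ω B.^ (p ℕ.* p) ≈⟨ Q₂.Q.*-cong (fermat² (+ 2)) ω^p² ⟩
            B.ι (+ 2) B.^ p B.* ω B.^ p ≈⟨ Q₂.Q.^-distrib-* (B.ι (+ 2)) ω p ⟨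
            X B.^ p ∎
            where
            open Q₂.Q.≈R
            ω^p² : ω B.^ (p ℕ.* p) Q₂.Q.≈ ω B.^ p
            ω^p² = begin
              ω B.^ (p ℕ.* p) ≈⟨ Q₂.≈⇒≈/ (≡.cong (ω B.^_) p*p≡) ⟩
              ω B.^ (p ℕ.+ T) ≈⟨ Q₂.Q.^-homo-* ω p T ⟩
              ω B.^ p B.* ω B.^ T ≈⟨ Q₂.Q.*-congˡ {ω B.^ p} (order-lifts per T ω^T≈1) ⟩
              ω B.^ p B.* B.1# ≈⟨ Q₂.Q.*-identityʳ (ω B.^ p) ⟩
              ω B.^ p ∎
          A^p+pY≈ : A B.^ p B.+ p̂ B.* Y Q₂.Q.≈ A B.^ p
          A^p+pY≈ =
            let w , f = F.^p-lift 0 (A B.^ p) Y in begin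
            A B.^ p B.+ p̂ B.* Y ≈⟨ X^p≈ ⟨
            X B.^ p ≈⟨ X^p²≈ ⟨
            (X B.^ p) B.^ p ≈⟨ Q₂.Q.^-congˡ p X^p≈ ⟩
            (A B.^ p B.+ p̂ B.* Y) B.^ p ≈⟨ Q₂.≈⇒≈/ (≡.cong (λ t → (A B.^ p B.+ t B.* Y) B.^ p) (≡.sym (B.*-identityʳ p̂))) ⟩
            (A B.^ p B.+ p̂ B.^ 1 B.* Y) B.^ p ≈⟨ Q₂.≈⇒≈/ f ⟩
            (A B.^ p) B.^ p B.+ p̂ B.^ 2 B.* w ≈⟨ Q₂.Q.+-cong (Q₂.Q.trans (Q₂.Q.^-assocʳ A p p) (fermat² a))
                (Q₂.∣⇒≈/0 (p̂²∣⇒p²∣ {p̂ B.^ 2 B.* w} 0 (B.∣-self {p̂ B.^ 2} w))) ⟩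
            A B.^ p B.+ B.0# ≈⟨ Q₂.Q.+-identityʳ (A B.^ p) ⟩
            A B.^ p ∎
            where open Q₂.Q.≈R
          Y≈0 : Y Q₁.Q.≈ B.0#
          Y≈0 = Q₁.∣⇒≈/0 (p²∣p*⇒p∣ {Y} (B.∣-resp {B.ι (+ (p ℕ.* p))} {(A B.^ p B.+ p̂ B.* Y) B.- A B.^ p}
            (B.solve 2 (λ a y → (a B.:+ y) B.:- a B.:= y) ≡.refl (A B.^ p) (p̂ B.* Y)) (Q₂.≈/⇒∣- A^p+pY≈)))
          ρ≈0 : ρ Q₁.Q.≈ B.0#
          ρ≈0 = Root₁.ι^-cancel a p∤a (p ℕ.∸ 1) {ρ} {B.0#}
              (Q₁.Q.trans (Q₁.≈⇒≈/ (B.*-comm (A B.^ (p ℕ.∸ 1)) ρ)) (Q₁.Q.trans Y≈0 (Q₁.≈⇒≈/ (≡.sym (B.zeroʳ (A B.^ (p ℕ.∸ 1)))))))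

      no-equal-periods : ⊥
      no-equal-periods = let u₂ , half = Root₁.ι-unit (+ 2) p∤2 in Half.impossible u₂ half

-- Local data of ℤ[θ], θ ^ M = ω, at each prime

p-free-part : ∀ {p} → Prime p → ∀ M → 1 ℕ.≤ M → Σ ℕ λ k → Σ ℕ λ m → (M ≡ m ℕ.* p ℕ.^ k) × ¬ (p ℕᵈ.∣ m)
p-free-part {p} pp = <-rec _ go
  where
  go : ∀ M → (∀ {M'} → M' ℕ.< M → 1 ℕ.≤ M' → Σ ℕ λ k → Σ ℕ λ m → (M' ≡ m ℕ.* p ℕ.^ k) × ¬ (p ℕᵈ.∣ m)) →
    1 ℕ.≤ M → Σ ℕ λ k → Σ ℕ λ m → (M ≡ m ℕ.* p ℕ.^ k) × ¬ (p ℕᵈ.∣ m)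
  go M ih 1≤M with p ℕᵈ.∣? M
  ... | no p∤M = 0 , M , ≡.sym (ℕₚ.*-identityʳ M) , p∤M
  ... | yes (divides zero e) = ⊥-elim (ℕₚ.<⇒≢ 1≤M (≡.sym e))
  ... | yes (divides (suc q) e) with ih (≡.subst (suc q ℕ.<_) (≡.sym e) (ℕₚ.m<m*n (suc q) p (prime>1 pp))) (s≤s z≤n)
  ... | k , m , e' , p∤m = suc k , m , ≡.trans e (≡.trans (≡.cong (ℕ._* p) e')
        (≡.trans (ℕₚ.*-assoc m (p ℕ.^ k) p) (≡.cong (m ℕ.*_) (ℕₚ.*-comm (p ℕ.^ k) p)))) , p∤m

-- By the pigeonhole principle two of the powers `p ^ 0, ..., p ^ L` agree modulo `L`; the smaller
-- one cancels because `p` is prime to `L`.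
p^≡1 : ∀ {p} → Prime p → ∀ L → 1 ℕ.≤ L → ¬ (p ℕᵈ.∣ L) → Σ ℕ λ j → 1 ℕ.≤ j × L ℕᵈ.∣ p ℕ.^ j ℕ.∸ 1
p^≡1 {p} pp L@(suc _) _ p∤L with Finₚ.pigeonhole (ℕₚ.n<1+n L) (λ i → fromℕ< (ℕᵐ.m%n<n (p ℕ.^ toℕ i) L))
... | i , j , i<j , eq = d , ℕₚ.m<n⇒0<n∸m i<j , remove-p^ (toℕ i)
      (≡.subst (L ℕᵈ.∣_) difference (divides (q' ℕ.∸ q) (≡.sym (ℕₚ.*-distribʳ-∸ L q' q))))
  where
  P Q r q q' d : ℕ
  P = p ℕ.^ toℕ i
  Q = p ℕ.^ toℕ j
  r = P ℕᵐ.% L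
  q = P ℕᵐ./ L
  q' = Q ℕᵐ./ L
  d = toℕ j ℕ.∸ toℕ i
  same-rest : Q ℕᵐ.% L ≡ r
  same-rest = ≡.sym (≡.trans (≡.sym (Finₚ.toℕ-fromℕ< (ℕᵐ.m%n<n P L))) (≡.trans (≡.cong toℕ eq) (Finₚ.toℕ-fromℕ< (ℕᵐ.m%n<n Q L))))
  difference : q' ℕ.* L ℕ.∸ q ℕ.* L ≡ P ℕ.* (p ℕ.^ d ℕ.∸ 1)
  difference = begin
    q' ℕ.* L ℕ.∸ q ℕ.* L ≡⟨ ℕₚ.[m+n]∸[m+o]≡n∸o r (q' ℕ.* L) (q ℕ.* L) ⟨
    (r ℕ.+ q' ℕ.* L) ℕ.∸ (r ℕ.+ q ℕ.* L) ≡⟨ ≡.cong₂ ℕ._∸_ (≡.trans (≡.cong (ℕ._+ q' ℕ.* L) (≡.sym same-rest)) (≡.sym (ℕᵐ.m≡m%n+[m/n]*n Q L))) (≡.sym (ℕᵐ.m≡m%n+[m/n]*n P L)) ⟩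
    Q ℕ.∸ P ≡⟨ ≡.cong (λ n → p ℕ.^ n ℕ.∸ P) (ℕₚ.m+[n∸m]≡n (ℕₚ.<⇒≤ i<j)) ⟨
    p ℕ.^ (toℕ i ℕ.+ d) ℕ.∸ P ≡⟨ ≡.cong (ℕ._∸ P) (ℕₚ.^-distribˡ-+-* p (toℕ i) d) ⟩
    P ℕ.* p ℕ.^ d ℕ.∸ P ≡⟨ ≡.cong (P ℕ.* p ℕ.^ d ℕ.∸_) (ℕₚ.*-identityʳ P) ⟨
    P ℕ.* p ℕ.^ d ℕ.∸ P ℕ.* 1 ≡⟨ ℕₚ.*-distribˡ-∸ P (p ℕ.^ d) 1 ⟨
    P ℕ.* (p ℕ.^ d ℕ.∸ 1) ∎
    where open ≡.≡-Reasoning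
  remove-p^ : ∀ n {c} → L ℕᵈ.∣ p ℕ.^ n ℕ.* c → L ℕᵈ.∣ c
  remove-p^ zero {c} e = ≡.subst (L ℕᵈ.∣_) (ℕₚ.+-identityʳ c) e
  remove-p^ (suc n) {c} e = remove-p^ n (Cop.coprime-divisor (Cop.sym (prime∤⇒coprime L pp p∤L))
    (≡.subst (L ℕᵈ.∣_) (ℕₚ.*-assoc p (p ℕ.^ n) c) e))

∤-* : ∀ {p} → Prime p → ∀ {m n} → ¬ (p ℕᵈ.∣ m) → ¬ (p ℕᵈ.∣ n) → ¬ (p ℕᵈ.∣ m ℕ.* n)
∤-* pp {m} {n} p∤m p∤n d with Prm.euclidsLemma m n pp d
... | inj₁ e = p∤m e
... | inj₂ e = p∤n e

∤pred : ∀ {p} → Prime p → ∀ {n} → 1 ℕ.≤ n → p ℕᵈ.∣ n → ¬ (p ℕᵈ.∣ n ℕ.∸ 1)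
∤pred {p} pp {suc n} _ p∣1+n p∣n = Prm.¬prime[1] (≡.subst Prime (ℕᵈ.∣1⇒≡1 (ℕᵈ.∣m+n∣m⇒∣n (≡.subst (p ℕᵈ.∣_) (ℕₚ.+-comm 1 n) p∣1+n) p∣n)) pp)

positive : ∀ {p} m → ¬ (p ℕᵈ.∣ m) → 1 ℕ.≤ m
positive {p} zero p∤m = ⊥-elim (p∤m (p ℕᵈ.∣0))
positive (suc m) _ = s≤s z≤n

-- `generated` expresses `A = ℤ[θ]` as an induction principle on predicates. It carries the property
-- of being fixed by a power of Frobenius from `θ` to all of `A`.
module LocalDataOf (A : CRing) (θ : CommutativeRing.Carrier A)
  (generated : (P : CommutativeRing.Carrier A → Set) → (∀ {x y} → CommutativeRing._≈_ A x y → P x → P y) →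
    (∀ z → P (Kit.ι A z)) → P θ →
    (∀ {x y} → P x → P y → P (CommutativeRing._+_ A x y)) → (∀ {x y} → P x → P y → P (CommutativeRing._*_ A x y)) → ∀ x → P x)
  (a b : ℤ) (M : ℕ) (1≤M : 1 ℕ.≤ M)
  (root : Kit._≈_ A (Kit._*_ A (Kit._^_ A θ M) (Kit._^_ A θ M)) (Kit._+_ A (Kit._*_ A (Kit.ι A a) (Kit._^_ A θ M)) (Kit.ι A b)))
  {p : ℕ} (pp : Prime p) where
  open Kit A
  open LocalCriterion A pp
  open Frobenius A pp using (frobenius^; ^p^-lift)
  open ≈R

  private
    instance
      p≢0 : ℕ.NonZero p
      p≢0 = Prm.prime⇒nonZero pp

  ω : Carrier
  ω = θ ^ M

  ι-^ : ∀ z n → ι (z ℤ.^ n) ≈ ι z ^ n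
  ι-^ z zero = refl
  ι-^ z (suc n) = trans (ι-* z (z ℤ.^ n)) (*-congˡ (ι-^ z n))

  -- The residue ring A / (π, p)

  module Residue (π : Carrier) where
    K : CRing
    K = Quot (Quot A π) p̂
    module K = Kit K
    private
      module Cπ = Congruence A π
      module Cp = Congruence (Quot A π) p̂
    module C = CharP K pp Cp.a≈/0
    module Root = RootModP K pp Cp.a≈/0 a b ω (Cp.≈⇒≈/ (Cπ.≈⇒≈/ root))

    ≈⇒K : ∀ {x y} → x ≈ y → x K.≈ y
    ≈⇒K e = Cp.≈⇒≈/ (Cπ.≈⇒≈/ e)

    ∈⇒K : ∀ {x} → x ∈[ π ] → x K.≈ 0#
    ∈⇒K {x} (s , t , e) = by t (by s (trans e (solve 2 (λ s t → s :+ t := (con (+ 0) :+ t) :+ s) refl (π * s) (p̂ * t))))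

    K⇒∈ : ∀ {x} → x K.≈ 0# → x ∈[ π ]
    K⇒∈ (by t (by s e)) = s , t , trans e (solve 2 (λ s t → (con (+ 0) :+ t) :+ s := s :+ t) refl (π * s) (p̂ * t))

    π≈0 : ∀ x → π * x K.≈ 0#
    π≈0 x = Cp.≈⇒≈/ (Cπ.∣⇒≈/0 (∣-self x))

    p≈0 : ∀ x → p̂ * x K.≈ 0#
    p≈0 x = Cp.∣⇒≈/0 (x , Cπ.≈⇒≈/ refl)

    Perfect : Set
    Perfect = Σ ℕ λ j → 1 ℕ.≤ j × C.Fixed j θ

    -- With `P = p ^ j`, every element of the residue ring satisfies `g = g ^ (P ^ k)`. Since
    -- `k ≤ P ^ k`, the vanishing of `g ^ k` makes `g` vanish.
    reduced : Perfect → ∀ g k → g ^ k ∈[ π ] → g ∈[ π ]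
    reduced (j , 1≤j , θ-fixed) g k g^k∈ = K⇒∈ (K.trans (K.sym (iterate k))
      (let o , e = ^-∣ g (n≤P^n k) in K.trans (≈⇒K e) (K.trans (K.*-congʳ {o} (∈⇒K g^k∈)) (K.zeroˡ o))))
      where
      P : ℕ
      P = p ℕ.^ j
      fixed : ∀ g → C.Fixed j g
      fixed = generated (C.Fixed j) (λ e → C.fixed-resp j (≈⇒K e)) (C.fixed-ι j) θ-fixed (C.fixed-+ j) (C.fixed-* j)
      2≤P : 2 ℕ.≤ P
      2≤P = ℕₚ.≤-trans (prime>1 pp) (ℕₚ.≤-trans (ℕₚ.≤-reflexive (≡.sym (ℕₚ.*-identityʳ p))) (ℕₚ.^-monoʳ-≤ p 1≤j))
      n≤P^n : ∀ n → n ℕ.≤ P ℕ.^ n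
      n≤P^n zero = z≤n
      n≤P^n (suc n) = ℕₚ.≤-trans (ℕₚ.≤-trans (ℕₚ.+-mono-≤ {1} (ℕₚ.≤-trans (s≤s z≤n) (ℕₚ.m^n>0 P {{ℕ.>-nonZero (ℕₚ.<-trans (s≤s z≤n) 2≤P)}} n)) (n≤P^n n))
        (ℕₚ.≤-reflexive (≡.cong (P ℕ.^ n ℕ.+_) (≡.sym (ℕₚ.+-identityʳ (P ℕ.^ n)))))) (ℕₚ.*-monoˡ-≤ (P ℕ.^ n) 2≤P)
      iterate : ∀ t → g ^ (P ℕ.^ t) K.≈ g
      iterate zero = ≈⇒K (*-identityʳ g)
      iterate (suc t) = K.trans (≈⇒K (sym (^-assocʳ g P (P ℕ.^ t)))) (K.trans (K.^-congˡ (P ℕ.^ t) (fixed g)) (iterate t))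

    regular : ∀ {u v} → u * v K.≈ 1# → ∀ g → u * g ∈[ π ] → g ∈[ π ]
    regular {u} {v} uv≈1 g ug∈ = K⇒∈ (Root.unit-cancel {u} {v} {g} {0#} uv≈1 (K.trans (∈⇒K ug∈) (≈⇒K (sym (zeroʳ u)))))

    perfect-if-0 : θ K.≈ 0# → Perfect
    perfect-if-0 θ≈0 = 1 , s≤s z≤n , C.fixed-resp 1 (K.sym θ≈0) (C.fixed-0 1)

    -- As `p` is prime to `L`, some `p ^ j - 1` with `j ≥ 1` is a multiple of `L`, so
    -- `θ ^ (p ^ j) = θ`.
    perfect-if-root-of-unity : ∀ L → 1 ℕ.≤ L → ¬ (p ℕᵈ.∣ L) → θ ^ L K.≈ 1# → Perfect
    perfect-if-root-of-unity L 1≤L p∤L θ^L≈1 = finish (p^≡1 pp L 1≤L p∤L)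
      where
      finish : (Σ ℕ λ j → 1 ℕ.≤ j × L ℕᵈ.∣ p ℕ.^ j ℕ.∸ 1) → Perfect
      finish (j , 1≤j , divides c e) = j , 1≤j , K.trans (≈⇒K (reflexive (≡.cong (θ ^_) p^j≡)))
        (K.trans (K.*-congˡ {θ} (K.trans (≈⇒K (sym (^-assocʳ θ L c))) (K.trans (K.^-congˡ c θ^L≈1) (K.1^ c)))) (≈⇒K (*-identityʳ θ)))
        where
        p^j≡ : p ℕ.^ j ≡ suc (L ℕ.* c)
        p^j≡ = ≡.trans (≡.sym (ℕₚ.m+[n∸m]≡n {1} (ℕₚ.m^n>0 p j))) (≡.cong suc (≡.trans e (ℕₚ.*-comm c L)))

    -- Used with `n = p` for an integer `y` and with `n = p²` for a power of `ω`. Since `p` divides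
    -- `n`, the exponent `m (n - 1)` that kills `θ` is prime to `p`.
    perfect-if-root : ∀ m n y → ¬ (p ℕᵈ.∣ m) → 1 ℕ.≤ n → p ℕᵈ.∣ n → θ ^ m K.≈ y → y ^ (n ℕ.∸ 1) K.≈ 1# → 1 ℕ.≤ n ℕ.∸ 1 → Perfect
    perfect-if-root m n y p∤m 1≤n p∣n θ^m≈y y^≈1 1≤n-1 = perfect-if-root-of-unity (m ℕ.* (n ℕ.∸ 1))
      (ℕₚ.*-mono-≤ (positive m p∤m) 1≤n-1) (∤-* pp p∤m (∤pred pp 1≤n p∣n))
      (K.trans (≈⇒K (sym (^-assocʳ θ m (n ℕ.∸ 1)))) (K.trans (K.^-congˡ (n ℕ.∸ 1) θ^m≈y) y^≈1))

    ι^[p-1]≈1 : ∀ z → ¬ (+ p ∣ᶻ z) → ι z ^ (p ℕ.∸ 1) K.≈ 1#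
    ι^[p-1]≈1 z p∤z = let u , e = Root.ι-unit z p∤z in Root.unit-cancel {ι z} {ι u} e
      (K.trans (≈⇒K (reflexive (≡.cong (ι z ^_) (≡.trans (ℕₚ.m+[n∸m]≡n {1} {p} (ℕₚ.<⇒≤ (prime>1 pp))) (≡.sym (ℕₚ.*-identityʳ p))))))
        (K.trans (C.fixed-ι 1 z) (≈⇒K (sym (*-identityʳ (ι z))))))

    perfect-if-ι : ∀ m z → ¬ (p ℕᵈ.∣ m) → ¬ (+ p ∣ᶻ z) → θ ^ m K.≈ ι z → Perfect
    perfect-if-ι m z p∤m p∤z e = perfect-if-root m p (ι z) p∤m (ℕₚ.<⇒≤ (prime>1 pp)) ℕᵈ.∣-refl e (ι^[p-1]≈1 z p∤z)
      (ℕₚ.∸-monoˡ-≤ 1 (prime>1 pp))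

    perfect-if-ω : ∀ m k → ¬ (+ p ∣ᶻ b) → ¬ (+ p ∣ᶻ a ℤ.* a ℤ.+ + 4 ℤ.* b) → ¬ (p ℕᵈ.∣ m) → θ ^ m K.≈ ω ^ k → Perfect
    perfect-if-ω m k p∤b p∤Δ p∤m e = perfect-if-root m (p ℕ.^ 2) (ω ^ k) p∤m (ℕₚ.m^n>0 p 2) (ℕᵈ.m∣m*n (p ℕ.^ 1)) e
      (K.trans (≈⇒K (trans (^-assocʳ ω k (p ℕ.^ 2 ℕ.∸ 1)) (trans (reflexive (≡.cong (ω ^_) (ℕₚ.*-comm k (p ℕ.^ 2 ℕ.∸ 1))))
        (sym (^-assocʳ ω (p ℕ.^ 2 ℕ.∸ 1) k))))) (K.trans (K.^-congˡ k (Root.ω^[p²-1]≈1 p∤b p∤Δ)) (K.1^ k)))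
      (ℕₚ.∸-monoˡ-≤ {2} {p ℕ.^ 2} 1 (ℕₚ.≤-trans (prime>1 pp) (ℕₚ.≤-trans (ℕₚ.≤-reflexive (≡.sym (ℕₚ.*-identityʳ p)))
        (ℕₚ.^-monoʳ-≤ p {1} {2} (s≤s z≤n)))))

    ≈-of-π : ∀ {x y} → π ≈ x - y → x K.≈ y
    ≈-of-π {x} {y} e = K.x-y≈0⇒x≈y {x} {y} (K.trans (≈⇒K (trans (sym e) (sym (*-identityʳ π)))) (π≈0 1#))

    1-unit : 1# * 1# K.≈ 1#
    1-unit = ≈⇒K (*-identityˡ 1#)

    localData : ∀ u E → π ^ E ≈ p̂ * u → Perfect → (Σ Carrier λ v → u * v K.≈ 1#) → LocalData
    localData u E eq perf (v , uv≈1) = record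
      { π = π ; w = 1# ; u = u ; E = E
      ; π^E*w≈p*u = trans (*-identityʳ _) eq
      ; reduced-π = reduced perf
      ; reduced-w = λ g k _ → g , 0# , solve 2 (λ g p → g := con (+ 1) :* g :+ p :* con (+ 0)) refl g p̂
      ; u-regular = regular {u} {v} uv≈1
      ; w-regular = regular {1#} {1#} 1-unit }

    module AtZero (π≈θ : π ≈ θ) where
      ω≈0 : ω K.≈ 0#
      ω≈0 = let z , e = ^-pos π 1≤M in K.trans (≈⇒K (trans (^-congˡ M (sym π≈θ)) e)) (π≈0 z)

      θ-perfect : Perfect
      θ-perfect = perfect-if-0 (≈-of-π (trans π≈θ (solve 1 (λ t → t := t :- con (+ 0)) refl θ)))

      -- The Eisenstein case: `θ ^ (2M) = a ω + b` is `p` times an element congruent to `b'` modulo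
      -- `(θ, p)`, since `ω` is a power of `θ`.
      p∣a∣b : ∀ a' b' → a ≡ a' ℤ.* + p → b ≡ b' ℤ.* + p → ¬ (+ p ∣ᶻ b') → LocalData
      p∣a∣b a' b' a≡ b≡ p∤b' = localData (ι a' * ω + ι b') (M ℕ.+ M) eq θ-perfect (ι u , unit)
        where
        u = proj₁ (Root.ι-unit b' p∤b')
        eq : π ^ (M ℕ.+ M) ≈ p̂ * (ι a' * ω + ι b')
        eq = begin
          π ^ (M ℕ.+ M) ≈⟨ trans (^-congˡ (M ℕ.+ M) π≈θ) (^-homo-* θ M M) ⟩
          ω * ω ≈⟨ root ⟩
          ι a * ω + ι b ≈⟨ +-cong (*-congʳ (trans (reflexive (≡.cong ι a≡)) (ι-* a' (+ p)))) (trans (reflexive (≡.cong ι b≡)) (ι-* b' (+ p))) ⟩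
          ι a' * p̂ * ω + ι b' * p̂ ≈⟨ solve 4 (λ a p w b → a :* p :* w :+ b :* p := p :* (a :* w :+ b)) refl (ι a') p̂ ω (ι b') ⟩
          p̂ * (ι a' * ω + ι b') ∎
        unit : (ι a' * ω + ι b') * ι u K.≈ 1#
        unit = K.trans (K.*-congʳ {ι u} (K.trans (K.+-congʳ {ι b'} (K.trans (K.*-congˡ {ι a'} ω≈0) (≈⇒K (zeroʳ (ι a')))))
          (≈⇒K (+-identityˡ (ι b'))))) (proj₂ (Root.ι-unit b' p∤b'))

      -a-inverse : ¬ (+ p ∣ᶻ a) → Σ Carrier λ u → (ω - ι a) * u K.≈ 1#
      -a-inverse p∤a =
        let u , e = Root.ι-unit a p∤a
        in - ι u , K.trans (≈⇒K (solve 3 (λ w a u → (w :- a) :* (:- u) := w :* (:- u) :+ a :* u) refl ω (ι a) (ι u)))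
          (K.trans (K.+-cong (K.trans (K.*-congʳ { - ι u} ω≈0) (≈⇒K (zeroˡ (- ι u)))) e) (≈⇒K (+-identityˡ 1#)))

    -- Put `R = r ^ q`. Expanding `ω = (π + r) ^ q` gives `π ^ q = ω - R` up to a multiple of `p π`.
    -- With `f(X) = X² - aX - b`, the equation `0 = f(ω) = (ω - R)² + (2R - a) (ω - R) +
    -- f(R)` turns the square into `p u`, and `u ≡ -v` because `ω - R` vanishes modulo `(π, p)`.
    ramified : ∀ k m → M ≡ m ℕ.* p ℕ.^ k → ¬ (p ℕᵈ.∣ m) → ∀ r c v → π ≈ θ ^ m - ι r → ¬ (+ p ∣ᶻ r) → ¬ (+ p ∣ᶻ v) →
      + 2 ℤ.* r ℤ.^ (p ℕ.^ k) ℤ.- a ≡ + p ℤ.* c →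
      r ℤ.^ (p ℕ.^ k) ℤ.* r ℤ.^ (p ℕ.^ k) ℤ.- a ℤ.* r ℤ.^ (p ℕ.^ k) ℤ.- b ≡ + p ℤ.* v → LocalData
    ramified k m M≡ p∤m r c v π≈ p∤r p∤v trace≡ value≡ = localData u (q ℕ.+ q) eq
        (perfect-if-ι m r p∤m p∤r θ^m≈) (- ι v⁻ , unit)
      where
      q = p ℕ.^ k
      r₁ = ι (r ℤ.^ q)
      v⁻ = proj₁ (Root.ι-unit v p∤v)
      θ^m≈ : θ ^ m K.≈ ι r
      θ^m≈ = ≈-of-π π≈
      κ = proj₁ (frobenius^ k π (ι r))
      u = - (ι c * (ω - r₁)) - ι v - ι (+ 2) * (π * κ * (ω - r₁)) + p̂ * (π * κ * (π * κ))
      ω≈ : ω ≈ π ^ q + r₁ + p̂ * (π * κ)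
      ω≈ = begin
        θ ^ M ≡⟨ ≡.cong (θ ^_) M≡ ⟩
        θ ^ (m ℕ.* q) ≈⟨ ^-assocʳ θ m q ⟨
        (θ ^ m) ^ q ≈⟨ ^-congˡ q (trans (solve 2 (λ t r → t := (t :- r) :+ r) refl (θ ^ m) (ι r)) (+-congʳ (sym π≈))) ⟩
        (π + ι r) ^ q ≈⟨ proj₂ (frobenius^ k π (ι r)) ⟩
        π ^ q + ι r ^ q + p̂ * (π * κ) ≈⟨ +-congʳ (+-congˡ (ι-^ r q)) ⟨
        π ^ q + r₁ + p̂ * (π * κ) ∎
      trace≈ : ι (+ 2) * r₁ - ι a ≈ p̂ * ι c
      trace≈ = trans (+-cong (sym (ι-* (+ 2) (r ℤ.^ q))) (sym (ι-neg a)))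
        (trans (sym (ι-+ (+ 2 ℤ.* r ℤ.^ q) (ℤ.- a))) (trans (reflexive (≡.cong ι trace≡)) (ι-* (+ p) c)))
      value≈ : r₁ * r₁ - ι a * r₁ - ι b ≈ p̂ * ι v
      value≈ = trans (+-cong (+-cong (sym (ι-* (r ℤ.^ q) (r ℤ.^ q))) (-‿cong (sym (ι-* a (r ℤ.^ q))))) refl)
        (trans (+-cong (+-congˡ (sym (ι-neg (a ℤ.* r ℤ.^ q)))) (sym (ι-neg b)))
        (trans (+-congʳ (sym (ι-+ (r ℤ.^ q ℤ.* r ℤ.^ q) (ℤ.- (a ℤ.* r ℤ.^ q)))))
        (trans (sym (ι-+ (r ℤ.^ q ℤ.* r ℤ.^ q ℤ.- a ℤ.* r ℤ.^ q) (ℤ.- b))) (trans (reflexive (≡.cong ι value≡)) (ι-* (+ p) v)))))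
      eq : π ^ (q ℕ.+ q) ≈ p̂ * u
      eq = begin
        π ^ (q ℕ.+ q) ≈⟨ ^-homo-* π q q ⟩
        π ^ q * π ^ q ≈⟨ *-cong π^q≈ π^q≈ ⟩
        (ω - r₁ - p̂ * (π * κ)) * (ω - r₁ - p̂ * (π * κ))
          ≈⟨ solve 6 (λ w r p t a b → (w :- r :- p :* t) :* (w :- r :- p :* t)
               := (w :* w :- a :* w :- b) :+ ((:- ((con (+ 2) :* r :- a) :* (w :- r))) :- (r :* r :- a :* r :- b))
                  :- p :* (con (+ 2) :* (t :* (w :- r))) :+ p :* (p :* (t :* t))) refl ω r₁ p̂ (π * κ) (ι a) (ι b) ⟩
        (ω * ω - ι a * ω - ι b) + (- ((ι (+ 2) * r₁ - ι a) * (ω - r₁)) - (r₁ * r₁ - ι a * r₁ - ι b))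
          - p̂ * (ι (+ 2) * (π * κ * (ω - r₁))) + p̂ * (p̂ * (π * κ * (π * κ)))
          ≈⟨ +-congʳ (+-congʳ (+-cong f[ω]≈0 (+-cong (-‿cong (*-congʳ trace≈)) (-‿cong value≈)))) ⟩
        0# + (- (p̂ * ι c * (ω - r₁)) - p̂ * ι v) - p̂ * (ι (+ 2) * (π * κ * (ω - r₁))) + p̂ * (p̂ * (π * κ * (π * κ)))
          ≈⟨ solve 6 (λ p c d v e f → con (+ 0) :+ ((:- (p :* c :* d)) :- p :* v) :- p :* e :+ p :* f
               := p :* ((:- (c :* d)) :- v :- e :+ f)) refl p̂ (ι c) (ω - r₁) (ι v) (ι (+ 2) * (π * κ * (ω - r₁))) (p̂ * (π * κ * (π * κ))) ⟩
        p̂ * u ∎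
        where
        π^q≈ : π ^ q ≈ ω - r₁ - p̂ * (π * κ)
        π^q≈ = trans (solve 3 (λ x r t → x := (x :+ r :+ t) :- r :- t) refl (π ^ q) r₁ (p̂ * (π * κ))) (+-congʳ (+-congʳ (sym ω≈)))
        f[ω]≈0 : ω * ω - ι a * ω - ι b ≈ 0#
        f[ω]≈0 = trans (+-congʳ (+-congʳ root)) (solve 2 (λ t b → t :+ b :- t :- b := con (+ 0)) refl (ι a * ω) (ι b))
      ω-r₁≈0 : ω - r₁ K.≈ 0#
      ω-r₁≈0 =
        let z , e = ^-pos π (ℕₚ.m^n>0 p k) in
        K.trans (≈⇒K (trans (+-congʳ ω≈) (trans (solve 3 (λ x r t → (x :+ r :+ t) :- r := x :+ t) refl (π ^ q) r₁ (p̂ * (π * κ))) (+-congʳ e))))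
          (K.trans (K.+-cong (π≈0 z) (p≈0 (π * κ))) (≈⇒K (+-identityʳ 0#)))
      u≈ : u K.≈ - ι v
      u≈ = K.trans (K.+-cong (K.+-cong (K.+-cong (K.-‿cong (K.trans (K.*-congˡ {ι c} ω-r₁≈0) (≈⇒K (zeroʳ (ι c))))) (≈⇒K { - ι v} refl))
          (K.-‿cong (K.trans (K.*-congˡ {ι (+ 2)} (K.trans (K.*-congˡ {π * κ} ω-r₁≈0) (≈⇒K (zeroʳ (π * κ))))) (≈⇒K (zeroʳ (ι (+ 2)))))))
          (p≈0 (π * κ * (π * κ))))
        (≈⇒K (solve 1 (λ v → (:- con (+ 0)) :- v :- con (+ 0) :+ con (+ 0) := :- v) refl (ι v)))
      unit : u * - ι v⁻ K.≈ 1#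
      unit = K.trans (K.*-congʳ { - ι v⁻} u≈) (K.trans (≈⇒K (solve 2 (λ v w → (:- v) :* (:- w) := v :* w) refl (ι v) (ι v⁻)))
        (proj₂ (Root.ι-unit v p∤v)))

    -- Iterating the `p²`-power does not change `μ` modulo `p`: a perturbation of `ω` by a multiple
    -- of `p` affects `ω ^ (p²)` only modulo `p³`.
    ω^p^even : ∀ {μ} → ω ^ (p ℕ.^ 2) ≈ ω + p̂ * μ → ∀ j → Σ Carrier λ z →
      ω ^ (p ℕ.^ (suc j ℕ.+ suc j)) ≈ ω + p̂ * (μ + p̂ * z)
    ω^p^even {μ} e zero = 0# , trans e (+-congˡ (*-congˡ (solve 2 (λ m p → m := m :+ p :* con (+ 0)) refl μ p̂)))
    ω^p^even {μ} e (suc j) =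
      let z , f = ω^p^even e j
          y , g = ^p^-lift 0 2 ω (μ + p̂ * z)
      in p̂ * y , (begin
      ω ^ (p ℕ.^ (suc (suc j) ℕ.+ suc (suc j))) ≡⟨ ≡.cong (ω ^_) (exponent (suc j)) ⟩
      ω ^ (p ℕ.^ (suc j ℕ.+ suc j) ℕ.* p ℕ.^ 2) ≈⟨ ^-assocʳ ω (p ℕ.^ (suc j ℕ.+ suc j)) (p ℕ.^ 2) ⟨
      (ω ^ (p ℕ.^ (suc j ℕ.+ suc j))) ^ (p ℕ.^ 2) ≈⟨ ^-congˡ (p ℕ.^ 2) (trans f (+-congˡ (*-congʳ (sym (*-identityʳ p̂))))) ⟩
      (ω + p̂ ^ 1 * (μ + p̂ * z)) ^ (p ℕ.^ 2) ≈⟨ g ⟩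
      ω ^ (p ℕ.^ 2) + p̂ ^ 3 * y ≈⟨ +-congʳ e ⟩
      ω + p̂ * μ + p̂ ^ 3 * y ≈⟨ solve 4 (λ w p m y → w :+ p :* m :+ (p :* (p :* (p :* con (+ 1)))) :* y := w :+ p :* (m :+ p :* (p :* y))) refl ω p̂ μ y ⟩
      ω + p̂ * (μ + p̂ * (p̂ * y)) ∎)
      where
      exponent : ∀ j → p ℕ.^ (suc j ℕ.+ suc j) ≡ p ℕ.^ (j ℕ.+ j) ℕ.* p ℕ.^ 2
      exponent j = ≡.trans (≡.cong (p ℕ.^_) (≡.trans (≡.cong suc (ℕₚ.+-suc j j)) (ℕₚ.+-comm 2 (j ℕ.+ j)))) (ℕₚ.^-distribˡ-+-* p (j ℕ.+ j) 2)

    -- Modulo `p` one has `ω ^ (q²) ≡ ω`, so `τ = ω ^ q` is a q-th root of `ω`, as `θ ^ m` is; this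
    -- is the origin of `π = θ ^ m - τ`. Then `π ^ q` is `ω - τ ^ q` up to a multiple of `p π`, and
    -- `τ ^ q = ω + p (μ + ...)` gives `u ≡ -μ`.
    unramified : ¬ (+ p ∣ᶻ b) → ¬ (+ p ∣ᶻ a ℤ.* a ℤ.+ + 4 ℤ.* b) → ∀ k m → M ≡ m ℕ.* p ℕ.^ suc k → ¬ (p ℕᵈ.∣ m) →
      π ≈ θ ^ m - ω ^ (p ℕ.^ suc k) → ∀ μ v → ω ^ (p ℕ.^ 2) ≈ ω + p̂ * μ → p̂ ∣ μ * v - 1# → LocalData
    unramified p∤b p∤Δ k m M≡ p∤m π≈ μ v ω^p²≈ μv≈1 = localData u q eq
        (perfect-if-ω m q p∤b p∤Δ p∤m (≈-of-π π≈)) (- v , unit)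
      where
      q = p ℕ.^ suc k
      τ = ω ^ q
      κ = proj₁ (frobenius^ (suc k) π τ)
      z = proj₁ (ω^p^even ω^p²≈ k)
      u = - (μ + p̂ * z + π * κ)
      τ^q≈ : τ ^ q ≈ ω + p̂ * (μ + p̂ * z)
      τ^q≈ = begin
        τ ^ q ≈⟨ ^-assocʳ ω q q ⟩
        ω ^ (q ℕ.* q) ≡⟨ ≡.cong (ω ^_) (ℕₚ.^-distribˡ-+-* p (suc k) (suc k)) ⟨
        ω ^ (p ℕ.^ (suc k ℕ.+ suc k)) ≈⟨ proj₂ (ω^p^even ω^p²≈ k) ⟩
        ω + p̂ * (μ + p̂ * z) ∎
      ω≈ : ω ≈ π ^ q + τ ^ q + p̂ * (π * κ)
      ω≈ = begin
        θ ^ M ≡⟨ ≡.cong (θ ^_) M≡ ⟩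
        θ ^ (m ℕ.* q) ≈⟨ ^-assocʳ θ m q ⟨
        (θ ^ m) ^ q ≈⟨ ^-congˡ q (trans (solve 2 (λ t r → t := (t :- r) :+ r) refl (θ ^ m) τ) (+-congʳ (sym π≈))) ⟩
        (π + τ) ^ q ≈⟨ proj₂ (frobenius^ (suc k) π τ) ⟩
        π ^ q + τ ^ q + p̂ * (π * κ) ∎
      eq : π ^ q ≈ p̂ * u
      eq = begin
        π ^ q ≈⟨ solve 3 (λ x r t → x := (x :+ r :+ t) :- r :- t) refl (π ^ q) (τ ^ q) (p̂ * (π * κ)) ⟩
        (π ^ q + τ ^ q + p̂ * (π * κ)) - τ ^ q - p̂ * (π * κ) ≈⟨ +-congʳ (+-cong (sym ω≈) (-‿cong τ^q≈)) ⟩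
        ω - (ω + p̂ * (μ + p̂ * z)) - p̂ * (π * κ) ≈⟨ solve 4 (λ w p m t → w :- (w :+ p :* m) :- p :* t := p :* (:- (m :+ t))) refl ω p̂ (μ + p̂ * z) (π * κ) ⟩
        p̂ * u ∎
      μ-unit : μ * v K.≈ 1#
      μ-unit = K.x-y≈0⇒x≈y {μ * v} {1#} (let t , e = μv≈1 in K.trans (≈⇒K e) (p≈0 t))
      unit : u * - v K.≈ 1#
      unit = K.trans (≈⇒K (solve 5 (λ m p z t v → (:- (m :+ p :* z :+ t)) :* (:- v) := m :* v :+ (p :* (z :* v) :+ t :* v)) refl μ p̂ z (π * κ) v))
        (K.trans (K.+-cong μ-unit (K.trans (K.+-cong (p≈0 (z * v)) (K.trans (≈⇒K (*-assoc π κ v)) (π≈0 (κ * v)))) (≈⇒K (+-identityʳ 0#))))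
          (≈⇒K (+-identityʳ 1#)))

  at-p∣a∣b : ∀ a' b' → a ≡ a' ℤ.* + p → b ≡ b' ℤ.* + p → ¬ (+ p ∣ᶻ b') → LocalData
  at-p∣a∣b = Residue.AtZero.p∣a∣b θ refl

  -- Modulo `p` the polynomial is `x ^ M (x ^ M - a)`. The first factor is handled by `π = θ`; the
  -- second is `w`, and its quotient is reduced because `p` divides neither `M` nor `a`.
  at-p∣b : ¬ (+ p ∣ᶻ a) → ∀ b' → b ≡ b' ℤ.* + p → ¬ (+ p ∣ᶻ b') → ¬ (p ℕᵈ.∣ M) → LocalData
  at-p∣b p∤a b' b≡ p∤b' p∤M = record
    { π = θ ; w = w ; u = ι b' ; E = M
    ; π^E*w≈p*u = begin
        ω * (ω - ι a) ≈⟨ solve 2 (λ w a → w :* (w :- a) := w :* w :- a :* w) refl ω (ι a) ⟩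
        ω * ω - ι a * ω ≈⟨ +-congʳ root ⟩
        ι a * ω + ι b - ι a * ω ≈⟨ solve 2 (λ t b → t :+ b :- t := b) refl (ι a * ω) (ι b) ⟩
        ι b ≈⟨ trans (reflexive (≡.cong ι b≡)) (trans (ι-* b' (+ p)) (*-comm _ _)) ⟩
        p̂ * ι b' ∎
    ; reduced-π = Residue.reduced θ (Residue.AtZero.θ-perfect θ refl)
    ; reduced-w = Residue.reduced w (Residue.perfect-if-ι w M a p∤M p∤a (Residue.≈-of-π w refl))
    ; u-regular = Residue.regular θ (proj₂ (Residue.Root.ι-unit θ b' p∤b'))
    ; w-regular = Residue.regular θ (proj₂ (Residue.AtZero.-a-inverse θ refl p∤a)) }
    where
    w = ω - ι a

  at-ramified : ∀ k m → M ≡ m ℕ.* p ℕ.^ k → ¬ (p ℕᵈ.∣ m) → ∀ r c v → ¬ (+ p ∣ᶻ r) → ¬ (+ p ∣ᶻ v) →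
    + 2 ℤ.* r ℤ.^ (p ℕ.^ k) ℤ.- a ≡ + p ℤ.* c →
    r ℤ.^ (p ℕ.^ k) ℤ.* r ℤ.^ (p ℕ.^ k) ℤ.- a ℤ.* r ℤ.^ (p ℕ.^ k) ℤ.- b ≡ + p ℤ.* v → LocalData
  at-ramified k m M≡ p∤m r c v = Residue.ramified (θ ^ m - ι r) k m M≡ p∤m r c v refl

  -- Here `A / p` is already reduced, so `p` itself is the uniformizer, with `E = 1` and `u = 1`.
  at-unramified-outside : ¬ (+ p ∣ᶻ b) → ¬ (+ p ∣ᶻ a ℤ.* a ℤ.+ + 4 ℤ.* b) → ¬ (p ℕᵈ.∣ M) → LocalData
  at-unramified-outside p∤b p∤Δ p∤M = Residue.localData p̂ 1# 1 refl
    (Residue.perfect-if-ω p̂ M 1 p∤b p∤Δ p∤M (Residue.≈⇒K p̂ (sym (*-identityʳ ω)))) (1# , Residue.1-unit p̂)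

  at-unramified-inside : ¬ (+ p ∣ᶻ b) → ¬ (+ p ∣ᶻ a ℤ.* a ℤ.+ + 4 ℤ.* b) → ∀ k m → M ≡ m ℕ.* p ℕ.^ suc k → ¬ (p ℕᵈ.∣ m) →
    ∀ μ v → ω ^ (p ℕ.^ 2) ≈ ω + p̂ * μ → p̂ ∣ μ * v - 1# → LocalData
  at-unramified-inside p∤b p∤Δ k m M≡ p∤m = Residue.unramified (θ ^ m - ω ^ (p ℕ.^ suc k)) p∤b p∤Δ k m M≡ p∤m refl

-- Elements of finitely generated modules are integral

module Integrality (R : CRing) (α : CommutativeRing.Carrier R) where
  open Kit R
  open ≈R

  -- Integer polynomials in `α` of degree below `d`, in the Horner form in which the statement
  -- defines algebraic integers.
  Low : ℕ → Carrier → Set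
  Low zero z = z ≈ 0#
  Low (suc d) z = Σ ℤ λ h → Σ Carrier λ z' → Low d z' × z ≈ ι h + α * z'

  low-resp : ∀ d {z w} → z ≈ w → Low d z → Low d w
  low-resp zero e l = trans (sym e) l
  low-resp (suc d) e (h , z' , l , f) = h , z' , l , trans (sym e) f

  low-0 : ∀ d → Low d 0#
  low-0 zero = refl
  low-0 (suc d) = + 0 , 0# , low-0 d , solve 1 (λ a → con (+ 0) := con (+ 0) :+ a :* con (+ 0)) refl α

  low-ι : ∀ d h → Low (suc d) (ι h)
  low-ι d h = h , 0# , low-0 d , solve 2 (λ h a → h := h :+ a :* con (+ 0)) refl (ι h) α

  low-+ : ∀ d {z w} → Low d z → Low d w → Low d (z + w)
  low-+ zero e f = trans (+-cong e f) (+-identityˡ 0#)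
  low-+ (suc d) (h , z , l , e) (k , w , m , f) = h ℤ.+ k , z + w , low-+ d l m , trans (+-cong e f)
    (trans (solve 5 (λ h k a z w → (h :+ a :* z) :+ (k :+ a :* w) := (h :+ k) :+ a :* (z :+ w)) refl (ι h) (ι k) α z w)
      (+-congʳ (sym (ι-+ h k))))

  low-neg : ∀ d {z} → Low d z → Low d (- z)
  low-neg zero e = trans (-‿cong e) (solve 0 (:- con (+ 0) := con (+ 0)) refl)
  low-neg (suc d) (h , z , l , e) = ℤ.- h , - z , low-neg d l , trans (-‿cong e)
    (trans (solve 3 (λ h a z → :- (h :+ a :* z) := (:- h) :+ a :* (:- z)) refl (ι h) α z) (+-congʳ (sym (ι-neg h))))

  low-scale : ∀ d c {z} → Low d z → Low d (ι c * z)
  low-scale zero c e = trans (*-congˡ e) (zeroʳ (ι c))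
  low-scale (suc d) c (h , z , l , e) = c ℤ.* h , ι c * z , low-scale d c l , trans (*-congˡ e)
    (trans (solve 4 (λ c h a z → c :* (h :+ a :* z) := c :* h :+ a :* (c :* z)) refl (ι c) (ι h) α z) (+-congʳ (sym (ι-* c h))))

  low-α : ∀ d {z} → Low d z → Low (suc d) (α * z)
  low-α d {z} l = + 0 , z , l , sym (+-identityˡ (α * z))

  low-suc : ∀ d {z} → Low d z → Low (suc d) z
  low-suc zero e = low-resp 1 (sym e) (low-0 1)
  low-suc (suc d) (h , z , l , e) = h , z , low-suc d l , e

  low-weaken : ∀ k d {z} → Low d z → Low (k ℕ.+ d) z
  low-weaken zero d l = l
  low-weaken (suc k) d l = low-suc (k ℕ.+ d) (low-weaken k d l)

  low-α^ : ∀ k d {z} → Low d z → Low (k ℕ.+ d) (α ^ k * z)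
  low-α^ zero d l = low-resp d (sym (*-identityˡ _)) l
  low-α^ (suc k) d l = low-resp (suc (k ℕ.+ d)) (sym (*-assoc _ _ _)) (low-α (k ℕ.+ d) (low-α^ k d l))

  low-* : ∀ d e {z w} → Low d z → Low e w → Low (d ℕ.+ e) (z * w)
  low-* zero e {z} {w} z≈0 m = low-resp e (sym (trans (*-congʳ z≈0) (zeroˡ w))) (low-0 e)
  low-* (suc d) e {z} {w} (h , z' , l , f) m = low-resp (suc d ℕ.+ e)
    (sym (trans (*-congʳ f) (trans (distribʳ w (ι h) (α * z')) (+-congˡ (*-assoc α z' w)))))
    (low-+ (suc (d ℕ.+ e)) (low-weaken (suc d) e (low-scale e h m)) (low-α (d ℕ.+ e) (low-* d e l m)))

  Span : ℕ → List Carrier → Carrier → Set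
  Span d [] z = z ≈ 0#
  Span d (e ∷ es) z = Σ Carrier λ l → Σ Carrier λ w → Low d l × Span d es w × z ≈ l * e + w

  span-resp : ∀ d es {z w} → z ≈ w → Span d es z → Span d es w
  span-resp d [] e s = trans (sym e) s
  span-resp d (_ ∷ es) e (l , w , ll , s , f) = l , w , ll , s , trans (sym e) f

  span-0 : ∀ d es → Span d es 0#
  span-0 d [] = refl
  span-0 d (e ∷ es) = 0# , 0# , low-0 d , span-0 d es , solve 1 (λ e → con (+ 0) := con (+ 0) :* e :+ con (+ 0)) refl e

  span-+ : ∀ d es {z w} → Span d es z → Span d es w → Span d es (z + w)
  span-+ d [] e f = trans (+-cong e f) (+-identityˡ 0#)
  span-+ d (g ∷ es) (l , w , ll , s , e) (l' , w' , ll' , s' , e') = l + l' , w + w' , low-+ d ll ll' , span-+ d es s s' ,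
    trans (+-cong e e') (solve 5 (λ l l' g w w' → (l :* g :+ w) :+ (l' :* g :+ w') := (l :+ l') :* g :+ (w :+ w')) refl l l' g w w')

  span-* : ∀ d e es {l z} → Low d l → Span e es z → Span (d ℕ.+ e) es (l * z)
  span-* d e [] {l} _ z≈0 = trans (*-congˡ z≈0) (zeroʳ l)
  span-* d e (g ∷ es) {l} ll (m , w , lm , s , f) = l * m , l * w , low-* d e ll lm , span-* d e es ll s ,
    trans (*-congˡ f) (solve 4 (λ l m g w → l :* (m :* g :+ w) := (l :* m) :* g :+ l :* w) refl l m g w)

  span-∈ : ∀ d {es e l} → e ∈ es → Low d l → Span d es (l * e)
  span-∈ d {g ∷ es} {l = l} (here ≡.refl) ll = l , 0# , ll , span-0 d es , sym (+-identityʳ (l * g))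
  span-∈ d {g ∷ es} {e} {l} (there e∈es) ll = 0# , l * e , low-0 d , span-∈ d e∈es ll ,
    solve 2 (λ g t → t := con (+ 0) :* g :+ t) refl g (l * e)

  span-α^ : ∀ d e es {z} → Span e es z → Span (d ℕ.+ e) es (α ^ d * z)
  span-α^ d e [] {z} z≈0 = trans (*-congˡ z≈0) (zeroʳ (α ^ d))
  span-α^ d e (g ∷ es) (m , w , lm , s , f) = α ^ d * m , α ^ d * w , low-α^ d e lm , span-α^ d e es s ,
    trans (*-congˡ f) (solve 4 (λ l m g w → l :* (m :* g :+ w) := (l :* m) :* g :+ l :* w) refl (α ^ d) m g w)

  -- The coefficients of `Span d` have degree below `d` in `α`, so `α ^ d` strictly dominates them.
  -- Keeping this under elimination is what makes the final relation monic.
  Closed : ℕ → List Carrier → Set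
  Closed d es = ∀ {e} → e ∈ es → Span d es (α ^ d * e)

  -- If α ^ d f = l f + w, then α ^ d - l annihilates f modulo the other generators.
  eliminate : ∀ d f es → Closed d (f ∷ es) → Closed (d ℕ.+ d) es
  eliminate d f es closed {e} e∈es =
    let l , w , ll , sw , α^f≈ = closed (here ≡.refl)
        m , v , lm , sv , α^e≈ = closed (there e∈es)
    in span-resp (d ℕ.+ d) es (sym (begin
        α ^ (d ℕ.+ d) * e ≈⟨ trans (*-congʳ (^-homo-* α d d)) (*-assoc (α ^ d) (α ^ d) e) ⟩
        α ^ d * (α ^ d * e) ≈⟨ *-congˡ α^e≈ ⟩
        α ^ d * (m * f + v) ≈⟨ solve 4 (λ t m f v → t :* (m :* f :+ v) := m :* (t :* f) :+ t :* v) refl (α ^ d) m f v ⟩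
        m * (α ^ d * f) + α ^ d * v ≈⟨ +-congʳ (*-congˡ α^f≈) ⟩
        m * (l * f + w) + α ^ d * v
          ≈⟨ solve 6 (λ m l f w t v → m :* (l :* f :+ w) :+ t :* v := (l :* (m :* f :+ v) :+ m :* w) :+ ((:- l) :* v :+ t :* v)) refl m l f w (α ^ d) v ⟩
        (l * (m * f + v) + m * w) + (- l * v + α ^ d * v) ≈⟨ +-congʳ (+-congʳ (*-congˡ (sym α^e≈))) ⟩
        (l * (α ^ d * e) + m * w) + (- l * v + α ^ d * v)
          ≈⟨ +-congʳ (+-congʳ (solve 3 (λ l t e → l :* (t :* e) := (t :* l) :* e) refl l (α ^ d) e)) ⟩
        ((α ^ d * l) * e + m * w) + (- l * v + α ^ d * v) ∎))
      (span-+ (d ℕ.+ d) es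
        (span-+ (d ℕ.+ d) es (span-∈ (d ℕ.+ d) e∈es (low-α^ d d ll)) (span-* d d es lm sw))
        (span-+ (d ℕ.+ d) es (span-* d d es (low-neg d ll) sv) (span-α^ d d es sv)))

  -- Elimination takes the place of the determinant of a matrix: each step removes one generator and
  -- doubles `d`, until only `u` remains. For `u = 1` the result is a monic equation.
  integral : ∀ es u d → Closed d (es ++ u ∷ []) → Σ ℕ λ e → Σ Carrier λ l → Low e l × α ^ e * u ≈ l * u
  integral [] u d closed = let l , w , ll , w≈0 , e = closed (here ≡.refl) in d , l , ll , trans e (trans (+-congˡ w≈0) (+-identityʳ (l * u)))
  integral (f ∷ es) u d closed = integral es u (d ℕ.+ d) (eliminate d f (es ++ u ∷ []) closed)

-- If multiplication by `α` preserves the `A`-module spanned by `β` and 1, then `α` is integral over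
-- ℤ, since this module is finitely generated over ℤ. It is applied with `β = 0` to elements of `A`,
-- and with `β = α` to roots of monic quadratic equations over `A`.
module TwoGenerators (a b : ℤ) (M : ℕ) (1≤M : 1 ℕ.≤ M) (A : CRing) (θ : CommutativeRing.Carrier A)
  (root : Kit._≈_ A (Kit._*_ A (Kit._^_ A θ M) (Kit._^_ A θ M)) (Kit._+_ A (Kit._*_ A (Kit.ι A a) (Kit._^_ A θ M)) (Kit.ι A b)))
  (horner : (S : CommutativeRing.Carrier A → Set) → (∀ {x y} → CommutativeRing._≈_ A x y → S x → S y) → (∀ z → S (Kit.ι A z)) →
    (∀ {x y} → S x → S y → S (CommutativeRing._+_ A x y)) → (∀ {x} → S x → S (CommutativeRing._*_ A θ x)) → ∀ x → S x)
  (R : CRing) (ψ : Hom A R) (α β : CommutativeRing.Carrier R) where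
  private module A = Kit A
  open Kit R
  open Integrality R α
  open Hom ψ renaming (⟦_⟧ to ψ[_])
  open ≈R

  private
    N : ℕ
    N = M ℕ.+ M
    M<N : M ℕ.< N
    M<N = ℕₚ.m<m+n M 1≤M
    0<N : 0 ℕ.< N
    0<N = ℕₚ.≤-trans 1≤M (ℕₚ.m≤m+n M M)

  t : Carrier
  t = ψ[ θ ]

  multiples : Carrier → ℕ → List Carrier
  multiples c zero = []
  multiples c (suc n) = c * t ^ n ∷ multiples c n

  -- The generator 1 has to come last, because `integral` keeps the last one. The other powers of
  -- `t` up to exponent `N - 1` are therefore listed as multiples of `t`.
  front : List Carrier
  front = multiples β N ++ multiples t (N ℕ.∸ 1)

  gens : List Carrier
  gens = front ++ 1# ∷ []

  ∈-multiples : ∀ c n i → i ℕ.< n → c * t ^ i ∈ multiples c n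
  ∈-multiples c (suc n) i (s≤s i≤n) with ℕₚ.m≤n⇒m<n∨m≡n i≤n
  ... | inj₁ i<n = there (∈-multiples c n i i<n)
  ... | inj₂ ≡.refl = here ≡.refl

  multiples-∈ : ∀ c n {e} → e ∈ multiples c n → Σ ℕ λ i → e ≡ c * t ^ i
  multiples-∈ c (suc n) (here e≡) = n , e≡
  multiples-∈ c (suc n) (there e∈) = multiples-∈ c n e∈

  InSpan : Carrier → Set
  InSpan = Span 1 gens

  in-resp : ∀ {z w} → z ≈ w → InSpan z → InSpan w
  in-resp = span-resp 1 gens

  in-∈ : ∀ {e} → e ∈ gens → InSpan e
  in-∈ {e} e∈ = in-resp (*-identityˡ e) (span-∈ 1 e∈ (low-ι 0 (+ 1)))

  in-+ : ∀ {z w} → InSpan z → InSpan w → InSpan (z + w)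
  in-+ = span-+ 1 gens

  in-ι : ∀ c {z} → InSpan z → InSpan (ι c * z)
  in-ι c {z} = scale-span gens
    where
    scale-span : ∀ es {z} → Span 1 es z → Span 1 es (ι c * z)
    scale-span [] e = trans (*-congˡ e) (zeroʳ (ι c))
    scale-span (g ∷ es) (m , w , lm , s , f) = ι c * m , ι c * w , low-scale 1 c lm , scale-span es s ,
      trans (*-congˡ f) (solve 4 (λ l m g w → l :* (m :* g :+ w) := (l :* m) :* g :+ l :* w) refl (ι c) m g w)

  t-root : t ^ M * t ^ M ≈ ι a * t ^ M + ι b
  t-root = trans (*-cong (sym (^-hom θ M)) (sym (^-hom θ M))) (trans (sym (*-hom (θ A.^ M) (θ A.^ M))) (trans (cong root)
    (trans (+-hom (A.ι a A.* θ A.^ M) (A.ι b)) (+-cong (trans (*-hom (A.ι a) (θ A.^ M)) (*-cong (ι-hom a) (^-hom θ M))) (ι-hom b)))))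

  powers-in : ∀ c → (∀ i → i ℕ.< N → InSpan (c * t ^ i)) → ∀ n → InSpan (c * t ^ n)
  powers-in c small = <-rec _ go
    where
    go : ∀ n → (∀ {i} → i ℕ.< n → InSpan (c * t ^ i)) → InSpan (c * t ^ n)
    go n ih with n ℕ.<? N
    ... | yes n<N = small n n<N
    ... | no n≮N with ℕₚ.m≤n⇒∃[o]m+o≡n (ℕₚ.≮⇒≥ n≮N)
    ... | o , ≡.refl = in-resp (sym eq) (in-+ (in-ι a (ih {M ℕ.+ o} (ℕₚ.+-monoˡ-< o M<N))) (in-ι b (ih {o} (ℕₚ.m<n+m o 0<N))))
      where
      eq : c * t ^ (N ℕ.+ o) ≈ ι a * (c * t ^ (M ℕ.+ o)) + ι b * (c * t ^ o)
      eq = begin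
        c * t ^ (N ℕ.+ o) ≈⟨ *-congˡ (trans (^-homo-* t N o) (*-congʳ (trans (^-homo-* t M M) t-root))) ⟩
        c * ((ι a * t ^ M + ι b) * t ^ o)
          ≈⟨ solve 5 (λ c a m b o → c :* ((a :* m :+ b) :* o) := a :* (c :* (m :* o)) :+ b :* (c :* o)) refl c (ι a) (t ^ M) (ι b) (t ^ o) ⟩
        ι a * (c * (t ^ M * t ^ o)) + ι b * (c * t ^ o) ≈⟨ +-congʳ (*-congˡ (*-congˡ (^-homo-* t M o))) ⟨
        ι a * (c * t ^ (M ℕ.+ o)) + ι b * (c * t ^ o) ∎

  β-powers : ∀ n → InSpan (β * t ^ n)
  β-powers = powers-in β λ i i<N → in-∈ (∈ₚ.∈-++⁺ˡ (∈ₚ.∈-++⁺ˡ (∈-multiples β N i i<N)))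

  1-powers : ∀ n → InSpan (1# * t ^ n)
  1-powers = powers-in 1# λ
    { zero _ → in-resp (sym (*-identityʳ 1#)) (in-∈ (∈ₚ.∈-++⁺ʳ front (here ≡.refl)))
    ; (suc i) i<N → in-resp (sym (*-identityˡ (t * t ^ i))) (in-∈ (∈ₚ.∈-++⁺ˡ (∈ₚ.∈-++⁺ʳ (multiples β N)
        (∈-multiples t (N ℕ.∸ 1) i (ℕₚ.∸-monoˡ-≤ {suc (suc i)} 1 i<N))))) }

  ψ-in : ∀ c → (∀ n → InSpan (c * t ^ n)) → ∀ z n → InSpan (c * t ^ n * ψ[ z ])
  ψ-in c powers = horner (λ z → ∀ n → InSpan (c * t ^ n * ψ[ z ]))
    (λ e s n → in-resp (*-congˡ (cong e)) (s n))
    (λ k n → in-resp (sym (trans (*-congˡ (ι-hom k)) (*-comm (c * t ^ n) (ι k)))) (in-ι k (powers n)))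
    (λ {f} {g} s s' n → in-resp (sym (trans (*-congˡ (+-hom f g)) (distribˡ (c * t ^ n) ψ[ f ] ψ[ g ]))) (in-+ (s n) (s' n)))
    (λ {f} s n → in-resp (sym (trans (*-congˡ (*-hom θ f))
       (solve 4 (λ c t n f → c :* n :* (t :* f) := c :* (t :* n) :* f) refl c t (t ^ n) ψ[ f ]))) (s (suc n)))

  module _ (κ λ' κ' λ'' : A.Carrier) (αβ≈ : α * β ≈ β * ψ[ κ ] + ψ[ λ' ]) (α≈ : α ≈ β * ψ[ κ' ] + ψ[ λ'' ]) where

    private
      combine : ∀ k l n → InSpan ((β * ψ[ k ] + ψ[ l ]) * t ^ n)
      combine k l n = in-resp (solve 4 (λ β k l n → β :* n :* k :+ con (+ 1) :* n :* l := (β :* k :+ l) :* n) refl β ψ[ k ] ψ[ l ] (t ^ n))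
        (in-+ (ψ-in β β-powers k n) (ψ-in 1# 1-powers l n))

    closed-at-1 : ∀ {e} → e ∈ 1# ∷ [] → InSpan (α ^ 1 * e)
    closed-at-1 (here ≡.refl) = in-resp (trans (*-congʳ (sym α≈)) (solve 1 (λ a → a :* con (+ 1) := a :* con (+ 1) :* con (+ 1)) refl α)) (combine κ' λ'' 0)

    closed-at-β : ∀ {e} → (Σ ℕ λ i → e ≡ β * t ^ i) → InSpan (α ^ 1 * e)
    closed-at-β (i , ≡.refl) = in-resp (trans (*-congʳ (sym αβ≈)) (solve 3 (λ a b n → a :* b :* n := a :* con (+ 1) :* (b :* n)) refl α β (t ^ i))) (combine κ λ' i)

    closed-at-t : ∀ {e} → (Σ ℕ λ i → e ≡ t * t ^ i) → InSpan (α ^ 1 * e)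
    closed-at-t (i , ≡.refl) = in-resp (trans (*-congʳ (sym α≈)) (solve 2 (λ a n → a :* n := a :* con (+ 1) :* n) refl α (t ^ suc i))) (combine κ' λ'' (suc i))

    gens-closed : Closed 1 gens
    gens-closed e∈ = split (∈ₚ.∈-++⁻ front e∈)
      where
      split-front : ∀ {e} → e ∈ multiples β N ⊎ e ∈ multiples t (N ℕ.∸ 1) → InSpan (α ^ 1 * e)
      split-front (inj₁ e∈β) = closed-at-β (multiples-∈ β N e∈β)
      split-front (inj₂ e∈t) = closed-at-t (multiples-∈ t (N ℕ.∸ 1) e∈t)
      split : ∀ {e} → e ∈ front ⊎ e ∈ 1# ∷ [] → InSpan (α ^ 1 * e)
      split (inj₁ e∈front) = split-front (∈ₚ.∈-++⁻ (multiples β N) e∈front)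
      split (inj₂ e∈1) = closed-at-1 e∈1

    integral-relation : Σ ℕ λ e → Σ Carrier λ l → Low e l × α ^ e ≈ l
    integral-relation =
      let e , l , ll , f = integral front 1# 1 gens-closed
      in e , l , ll , trans (sym (*-identityʳ (α ^ e))) (trans f (*-identityʳ l))

-- Rational coefficients

ℚ-ring : CRing
ℚ-ring = ℚₚ.+-*-commutativeRing

private
  toℚᵘ-ℤ : ∀ z → ℚ.toℚᵘ (ℤ→ℚ z) ℚᵘ.≃ mkℚᵘ z 0
  toℚᵘ-ℤ z = ℚₚ.toℚᵘ-fromℚᵘ (mkℚᵘ z 0)

ℤ→ℚ-hom : Hom ℤ-ring ℚ-ring
ℤ→ℚ-hom = record
  { ⟦_⟧ = ℤ→ℚ
  ; cong = ≡.cong ℤ→ℚ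
  ; +-hom = λ x y → ℚₚ.toℚᵘ-injective (≃-trans (toℚᵘ-ℤ (x ℤ.+ y)) (≃-trans
      (*≡* (solve 2 (λ x y → (x :+ y) :* con (+ 1) := (x :* con (+ 1) :+ y :* con (+ 1)) :* con (+ 1)) ≡.refl x y))
      (≃-sym (≃-trans (ℚₚ.toℚᵘ-homo-+ (ℤ→ℚ x) (ℤ→ℚ y)) (ℚᵘₚ.+-cong (toℚᵘ-ℤ x) (toℚᵘ-ℤ y))))))
  ; *-hom = λ x y → ℚₚ.toℚᵘ-injective (≃-trans (toℚᵘ-ℤ (x ℤ.* y)) (≃-trans (*≡* ≡.refl)
      (≃-sym (≃-trans (ℚₚ.toℚᵘ-homo-* (ℤ→ℚ x) (ℤ→ℚ y)) (ℚᵘₚ.*-cong (toℚᵘ-ℤ x) (toℚᵘ-ℤ y))))))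
  ; 1-hom = ≡.refl }
  where
  open Data.Integer.Solver.+-*-Solver
  open ℚᵘₚ using (≃-trans; ≃-sym)

ι-ℚ : ∀ z → Kit.ι ℚ-ring z ≡ ℤ→ℚ z
ι-ℚ z = ≡.trans (≡.sym (Hom.ι-hom ℤ→ℚ-hom z)) (≡.cong ℤ→ℚ (ι-ℤ z))

ℤ→ℚ-injective : ∀ {x y} → ℤ→ℚ x ≡ ℤ→ℚ y → x ≡ y
ℤ→ℚ-injective {x} {y} e with ℚₚ.fromℚᵘ-injective {mkℚᵘ x 0} {mkℚᵘ y 0} e
... | *≡* f = ≡.trans (≡.sym (ℤₚ.*-identityʳ x)) (≡.trans f (ℤₚ.*-identityʳ y))

reciprocal : ∀ d → Σ ℚ λ r → ℤ→ℚ (+ suc d) ℚ.* r ≡ 1ℚ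
reciprocal d = ℚ.fromℚᵘ (mkℚᵘ (+ 1) d) , ℚₚ.toℚᵘ-injective (≃-trans (ℚₚ.toℚᵘ-homo-* (ℤ→ℚ (+ suc d)) (ℚ.fromℚᵘ (mkℚᵘ (+ 1) d)))
  (≃-trans (ℚᵘₚ.*-cong (toℚᵘ-ℤ (+ suc d)) (ℚₚ.toℚᵘ-fromℚᵘ (mkℚᵘ (+ 1) d)))
    (*≡* (solve 1 (λ d → d :* con (+ 1) :* con (+ 1) := con (+ 1) :* (con (+ 1) :* d)) ≡.refl (+ suc d)))))
  where
  open Data.Integer.Solver.+-*-Solver
  open ℚᵘₚ using (≃-trans; ≃-sym)

ℤ→ℚ-cancel : ∀ d → 1 ℕ.≤ d → ∀ {x y} → ℤ→ℚ (+ d) ℚ.* x ≡ ℤ→ℚ (+ d) ℚ.* y → x ≡ y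
ℤ→ℚ-cancel (suc d) _ {x} {y} e = let r , dr≡1 = reciprocal d in begin
    x ≡⟨ ℚₚ.*-identityˡ x ⟨
    1ℚ ℚ.* x ≡⟨ ≡.cong (ℚ._* x) dr≡1 ⟨
    ℤ→ℚ (+ suc d) ℚ.* r ℚ.* x ≡⟨ solve 3 (λ d r x → d :* r :* x := r :* (d :* x)) ≡.refl (ℤ→ℚ (+ suc d)) r x ⟩
    r ℚ.* (ℤ→ℚ (+ suc d) ℚ.* x) ≡⟨ ≡.cong (r ℚ.*_) e ⟩
    r ℚ.* (ℤ→ℚ (+ suc d) ℚ.* y) ≡⟨ solve 3 (λ d r x → d :* r :* x := r :* (d :* x)) ≡.refl (ℤ→ℚ (+ suc d)) r y ⟨
    ℤ→ℚ (+ suc d) ℚ.* r ℚ.* y ≡⟨ ≡.cong (ℚ._* y) dr≡1 ⟩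
    1ℚ ℚ.* y ≡⟨ ℚₚ.*-identityˡ y ⟩
    y ∎
  where
  open ≡.≡-Reasoning
  open Kit ℚ-ring using (solve; _:=_; _:*_)

denominator : ∀ q → Σ ℕ λ d → Σ ℤ λ z → ℤ→ℚ (+ suc d) ℚ.* q ≡ ℤ→ℚ z
denominator q@(ℚ.mkℚ n d _) = d , n , ℚₚ.toℚᵘ-injective (≃-trans (ℚₚ.toℚᵘ-homo-* (ℤ→ℚ (+ suc d)) q)
  (≃-trans (ℚᵘₚ.*-congʳ {mkℚᵘ n d} (toℚᵘ-ℤ (+ suc d))) (≃-trans
    (*≡* (solve 2 (λ d n → d :* n :* con (+ 1) := n :* (con (+ 1) :* d)) ≡.refl (+ suc d) n)) (≃-sym (toℚᵘ-ℤ n)))))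
  where
  open Data.Integer.Solver.+-*-Solver
  open ℚᵘₚ using (≃-trans; ≃-sym)

ℚ-stable : ∀ x → .(x ≡ 0ℚ) → x ≡ 0ℚ
ℚ-stable x e = recompute (x ℚₚ.≟ 0ℚ) e

-- Base change of polynomials, and denominators over ℚ

module _ {R S : CRing} (f : Hom R S) where
  private
    module R = Kit R
    module S = Kit S
    module SR = Series R
    module SS = Series S
  open Hom f

  map-⋆ : ∀ g h n → ⟦ (g SR.⋆ h) n ⟧ S.≈ ((λ i → ⟦ g i ⟧) SS.⋆ (λ i → ⟦ h i ⟧)) n
  map-⋆ g h zero = *-hom (g 0) (h 0)
  map-⋆ g h (suc n) = S.trans (+-hom _ _) (S.+-cong (*-hom (g 0) (h (suc n))) (map-⋆ (SR.tail g) h n))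

  mapPoly : Hom (Poly R) (Poly S)
  mapPoly = record
    { ⟦_⟧ = λ { (poly g d bg) → poly (λ n → ⟦ g n ⟧) d λ m l → S.trans (cong (bg m l)) 0-hom }
    ; cong = λ e → same λ n → cong (at e n)
    ; +-hom = λ g h → same λ n → +-hom _ _
    ; *-hom = λ g h → same (map-⋆ (coeff g) (coeff h))
    ; 1-hom = same λ { zero → 1-hom ; (suc n) → 0-hom } }

module PQ = Kit (Poly ℚ-ring)
module PolyQ = PolyKit ℚ-ring ℚ-stable

φ : Hom (Poly ℤ-ring) (Poly ℚ-ring)
φ = mapPoly ℤ→ℚ-hom

φ-injective : ∀ {f g} → Hom.⟦ φ ⟧ f PQ.≈ Hom.⟦ φ ⟧ g → f P.≈ g
φ-injective e = same λ n → ℤ→ℚ-injective (at e n)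

ι-coeffℚ : ∀ z f n → coeff (PQ.ι z PQ.* f) n ≡ ℤ→ℚ z ℚ.* coeff f n
ι-coeffℚ z f n = ≡.trans (PolyQ.ι-coeff z f n) (≡.cong (ℚ._* coeff f n) (ι-ℚ z))

common-denominator : ∀ f → Σ ℕ λ d → 1 ℕ.≤ d × Σ P.Carrier λ g → Hom.⟦ φ ⟧ g PQ.≈ PQ.ι (+ d) PQ.* f
common-denominator = PolyQ.induction _
  (λ { {f} {f'} e (d , 1≤d , g , h) → d , 1≤d , g , PQ.trans h (PQ.*-congˡ {PQ.ι (+ d)} e) })
  (λ c → let d , z , e = denominator c in suc d , s≤s z≤n , PolyZ.const z , same λ
    { zero → ≡.sym (≡.trans (ι-coeffℚ (+ suc d) (PolyQ.const c) 0) e)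
    ; (suc n) → ≡.sym (≡.trans (ι-coeffℚ (+ suc d) (PolyQ.const c) (suc n)) (ℚₚ.*-zeroʳ (ℤ→ℚ (+ suc d)))) })
  (λ { {f} {f'} (d , 1≤d , g , h) (d' , 1≤d' , g' , h') →
    d ℕ.* d' , ℕₚ.*-mono-≤ 1≤d 1≤d' , P.ι (+ d') P.* g P.+ P.ι (+ d) P.* g' ,
    PQ.trans (+-hom (P.ι (+ d') P.* g) (P.ι (+ d) P.* g'))
      (PQ.trans (PQ.+-cong (PQ.trans (*-hom (P.ι (+ d')) g) (PQ.*-cong (ι-hom (+ d')) h)) (PQ.trans (*-hom (P.ι (+ d)) g') (PQ.*-cong (ι-hom (+ d)) h')))
      (PQ.trans (PQ.solve 4 (λ d d' f f' → d' PQ.:* (d PQ.:* f) PQ.:+ d PQ.:* (d' PQ.:* f') PQ.:= (d PQ.:* d') PQ.:* (f PQ.:+ f')) PQ.refl (PQ.ι (+ d)) (PQ.ι (+ d')) f f')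
        (PQ.*-congʳ {f PQ.+ f'} (PQ.sym (PQ.trans (PQ.reflexive (≡.cong PQ.ι (ℤₚ.pos-* d d'))) (PQ.ι-* (+ d) (+ d'))))))) })
  (λ { {f} (d , 1≤d , g , h) → d , 1≤d , PolyZ.x̂ P.* g ,
    PQ.trans (*-hom PolyZ.x̂ g) (PQ.trans (PQ.*-cong φ-x̂ h)
      (PQ.solve 3 (λ x d f → x PQ.:* (d PQ.:* f) PQ.:= d PQ.:* (x PQ.:* f)) PQ.refl PolyQ.x̂ (PQ.ι (+ d)) f)) })
  where
  open Hom φ
  φ-x̂ : ⟦ PolyZ.x̂ ⟧ PQ.≈ PolyQ.x̂
  φ-x̂ = same λ { zero → ≡.refl ; (suc zero) → ≡.refl ; (suc (suc n)) → ≡.refl }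

-- The operations of the statement agree with those of Poly ℚ-ring

module SQ = Series ℚ-ring

sumTo≡ : ∀ f k → sumTo f k ≡ SQ.sumTo' f k
sumTo≡ f zero = ≡.refl
sumTo≡ f (suc k) = ≡.cong (ℚ._+ f (suc k)) (sumTo≡ f k)

⊛≡⋆ : ∀ f g n → (f ⊛ g) n ≡ (f SQ.⋆ g) n
⊛≡⋆ f g n = ≡.trans (sumTo≡ (λ i → f i ℚ.* g (n ℕ.∸ i)) n) (≡.sym (SQ.⋆-sum f g n))

pow≡ : ∀ f e n → pow (coeff f) e n ≡ coeff (f PQ.^ e) n
pow≡ f zero zero = ≡.refl
pow≡ f zero (suc n) = ≡.refl
pow≡ f (suc e) n = ≡.trans (⊛≡⋆ (coeff f) (pow (coeff f) e) n) (SQ.⋆-cong {f = coeff f} (λ _ → ≡.refl) (pow≡ f e) n)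

lowPoly : PQ.Carrier → (e : ℕ) → (Fin e → ℤ) → PQ.Carrier
lowPoly α zero h = PQ.0#
lowPoly α (suc e) h = PQ.ι (h Fin.zero) PQ.+ α PQ.* lowPoly α e (λ i → h (Fin.suc i))

elem-small : ∀ N c (i : Fin N) → elem N c (toℕ i) ≡ c i
elem-small N c i with toℕ i ℕ.<? N
... | yes i<N = ≡.cong c (Finₚ.fromℕ<-toℕ i i<N)
... | no i≮N = ⊥-elim (i≮N (Finₚ.toℕ<n i))

elem-large : ∀ N c k → N ℕ.≤ k → elem N c k ≡ 0ℚ
elem-large N c k N≤k with k ℕ.<? N
... | yes k<N = ⊥-elim (ℕₚ.<⇒≱ k<N N≤k)
... | no _ = ≡.refl

elemPoly : ∀ N → (Fin N → ℚ) → PQ.Carrier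
elemPoly N c = poly (elem N c) N λ m l → elem-large N c m (ℕₚ.<⇒≤ l)

-- A name for the local function of IsAlgInt, which is not accessible from outside.
lowerTerms : ∀ N g c → Σ ((e : ℕ) → (Fin e → ℤ) → ℕ → ℚ) λ l →
  IsAlgInt N g c ≡ (Σ ℕ λ e → Σ (Fin e → ℤ) λ h → DividesQ (toℚPoly g) (pow (elem N c) e ⊕ l e h))
lowerTerms N g c = _ , ≡.refl

lowerTerms≡ : ∀ N g c e h k → proj₁ (lowerTerms N g c) e h k ≡ coeff (lowPoly (elemPoly N c) e h) k
lowerTerms≡ N g c zero h k = ≡.refl
lowerTerms≡ N g c (suc e) h k = ≡.cong₂ ℚ._+_ (scale-one k)
  (≡.trans (⊛≡⋆ (elem N c) (proj₁ (lowerTerms N g c) e _) k) (SQ.⋆-cong {f = elem N c} (λ _ → ≡.refl) (lowerTerms≡ N g c e _) k))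
  where
  scale-one : ∀ k → ℤ→ℚ (h Fin.zero) ℚ.* one k ≡ coeff (PQ.ι (h Fin.zero)) k
  scale-one k = ≡.sym (≡.trans (at (PolyQ.ι≈const (h Fin.zero)) k) (go k))
    where
    go : ∀ k → coeff (PolyQ.const (Kit.ι ℚ-ring (h Fin.zero))) k ≡ ℤ→ℚ (h Fin.zero) ℚ.* one k
    go zero = ≡.trans (ι-ℚ (h Fin.zero)) (≡.sym (ℚₚ.*-identityʳ (ℤ→ℚ (h Fin.zero))))
    go (suc k) = ≡.sym (ℚₚ.*-zeroʳ (ℤ→ℚ (h Fin.zero)))

all-divide⇒0 : ∀ z → (∀ D → 1 ℕ.≤ D → + D ∣ᶻ z) → z ≡ + 0
all-divide⇒0 z h with ℤ.∣ z ∣ in e | ∣ᶻ⇒∣ (h (suc ℤ.∣ z ∣) (s≤s z≤n))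
... | zero | _ = ℤₚ.∣i∣≡0⇒i≡0 e
... | suc n | d = ⊥-elim (ℕₚ.<⇒≱ (ℕₚ.n<1+n (suc n)) (ℕᵈ.∣⇒≤ d))

module _ {R S : CRing} (f : Hom R S) where
  private
    module R = Kit R
    module S = Kit S
  open Hom f

  hom-low : ∀ d γ e h → ⟦ Descent.low R d γ e h ⟧ S.≈ Descent.low S ⟦ d ⟧ ⟦ γ ⟧ e h
  hom-low d γ zero h = 0-hom
  hom-low d γ (suc e) h = S.trans (+-hom _ _) (S.+-cong
    (S.trans (*-hom _ _) (S.*-cong (ι-hom (h Fin.zero)) (^-hom d (suc e))))
    (S.trans (*-hom γ _) (S.*-congˡ (hom-low d γ e (λ i → h (Fin.suc i))))))

-- While both degree bounds are positive, the product of the two top coefficients is zero, so one of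
-- the bounds drops. Once `g` is a constant, it is nonzero and can be cancelled.
factor-of-constant : ∀ d e f g → Series.Bounded ℤ-ring d f → Series.Bounded ℤ-ring e g →
  (∀ m → 1 ℕ.≤ m → Series._⋆_ ℤ-ring f g m ≡ + 0) → Series._⋆_ ℤ-ring f g 0 ≢ + 0 → ∀ m → 1 ℕ.≤ m → f m ≡ + 0
factor-of-constant zero e f g bf bg _ _ m 1≤m = bf m 1≤m
factor-of-constant (suc d) zero f g bf bg high low m@(suc m') 1≤m = cancel (ℤₚ.i*j≡0⇒i≡0∨j≡0 (g 0) (≡.trans (≡.sym g⋆f) (≡.trans (≡.sym (S.⋆-comm f g m)) (high m 1≤m))))
  where
  module S = Series ℤ-ring
  g⋆f : (g S.⋆ f) m ≡ g 0 ℤ.* f m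
  g⋆f = ≡.trans (≡.cong (λ t → g 0 ℤ.* f m ℤ.+ t) (S.⋆-zeroˡ f (S.bounded-0-tail bg) m')) (ℤₚ.+-identityʳ (g 0 ℤ.* f m))
  cancel : g 0 ≡ + 0 ⊎ f m ≡ + 0 → f m ≡ + 0
  cancel (inj₁ g0≡0) = ⊥-elim (low (≡.trans (≡.cong (f 0 ℤ.*_) g0≡0) (ℤₚ.*-zeroʳ (f 0))))
  cancel (inj₂ fm≡0) = fm≡0
factor-of-constant (suc d) (suc e) f g bf bg high low = lower (ℤₚ.i*j≡0⇒i≡0∨j≡0 (f (suc d)) (≡.trans (≡.sym (S.⋆-top bf bg)) (high (suc d ℕ.+ suc e) (s≤s z≤n))))
  where
  module S = Series ℤ-ring
  tighten : ∀ k (h : ℕ → ℤ) → S.Bounded (suc k) h → h (suc k) ≡ + 0 → S.Bounded k h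
  tighten k h bh e m k<m with ℕₚ.m≤n⇒m<n∨m≡n k<m
  ... | inj₁ l = bh m l
  ... | inj₂ ≡.refl = e
  lower : f (suc d) ≡ + 0 ⊎ g (suc e) ≡ + 0 → ∀ m → 1 ℕ.≤ m → f m ≡ + 0
  lower (inj₁ z) = factor-of-constant d (suc e) f g (tighten d f bf z) bg high low
  lower (inj₂ z) = factor-of-constant (suc d) e f g bf (tighten e g bg z) high low

-- The order ℤ[x] / (x ^ 2M - a x ^ M - b)

module Trinomial (a b : ℤ) (M : ℕ) (1≤M : 1 ℕ.≤ M) where
  open PolyZ

  N : ℕ
  N = M ℕ.+ M

  M<N : M ℕ.< N
  M<N = ℕₚ.m<m+n M 1≤M

  0<N : 0 ℕ.< N
  0<N = ℕₚ.≤-trans 1≤M (ℕₚ.m≤m+n M M)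

  F : P.Carrier
  F = x̂ P.^ N P.- P.ι a P.* x̂ P.^ M P.- P.ι b

  F-coeff : ∀ n → coeff F n ≡ coeff (x̂ P.^ N) n ℤ.- a ℤ.* coeff (x̂ P.^ M) n ℤ.- coeff (const b) n
  F-coeff n = ≡.cong₂ (λ u v → coeff (x̂ P.^ N) n ℤ.- u ℤ.- v)
    (≡.trans (ι-coeff a (x̂ P.^ M) n) (≡.cong (ℤ._* coeff (x̂ P.^ M) n) (ι-ℤ a)))
    (≡.trans (at (ι≈const b) n) (≡.cong (λ c → coeff (const c) n) (ι-ℤ b)))

  const-suc : ∀ c n → 0 ℕ.< n → coeff (const c) n ≡ + 0
  const-suc c (suc n) _ = ≡.refl

  F-monic : MonicOf N F
  F-monic = bounded-F , top-F
    where
    lower : ∀ n → M ℕ.< n → ∀ u → coeff (x̂ P.^ N) n ≡ u → coeff F n ≡ u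
    lower n M<n u e = ≡.trans (F-coeff n) (≡.trans
      (≡.cong₂ (λ v w → coeff (x̂ P.^ N) n ℤ.- a ℤ.* v ℤ.- w) (x^-other M n (ℕₚ.<⇒≢ M<n)) (const-suc b n (ℕₚ.≤-<-trans z≤n M<n)))
      (≡.trans (solve 2 (λ t a → t :- a :* con (+ 0) :- con (+ 0) := t) ≡.refl (coeff (x̂ P.^ N) n) a) e))
      where open Data.Integer.Solver.+-*-Solver
    bounded-F : ∀ m → N ℕ.< m → coeff F m ≡ + 0
    bounded-F m N<m = lower m (ℕₚ.<-trans M<N N<m) (+ 0) (x^-other N m (ℕₚ.<⇒≢ N<m))
    top-F : coeff F N ≡ + 1
    top-F = lower N M<N (+ 1) (x^-top N)

module TrinomialRing (a b : ℤ) (M : ℕ) (1≤M : 1 ℕ.≤ M) (g : ℕ → ℤ) (F≡g : ∀ n → coeff (Trinomial.F a b M 1≤M) n ≡ g n) where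
  open PolyZ
  open Trinomial a b M 1≤M

  open MonicDivision {N} {F} F-monic

  A : CRing
  A = Quot (Poly ℤ-ring) F
  module A = Kit A
  module QF = Congruence (Poly ℤ-ring) F

  θ : A.Carrier
  θ = x̂

  root : θ A.^ M A.* θ A.^ M A.≈ A.ι a A.* θ A.^ M A.+ A.ι b
  root = by P.1# (P.trans (P.sym (P.^-homo-* x̂ M M)) (P.solve 3
    (λ t u v → t P.:= (u P.:+ v) P.:+ (t P.:- u P.:- v) P.:* P.con (+ 1)) P.refl (x̂ P.^ N) (P.ι a P.* x̂ P.^ M) (P.ι b)))

  horner : (S : A.Carrier → Set) → (∀ {x y} → x A.≈ y → S x → S y) → (∀ z → S (A.ι z)) →
    (∀ {x y} → S x → S y → S (x A.+ y)) → (∀ {x} → S x → S (θ A.* x)) → ∀ x → S x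
  horner S resp S-ι = induction S (λ e → resp (QF.≈⇒≈/ e))
    (λ c → resp (QF.≈⇒≈/ (P.trans (ι≈const c) (≡.subst (λ z → const z P.≈ const c) (≡.sym (ι-ℤ c)) P.refl))) (S-ι c))

  generated : (S : A.Carrier → Set) → (∀ {x y} → x A.≈ y → S x → S y) →
    (∀ z → S (A.ι z)) → S θ → (∀ {x y} → S x → S y → S (x A.+ y)) → (∀ {x y} → S x → S y → S (x A.* y)) → ∀ x → S x
  generated S resp S-ι S-θ S-+ S-* = horner S resp S-ι S-+ (S-* S-θ)

  ι-coeffℤ : ∀ z f n → coeff (P.ι z P.* f) n ≡ z ℤ.* coeff f n
  ι-coeffℤ z f n = ≡.trans (ι-coeff z f n) (≡.cong (ℤ._* coeff f n) (ι-ℤ z))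

  divide : ∀ d → 1 ℕ.≤ d → ∀ g → (∀ i → + d ∣ᶻ coeff g i) → Σ P.Carrier λ g' → g P.≈ P.ι (+ d) P.* g'
  divide d@(suc _) _ g div = g' , same λ n → ≡.trans (ℤˢ._∣_.equality (div n))
      (≡.trans (ℤₚ.*-comm (ℤˢ.quotient (div n)) (+ d)) (≡.sym (ι-coeffℤ (+ d) g' n)))
    where
    g' : P.Carrier
    g' = poly (λ n → ℤˢ.quotient (div n)) (degree g) λ m l →
      ℤₚ.*-cancelʳ-≡ (ℤˢ.quotient (div m)) (+ 0) (+ d) (≡.trans (≡.sym (ℤˢ._∣_.equality (div m))) (bounded g m l))

  ι-divides : ∀ d g i → + d ∣ᶻ coeff (P.ι (+ d) P.* g) i
  ι-divides d g i = ℤˢ.divides (coeff g i) (≡.trans (ι-coeffℤ (+ d) g i) (ℤₚ.*-comm (+ d) (coeff g i)))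

  -- In `d x = d y + F q` the product `F q` is divisible by `d`, hence so is `q`, because `F` is
  -- monic; then `d` cancels in ℤ[x].
  A-cancel : ∀ d → 1 ℕ.≤ d → ∀ {x y} → A.ι (+ d) A.* x A.≈ A.ι (+ d) A.* y → x A.≈ y
  A-cancel d@(suc _) 1≤d {x} {y} (by q e) =
    let q' , q≈ = divide d 1≤d q (cofactor-divisible d q λ i _ → fq-div i)
    in by q' (same λ n → ℤₚ.*-cancelˡ-≡ (+ d) (coeff x n) (coeff (y P.+ F P.* q') n) (begin
      + d ℤ.* coeff x n ≡⟨ ι-coeffℤ (+ d) x n ⟨
      coeff (P.ι (+ d) P.* x) n ≡⟨ at e n ⟩
      coeff (P.ι (+ d) P.* y P.+ F P.* q) n ≡⟨ at (P.+-congˡ {P.ι (+ d) P.* y} (P.*-congˡ {F} q≈)) n ⟩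
      coeff (P.ι (+ d) P.* y P.+ F P.* (P.ι (+ d) P.* q')) n ≡⟨ at (P.solve 4 (λ d y f q → d P.:* y P.:+ f P.:* (d P.:* q) P.:= d P.:* (y P.:+ f P.:* q)) P.refl (P.ι (+ d)) y F q') n ⟩
      coeff (P.ι (+ d) P.* (y P.+ F P.* q')) n ≡⟨ ι-coeffℤ (+ d) (y P.+ F P.* q') n ⟩
      + d ℤ.* coeff (y P.+ F P.* q') n ∎))
    where
    open ≡.≡-Reasoning
    fq-div : ∀ i → + d ∣ᶻ coeff (F P.* q) i
    fq-div i = ≡.subst (+ d ∣ᶻ_) (at (P.trans (P.+-congʳ {P.- (P.ι (+ d) P.* y)} e) (P.solve 2 (λ t u → (t P.:+ u) P.:- t P.:= u) P.refl (P.ι (+ d) P.* y) (F P.* q))) i)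
      (ℤˢ.∣m∣n⇒∣m-n (ι-divides d x i) (ι-divides d y i))

  Reduced : P.Carrier → Set
  Reduced g = ∀ i → N ℕ.≤ i → coeff g i ≡ + 0

  -- In `g = D η + F q` the high coefficients of `g` vanish, so those of `F q` are divisible by `D`,
  -- and with them all of `q`. Divisibility in `A` can thus be read off the coefficients of a
  -- reduced representative.
  reduced-divisible : ∀ D → 1 ℕ.≤ D → ∀ g → Reduced g → A.ι (+ D) A.∣ g → ∀ i → + D ∣ᶻ coeff g i
  reduced-divisible D 1≤D g red (η , by q e) i =
    let q' , q≈ = divide D 1≤D q (cofactor-divisible D q high)
    in ≡.subst (+ D ∣ᶻ_) (≡.sym (at (P.trans e (P.trans (P.+-congˡ {P.ι (+ D) P.* η} (P.*-congˡ {F} q≈))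
      (P.solve 4 (λ d y f q → d P.:* y P.:+ f P.:* (d P.:* q) P.:= d P.:* (y P.:+ f P.:* q)) P.refl (P.ι (+ D)) η F q'))) i)) (ι-divides D (η P.+ F P.* q') i)
    where
    high : ∀ i → N ℕ.≤ i → + D ∣ᶻ coeff (F P.* q) i
    high i N≤i = ≡.subst (+ D ∣ᶻ_) (≡.trans (≡.cong (ℤ._- coeff (P.ι (+ D) P.* η) i) (≡.sym (red i N≤i)))
        (at (P.trans (P.+-congʳ {P.- (P.ι (+ D) P.* η)} e) (P.solve 2 (λ t u → (t P.:+ u) P.:- t P.:= u) P.refl (P.ι (+ D) P.* η) (F P.* q))) i))
      (ℤˢ.∣m∣n⇒∣m-n (ℤˢ.divides (+ 0) ≡.refl) (ι-divides D η i))

  reduce : ∀ g → Σ P.Carrier λ r → Reduced r × g A.≈ r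
  reduce = induction (λ g → Σ P.Carrier λ r → Reduced r × g A.≈ r)
    (λ { e (r , red , f) → r , red , A.trans (QF.≈⇒≈/ (P.sym e)) f })
    (λ c → const c , (λ i N≤i → const-suc c i (ℕₚ.<-≤-trans 0<N N≤i)) , QF.≈⇒≈/ P.refl)
    (λ { (r , red , e) (s , red' , f) → r P.+ s , (λ i N≤i → ≡.cong₂ ℤ._+_ (red i N≤i) (red' i N≤i)) , A.+-cong e f })
    (λ { (r , red , e) → times-x r red , times-x-reduced r red , A.trans (A.*-congˡ {x̂} e) (times-x≈ r red) })
    where
    N' : ℕ
    N' = N ℕ.∸ 1
    1+N' : suc N' ≡ N
    1+N' = ℕₚ.m+[n∸m]≡n 0<N
    times-x : ∀ r → Reduced r → P.Carrier
    times-x r red = x̂ P.* r P.- P.ι (coeff r N') P.* F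
    times-x≈ : ∀ r red → x̂ A.* r A.≈ times-x r red
    times-x≈ r red = by (P.ι (coeff r N')) (P.solve 3 (λ t c f → t P.:= (t P.:- c P.:* f) P.:+ f P.:* c) P.refl (x̂ P.* r) (P.ι (coeff r N')) F)
    times-x-reduced : ∀ r red → Reduced (times-x r red)
    times-x-reduced r red zero N≤0 = ⊥-elim (ℕₚ.<⇒≱ 0<N N≤0)
    times-x-reduced r red (suc i) N≤1+i with ℕₚ.m≤n⇒m<n∨m≡n N≤1+i
    ... | inj₁ (s≤s N≤i) = ≡.trans (≡.cong₂ (λ u v → u ℤ.- v) (≡.trans (x̂*-suc r i) (red i N≤i))
            (≡.trans (ι-coeffℤ (coeff r N') F (suc i)) (≡.trans (≡.cong (coeff r N' ℤ.*_) (proj₁ F-monic (suc i) (s≤s N≤i))) (ℤₚ.*-zeroʳ (coeff r N'))))) ≡.refl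
    ... | inj₂ N≡1+i = ≡.trans (≡.cong₂ (λ u v → u ℤ.- v) (≡.trans (x̂*-suc r i) (≡.cong (coeff r) (ℕₚ.suc-injective (≡.trans (≡.sym N≡1+i) (≡.sym 1+N')))))
            (≡.trans (ι-coeffℤ (coeff r N') F (suc i)) (≡.trans (≡.cong (coeff r N' ℤ.*_) (≡.trans (≡.cong (coeff F) (≡.sym N≡1+i)) (proj₂ F-monic)))
              (ℤₚ.*-identityʳ (coeff r N'))))) (ℤₚ.+-inverseʳ (coeff r N'))

  -- Idempotents

  -- In `A` zero is divisible by every `D`, hence so are the coefficients of its reduced
  -- representative.
  reduced-zero : ∀ g → Reduced g → g A.≈ A.0# → ∀ i → coeff g i ≡ + 0
  reduced-zero g red g≈0 i = all-divide⇒0 (coeff g i) λ D 1≤D →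
    reduced-divisible D 1≤D g red (A.∣-resp {A.ι (+ D)} {A.0#} {g} (A.sym {g} {A.0#} g≈0) (A.∣-0 {A.ι (+ D)})) i

  Supported : ℕ → P.Carrier → Set
  Supported r g = ∀ i → ¬ (r ℕᵈ.∣ i) → coeff g i ≡ + 0

  sum-0 : ∀ f k → (∀ i → i ℕ.≤ k → f i ≡ + 0) → SZ.sumTo' f k ≡ + 0
  sum-0 f k h = ≡.trans (SZ.sumTo'-cong k h) (zeros k)
    where
    zeros : ∀ k → SZ.sumTo' (λ _ → + 0) k ≡ + 0
    zeros zero = ≡.refl
    zeros (suc k) = ≡.cong (λ t → t ℤ.+ + 0) (zeros k)

  supported-* : ∀ r {f g} → Supported r f → Supported r g → Supported r (f P.* g)
  supported-* r {f} {g} sf sg n r∤n = ≡.trans (SZ.⋆-sum (coeff f) (coeff g) n) (sum-0 _ n λ i i≤n → term i i≤n (r ℕᵈ.∣? i))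
    where
    term : ∀ i → i ℕ.≤ n → Dec (r ℕᵈ.∣ i) → coeff f i ℤ.* coeff g (n ℕ.∸ i) ≡ + 0
    term i i≤n (no r∤i) = ≡.cong (ℤ._* coeff g (n ℕ.∸ i)) (sf i r∤i)
    term i i≤n (yes r∣i) = ≡.trans (≡.cong (coeff f i ℤ.*_) (sg (n ℕ.∸ i) λ d → r∤n (≡.subst (r ℕᵈ.∣_) (ℕₚ.m+[n∸m]≡n i≤n) (ℕᵈ.∣m∣n⇒∣m+n r∣i d))))
      (ℤₚ.*-zeroʳ (coeff f i))

  supported-+ : ∀ r {f g} → Supported r f → Supported r g → Supported r (f P.+ g)
  supported-+ r sf sg i r∤i = ≡.cong₂ ℤ._+_ (sf i r∤i) (sg i r∤i)

  supported-const : ∀ r c → Supported r (const c)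
  supported-const r c zero r∤0 = ⊥-elim (r∤0 (r ℕᵈ.∣0))
  supported-const r c (suc i) _ = ≡.refl

  supported-resp : ∀ r {f g} → f P.≈ g → Supported r f → Supported r g
  supported-resp r e sf i r∤i = ≡.trans (≡.sym (at e i)) (sf i r∤i)

  supported-ι : ∀ r c → Supported r (P.ι c)
  supported-ι r c = supported-resp r {const (Kit.ι ℤ-ring c)} {P.ι c} (P.sym (ι≈const c)) (supported-const r (Kit.ι ℤ-ring c))

  supported-^ : ∀ r {f} n → Supported r f → Supported r (f P.^ n)
  supported-^ r zero sf = supported-ι r (+ 1)
  supported-^ r {f} (suc n) sf = supported-* r {f} {f P.^ n} sf (supported-^ r n sf)

  supported-x^ : ∀ r n → r ℕᵈ.∣ n → Supported r (x̂ P.^ n)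
  supported-x^ r n r∣n i r∤i = x^-other n i λ { ≡.refl → r∤i r∣n }

  F-supported : ∀ r → r ℕᵈ.∣ M → Supported r F
  F-supported r r∣M i r∤i = ≡.trans (F-coeff i) (≡.trans
    (≡.cong₂ (λ u v → u ℤ.- a ℤ.* v ℤ.- coeff (const b) i) (supported-x^ r N (ℕᵈ.∣m∣n⇒∣m+n r∣M r∣M) i r∤i) (supported-x^ r M r∣M i r∤i))
    (≡.trans (≡.cong (λ w → + 0 ℤ.- a ℤ.* + 0 ℤ.- w) (supported-const r b i r∤i))
      (solve 1 (λ a → con (+ 0) :- a :* con (+ 0) :- con (+ 0) := con (+ 0)) ≡.refl a)))
    where open Data.Integer.Solver.+-*-Solver

  unless : {Q : Set} → Dec Q → ℤ → ℤ
  unless (yes _) z = + 0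
  unless (no _) z = z

  unless-0 : {Q : Set} (d : Dec Q) → unless d (+ 0) ≡ + 0
  unless-0 (yes _) = ≡.refl
  unless-0 (no _) = ≡.refl

  unless-+ : {Q : Set} (d : Dec Q) → ∀ u v → unless d (u ℤ.+ v) ≡ unless d u ℤ.+ unless d v
  unless-+ (yes _) u v = ≡.refl
  unless-+ (no _) u v = ≡.refl

  -- The part of `g` whose exponents are not multiples of `r`. The map is linear over the
  -- polynomials in `x ^ r`, among them `F` when `r ∣ M`, so it respects congruences modulo `F`.
  off : ℕ → P.Carrier → P.Carrier
  off r g = poly (λ n → unless (r ℕᵈ.∣? n) (coeff g n)) (degree g) λ m l →
    ≡.trans (≡.cong (unless (r ℕᵈ.∣? m)) (bounded g m l)) (unless-0 (r ℕᵈ.∣? m))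

  off-cong : ∀ r {f g} → f P.≈ g → off r f P.≈ off r g
  off-cong r e = same λ n → ≡.cong (unless (r ℕᵈ.∣? n)) (at e n)

  off-+ : ∀ r f g → off r (f P.+ g) P.≈ off r f P.+ off r g
  off-+ r f g = same λ n → unless-+ (r ℕᵈ.∣? n) (coeff f n) (coeff g n)

  off-supported : ∀ r {g} → Supported r g → off r g P.≈ P.0#
  off-supported r {g} sg = same λ n → go n (r ℕᵈ.∣? n)
    where
    go : ∀ n (d : Dec (r ℕᵈ.∣ n)) → unless d (coeff g n) ≡ + 0
    go n (yes _) = ≡.refl
    go n (no r∤n) = sg n r∤n

  off-0⇒supported : ∀ r g → (∀ i → coeff (off r g) i ≡ + 0) → Supported r g
  off-0⇒supported r g h i r∤i = go (r ℕᵈ.∣? i) (h i)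
    where
    go : (d : Dec (r ℕᵈ.∣ i)) → unless d (coeff g i) ≡ + 0 → coeff g i ≡ + 0
    go (yes r∣i) _ = ⊥-elim (r∤i r∣i)
    go (no _) e = e

  off-*ˡ : ∀ r {f} g → Supported r f → off r (f P.* g) P.≈ f P.* off r g
  off-*ˡ r {f} g sf = same λ n → ≡.sym (go n (r ℕᵈ.∣? n))
    where
    go : ∀ n (d : Dec (r ℕᵈ.∣ n)) → coeff (f P.* off r g) n ≡ unless d (coeff (f P.* g) n)
    go n (yes r∣n) = ≡.trans (SZ.⋆-sum (coeff f) (coeff (off r g)) n) (sum-0 _ n λ i i≤n → term i i≤n (r ℕᵈ.∣? i) (r ℕᵈ.∣? (n ℕ.∸ i)))
      where
      term : ∀ i → i ℕ.≤ n → Dec (r ℕᵈ.∣ i) → (d : Dec (r ℕᵈ.∣ n ℕ.∸ i)) → coeff f i ℤ.* unless d (coeff g (n ℕ.∸ i)) ≡ + 0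
      term i i≤n (no r∤i) d = ≡.cong (ℤ._* unless d (coeff g (n ℕ.∸ i))) (sf i r∤i)
      term i i≤n (yes r∣i) (yes _) = ℤₚ.*-zeroʳ (coeff f i)
      term i i≤n (yes r∣i) (no ¬d) = ⊥-elim (¬d (ℕᵈ.∣m+n∣m⇒∣n (≡.subst (r ℕᵈ.∣_) (≡.sym (ℕₚ.m+[n∸m]≡n i≤n)) r∣n) r∣i))
    go n (no r∤n) = ≡.trans (SZ.⋆-sum (coeff f) (coeff (off r g)) n) (≡.trans
      (SZ.sumTo'-cong n λ i i≤n → term i i≤n (r ℕᵈ.∣? i) (r ℕᵈ.∣? (n ℕ.∸ i))) (≡.sym (SZ.⋆-sum (coeff f) (coeff g) n)))
      where
      term : ∀ i → i ℕ.≤ n → Dec (r ℕᵈ.∣ i) → (d : Dec (r ℕᵈ.∣ n ℕ.∸ i)) → coeff f i ℤ.* unless d (coeff g (n ℕ.∸ i)) ≡ coeff f i ℤ.* coeff g (n ℕ.∸ i)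
      term i i≤n (no r∤i) d = ≡.trans (≡.cong (ℤ._* unless d (coeff g (n ℕ.∸ i))) (sf i r∤i)) (≡.sym (≡.cong (ℤ._* coeff g (n ℕ.∸ i)) (sf i r∤i)))
      term i i≤n (yes r∣i) (yes d) = ⊥-elim (r∤n (≡.subst (r ℕᵈ.∣_) (ℕₚ.m+[n∸m]≡n i≤n) (ℕᵈ.∣m∣n⇒∣m+n r∣i d)))
      term i i≤n (yes r∣i) (no _) = ≡.refl

  module _ {p : ℕ} (pp : Prime p) (r : ℕ) where
    private
      module Fr = Frobenius (Poly ℤ-ring) pp
      rp : ℕ
      rp = r ℕ.* p
      instance
        p≢0 : ℕ.NonZero p
        p≢0 = Prm.prime⇒nonZero pp

    -- Modulo `p` the p-th power of a sum of monomials is the sum of their p-th powers. A polynomial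
    -- in `x ^ r` therefore has a p-th power that is a polynomial in `x ^ (r p)` up to a multiple of
    -- `p`.
    PthPower : P.Carrier → Set
    PthPower g = Σ P.Carrier λ z → Σ P.Carrier λ y → Supported rp z × (g P.^ p P.≈ z P.+ Fr.p̂ P.* y)

    pth-resp : ∀ {f g} → f P.≈ g → PthPower f → PthPower g
    pth-resp e (z , y , sz , f) = z , y , sz , P.trans (P.^-congˡ p (P.sym e)) f

    pth-+ : ∀ {f g} → PthPower f → PthPower g → PthPower (f P.+ g)
    pth-+ {f} {g} (z , y , sz , e) (z' , y' , sz' , e') =
      let w , h = Fr.frobenius f g in
      z P.+ z' , y P.+ y' P.+ f P.* w , supported-+ rp {z} {z'} sz sz' , P.trans h (P.trans (P.+-congʳ {Fr.p̂ P.* (f P.* w)} (P.+-cong e e'))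
        (P.solve 6 (λ z z' p y y' t → ((z P.:+ p P.:* y) P.:+ (z' P.:+ p P.:* y')) P.:+ p P.:* t P.:= (z P.:+ z') P.:+ p P.:* (y P.:+ y' P.:+ t))
          P.refl z z' Fr.p̂ y y' (f P.* w)))

    pth-monomial : ∀ c d → ¬ (r ℕᵈ.∣ d) → c ≡ + 0 → PthPower (P.ι c P.* x̂ P.^ d)
    pth-monomial c d _ ≡.refl = P.0# , P.0# , (λ _ _ → ≡.refl) , P.trans (P.^-congˡ p (P.zeroˡ (x̂ P.^ d)))
      (P.trans (let w , e = P.^-pos P.0# {p} (ℕₚ.<⇒≤ (prime>1 pp)) in P.trans e (P.zeroˡ w))
        (P.solve 1 (λ p → P.con (+ 0) P.:= P.con (+ 0) P.:+ p P.:* P.con (+ 0)) P.refl Fr.p̂))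

    pth-monomial' : ∀ c d → r ℕᵈ.∣ d → PthPower (P.ι c P.* x̂ P.^ d)
    pth-monomial' c d r∣d = P.ι c P.^ p P.* x̂ P.^ (d ℕ.* p) , P.0# ,
      supported-* rp {P.ι c P.^ p} {x̂ P.^ (d ℕ.* p)} (supported-^ rp {P.ι c} p (supported-ι rp c)) (supported-x^ rp (d ℕ.* p) (ℕᵈ.*-monoˡ-∣ p r∣d)) ,
      P.trans (P.^-distrib-* (P.ι c) (x̂ P.^ d) p) (P.trans (P.*-congˡ {P.ι c P.^ p} (P.^-assocʳ x̂ d p))
        (P.solve 2 (λ p t → t P.:= t P.:+ p P.:* P.con (+ 0)) P.refl Fr.p̂ (P.ι c P.^ p P.* x̂ P.^ (d ℕ.* p))))

    pth-power : ∀ d g → SZ.Bounded d (coeff g) → Supported r g → PthPower g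
    leading : ∀ d g → Supported r g → PthPower (P.ι (coeff g d) P.* x̂ P.^ d)
    leading d g sg with r ℕᵈ.∣? d
    ... | yes r∣d = pth-monomial' (coeff g d) d r∣d
    ... | no r∤d = pth-monomial (coeff g d) d r∤d (sg d r∤d)
    pth-power zero g bg sg = pth-resp {P.ι (coeff g 0) P.* x̂ P.^ 0} {g} (P.trans (P.*-identityʳ (P.ι (coeff g 0)))
      (P.trans (ι≈const (coeff g 0)) (same λ { zero → ι-ℤ (coeff g 0) ; (suc n) → ≡.sym (bg (suc n) (s≤s z≤n)) }))) (leading 0 g sg)
    pth-power (suc d) g bg sg = pth-resp {lower P.+ P.ι (coeff g (suc d)) P.* x̂ P.^ suc d} {g}
        (P.solve 2 (λ g t → (g P.:- t) P.:+ t P.:= g) P.refl g top)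
        (pth-+ {lower} {top} (pth-power d lower lower-bounded lower-supported) (leading (suc d) g sg))
      where
      top lower : P.Carrier
      top = P.ι (coeff g (suc d)) P.* x̂ P.^ suc d
      lower = g P.- top
      lower-other : ∀ n → suc d ≢ n → coeff lower n ≡ coeff g n
      lower-other n ne = ≡.trans (≡.cong (λ t → coeff g n ℤ.- t) (≡.trans (ι-coeffℤ (coeff g (suc d)) (x̂ P.^ suc d) n)
        (≡.trans (≡.cong (coeff g (suc d) ℤ.*_) (x^-other (suc d) n ne)) (ℤₚ.*-zeroʳ (coeff g (suc d)))))) (ℤₚ.+-identityʳ (coeff g n))
      lower-top : coeff lower (suc d) ≡ + 0
      lower-top = ≡.trans (≡.cong (λ t → coeff g (suc d) ℤ.- t) (≡.trans (ι-coeffℤ (coeff g (suc d)) (x̂ P.^ suc d) (suc d))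
        (≡.trans (≡.cong (coeff g (suc d) ℤ.*_) (x^-top (suc d))) (ℤₚ.*-identityʳ (coeff g (suc d)))))) (ℤₚ.+-inverseʳ (coeff g (suc d)))
      lower-bounded : SZ.Bounded d (coeff lower)
      lower-bounded m d<m with ℕₚ.m≤n⇒m<n∨m≡n d<m
      ... | inj₁ l = ≡.trans (lower-other m (ℕₚ.<⇒≢ l)) (bg m l)
      ... | inj₂ ≡.refl = lower-top
      lower-supported : Supported r lower
      lower-supported i r∤i with suc d ℕ.≟ i
      ... | yes ≡.refl = lower-top
      ... | no ne = ≡.trans (lower-other i ne) (sg i r∤i)

    -- ε = ε ^ (p ^ (j + 1)) is, modulo p ^ (j + 1), a polynomial in x ^ rp, for every j.
    idempotent-support : rp ℕᵈ.∣ M → ∀ ε → Reduced ε → ε A.* ε A.≈ ε → Supported r ε → Supported rp ε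
    idempotent-support rp∣M ε red ε²≈ε sε = off-0⇒supported rp ε λ i → vanish (coeff (off rp ε) i) λ j →
        reduced-divisible (p ℕ.^ suc j) (ℕₚ.m^n>0 p (suc j)) (off rp ε) off-red (off-divisible j) i
      where
      vanish : ∀ z → (∀ j → + (p ℕ.^ suc j) ∣ᶻ z) → z ≡ + 0
      -- The single instance `j = |z|` suffices, since `|z| < p ^ (|z| + 1)`.
      vanish z h with ℤ.∣ z ∣ in e | ∣ᶻ⇒∣ (h ℤ.∣ z ∣)
      ... | zero | _ = ℤₚ.∣i∣≡0⇒i≡0 e
      ... | suc n | d = ⊥-elim (ℕₚ.<⇒≱ (n<p^n (suc (suc n))) (ℕₚ.≤-trans (ℕᵈ.∣⇒≤ d) (ℕₚ.n≤1+n (suc n))))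
        where
        n<p^n : ∀ n → n ℕ.< p ℕ.^ n
        n<p^n zero = s≤s z≤n
        n<p^n (suc n) = ℕₚ.≤-trans (s≤s (n<p^n n)) (ℕₚ.≤-trans (ℕₚ.+-monoˡ-≤ (p ℕ.^ n) (ℕₚ.m^n>0 p n))
          (ℕₚ.≤-trans (ℕₚ.≤-reflexive (≡.cong (p ℕ.^ n ℕ.+_) (≡.sym (ℕₚ.+-identityʳ (p ℕ.^ n))))) (ℕₚ.*-monoˡ-≤ (p ℕ.^ n) (prime>1 pp))))
      off-red : Reduced (off rp ε)
      off-red i N≤i = ≡.trans (≡.cong (unless (rp ℕᵈ.∣? i)) (red i N≤i)) (unless-0 (rp ℕᵈ.∣? i))
      ε^≈ε : ∀ n → ε A.^ suc n A.≈ ε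
      ε^≈ε zero = A.*-identityʳ ε
      ε^≈ε (suc n) = A.trans (A.*-congˡ {ε} (ε^≈ε n)) ε²≈ε
      ε^≈ε' : ∀ n → 1 ℕ.≤ n → ε A.^ n A.≈ ε
      ε^≈ε' (suc n) _ = ε^≈ε n
      pth = pth-power (degree ε) ε (bounded ε) sε
      ι-p^ : ∀ j → P.ι (+ (p ℕ.^ j)) P.≈ Fr.p̂ P.^ j
      ι-p^ zero = P.refl
      ι-p^ (suc j) = P.trans (P.reflexive (≡.cong P.ι (ℤₚ.pos-* p (p ℕ.^ j)))) (P.trans (P.ι-* (+ p) (+ (p ℕ.^ j))) (P.*-congˡ {Fr.p̂} (ι-p^ j)))
      -- From `ε ^ p = z + p y` the lifting lemma gives `ε = z ^ (p ^ j) + p ^ (j + 1) w` modulo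
      -- `F`. Applying `off` kills the first term, and `p ^ (j + 1)` and `F` pass through it.
      off-divisible : ∀ j → A.ι (+ (p ℕ.^ suc j)) A.∣ off rp ε
      off-divisible j =
        let z , y , sz , e = pth
            w , f = Fr.^p^-lift 0 j z y
            by q g = A.trans (A.sym (ε^≈ε' (p ℕ.* p ℕ.^ j) (ℕₚ.m^n>0 p (suc j)))) (QF.≈⇒≈/ (P.trans (P.sym (P.^-assocʳ ε p (p ℕ.^ j)))
              (P.trans (P.^-congˡ (p ℕ.^ j) (P.trans e (P.+-congˡ {z} (P.*-congʳ {y} (P.sym (P.*-identityʳ Fr.p̂)))))) f)))
            Z = z P.^ (p ℕ.^ j)
            pow = P.trans (P.reflexive (≡.cong (λ n → Fr.p̂ P.^ suc n) (ℕₚ.+-identityʳ j))) (P.sym (ι-p^ (suc j)))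
            D = P.ι (+ (p ℕ.^ suc j))
        in off rp w , by (off rp q) (P.trans (off-cong rp (P.trans g (P.+-congʳ {F P.* q} (P.+-congˡ {Z} (P.*-congʳ {w} pow)))))
             (P.trans (off-+ rp (Z P.+ D P.* w) (F P.* q))
             (P.+-cong (P.trans (off-+ rp Z (D P.* w)) (P.trans (P.+-cong (off-supported rp {Z} (supported-^ rp {z} (p ℕ.^ j) sz))
                 (off-*ˡ rp {D} w (supported-ι rp (+ (p ℕ.^ suc j))))) (P.+-identityˡ (D P.* off rp w))))
               (off-*ˡ rp {F} q (F-supported rp rp∣M)))))

  supported-M : ∀ ε → Reduced ε → ε A.* ε A.≈ ε → Supported M ε
  supported-M ε red ε²≈ε = ≡.subst (λ n → Supported n ε) (≡.sym (≡.trans isF (≡.sym (ℕₚ.+-identityʳ (product (PrimeFactorisation.factors fac))))))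
      (go _ factorsPrime 1 (divides 1 (≡.trans isF (≡.trans (≡.sym (ℕₚ.+-identityʳ _)) (≡.sym (ℕₚ.*-identityˡ _))))) λ i 1∤i → ⊥-elim (1∤i (ℕᵈ.1∣ i)))
    where
    fac = factorise M {{ℕ.>-nonZero 1≤M}}
    open PrimeFactorisation fac using (factorsPrime) renaming (isFactorisation to isF)
    go : ∀ ps → All Prime ps → ∀ r → r ℕ.* product ps ℕᵈ.∣ M → Supported r ε → Supported (r ℕ.* product ps) ε
    go [] [] r _ sr = ≡.subst (λ n → Supported n ε) (≡.sym (ℕₚ.*-identityʳ r)) sr
    go (p ∷ ps) (pp ∷ pps) r d sr = ≡.subst (λ n → Supported n ε) (ℕₚ.*-assoc r p (product ps))
      (go ps pps (r ℕ.* p) d' (idempotent-support pp r (ℕᵈ.∣-trans (ℕᵈ.m∣m*n (product ps)) d') ε red ε²≈ε sr))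
      where
      d' : r ℕ.* p ℕ.* product ps ℕᵈ.∣ M
      d' = ≡.subst (ℕᵈ._∣ M) (≡.sym (ℕₚ.*-assoc r p (product ps))) d

  linear-coeff : ∀ u v n → coeff (P.ι u P.+ P.ι v P.* x̂ P.^ M) n ≡ coeff (const u) n ℤ.+ v ℤ.* coeff (x̂ P.^ M) n
  linear-coeff u v n = ≡.cong₂ ℤ._+_ (≡.trans (at (ι≈const u) n) (≡.cong (λ c → coeff (const c) n) (ι-ℤ u))) (ι-coeffℤ v (x̂ P.^ M) n)

  linear-zero : ∀ u v → A.ι u A.+ A.ι v A.* θ A.^ M A.≈ A.0# → u ≡ + 0 × v ≡ + 0
  linear-zero u v e = ≡.trans (≡.sym at-0) (zero-at 0) , ≡.trans (≡.sym at-M) (zero-at M)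
    where
    lin = P.ι u P.+ P.ι v P.* x̂ P.^ M
    zero-at = reduced-zero lin (λ i N≤i → ≡.trans (linear-coeff u v i) (≡.trans (≡.cong₂ (λ s t → s ℤ.+ v ℤ.* t)
      (const-suc u i (ℕₚ.<-≤-trans 0<N N≤i)) (x^-other M i (ℕₚ.<⇒≢ (ℕₚ.<-≤-trans M<N N≤i)))) (≡.cong (λ t → + 0 ℤ.+ t) (ℤₚ.*-zeroʳ v)))) e
    at-0 : coeff lin 0 ≡ u
    at-0 = ≡.trans (linear-coeff u v 0) (≡.trans (≡.cong (λ t → u ℤ.+ v ℤ.* t) (x^-other M 0 (λ M≡0 → ℕₚ.<⇒≢ 1≤M (≡.sym M≡0))))
      (≡.trans (≡.cong (λ t → u ℤ.+ t) (ℤₚ.*-zeroʳ v)) (ℤₚ.+-identityʳ u)))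
    at-M : coeff lin M ≡ v
    at-M = ≡.trans (linear-coeff u v M) (≡.trans (≡.cong₂ (λ s t → s ℤ.+ v ℤ.* t) (const-suc u M 1≤M) (x^-top M))
      (≡.trans (ℤₚ.+-identityˡ (v ℤ.* + 1)) (ℤₚ.*-identityʳ v)))

  linear-form : ∀ ε → Reduced ε → Supported M ε → ε P.≈ P.ι (coeff ε 0) P.+ P.ι (coeff ε M) P.* x̂ P.^ M
  linear-form ε red sε = same λ n → ≡.trans (go n (n ℕ.≟ 0) (n ℕ.≟ M)) (≡.sym (linear-coeff (coeff ε 0) (coeff ε M) n))
    where
    c = coeff ε 0
    d = coeff ε M
    go : ∀ n → Dec (n ≡ 0) → Dec (n ≡ M) → coeff ε n ≡ coeff (const c) n ℤ.+ d ℤ.* coeff (x̂ P.^ M) n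
    go n (yes ≡.refl) _ = ≡.sym (≡.trans (≡.cong (λ t → c ℤ.+ d ℤ.* t) (x^-other M 0 (λ M≡0 → ℕₚ.<⇒≢ 1≤M (≡.sym M≡0))))
      (≡.trans (≡.cong (λ t → c ℤ.+ t) (ℤₚ.*-zeroʳ d)) (ℤₚ.+-identityʳ c)))
    go n (no n≢0) (yes ≡.refl) = ≡.sym (≡.trans (≡.cong₂ (λ s t → s ℤ.+ d ℤ.* t) (const-suc c M 1≤M) (x^-top M))
      (≡.trans (ℤₚ.+-identityˡ (d ℤ.* + 1)) (ℤₚ.*-identityʳ d)))
    go n (no n≢0) (no n≢M) = ≡.trans ε-n≡0 (≡.sym (≡.trans (≡.cong₂ (λ s t → s ℤ.+ d ℤ.* t) (const-suc c n (ℕₚ.n≢0⇒n>0 n≢0)) (x^-other M n λ e → n≢M (≡.sym e)))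
      (≡.cong (λ t → + 0 ℤ.+ t) (ℤₚ.*-zeroʳ d))))
      where
      ε-n≡0 : coeff ε n ≡ + 0
      ε-n≡0 with M ℕᵈ.∣? n
      ... | no M∤n = sε n M∤n
      ... | yes (divides zero e) = ⊥-elim (n≢0 e)
      ... | yes (divides (suc zero) e) = ⊥-elim (n≢M (≡.trans e (ℕₚ.+-identityʳ M)))
      ... | yes (divides (suc (suc k)) e) = red n (≡.subst (N ℕ.≤_) (≡.sym e) (ℕₚ.+-monoʳ-≤ M (ℕₚ.m≤m+n M (k ℕ.* M))))

  -- Writing `ε = c + d ω`, idempotency gives `c² + b d² = c` and `d (2c + a d - 1) = 0`. If `d`
  -- were nonzero, then `2c - 1 = -a d`, and the first equation would become `d² Δ = 1`.
  idempotent-0-1 : (∀ d → d ℤ.* d ℤ.* (a ℤ.* a ℤ.+ + 4 ℤ.* b) ≢ + 1) → ∀ ε → ε A.* ε A.≈ ε → ε A.≈ A.0# ⊎ ε A.≈ A.1#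
  idempotent-0-1 noUnit ε₀ ε₀²≈ε₀ = conclude (ℤₚ.i*j≡0⇒i≡0∨j≡0 d d-factor)
    where
    open Data.Integer.Solver.+-*-Solver
    red = reduce ε₀
    ε : P.Carrier
    ε = proj₁ red
    ε₀≈ε : ε₀ A.≈ ε
    ε₀≈ε = proj₂ (proj₂ red)
    ε²≈ε : ε A.* ε A.≈ ε
    ε²≈ε = A.trans (A.sym (A.*-cong ε₀≈ε ε₀≈ε)) (A.trans ε₀²≈ε₀ ε₀≈ε)
    c d : ℤ
    c = coeff ε 0
    d = coeff ε M
    W : A.Carrier
    W = θ A.^ M
    ε≈ : ε A.≈ A.ι c A.+ A.ι d A.* W
    ε≈ = QF.≈⇒≈/ (linear-form ε (proj₁ (proj₂ red)) (supported-M ε (proj₁ (proj₂ red)) ε²≈ε))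
    u v : ℤ
    u = c ℤ.* c ℤ.+ b ℤ.* (d ℤ.* d) ℤ.- c
    v = + 2 ℤ.* (c ℤ.* d) ℤ.+ a ℤ.* (d ℤ.* d) ℤ.- d
    vanish : A.ι u A.+ A.ι v A.* W A.≈ A.0#
    vanish = A.trans (A.+-cong u≈ (A.*-congʳ {W} v≈)) (A.trans
        (A.solve 5 (λ c d a b w → (c A.:* c A.:+ b A.:* (d A.:* d) A.:- c) A.:+ (A.con (+ 2) A.:* (c A.:* d) A.:+ a A.:* (d A.:* d) A.:- d) A.:* w
            A.:= (c A.:* c A.:+ A.con (+ 2) A.:* (c A.:* d) A.:* w A.:+ (d A.:* d) A.:* (a A.:* w A.:+ b)) A.:- (c A.:+ d A.:* w)) A.refl (A.ι c) (A.ι d) (A.ι a) (A.ι b) W)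
      (A.trans (A.+-congʳ {A.- (A.ι c A.+ A.ι d A.* W)} (A.+-congˡ {A.ι c A.* A.ι c A.+ A.ι (+ 2) A.* (A.ι c A.* A.ι d) A.* W} (A.*-congˡ {A.ι d A.* A.ι d} (A.sym root))))
      (A.trans (A.solve 3 (λ c d w → (c A.:* c A.:+ A.con (+ 2) A.:* (c A.:* d) A.:* w A.:+ (d A.:* d) A.:* (w A.:* w)) A.:- (c A.:+ d A.:* w)
            A.:= (c A.:+ d A.:* w) A.:* (c A.:+ d A.:* w) A.:- (c A.:+ d A.:* w)) A.refl (A.ι c) (A.ι d) W)
        (A.x≈y⇒x-y≈0 (A.trans (A.sym (A.*-cong ε≈ ε≈)) (A.trans ε²≈ε ε≈))))))
      where
      u≈ : A.ι u A.≈ A.ι c A.* A.ι c A.+ A.ι b A.* (A.ι d A.* A.ι d) A.- A.ι c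
      u≈ = A.trans (A.ι-+ (c ℤ.* c ℤ.+ b ℤ.* (d ℤ.* d)) (ℤ.- c)) (A.+-cong (A.trans (A.ι-+ (c ℤ.* c) (b ℤ.* (d ℤ.* d)))
        (A.+-cong (A.ι-* c c) (A.trans (A.ι-* b (d ℤ.* d)) (A.*-congˡ {A.ι b} (A.ι-* d d))))) (A.ι-neg c))
      v≈ : A.ι v A.≈ A.ι (+ 2) A.* (A.ι c A.* A.ι d) A.+ A.ι a A.* (A.ι d A.* A.ι d) A.- A.ι d
      v≈ = A.trans (A.ι-+ (+ 2 ℤ.* (c ℤ.* d) ℤ.+ a ℤ.* (d ℤ.* d)) (ℤ.- d)) (A.+-cong (A.trans (A.ι-+ (+ 2 ℤ.* (c ℤ.* d)) (a ℤ.* (d ℤ.* d)))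
        (A.+-cong (A.trans (A.ι-* (+ 2) (c ℤ.* d)) (A.*-congˡ {A.ι (+ 2)} (A.ι-* c d))) (A.trans (A.ι-* a (d ℤ.* d)) (A.*-congˡ {A.ι a} (A.ι-* d d))))) (A.ι-neg d))
    u≡0 : u ≡ + 0
    u≡0 = proj₁ (linear-zero u v vanish)
    d-factor : d ℤ.* (+ 2 ℤ.* c ℤ.+ a ℤ.* d ℤ.- + 1) ≡ + 0
    d-factor = ≡.trans (solve 3 (λ a c d → d :* (con (+ 2) :* c :+ a :* d :- con (+ 1)) := con (+ 2) :* (c :* d) :+ a :* (d :* d) :- d) ≡.refl a c d)
      (proj₂ (linear-zero u v vanish))
    conclude : d ≡ + 0 ⊎ + 2 ℤ.* c ℤ.+ a ℤ.* d ℤ.- + 1 ≡ + 0 → ε₀ A.≈ A.0# ⊎ ε₀ A.≈ A.1#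
    conclude (inj₂ e) = ⊥-elim (noUnit d (≡.trans
      (solve 4 (λ a b c d → d :* d :* (a :* a :+ con (+ 4) :* b) := con (+ 1) :+ (con (+ 4) :* (c :* c :+ b :* (d :* d) :- c)
          :+ (con (+ 2) :* c :+ a :* d :- con (+ 1)) :* (a :* d :- con (+ 2) :* c :+ con (+ 1)))) ≡.refl a b c d)
      (≡.cong₂ (λ s t → + 1 ℤ.+ (+ 4 ℤ.* s ℤ.+ t ℤ.* (a ℤ.* d ℤ.- + 2 ℤ.* c ℤ.+ + 1))) u≡0 e)))
    conclude (inj₁ d≡0) = finish (ℤₚ.i*j≡0⇒i≡0∨j≡0 c c-factor)
      where
      c-factor : c ℤ.* (c ℤ.- + 1) ≡ + 0
      c-factor = ≡.trans (solve 3 (λ b c d → c :* (c :- con (+ 1)) := (c :* c :+ b :* (d :* d) :- c) :- b :* (d :* d)) ≡.refl b c d)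
        (≡.trans (≡.cong₂ (λ s t → s ℤ.- b ℤ.* (t ℤ.* t)) u≡0 d≡0) (solve 1 (λ b → con (+ 0) :- b :* (con (+ 0) :* con (+ 0)) := con (+ 0)) ≡.refl b))
      ε₀≈c : ε₀ A.≈ A.ι c
      ε₀≈c = A.trans ε₀≈ε (A.trans ε≈ (A.trans (A.+-congˡ {A.ι c} (A.trans (A.*-congʳ {W} (A.reflexive (≡.cong A.ι d≡0))) (A.zeroˡ W))) (A.+-identityʳ (A.ι c))))
      finish : c ≡ + 0 ⊎ c ℤ.- + 1 ≡ + 0 → ε₀ A.≈ A.0# ⊎ ε₀ A.≈ A.1#
      finish (inj₁ c≡0) = inj₁ (A.trans ε₀≈c (A.reflexive (≡.cong A.ι c≡0)))
      finish (inj₂ c≡1) = inj₂ (A.trans ε₀≈c (A.reflexive (≡.cong A.ι (ℤₚ.i-j≡0⇒i≡j c (+ 1) c≡1))))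

  -- Integral elements of ℚ[x] / (F)

  Fℚ : PQ.Carrier
  Fℚ = Hom.⟦ φ ⟧ F

  Aℚ : CRing
  Aℚ = Quot (Poly ℚ-ring) Fℚ
  module QQ = Congruence (Poly ℚ-ring) Fℚ
  module Aℚ = Kit Aℚ

  ψ : Hom A Aℚ
  ψ = record
    { ⟦_⟧ = ⟦_⟧
    ; cong = λ { {x} {y} (by q e) → by ⟦ q ⟧ (PQ.trans (cong e) (PQ.trans (+-hom y (F P.* q)) (PQ.+-congˡ {⟦ y ⟧} (*-hom F q)))) }
    ; +-hom = λ x y → QQ.≈⇒≈/ (+-hom x y)
    ; *-hom = λ x y → QQ.≈⇒≈/ (*-hom x y)
    ; 1-hom = QQ.≈⇒≈/ 1-hom }
    where open Hom φ

  -- Clearing the denominators of the rational cofactor turns `x = F q` into `d x = F ζ` over ℤ, and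
  -- `d` cancels in `A`.
  ψ-injective : ∀ x → Hom.⟦ ψ ⟧ x Aℚ.≈ Aℚ.0# → x A.≈ A.0#
  ψ-injective x (by q e) =
    let d , 1≤d , ζ , ζ≈ = common-denominator q
    in A-cancel d 1≤d {x} {A.0#} (A.trans (by ζ (P.trans (φ-injective (begin
         ⟦ P.ι (+ d) P.* x ⟧ ≈⟨ PQ.trans (*-hom (P.ι (+ d)) x) (PQ.*-cong (ι-hom (+ d)) e) ⟩
         PQ.ι (+ d) PQ.* (PQ.0# PQ.+ Fℚ PQ.* q) ≈⟨ PQ.solve 3 (λ d f q → d PQ.:* (PQ.con (+ 0) PQ.:+ f PQ.:* q) PQ.:= f PQ.:* (d PQ.:* q)) PQ.refl (PQ.ι (+ d)) Fℚ q ⟩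
         Fℚ PQ.* (PQ.ι (+ d) PQ.* q) ≈⟨ PQ.*-congˡ {Fℚ} ζ≈ ⟨
         Fℚ PQ.* ⟦ ζ ⟧ ≈⟨ *-hom F ζ ⟨
         ⟦ F P.* ζ ⟧ ∎)) (P.sym (P.+-identityˡ (F P.* ζ))))) (A.sym (A.zeroʳ (A.ι (+ d)))))
    where
    open Hom φ
    open PQ.≈R

  Aℚ-cancel : ∀ d → 1 ℕ.≤ d → ∀ x y → Aℚ.ι (+ d) Aℚ.* x Aℚ.≈ Aℚ.ι (+ d) Aℚ.* y → x Aℚ.≈ y
  Aℚ-cancel (suc d) _ x y e = Aℚ.trans (Aℚ.sym (undo x)) (Aℚ.trans (Aℚ.*-congˡ {r} e) (undo y))
    where
    r : PQ.Carrier
    r = PolyQ.const (proj₁ (reciprocal d))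
    undo : ∀ x → r Aℚ.* (Aℚ.ι (+ suc d) Aℚ.* x) Aℚ.≈ x
    undo x = QQ.≈⇒≈/ (same λ n → ≡.trans (PolyQ.const-* (proj₁ (reciprocal d)) (PQ.ι (+ suc d) PQ.* x) n)
      (≡.trans (≡.cong (proj₁ (reciprocal d) ℚ.*_) (ι-coeffℚ (+ suc d) x n))
      (≡.trans (≡.sym (ℚₚ.*-assoc (proj₁ (reciprocal d)) (ℤ→ℚ (+ suc d)) (coeff x n)))
      (≡.trans (≡.cong (ℚ._* coeff x n) (≡.trans (ℚₚ.*-comm (proj₁ (reciprocal d)) (ℤ→ℚ (+ suc d))) (proj₂ (reciprocal d)))) (ℚₚ.*-identityˡ (coeff x n))))))

  toℚPoly≡ : ∀ n → toℚPoly g n ≡ coeff Fℚ n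
  toℚPoly≡ n = ≡.cong ℤ→ℚ (≡.sym (F≡g n))

  module _ (c : Fin N → ℚ) where

    α : PQ.Carrier
    α = elemPoly N c

    Relation : Set
    Relation = Σ ℕ λ e → Σ (Fin e → ℤ) λ h → α Aℚ.^ e Aℚ.+ lowPoly α e h Aℚ.≈ Aℚ.0#

    private
      sides : ∀ e h q m → (toℚPoly g ⊛ coeff q) m ≡ coeff (Fℚ PQ.* q) m ×
        (pow (elem N c) e ⊕ proj₁ (lowerTerms N g c) e h) m ≡ coeff (α PQ.^ e PQ.+ lowPoly α e h) m
      sides e h q m = ≡.trans (⊛≡⋆ (toℚPoly g) (coeff q) m) (SQ.⋆-cong {g = coeff q} toℚPoly≡ (λ _ → ≡.refl) m) ,
        ≡.cong₂ ℚ._+_ (pow≡ α e m) (lowerTerms≡ N g c e h m)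

    algInt⇒relation : IsAlgInt N g c → Relation
    algInt⇒relation (e , h , q , (d , bq) , eq) = e , h , by qp (PQ.trans (same λ m →
        ≡.trans (≡.sym (proj₂ (sides e h qp m))) (≡.trans (≡.sym (eq m)) (proj₁ (sides e h qp m)))) (PQ.sym (PQ.+-identityˡ (Fℚ PQ.* qp))))
      where
      qp : PQ.Carrier
      qp = poly q d bq

    relation⇒algInt : Relation → IsAlgInt N g c
    relation⇒algInt (e , h , by q eq) = e , h , coeff q , (degree q , PolyQ.bounded q) , λ m →
      ≡.trans (proj₁ (sides e h q m)) (≡.trans (≡.sym (≡.trans (at eq m) (at (PQ.+-identityˡ (Fℚ PQ.* q)) m))) (≡.sym (proj₂ (sides e h q m))))

    lowPoly≈low : ∀ e h → Descent.low Aℚ Aℚ.1# α e h Aℚ.≈ lowPoly α e h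
    lowPoly≈low zero h = Aℚ.refl
    lowPoly≈low (suc e) h = Aℚ.+-cong (Aℚ.trans (Aℚ.*-congˡ {Aℚ.ι (h Fin.zero)} (Aℚ.1^ (suc e))) (Aℚ.*-identityʳ (Aℚ.ι (h Fin.zero))))
      (Aℚ.*-congˡ {α} (lowPoly≈low e (λ i → h (Fin.suc i))))

    -- The equation of `α`, multiplied by `d ^ e`, becomes one for `γ = d α` in `A`, where `closed`
    -- yields `d ∣ γ`. As `γ` is reduced, `d` divides its coefficients, which are `d` times the
    -- coordinates `c i`.
    algInt⇒integer : (∀ d → 1 ℕ.≤ d → ∀ γ e h → γ A.^ e A.+ Descent.low A (A.ι (+ d)) γ e h A.≈ A.0# → A.ι (+ d) A.∣ γ) →
      IsAlgInt N g c → ∀ i → IsIntegerQ (c i)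
    algInt⇒integer closed alg i =
      let e , h , rel = algInt⇒relation alg
          d , 1≤d , γ , γ≈ = common-denominator α
      in coordinate d 1≤d γ γ≈ (closed d 1≤d γ e h (ψ-injective (γ A.^ e A.+ Descent.low A (A.ι (+ d)) γ e h) (scaled e h rel d γ γ≈)))
      where
      open Hom ψ
      module Dq = Descent Aℚ using (low; low-cong; low-scale)
      scaled : ∀ e h → α Aℚ.^ e Aℚ.+ lowPoly α e h Aℚ.≈ Aℚ.0# → ∀ d γ → ⟦ γ ⟧ PQ.≈ PQ.ι (+ d) PQ.* α →
        ⟦ γ A.^ e A.+ Descent.low A (A.ι (+ d)) γ e h ⟧ Aℚ.≈ Aℚ.0#
      scaled e h rel d γ γ≈ = begin
        ⟦ γ A.^ e A.+ Descent.low A (A.ι (+ d)) γ e h ⟧ ≈⟨ +-hom (γ A.^ e) (Descent.low A (A.ι (+ d)) γ e h) ⟩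
        ⟦ γ A.^ e ⟧ Aℚ.+ ⟦ Descent.low A (A.ι (+ d)) γ e h ⟧ ≈⟨ Aℚ.+-cong (^-hom γ e) (hom-low ψ (A.ι (+ d)) γ e h) ⟩
        ⟦ γ ⟧ Aℚ.^ e Aℚ.+ Dq.low ⟦ A.ι (+ d) ⟧ ⟦ γ ⟧ e h
          ≈⟨ Aℚ.+-cong (Aℚ.^-congˡ e (QQ.≈⇒≈/ γ≈)) (Dq.low-cong e h (Aℚ.trans (ι-hom (+ d)) (Aℚ.sym (Aℚ.*-identityʳ δ))) (QQ.≈⇒≈/ γ≈)) ⟩
        (δ Aℚ.* α) Aℚ.^ e Aℚ.+ Dq.low (δ Aℚ.* Aℚ.1#) (δ Aℚ.* α) e h ≈⟨ Aℚ.+-cong (Aℚ.^-distrib-* δ α e) (Dq.low-scale δ Aℚ.1# α e h) ⟩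
        δ Aℚ.^ e Aℚ.* α Aℚ.^ e Aℚ.+ δ Aℚ.^ e Aℚ.* Dq.low Aℚ.1# α e h ≈⟨ Aℚ.distribˡ (δ Aℚ.^ e) (α Aℚ.^ e) (Dq.low Aℚ.1# α e h) ⟨
        δ Aℚ.^ e Aℚ.* (α Aℚ.^ e Aℚ.+ Dq.low Aℚ.1# α e h) ≈⟨ Aℚ.*-congˡ {δ Aℚ.^ e} (Aℚ.trans (Aℚ.+-congˡ {α Aℚ.^ e} (lowPoly≈low e h)) rel) ⟩
        δ Aℚ.^ e Aℚ.* Aℚ.0# ≈⟨ Aℚ.zeroʳ (δ Aℚ.^ e) ⟩
        Aℚ.0# ∎
        where
        open Aℚ.≈R
        δ = Aℚ.ι (+ d)
      coordinate : ∀ d → 1 ℕ.≤ d → ∀ γ → ⟦ γ ⟧ PQ.≈ PQ.ι (+ d) PQ.* α → A.ι (+ d) A.∣ γ → IsIntegerQ (c i)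
      coordinate d 1≤d γ γ≈ d∣γ = k , ℤ→ℚ-cancel d 1≤d (begin
          ℤ→ℚ (+ d) ℚ.* ℤ→ℚ k ≡⟨ Hom.*-hom ℤ→ℚ-hom (+ d) k ⟨
          ℤ→ℚ (+ d ℤ.* k) ≡⟨ ≡.cong ℤ→ℚ (≡.trans (ℤˢ._∣_.equality div) (ℤₚ.*-comm k (+ d))) ⟨
          ℤ→ℚ (coeff γ (toℕ i)) ≡⟨ γ-coeff (toℕ i) ⟩
          ℤ→ℚ (+ d) ℚ.* elem N c (toℕ i) ≡⟨ ≡.cong (ℤ→ℚ (+ d) ℚ.*_) (elem-small N c i) ⟩
          ℤ→ℚ (+ d) ℚ.* c i ∎)
        where
        open ≡.≡-Reasoning
        γ-coeff : ∀ n → ℤ→ℚ (coeff γ n) ≡ ℤ→ℚ (+ d) ℚ.* elem N c n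
        γ-coeff n = ≡.trans (at γ≈ n) (ι-coeffℚ (+ d) α n)
        red : Reduced γ
        red n N≤n = ℤ→ℚ-injective (≡.trans (γ-coeff n) (≡.trans (≡.cong (ℤ→ℚ (+ d) ℚ.*_) (elem-large N c n N≤n)) (ℚₚ.*-zeroʳ (ℤ→ℚ (+ d)))))
        div = reduced-divisible d 1≤d γ red d∣γ (toℕ i)
        k = ℤˢ.quotient div

    private
      consFin : ∀ {e} → ℤ → (Fin e → ℤ) → Fin (suc e) → ℤ
      consFin z h Fin.zero = z
      consFin z h (Fin.suc i) = h i

      low⇒lowPoly : ∀ e {z} → Integrality.Low Aℚ α e z → Σ (Fin e → ℤ) λ h → z Aℚ.≈ lowPoly α e h
      low⇒lowPoly zero z≈0 = (λ ()) , z≈0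
      low⇒lowPoly (suc e) (k , z' , l , z≈) =
        let h , z'≈ = low⇒lowPoly e l
        in consFin k h , Aℚ.trans z≈ (Aℚ.+-congˡ {Aℚ.ι k} (Aℚ.*-congˡ {α} z'≈))

    integral⇒algInt : (Σ ℕ λ e → Σ PQ.Carrier λ l → Integrality.Low Aℚ α e l × α Aℚ.^ e Aℚ.≈ l) → IsAlgInt N g c
    integral⇒algInt (e , l , ll , α^e≈) =
      let h , -l≈ = low⇒lowPoly e (Integrality.low-neg Aℚ α e ll)
      in relation⇒algInt (e , h , Aℚ.trans (Aℚ.+-cong α^e≈ (Aℚ.sym { Aℚ.- l} { lowPoly α e h} -l≈)) (Aℚ.-‿inverseʳ l))

    integer⇒algInt : (∀ i → IsIntegerQ (c i)) → IsAlgInt N g c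
    -- With `β = 0` the module is the image of `A`, which contains `α` as the image of `zp`.
    integer⇒algInt int = integral⇒algInt (TwoGenerators.integral-relation a b M 1≤M A θ root horner Aℚ ψ α Aℚ.0# A.0# A.0# A.0# zp
        (Aℚ.trans (Aℚ.zeroʳ α) (Aℚ.sym (absorb A.0# 0-hom)))
        (Aℚ.sym (absorb zp α≈)))
      where
      open Hom ψ
      z : ℕ → ℤ
      z n with n ℕ.<? N
      ... | yes n<N = proj₁ (int (fromℕ< n<N))
      ... | no _ = + 0
      z-large : ∀ n → N ℕ.< n → z n ≡ + 0
      z-large n N<n with n ℕ.<? N
      ... | yes n<N = ⊥-elim (ℕₚ.<-asym n<N N<n)
      ... | no _ = ≡.refl
      z≡ : ∀ n → ℤ→ℚ (z n) ≡ elem N c n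
      z≡ n with n ℕ.<? N
      ... | yes n<N = proj₂ (int (fromℕ< n<N))
      ... | no _ = ≡.refl
      zp : A.Carrier
      zp = poly z N z-large
      α≈ : ⟦ zp ⟧ Aℚ.≈ α
      α≈ = QQ.≈⇒≈/ (same z≡)
      absorb : ∀ y {w} → ⟦ y ⟧ Aℚ.≈ w → Aℚ.0# Aℚ.* ⟦ A.0# ⟧ Aℚ.+ ⟦ y ⟧ Aℚ.≈ w
      absorb y e = Aℚ.trans (Aℚ.+-congʳ {⟦ y ⟧} (Aℚ.zeroˡ ⟦ A.0# ⟧)) (Aℚ.trans (Aℚ.+-identityˡ ⟦ y ⟧) e)

    -- Dividing the equation by `p²` gives `α² = κ α + λ'` for `α = γ / p`, so the span of `α` and 1
    -- is preserved by multiplication by `α`.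
    quotient-algInt : ∀ p → 1 ℕ.≤ p → ∀ γ κ λ' → Hom.⟦ ψ ⟧ γ Aℚ.≈ Aℚ.ι (+ p) Aℚ.* α →
      γ A.* γ A.≈ A.ι (+ p) A.* (κ A.* γ) A.+ A.ι (+ p) A.* (A.ι (+ p) A.* λ') → IsAlgInt N g c
    quotient-algInt p 1≤p γ κ λ' γ≈ γ²≈ = integral⇒algInt (TwoGenerators.integral-relation a b M 1≤M A θ root horner Aℚ ψ α α κ λ' A.1# A.0# α²≈
        (Aℚ.sym (Aℚ.trans (Aℚ.+-cong (Aℚ.*-congˡ {α} 1-hom) 0-hom) (Aℚ.trans (Aℚ.+-identityʳ (α Aℚ.* Aℚ.1#)) (Aℚ.*-identityʳ α)))))
      where
      open Hom ψ
      p̂ = Aℚ.ι (+ p)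
      K = ⟦ κ ⟧
      L = ⟦ λ' ⟧
      open Aℚ.≈R
      α²≈ : α Aℚ.* α Aℚ.≈ α Aℚ.* K Aℚ.+ L
      α²≈ = Aℚ-cancel p 1≤p (α Aℚ.* α) (α Aℚ.* K Aℚ.+ L) (Aℚ-cancel p 1≤p (p̂ Aℚ.* (α Aℚ.* α)) (p̂ Aℚ.* (α Aℚ.* K Aℚ.+ L)) (begin
        p̂ Aℚ.* (p̂ Aℚ.* (α Aℚ.* α)) ≈⟨ Aℚ.solve 2 (λ p a → p Aℚ.:* (p Aℚ.:* (a Aℚ.:* a)) Aℚ.:= (p Aℚ.:* a) Aℚ.:* (p Aℚ.:* a)) Aℚ.refl p̂ α ⟩
        (p̂ Aℚ.* α) Aℚ.* (p̂ Aℚ.* α) ≈⟨ Aℚ.*-cong γ≈ γ≈ ⟨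
        ⟦ γ ⟧ Aℚ.* ⟦ γ ⟧ ≈⟨ *-hom γ γ ⟨
        ⟦ γ A.* γ ⟧ ≈⟨ cong γ²≈ ⟩
        ⟦ A.ι (+ p) A.* (κ A.* γ) A.+ A.ι (+ p) A.* (A.ι (+ p) A.* λ') ⟧ ≈⟨ +-hom (A.ι (+ p) A.* (κ A.* γ)) (A.ι (+ p) A.* (A.ι (+ p) A.* λ')) ⟩
        ⟦ A.ι (+ p) A.* (κ A.* γ) ⟧ Aℚ.+ ⟦ A.ι (+ p) A.* (A.ι (+ p) A.* λ') ⟧
          ≈⟨ Aℚ.+-cong (Aℚ.trans (*-hom (A.ι (+ p)) (κ A.* γ)) (Aℚ.*-cong (ι-hom (+ p)) (Aℚ.trans (*-hom κ γ) (Aℚ.*-congˡ {K} γ≈))))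
              (Aℚ.trans (*-hom (A.ι (+ p)) (A.ι (+ p) A.* λ')) (Aℚ.*-cong (ι-hom (+ p)) (Aℚ.trans (*-hom (A.ι (+ p)) λ') (Aℚ.*-congʳ {L} (ι-hom (+ p)))))) ⟩
        p̂ Aℚ.* (K Aℚ.* (p̂ Aℚ.* α)) Aℚ.+ p̂ Aℚ.* (p̂ Aℚ.* L)
          ≈⟨ Aℚ.solve 4 (λ p k a l → p Aℚ.:* (k Aℚ.:* (p Aℚ.:* a)) Aℚ.:+ p Aℚ.:* (p Aℚ.:* l) Aℚ.:= p Aℚ.:* (p Aℚ.:* (a Aℚ.:* k Aℚ.:+ l))) Aℚ.refl p̂ K α L ⟩
        p̂ Aℚ.* (p̂ Aℚ.* (α Aℚ.* K Aℚ.+ L)) ∎))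

  -- Irreducibility

  Δ : ℤ
  Δ = a ℤ.* a ℤ.+ + 4 ℤ.* b

  E : P.Carrier → P.Carrier
  E (poly f d bf) = poly (SZ.euler f) d λ m l → ≡.trans (≡.cong (Kit.ι ℤ-ring (+ m) ℤ.*_) (bf m l)) (ℤₚ.*-zeroʳ (Kit.ι ℤ-ring (+ m)))

  E-cong : ∀ {f g} → f P.≈ g → E f P.≈ E g
  E-cong e = same λ n → ≡.cong (Kit.ι ℤ-ring (+ n) ℤ.*_) (at e n)

  E-* : ∀ f g → E (f P.* g) P.≈ E f P.* g P.+ f P.* E g
  E-* f g = same (SZ.euler-⋆ (coeff f) (coeff g))

  E-ι* : ∀ c f → E (P.ι c P.* f) P.≈ P.ι c P.* E f
  E-ι* c f = same λ n → ≡.trans (≡.cong (Kit.ι ℤ-ring (+ n) ℤ.*_) (ι-coeffℤ c f n)) (≡.trans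
    (solve 3 (λ k c t → k :* (c :* t) := c :* (k :* t)) ≡.refl (Kit.ι ℤ-ring (+ n)) c (coeff f n)) (≡.sym (ι-coeffℤ c (E f) n)))
    where open Data.Integer.Solver.+-*-Solver

  E-x^ : ∀ k → E (x̂ P.^ k) P.≈ P.ι (+ k) P.* x̂ P.^ k
  E-x^ k = same λ n → ≡.trans (≡.cong (ℤ._* coeff (x̂ P.^ k) n) (ι-ℤ (+ n))) (≡.trans (go n (k ℕ.≟ n)) (≡.sym (ι-coeffℤ (+ k) (x̂ P.^ k) n)))
    where
    go : ∀ n → Dec (k ≡ n) → + n ℤ.* coeff (x̂ P.^ k) n ≡ + k ℤ.* coeff (x̂ P.^ k) n
    go n (yes ≡.refl) = ≡.refl
    go n (no k≢n) = ≡.trans (≡.cong (+ n ℤ.*_) (x^-other k n k≢n)) (≡.trans (ℤₚ.*-zeroʳ (+ n)) (≡.sym (≡.trans (≡.cong (+ k ℤ.*_) (x^-other k n k≢n)) (ℤₚ.*-zeroʳ (+ k)))))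

  E-F : E F P.≈ P.ι (+ M) P.* (P.ι (+ 2) P.* (x̂ P.^ M P.* x̂ P.^ M) P.- P.ι a P.* x̂ P.^ M)
  E-F = P.trans (same λ n → E-minus n) (P.trans (P.+-cong (P.+-cong (E-x^ N) (P.-‿cong (P.trans (E-ι* a (x̂ P.^ M)) (P.*-congˡ {P.ι a} (E-x^ M))))) (P.-‿cong E-b))
      (P.trans (P.+-congʳ { P.- P.0#} (P.+-congʳ { P.- (P.ι a P.* (P.ι (+ M) P.* x̂ P.^ M))} (P.*-cong (P.ι-+ (+ M) (+ M)) (P.^-homo-* x̂ M M))))
      (P.solve 3 (λ m a y → (m P.:+ m) P.:* (y P.:* y) P.:- a P.:* (m P.:* y) P.:- P.con (+ 0) P.:= m P.:* (P.con (+ 2) P.:* (y P.:* y) P.:- a P.:* y)) P.refl (P.ι (+ M)) (P.ι a) (x̂ P.^ M))))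
    where
    open Data.Integer.Solver.+-*-Solver
    E-minus : ∀ n → coeff (E F) n ≡ coeff (E (x̂ P.^ N) P.- E (P.ι a P.* x̂ P.^ M) P.- E (P.ι b)) n
    E-minus n = solve 4 (λ k u v w → k :* (u :+ (:- v) :+ (:- w)) := k :* u :+ (:- (k :* v)) :+ (:- (k :* w))) ≡.refl
      (Kit.ι ℤ-ring (+ n)) (coeff (x̂ P.^ N) n) (coeff (P.ι a P.* x̂ P.^ M) n) (coeff (P.ι b) n)
    E-b : E (P.ι b) P.≈ P.0#
    E-b = same λ { zero → ≡.refl ; (suc n) → ≡.trans (≡.cong (Kit.ι ℤ-ring (+ suc n) ℤ.*_) (at (ι≈const b) (suc n))) (ℤₚ.*-zeroʳ (Kit.ι ℤ-ring (+ suc n))) }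

  -- Cofactors of a Bézout identity for `E F` and `F` with constant `M b Δ`, obtained from
  -- `(b + F) (Δ + 4F) = b Δ + F (Δ + 4b + 4F)` and `Δ + 4b = a² + 8b`.
  tB rB : P.Carrier
  tB = (x̂ P.^ M P.- P.ι a) P.* (P.ι (+ 2) P.* x̂ P.^ M P.- P.ι a)
  rB = P.ι (+ M) P.* (P.ι a P.* P.ι a P.+ P.ι (+ 8) P.* P.ι b P.+ P.ι (+ 4) P.* F)

  -- With y = x ^ M: y f'(y) (y - a) f'(y) = (b + F) (Δ + 4 F).
  bezout : P.ι (+ M ℤ.* (b ℤ.* Δ)) P.≈ E F P.* tB P.- F P.* rB
  bezout = P.trans ι-expand (P.trans (P.solve 5
      (λ m a b y f → m P.:* (b P.:* (a P.:* a P.:+ P.con (+ 4) P.:* b))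
        P.:= (m P.:* (P.con (+ 2) P.:* (y P.:* y) P.:- a P.:* y)) P.:* ((y P.:- a) P.:* (P.con (+ 2) P.:* y P.:- a))
          P.:- (y P.:* y P.:- a P.:* y P.:- b) P.:* (m P.:* (a P.:* a P.:+ P.con (+ 8) P.:* b P.:+ P.con (+ 4) P.:* (y P.:* y P.:- a P.:* y P.:- b))))
      P.refl (P.ι (+ M)) (P.ι a) (P.ι b) Y F)
    (P.+-cong (P.*-congʳ {tB} (P.sym E-F)) (P.-‿cong (P.*-cong F≈ (P.*-congˡ {P.ι (+ M)} (P.+-congˡ {P.ι a P.* P.ι a P.+ P.ι (+ 8) P.* P.ι b} (P.*-congˡ {P.ι (+ 4)} F≈)))))))
    where
    Y = x̂ P.^ M
    F≈ : Y P.* Y P.- P.ι a P.* Y P.- P.ι b P.≈ F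
    F≈ = P.+-congʳ { P.- P.ι b} (P.+-congʳ { P.- (P.ι a P.* Y)} (P.sym (P.^-homo-* x̂ M M)))
    ι-expand : P.ι (+ M ℤ.* (b ℤ.* Δ)) P.≈ P.ι (+ M) P.* (P.ι b P.* (P.ι a P.* P.ι a P.+ P.ι (+ 4) P.* P.ι b))
    ι-expand = P.trans (P.ι-* (+ M) (b ℤ.* Δ)) (P.*-congˡ {P.ι (+ M)} (P.trans (P.ι-* b Δ) (P.*-congˡ {P.ι b}
      (P.trans (P.ι-+ (a ℤ.* a) (+ 4 ℤ.* b)) (P.+-cong (P.ι-* a a) (P.ι-* (+ 4) b))))))

  module _ (C : ℕ) (1≤C : 1 ℕ.≤ C) (C≡ : + C ≡ + M ℤ.* (b ℤ.* Δ))
    (noUnit : ∀ d → d ℤ.* d ℤ.* (a ℤ.* a ℤ.+ + 4 ℤ.* b) ≢ + 1)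
    (closed : ∀ d → 1 ℕ.≤ d → ∀ γ e h → γ A.^ e A.+ Descent.low A (A.ι (+ d)) γ e h A.≈ A.0# → A.ι (+ d) A.∣ γ) where

    constant-factor : ∀ H Z c → c ≢ + 0 → H P.* Z P.≈ P.ι c → ∀ m → 1 ℕ.≤ m → coeff H m ≡ + 0
    constant-factor H Z c c≢0 e = factor-of-constant (degree H) (degree Z) (coeff H) (coeff Z) (bounded H) (bounded Z)
      (λ { (suc m) _ → ≡.trans (at e (suc m)) (at (ι≈const c) (suc m)) })
      (λ z → c≢0 (≡.trans (≡.sym (≡.trans (at e 0) (≡.trans (at (ι≈const c) 0) (ι-ℤ c)))) z))

    -- By the Leibniz rule the Bézout identity splits into `X + Y ≡ δ` modulo `F`, while `X Y`
    -- contains the factor `H K = D F`. So `X / δ` is an idempotent of ℚ[x] / (F), the projection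
    -- belonging to the factorisation. It is integral, hence lies in `A`, and is therefore 0 or 1.
    module Factorisation (D : ℕ) (1≤D : 1 ℕ.≤ D) (H K : P.Carrier) (HK≈ : H P.* K P.≈ P.ι (+ D) P.* F) where
      D̂ Ĉ X Y δ : P.Carrier
      D̂ = P.ι (+ D)
      Ĉ = P.ι (+ C)
      X = tB P.* (E H P.* K)
      Y = tB P.* (H P.* E K)
      δ = P.ι (+ (D ℕ.* C))

      1≤DC : 1 ℕ.≤ D ℕ.* C
      1≤DC = ℕₚ.*-mono-≤ 1≤D 1≤C

      δ≈ : δ P.≈ D̂ P.* Ĉ
      δ≈ = P.trans (P.reflexive (≡.cong P.ι (ℤₚ.pos-* D C))) (P.ι-* (+ D) (+ C))

      X+Y : X P.+ Y P.≈ δ P.+ F P.* (D̂ P.* rB)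
      X+Y = begin
        X P.+ Y ≈⟨ P.distribˡ tB (E H P.* K) (H P.* E K) ⟨
        tB P.* (E H P.* K P.+ H P.* E K) ≈⟨ P.*-congˡ {tB} (P.trans (P.sym (E-* H K)) (P.trans (E-cong HK≈) (E-ι* (+ D) F))) ⟩
        tB P.* (D̂ P.* E F) ≈⟨ P.solve 4 (λ t d e f → t P.:* (d P.:* e) P.:= d P.:* (e P.:* t P.:- f) P.:+ d P.:* f) P.refl tB D̂ (E F) (F P.* rB) ⟩
        D̂ P.* (E F P.* tB P.- F P.* rB) P.+ D̂ P.* (F P.* rB)
          ≈⟨ P.+-cong (P.trans (P.*-congˡ {D̂} (P.trans (P.sym bezout) (P.reflexive (≡.cong P.ι (≡.sym C≡))))) (P.sym δ≈))
               (P.solve 3 (λ d f r → d P.:* (f P.:* r) P.:= f P.:* (d P.:* r)) P.refl D̂ F rB) ⟩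
        δ P.+ F P.* (D̂ P.* rB) ∎
        where open P.≈R

      X+Y≈δ : X A.+ Y A.≈ δ
      X+Y≈δ = by (D̂ P.* rB) X+Y

      XY≈0 : X A.* Y A.≈ A.0#
      XY≈0 = by (D̂ P.* (tB P.* tB P.* (E H P.* E K))) (begin
        X P.* Y ≈⟨ P.solve 5 (λ t u v h k → (t P.:* (u P.:* k)) P.:* (t P.:* (h P.:* v)) P.:= (h P.:* k) P.:* (t P.:* t P.:* (u P.:* v))) P.refl tB (E H) (E K) H K ⟩
        (H P.* K) P.* (tB P.* tB P.* (E H P.* E K)) ≈⟨ P.*-congʳ {tB P.* tB P.* (E H P.* E K)} HK≈ ⟩
        (D̂ P.* F) P.* (tB P.* tB P.* (E H P.* E K)) ≈⟨ P.solve 3 (λ d f z → (d P.:* f) P.:* z P.:= P.con (+ 0) P.:+ f P.:* (d P.:* z)) P.refl D̂ F (tB P.* tB P.* (E H P.* E K)) ⟩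
        P.0# P.+ F P.* (D̂ P.* (tB P.* tB P.* (E H P.* E K))) ∎)
        where open P.≈R

      X²≈ : X A.* X A.≈ δ A.* X
      X²≈ = begin
        X A.* X ≈⟨ A.solve 2 (λ x y → x A.:* x A.:= (x A.:+ y) A.:* x A.:- x A.:* y) A.refl X Y ⟩
        (X A.+ Y) A.* X A.- X A.* Y ≈⟨ A.+-cong (A.*-congʳ {X} X+Y≈δ) (A.-‿cong XY≈0) ⟩
        δ A.* X A.- A.0# ≈⟨ A.solve 1 (λ t → t A.:- A.con (+ 0) A.:= t) A.refl (δ A.* X) ⟩
        δ A.* X ∎
        where open A.≈R

      -- The lower coefficients 0 and -1 of the equation `T² - T = 0` of `X / δ`.
      coefficients : Fin 2 → ℤ
      coefficients Fin.zero = + 0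
      coefficients (Fin.suc _) = -[1+ 0 ]

      δ∣X : A.ι (+ (D ℕ.* C)) A.∣ X
      δ∣X = closed (D ℕ.* C) 1≤DC X 2 coefficients (A.trans
        (A.solve 2 (λ x d → x A.:* (x A.:* A.con (+ 1)) A.:+ (A.con (+ 0) A.:* (d A.:* (d A.:* A.con (+ 1))) A.:+ x A.:* (A.con -[1+ 0 ] A.:* (d A.:* A.con (+ 1)) A.:+ x A.:* A.con (+ 0)))
            A.:= x A.:* x A.:- d A.:* x) A.refl X δ) (A.x≈y⇒x-y≈0 {X A.* X} {δ A.* X} X²≈))

      ε : A.Carrier
      ε = proj₁ δ∣X

      X≈δε : X A.≈ δ A.* ε
      X≈δε = proj₂ δ∣X

      ε²≈ε : ε A.* ε A.≈ ε
      ε²≈ε = A-cancel (D ℕ.* C) 1≤DC {ε A.* ε} {ε} (A-cancel (D ℕ.* C) 1≤DC {δ A.* (ε A.* ε)} {δ A.* ε} (begin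
        δ A.* (δ A.* (ε A.* ε)) ≈⟨ A.solve 2 (λ d e → d A.:* (d A.:* (e A.:* e)) A.:= (d A.:* e) A.:* (d A.:* e)) A.refl δ ε ⟩
        (δ A.* ε) A.* (δ A.* ε) ≈⟨ A.*-cong X≈δε X≈δε ⟨
        X A.* X ≈⟨ X²≈ ⟩
        δ A.* X ≈⟨ A.*-congˡ {δ} X≈δε ⟩
        δ A.* (δ A.* ε) ∎))
        where open A.≈R

      D²C≢0 : + D ℤ.* + (D ℕ.* C) ≢ + 0
      D²C≢0 e with ℤₚ.i*j≡0⇒i≡0∨j≡0 (+ D) e
      ... | inj₁ D≡0 = ℕₚ.<⇒≢ 1≤D (≡.sym (ℤₚ.+-injective D≡0))
      ... | inj₂ DC≡0 = ℕₚ.<⇒≢ 1≤DC (≡.sym (ℤₚ.+-injective DC≡0))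

      D̂δ≈ : ∀ V q → V P.≈ δ P.+ F P.* q → D̂ P.* V P.- (H P.* K) P.* q P.≈ P.ι (+ D ℤ.* + (D ℕ.* C))
      D̂δ≈ V q e = begin
        D̂ P.* V P.- (H P.* K) P.* q ≈⟨ P.+-cong (P.*-congˡ {D̂} e) (P.-‿cong (P.*-congʳ {q} HK≈)) ⟩
        D̂ P.* (δ P.+ F P.* q) P.- (D̂ P.* F) P.* q ≈⟨ P.solve 4 (λ d e f q → d P.:* (e P.:+ f P.:* q) P.:- (d P.:* f) P.:* q P.:= d P.:* e) P.refl D̂ δ F q ⟩
        D̂ P.* δ ≈⟨ P.ι-* (+ D) (+ (D ℕ.* C)) ⟨
        P.ι (+ D ℤ.* + (D ℕ.* C)) ∎
        where open P.≈R

      -- Both `Y` and `H K` are multiples of `H`, so `H` divides the nonzero integer `D δ`.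
      H-constant : Y A.≈ δ → ∀ m → 1 ℕ.≤ m → coeff H m ≡ + 0
      H-constant (by q e) = constant-factor H (D̂ P.* (tB P.* E K) P.- K P.* q) (+ D ℤ.* + (D ℕ.* C)) D²C≢0 (P.trans
        (P.solve 6 (λ h d t e k q → h P.:* (d P.:* (t P.:* e) P.:- k P.:* q) P.:= d P.:* (t P.:* (h P.:* e)) P.:- (h P.:* k) P.:* q) P.refl H D̂ tB (E K) K q) (D̂δ≈ Y q e))

      K-constant : X A.≈ δ → ∀ m → 1 ℕ.≤ m → coeff K m ≡ + 0
      K-constant (by q e) = constant-factor K (D̂ P.* (tB P.* E H) P.- H P.* q) (+ D ℤ.* + (D ℕ.* C)) D²C≢0 (P.trans
        (P.solve 6 (λ h d t e k q → k P.:* (d P.:* (t P.:* e) P.:- h P.:* q) P.:= d P.:* (t P.:* (e P.:* k)) P.:- (h P.:* k) P.:* q) P.refl H D̂ tB (E H) K q) (D̂δ≈ X q e))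

      one-constant : (∀ m → 1 ℕ.≤ m → coeff H m ≡ + 0) ⊎ (∀ m → 1 ℕ.≤ m → coeff K m ≡ + 0)
      one-constant = split (idempotent-0-1 noUnit ε ε²≈ε)
        where
        open A.≈R
        split : ε A.≈ A.0# ⊎ ε A.≈ A.1# → (∀ m → 1 ℕ.≤ m → coeff H m ≡ + 0) ⊎ (∀ m → 1 ℕ.≤ m → coeff K m ≡ + 0)
        split (inj₁ ε≈0) = inj₁ (H-constant (begin
          Y ≈⟨ A.solve 2 (λ x y → y A.:= (x A.:+ y) A.:- x) A.refl X Y ⟩
          (X A.+ Y) A.- X ≈⟨ A.+-cong X+Y≈δ (A.-‿cong (A.trans X≈δε (A.trans (A.*-congˡ {δ} ε≈0) (A.zeroʳ δ)))) ⟩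
          δ A.- A.0# ≈⟨ A.solve 1 (λ t → t A.:- A.con (+ 0) A.:= t) A.refl δ ⟩
          δ ∎))
        split (inj₂ ε≈1) = inj₂ (K-constant (A.trans X≈δε (A.trans (A.*-congˡ {δ} ε≈1) (A.*-identityʳ δ))))

    irreducible : IrreducibleQ N g
    irreducible = 0<N , λ { h k (d , bh) (e , bk) eq → factors (poly h d bh) (poly k e bk) eq }
      where
      open Hom φ
      zero-coeff : ∀ d → 1 ℕ.≤ d → ∀ f G → ⟦ G ⟧ PQ.≈ PQ.ι (+ d) PQ.* f → (∀ m → 1 ℕ.≤ m → coeff G m ≡ + 0) → IsConstant (coeff f)
      zero-coeff d 1≤d f G G≈ G-const m 1≤m = ℤ→ℚ-cancel d 1≤d (≡.trans (≡.sym (ι-coeffℚ (+ d) f m)) (≡.trans (≡.sym (at G≈ m))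
        (≡.trans (≡.cong ℤ→ℚ (G-const m 1≤m)) (≡.sym (ℚₚ.*-zeroʳ (ℤ→ℚ (+ d)))))))
      factors : ∀ h k → (∀ m → (coeff h ⊛ coeff k) m ≡ toℚPoly g m) → IsConstant (coeff h) ⊎ IsConstant (coeff k)
      factors h k eq =
        let d , 1≤d , H , H≈ = common-denominator h
            e , 1≤e , K , K≈ = common-denominator k
        in conclude d e 1≤d 1≤e H K H≈ K≈ (Factorisation.one-constant (d ℕ.* e) (ℕₚ.*-mono-≤ 1≤d 1≤e) H K (φ-injective (begin
            ⟦ H P.* K ⟧ ≈⟨ *-hom H K ⟩
            ⟦ H ⟧ PQ.* ⟦ K ⟧ ≈⟨ PQ.*-cong H≈ K≈ ⟩
            (PQ.ι (+ d) PQ.* h) PQ.* (PQ.ι (+ e) PQ.* k) ≈⟨ PQ.solve 4 (λ d h e k → (d PQ.:* h) PQ.:* (e PQ.:* k) PQ.:= (d PQ.:* e) PQ.:* (h PQ.:* k)) PQ.refl (PQ.ι (+ d)) h (PQ.ι (+ e)) k ⟩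
            (PQ.ι (+ d) PQ.* PQ.ι (+ e)) PQ.* (h PQ.* k)
              ≈⟨ PQ.*-cong (PQ.trans (PQ.sym (PQ.ι-* (+ d) (+ e))) (PQ.reflexive (≡.cong PQ.ι (≡.sym (ℤₚ.pos-* d e))))) hk≈ ⟩
            PQ.ι (+ (d ℕ.* e)) PQ.* ⟦ F ⟧ ≈⟨ PQ.*-congʳ {⟦ F ⟧} (ι-hom (+ (d ℕ.* e))) ⟨
            ⟦ P.ι (+ (d ℕ.* e)) ⟧ PQ.* ⟦ F ⟧ ≈⟨ *-hom (P.ι (+ (d ℕ.* e))) F ⟨
            ⟦ P.ι (+ (d ℕ.* e)) P.* F ⟧ ∎)))
        where
        open PQ.≈R
        hk≈ : h PQ.* k PQ.≈ ⟦ F ⟧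
        hk≈ = same λ n → ≡.trans (≡.sym (⊛≡⋆ (coeff h) (coeff k) n)) (≡.trans (eq n) (≡.cong ℤ→ℚ (≡.sym (F≡g n))))
        conclude : ∀ d e → 1 ℕ.≤ d → 1 ℕ.≤ e → ∀ H K → ⟦ H ⟧ PQ.≈ PQ.ι (+ d) PQ.* h → ⟦ K ⟧ PQ.≈ PQ.ι (+ e) PQ.* k →
          (∀ m → 1 ℕ.≤ m → coeff H m ≡ + 0) ⊎ (∀ m → 1 ℕ.≤ m → coeff K m ≡ + 0) → IsConstant (coeff h) ⊎ IsConstant (coeff k)
        conclude d e 1≤d 1≤e H K H≈ K≈ (inj₁ c) = inj₁ (zero-coeff d 1≤d h H H≈ c)
        conclude d e 1≤d 1≤e H K H≈ K≈ (inj₂ c) = inj₂ (zero-coeff e 1≤e k K K≈ c)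

  -- A non-integral element of the ring of integers at a Wall-Sun-Sun prime

  module Obstruction {p : ℕ} (pp : Prime p) (m : ℕ) (1≤m : 1 ℕ.≤ m) (M≡ : M ≡ m ℕ.* p) (ℓ : A.Carrier)
    (ω^p²≈ : (θ A.^ M) A.^ (p ℕ.^ 2) A.≈ θ A.^ M A.+ A.ι (+ p) A.* (A.ι (+ p) A.* ℓ)) where
    open Frobenius A pp using (frobenius)
    private
      1≤p : 1 ℕ.≤ p
      1≤p = ℕₚ.<⇒≤ (prime>1 pp)
      e n : ℕ
      e = p ℕ.∸ 1
      n = p ℕ.∸ 2
      p≡1+e : suc e ≡ p
      p≡1+e = ℕₚ.m+[n∸m]≡n 1≤p
      e+e≡ : e ℕ.+ e ≡ n ℕ.+ p
      e+e≡ = go p (prime>1 pp)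
        where
        go : ∀ p → 2 ℕ.≤ p → (p ℕ.∸ 1) ℕ.+ (p ℕ.∸ 1) ≡ (p ℕ.∸ 2) ℕ.+ p
        go (suc (suc k)) (s≤s (s≤s z≤n)) = ≡.sym (ℕₚ.+-suc k (suc k))

    1/p : Σ ℚ λ q → ℤ→ℚ (+ p) ℚ.* q ≡ 1ℚ
    1/p = inverse p 1≤p
      where
      inverse : ∀ p → 1 ℕ.≤ p → Σ ℚ λ q → ℤ→ℚ (+ p) ℚ.* q ≡ 1ℚ
      inverse (suc k) _ = reciprocal k

    p̂ ω y τ π κ γ : A.Carrier
    p̂ = A.ι (+ p)
    ω = θ A.^ M
    y = θ A.^ m
    τ = ω A.^ p
    π = y A.- τ
    κ = proj₁ (frobenius π τ)
    γ = π A.^ e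

    y^p≈ω : y A.^ p A.≈ ω
    y^p≈ω = A.trans (A.^-assocʳ θ m p) (A.reflexive (≡.cong (θ A.^_) (≡.sym M≡)))

    π^p≈ : π A.^ p A.≈ A.- (p̂ A.* (p̂ A.* ℓ)) A.- p̂ A.* (π A.* κ)
    π^p≈ = begin
      π A.^ p ≈⟨ A.solve 3 (λ x r t → x A.:= (x A.:+ r A.:+ t) A.:- r A.:- t) A.refl (π A.^ p) (τ A.^ p) (p̂ A.* (π A.* κ)) ⟩
      (π A.^ p A.+ τ A.^ p A.+ p̂ A.* (π A.* κ)) A.- τ A.^ p A.- p̂ A.* (π A.* κ)
        ≈⟨ A.+-congʳ { A.- (p̂ A.* (π A.* κ))} (A.+-cong (A.sym (proj₂ (frobenius π τ))) (A.-‿cong τ^p≈)) ⟩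
      (π A.+ τ) A.^ p A.- (ω A.+ p̂ A.* (p̂ A.* ℓ)) A.- p̂ A.* (π A.* κ)
        ≈⟨ A.+-congʳ { A.- (p̂ A.* (π A.* κ))} (A.+-congʳ { A.- (ω A.+ p̂ A.* (p̂ A.* ℓ))} (A.trans (A.^-congˡ p (A.solve 2 (λ y t → (y A.:- t) A.:+ t A.:= y) A.refl y τ)) y^p≈ω)) ⟩
      ω A.- (ω A.+ p̂ A.* (p̂ A.* ℓ)) A.- p̂ A.* (π A.* κ) ≈⟨ A.solve 3 (λ w l t → w A.:- (w A.:+ l) A.:- t A.:= (A.:- l) A.:- t) A.refl ω (p̂ A.* (p̂ A.* ℓ)) (p̂ A.* (π A.* κ)) ⟩
      A.- (p̂ A.* (p̂ A.* ℓ)) A.- p̂ A.* (π A.* κ) ∎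
      where
      open A.≈R
      τ^p≈ : τ A.^ p A.≈ ω A.+ p̂ A.* (p̂ A.* ℓ)
      τ^p≈ = A.trans (A.^-assocʳ ω p p) (A.trans (A.reflexive (≡.cong (ω A.^_) (≡.cong (p ℕ.*_) (≡.sym (ℕₚ.*-identityʳ p))))) ω^p²≈)

    -- At a Wall-Sun-Sun prime `μ = p ℓ`, so `π ^ p` is `-p κ π` up to a multiple of `p²`.
    -- Multiplied by `π ^ (p - 2)` this gives `γ²` for `γ = π ^ (p - 1)`, with coefficients
    -- divisible by `p` and `p²`, as a monic quadratic equation for `γ / p` requires.
    γ²≈ : γ A.* γ A.≈ p̂ A.* (A.- κ A.* γ) A.+ p̂ A.* (p̂ A.* (A.- (ℓ A.* π A.^ n)))
    γ²≈ = begin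
      γ A.* γ ≈⟨ A.^-homo-* π e e ⟨
      π A.^ (e ℕ.+ e) ≡⟨ ≡.cong (π A.^_) e+e≡ ⟩
      π A.^ (n ℕ.+ p) ≈⟨ A.^-homo-* π n p ⟩
      π A.^ n A.* π A.^ p ≈⟨ A.*-congˡ {π A.^ n} π^p≈ ⟩
      π A.^ n A.* (A.- (p̂ A.* (p̂ A.* ℓ)) A.- p̂ A.* (π A.* κ))
        ≈⟨ A.solve 5 (λ t p l π k → t A.:* ((A.:- (p A.:* (p A.:* l))) A.:- p A.:* (π A.:* k)) A.:= p A.:* ((A.:- k) A.:* (π A.:* t)) A.:+ p A.:* (p A.:* (A.:- (l A.:* t)))) A.refl (π A.^ n) p̂ ℓ π κ ⟩
      p̂ A.* (A.- κ A.* (π A.* π A.^ n)) A.+ p̂ A.* (p̂ A.* (A.- (ℓ A.* π A.^ n)))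
        ≡⟨ ≡.cong (λ k → p̂ A.* (A.- κ A.* π A.^ k) A.+ p̂ A.* (p̂ A.* (A.- (ℓ A.* π A.^ n)))) (go p (prime>1 pp)) ⟩
      p̂ A.* (A.- κ A.* γ) A.+ p̂ A.* (p̂ A.* (A.- (ℓ A.* π A.^ n))) ∎
      where
      open A.≈R
      go : ∀ p → 2 ℕ.≤ p → suc (p ℕ.∸ 2) ≡ p ℕ.∸ 1
      go (suc (suc k)) (s≤s (s≤s z≤n)) = ≡.refl

    private
      r : P.Carrier
      r = proj₁ (reduce γ)
      r-reduced : Reduced r
      r-reduced = proj₁ (proj₂ (reduce γ))
      γ≈r : γ A.≈ r
      γ≈r = proj₂ (proj₂ (reduce γ))

    c : Fin N → ℚ
    c i = proj₁ 1/p ℚ.* ℤ→ℚ (coeff r (toℕ i))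

    p*c≡ : ∀ i → ℤ→ℚ (+ p) ℚ.* c i ≡ ℤ→ℚ (coeff r (toℕ i))
    p*c≡ i = ≡.trans (≡.sym (ℚₚ.*-assoc (ℤ→ℚ (+ p)) (proj₁ 1/p) (ℤ→ℚ (coeff r (toℕ i)))))
      (≡.trans (≡.cong (ℚ._* ℤ→ℚ (coeff r (toℕ i))) (proj₂ 1/p)) (ℚₚ.*-identityˡ (ℤ→ℚ (coeff r (toℕ i)))))

    c-algInt : IsAlgInt N g c
    c-algInt = quotient-algInt c p 1≤p γ (A.- κ) (A.- (ℓ A.* π A.^ n)) (Aℚ.trans (Hom.cong ψ γ≈r) (QQ.≈⇒≈/ (same λ k →
        ≡.trans (scaled k) (≡.sym (ι-coeffℚ (+ p) (elemPoly N c) k))))) γ²≈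
      where
      scaled : ∀ k → ℤ→ℚ (coeff r k) ≡ ℤ→ℚ (+ p) ℚ.* elem N c k
      scaled k = go (k ℕ.<? N)
        where
        go : Dec (k ℕ.< N) → ℤ→ℚ (coeff r k) ≡ ℤ→ℚ (+ p) ℚ.* elem N c k
        go (yes k<N) = ≡.subst (λ j → ℤ→ℚ (coeff r j) ≡ ℤ→ℚ (+ p) ℚ.* elem N c j) (Finₚ.toℕ-fromℕ< k<N)
          (≡.trans (≡.sym (p*c≡ (fromℕ< k<N))) (≡.cong (ℤ→ℚ (+ p) ℚ.*_) (≡.sym (elem-small N c (fromℕ< k<N)))))
        go (no k≮N) = ≡.trans (≡.cong ℤ→ℚ (r-reduced k (ℕₚ.≮⇒≥ k≮N))) (≡.sym (≡.trans (≡.cong (ℤ→ℚ (+ p) ℚ.*_) (elem-large N c k (ℕₚ.≮⇒≥ k≮N))) (ℚₚ.*-zeroʳ (ℤ→ℚ (+ p)))))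

    integer⇒p∣γ : (∀ i → IsIntegerQ (c i)) → p̂ A.∣ γ
    integer⇒p∣γ int = let r' , r≈ = divide p 1≤p r divisible in r' , A.trans γ≈r (QF.≈⇒≈/ r≈)
      where
      divisible : ∀ k → + p ∣ᶻ coeff r k
      divisible k = go (k ℕ.<? N)
        where
        go : Dec (k ℕ.< N) → + p ∣ᶻ coeff r k
        go (no k≮N) = ≡.subst (+ p ∣ᶻ_) (≡.sym (r-reduced k (ℕₚ.≮⇒≥ k≮N))) (ℤˢ.divides (+ 0) ≡.refl)
        go (yes k<N) = ≡.subst (λ j → + p ∣ᶻ coeff r j) (Finₚ.toℕ-fromℕ< k<N)
          (let z , z≡ = int (fromℕ< k<N) in ℤˢ.divides z (ℤ→ℚ-injective (≡.trans (≡.sym (p*c≡ (fromℕ< k<N)))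
            (≡.trans (≡.cong (ℤ→ℚ (+ p) ℚ.*_) (≡.sym z≡)) (≡.trans (≡.sym (Hom.*-hom ℤ→ℚ-hom (+ p) z)) (≡.cong ℤ→ℚ (ℤₚ.*-comm (+ p) z)))))))

    private
      module Tm = Trinomial a b m 1≤m
      G : P.Carrier
      G = Tm.F

    -- π (y - (a - ω)^p) ≡ y² - a y - b modulo p, and the powers of the right-hand side
    -- up to p - 1 are monic of degree less than 2M.
    p∤γ : ¬ (p̂ A.∣ γ)
    p∤γ p∣γ = prime∤1 pp (≡.subst (+ p ∣ᶻ_) (proj₂ G^e-monic) (reduced-divisible p 1≤p (G P.^ e) G^e-reduced p∣G^e (e ℕ.* (m ℕ.+ m))))
      where
      module Qp = Congruence A p̂
      module K = Kit (Quot A p̂) using (_≈_; trans; sym; +-cong; +-congˡ; -‿cong; *-congʳ; ^-congˡ; module ≈R)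
      module C = CharP (Quot A p̂) pp Qp.a≈/0 using (fixed-ι; +-^p^)
      G^e-monic : MonicOf (e ℕ.* (m ℕ.+ m)) (G P.^ e)
      G^e-monic = monic-^ {f = G} e Tm.F-monic
      degree<N : e ℕ.* (m ℕ.+ m) ℕ.< N
      degree<N = ≡.subst (e ℕ.* (m ℕ.+ m) ℕ.<_) (≡.trans (≡.cong (ℕ._* (m ℕ.+ m)) p≡1+e)
        (≡.trans (ℕₚ.*-comm p (m ℕ.+ m)) (≡.trans (ℕₚ.*-distribʳ-+ p m m) (≡.sym (≡.cong₂ ℕ._+_ M≡ M≡)))))
        (ℕₚ.m<n+m (e ℕ.* (m ℕ.+ m)) (ℕₚ.≤-trans 1≤m (ℕₚ.m≤m+n m m)))
      G^e-reduced : Reduced (G P.^ e)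
      G^e-reduced i N≤i = proj₁ G^e-monic i (ℕₚ.<-≤-trans degree<N N≤i)
      ω' π̃ : A.Carrier
      ω' = A.ι a A.- ω
      π̃ = y A.- ω' A.^ p
      fermat : ∀ z → A.ι z A.^ p K.≈ A.ι z
      fermat z = K.trans (Qp.≈⇒≈/ (A.reflexive (≡.cong (A.ι z A.^_) (≡.sym (ℕₚ.*-identityʳ p))))) (C.fixed-ι 1 z)
      +-^p : ∀ x y → (x A.+ y) A.^ p K.≈ x A.^ p A.+ y A.^ p
      +-^p x y = ≡.subst (λ q → (x A.+ y) A.^ q K.≈ x A.^ q A.+ y A.^ q) (ℕₚ.*-identityʳ p) (C.+-^p^ 1 x y)
      trace : ω A.^ p A.+ ω' A.^ p K.≈ A.ι a
      trace = K.trans (K.sym (+-^p ω ω')) (K.trans (Qp.≈⇒≈/ (A.^-congˡ p (A.solve 2 (λ w a → w A.:+ (a A.:- w) A.:= a) A.refl ω (A.ι a)))) (fermat a))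
      norm : ω A.^ p A.* ω' A.^ p K.≈ A.- A.ι b
      norm = K.trans (Qp.≈⇒≈/ (A.trans (A.sym (A.^-distrib-* ω ω' p)) (A.^-congˡ p (begin
          ω A.* ω' ≈⟨ A.solve 2 (λ w a → w A.:* (a A.:- w) A.:= a A.:* w A.:- w A.:* w) A.refl ω (A.ι a) ⟩
          A.ι a A.* ω A.- ω A.* ω ≈⟨ A.+-congˡ {A.ι a A.* ω} (A.-‿cong root) ⟩
          A.ι a A.* ω A.- (A.ι a A.* ω A.+ A.ι b) ≈⟨ A.solve 2 (λ t b → t A.:- (t A.:+ b) A.:= A.:- b) A.refl (A.ι a A.* ω) (A.ι b) ⟩
          A.- A.ι b ≈⟨ A.ι-neg b ⟨
          A.ι (ℤ.- b) ∎)))) (K.trans (fermat (ℤ.- b)) (Qp.≈⇒≈/ (A.ι-neg b)))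
        where open A.≈R
      -- Frobenius is additive and multiplicative and fixes the integers `a` and `-b` modulo `p`. So
      -- `ω ^ p` and `ω' ^ p` have sum `a` and product `-b`, like `ω` and its conjugate
      -- `ω' = a - ω`, and `y² - a y - b` factors accordingly.
      G≈ππ̃ : G K.≈ π A.* π̃
      G≈ππ̃ = begin
        G ≈⟨ Qp.≈⇒≈/ (QF.≈⇒≈/ (P.+-congʳ { P.- P.ι b} (P.+-congʳ { P.- (P.ι a P.* θ P.^ m)} (P.^-homo-* θ m m)))) ⟩
        y A.* y A.- A.ι a A.* y A.+ A.- A.ι b ≈⟨ K.+-cong (K.+-congˡ {y A.* y} (K.-‿cong (K.*-congʳ {y} trace))) norm ⟨
        y A.* y A.- (ω A.^ p A.+ ω' A.^ p) A.* y A.+ ω A.^ p A.* ω' A.^ p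
          ≈⟨ Qp.≈⇒≈/ (A.solve 3 (λ y u v → y A.:* y A.:- (u A.:+ v) A.:* y A.:+ u A.:* v A.:= (y A.:- u) A.:* (y A.:- v)) A.refl y (ω A.^ p) (ω' A.^ p)) ⟩
        π A.* π̃ ∎
        where open K.≈R
      p∣G^e : p̂ A.∣ G A.^ e
      p∣G^e = Qp.≈/0⇒∣ (K.trans (K.^-congˡ e G≈ππ̃) (K.trans (Qp.≈⇒≈/ (A.^-distrib-* π π̃ e)) (Qp.∣⇒≈/0 (A.∣-*ʳ {p̂} {γ} (π̃ A.^ e) p∣γ))))

    not-integrally-closed : ¬ (∀ (c : Fin N → ℚ) → IsAlgInt N g c → ∀ i → IsIntegerQ (c i))
    not-integrally-closed closed = p∤γ (integer⇒p∣γ (closed c c-algInt))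

  unramified-local-data : ∀ {p} (pp : Prime p) → ¬ (+ p ∣ᶻ b) → ¬ (+ p ∣ᶻ Δ) →
    (∀ c d → + p ∣ᶻ Quadratic.norm a b c d → (+ p ∣ᶻ c) × (+ p ∣ᶻ d)) → ¬ Quadratic.AtPrime.EqualPeriods a b pp →
    ∀ k m → M ≡ m ℕ.* p ℕ.^ suc k → ¬ (p ℕᵈ.∣ m) → LocalCriterion.LocalData A pp
  unramified-local-data {p} pp p∤b p∤Δ inert ¬per k m M≡ p∤m =
    let v , μv≈1 = U.μ-unit inert ¬per
    in LocalDataOf.at-unramified-inside A θ generated a b M 1≤M root pp p∤b p∤Δ k m M≡ p∤m
         (Hom.⟦ eval ⟧ U.μ) (Hom.⟦ eval ⟧ v) (power-eval p (p ℕ.^ 2) U.μ U.ω^p²≡) (unit-eval p U.μ v μv≈1)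
    where
    module U = Quadratic.AtPrime.Unramified a b pp p∤b p∤Δ
    open Quadratic.Eval a b A (θ A.^ M) root using (eval; power-eval; divisible-eval; unit-eval)

  equal-periods-obstruction : ∀ {p} (pp : Prime p) → ¬ (+ p ∣ᶻ b) → ¬ (+ p ∣ᶻ Δ) → p ℕᵈ.∣ M → Quadratic.AtPrime.EqualPeriods a b pp →
    ¬ (∀ (c : Fin N → ℚ) → IsAlgInt N g c → ∀ i → IsIntegerQ (c i))
  equal-periods-obstruction {p} pp p∤b p∤Δ (divides m M≡) per =
    let q , μ≡ = U.equal-periods⇒p∣μ per
    in Obstruction.not-integrally-closed pp m 1≤m M≡ (Hom.⟦ eval ⟧ q)
         (A.trans (power-eval p (p ℕ.^ 2) U.μ U.ω^p²≡) (A.+-congˡ {θ A.^ M} (A.*-congˡ {A.ι (+ p)} (divisible-eval p U.μ q μ≡))))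
    where
    module U = Quadratic.AtPrime.Unramified a b pp p∤b p∤Δ
    open Quadratic.Eval a b A (θ A.^ M) root using (eval; power-eval; divisible-eval; unit-eval)
    1≤m : 1 ℕ.≤ m
    1≤m = ℕₚ.n≢0⇒n>0 λ m≡0 → ℕₚ.<⇒≢ 1≤M (≡.sym (≡.trans M≡ (≡.cong (ℕ._* p) m≡0)))

  monogenic : (∀ {p} (pp : Prime p) → LocalCriterion.LocalData A pp) → ∀ r → 1 ℕ.≤ r → + r ≡ + M ℤ.* (b ℤ.* Δ) →
    (∀ d → d ℤ.* d ℤ.* Δ ≢ + 1) → Monogenic N g
  monogenic local r 1≤r r≡ noUnit = irreducible r 1≤r r≡ noUnit closed , λ c → mk⇔ (algInt⇒integer c closed) (integer⇒algInt c)
    where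
    closed = Descent.integral⇒divisible A A-cancel local

-- Arithmetic of the hypotheses

even⊎odd : ∀ z → (Σ ℤ λ k → z ≡ k ℤ.* + 2) ⊎ (Σ ℤ λ k → z ≡ + 1 ℤ.+ k ℤ.* + 2)
even⊎odd z = go (z ℤᵐ.% (+ 2)) (ℤᵐ.a≡a%n+[a/n]*n z (+ 2)) (ℤᵐ.n%d<d z (+ 2))
  where
  go : ∀ r → z ≡ + r ℤ.+ (z ℤᵐ./ (+ 2)) ℤ.* + 2 → r ℕ.< 2 → (Σ ℤ λ k → z ≡ k ℤ.* + 2) ⊎ (Σ ℤ λ k → z ≡ + 1 ℤ.+ k ℤ.* + 2)
  go zero e _ = inj₁ (z ℤᵐ./ (+ 2) , ≡.trans e (ℤₚ.+-identityˡ _))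
  go (suc zero) e _ = inj₂ (z ℤᵐ./ (+ 2) , e)
  go (suc (suc _)) _ (s≤s (s≤s ()))

2∤⇒odd : ∀ z → ¬ (+ 2 ∣ᶻ z) → Σ ℤ λ k → z ≡ + 1 ℤ.+ k ℤ.* + 2
2∤⇒odd z 2∤z with even⊎odd z
... | inj₁ (k , e) = ⊥-elim (2∤z (ℤˢ.divides k e))
... | inj₂ odd = odd

odd-odd : ∀ x y → ¬ (+ 2 ∣ᶻ x) → ¬ (+ 2 ∣ᶻ y) → + 2 ∣ᶻ x ℤ.- y
odd-odd x y 2∤x 2∤y with 2∤⇒odd x 2∤x | 2∤⇒odd y 2∤y
... | k , ≡.refl | l , ≡.refl = ℤˢ.divides (k ℤ.- l)
      (solve 2 (λ k l → con (+ 1) :+ k :* con (+ 2) :- (con (+ 1) :+ l :* con (+ 2)) := (k :- l) :* con (+ 2)) ≡.refl k l)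
  where open Data.Integer.Solver.+-*-Solver

prime∣^ : ∀ {p} → Prime p → ∀ s n → p ℕᵈ.∣ s ℕ.^ n → p ℕᵈ.∣ s
prime∣^ pp s zero d = ⊥-elim (prime∤1 pp (∣⇒∣ᶻ d))
prime∣^ pp s (suc n) d with Prm.euclidsLemma s (s ℕ.^ n) pp d
... | inj₁ e = e
... | inj₂ e = prime∣^ pp s n e

euclid² : ∀ {p} → Prime p → ∀ x → + p ∣ᶻ x ℤ.* x → + p ∣ᶻ x
euclid² pp x d with euclidᶻ pp x x d
... | inj₁ e = e
... | inj₂ e = e

congruent⇒%≡ : ∀ p .{{_ : ℕ.NonZero p}} m n → + p ∣ᶻ + m ℤ.- + n → m ℕᵐ.% p ≡ n ℕᵐ.% p
congruent⇒%≡ p m n d = go (ℕₚ.≤-total n m)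
  where
  open Data.Integer.Solver.+-*-Solver
  ordered : ∀ m n → n ℕ.≤ m → + p ∣ᶻ + m ℤ.- + n → m ℕᵐ.% p ≡ n ℕᵐ.% p
  ordered m n n≤m d with ∣ᶻ⇒∣ {p} {+ (m ℕ.∸ n)} (≡.subst (+ p ∣ᶻ_) (≡.trans (ℤₚ.m-n≡m⊖n m n) (ℤₚ.⊖-≥ n≤m)) d)
  ... | divides q e = ≡.trans (≡.cong (ℕᵐ._% p) (≡.trans (≡.sym (ℕₚ.m+[n∸m]≡n n≤m)) (≡.cong (n ℕ.+_) e))) (ℕᵐ.[m+kn]%n≡m%n n q p)
  go : n ℕ.≤ m ⊎ m ℕ.≤ n → m ℕᵐ.% p ≡ n ℕᵐ.% p
  go (inj₁ n≤m) = ordered m n n≤m d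
  go (inj₂ m≤n) = ≡.sym (ordered n m m≤n (≡.subst (+ p ∣ᶻ_) (solve 2 (λ m n → :- (m :- n) := n :- m) ≡.refl (+ m) (+ n)) (ℤˢ.∣m⇒∣-m d)))

legendre-residue : ∀ D q x → ¬ (suc q ℕᵈ.∣ D) → (x ℕ.* x) ℕᵐ.% suc q ≡ D ℕᵐ.% suc q → legendre D (suc q) ≡ + 1
legendre-residue D q x p∤D e with D ℕᵐ.% suc q ℕ.≡ᵇ 0 in zero?
... | true = ⊥-elim (p∤D (ℕᵈ.m%n≡0⇒n∣m D (suc q) (ℕₚ.≡ᵇ⇒≡ (D ℕᵐ.% suc q) 0 (≡.subst Data.Bool.T (≡.sym zero?) tt))))
... | false with Finₚ.any? (λ (y : Fin (suc q)) → (toℕ y ℕ.* toℕ y) ℕᵐ.% suc q ℕ.≟ D ℕᵐ.% suc q)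
...   | yes _ = ≡.refl
...   | no none = ⊥-elim (none (fromℕ< (ℕᵐ.m%n<n x (suc q)) , ≡.trans
          (≡.cong (λ y → (y ℕ.* y) ℕᵐ.% suc q) (Finₚ.toℕ-fromℕ< (ℕᵐ.m%n<n x (suc q)))) (≡.trans (≡.sym (ℕᵐ.%-distribˡ-* x x (suc q))) e)))

legendre-zero : ∀ D q → suc q ℕᵈ.∣ D → legendre D (suc q) ≡ + 0
legendre-zero D q p∣D with D ℕᵐ.% suc q | ℕᵈ.n∣m⇒m%n≡0 D (suc q) p∣D
... | zero | _ = ≡.refl

𝒟-cases : ∀ a b → ((Σ ℕ λ k → a ≡ 1 ℕ.+ k ℕ.* 2) × 𝒟 a b ≡ a ℕ.* a ℕ.+ 4 ℕ.* b) ⊎ (Σ ℕ λ k → a ≡ k ℕ.* 2 × 𝒟 a b ≡ k ℕ.* k ℕ.+ b)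
𝒟-cases a b with a ℕᵐ.% 2 | ℕᵐ.m≡m%n+[m/n]*n a 2 | ℕᵐ.m%n<n a 2
... | zero | e | _ = inj₂ (a ℕᵐ./ 2 , e , ≡.refl)
... | suc zero | e | _ = inj₁ ((a ℕᵐ./ 2 , e) , ≡.refl)
... | suc (suc _) | _ | s≤s (s≤s ())

module Hypotheses (a b : ℕ) (1≤a : 1 ℕ.≤ a) (1≤b : 1 ℕ.≤ b) (4∤a : ¬ (4 ℕᵈ.∣ a)) (squarefree-b : SquareFree b) (squarefree-𝒟 : SquareFree (𝒟 a b)) where
  open Data.Integer.Solver.+-*-Solver

  A B Δ D : ℤ
  A = + a
  B = + b
  Δ = A ℤ.* A ℤ.+ + 4 ℤ.* B
  D = + 𝒟 a b

  Δ≡ : Δ ≡ + (a ℕ.* a ℕ.+ 4 ℕ.* b)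
  Δ≡ = ≡.sym (≡.trans (ℤₚ.pos-+ (a ℕ.* a) (4 ℕ.* b)) (≡.cong₂ ℤ._+_ (ℤₚ.pos-* a a) (ℤₚ.pos-* 4 b)))

  D-cases : (¬ (+ 2 ∣ᶻ A) × Δ ≡ D) ⊎ (Σ ℤ λ k → A ≡ k ℤ.* + 2 × D ≡ k ℤ.* k ℤ.+ B × ¬ (+ 2 ∣ᶻ k))
  D-cases with 𝒟-cases a b
  ... | inj₁ ((k , a≡) , 𝒟≡) = inj₁ (2∤A , ≡.trans Δ≡ (≡.cong (λ n → + n) (≡.sym 𝒟≡)))
    where
    2∤A : ¬ (+ 2 ∣ᶻ A)
    2∤A d = Prm.¬prime[1] (≡.subst Prime (ℕᵈ.∣1⇒≡1 (ℕᵈ.∣m+n∣m⇒∣n (≡.subst (2 ℕᵈ.∣_) (≡.trans a≡ (ℕₚ.+-comm 1 (k ℕ.* 2))) (∣ᶻ⇒∣ d)) (ℕᵈ.n∣m*n k))) Prm.prime[2])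
  ... | inj₂ (k , a≡ , 𝒟≡) = inj₂ (+ k , ≡.trans (≡.cong (λ n → + n) a≡) (ℤₚ.pos-* k 2) ,
        ≡.trans (≡.cong (λ n → + n) 𝒟≡) (≡.trans (ℤₚ.pos-+ (k ℕ.* k) b) (≡.cong (ℤ._+ B) (ℤₚ.pos-* k k))) , 2∤k)
    where
    2∤k : ¬ (+ 2 ∣ᶻ + k)
    2∤k d = 4∤a (≡.subst (4 ℕᵈ.∣_) (≡.sym a≡) (ℕᵈ.*-monoˡ-∣ 2 (∣ᶻ⇒∣ {2} {+ k} d)))

  no-unit : ∀ d → d ℤ.* d ℤ.* Δ ≢ + 1
  no-unit d e = ℕₚ.<⇒≢ 1<Δ (≡.sym (ℕₚ.m*n≡1⇒n≡1 ℤ.∣ d ℤ.* d ∣ (a ℕ.* a ℕ.+ 4 ℕ.* b)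
      (≡.trans (≡.sym (≡.trans (ℤₚ.abs-* (d ℤ.* d) Δ) (≡.cong (λ z → ℤ.∣ d ℤ.* d ∣ ℕ.* ℤ.∣ z ∣) Δ≡))) (≡.cong ℤ.∣_∣ e))))
    where
    1<Δ : 1 ℕ.< a ℕ.* a ℕ.+ 4 ℕ.* b
    1<Δ = ℕₚ.≤-trans (ℕₚ.*-mono-≤ {2} {4} {1} {b} (s≤s (s≤s z≤n)) 1≤b) (ℕₚ.m≤n+m (4 ℕ.* b) (a ℕ.* a))

  square∤ : ∀ {n} → SquareFree n → ∀ {p} → Prime p → ¬ (p ℕ.* p ℕᵈ.∣ n)
  square∤ sq {p} pp d = Prm.¬prime[1] (≡.subst Prime (sq p d) pp)

  module At {p : ℕ} (pp : Prime p) where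

    p²∤D : ∀ t → D ≢ t ℤ.* + p ℤ.* + p
    p²∤D t e = square∤ squarefree-𝒟 pp (∣ᶻ⇒∣ {p ℕ.* p} {D} (ℤˢ.divides t (≡.trans e (≡.trans (ℤₚ.*-assoc t (+ p) (+ p)) (≡.cong (t ℤ.*_) (≡.sym (ℤₚ.pos-* p p)))))))

    p∤b/p : ∀ b' → B ≡ b' ℤ.* + p → ¬ (+ p ∣ᶻ b')
    p∤b/p b' b≡ (ℤˢ.divides q e) = square∤ squarefree-b pp (∣ᶻ⇒∣ {p ℕ.* p} {B} (ℤˢ.divides q (≡.trans b≡
      (≡.trans (≡.cong (ℤ._* + p) e) (≡.trans (ℤₚ.*-assoc q (+ p) (+ p)) (≡.cong (q ℤ.*_) (≡.sym (ℤₚ.pos-* p p))))))))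

    p∣D⇒p∣Δ : + p ∣ᶻ D → + p ∣ᶻ Δ
    p∣D⇒p∣Δ d with D-cases
    ... | inj₁ (_ , Δ≡D) = ≡.subst (+ p ∣ᶻ_) (≡.sym Δ≡D) d
    ... | inj₂ (k , A≡ , D≡ , _) = ≡.subst (+ p ∣ᶻ_) (≡.sym (≡.trans (≡.cong (λ t → t ℤ.* t ℤ.+ + 4 ℤ.* B) A≡)
          (≡.trans (solve 2 (λ k b → k :* con (+ 2) :* (k :* con (+ 2)) :+ con (+ 4) :* b := con (+ 4) :* (k :* k :+ b)) ≡.refl k B) (≡.cong (+ 4 ℤ.*_) (≡.sym D≡))))) (ℤˢ.∣n⇒∣m*n (+ 4) d)

    Δ≡D⊎4D : Δ ≡ D ⊎ Δ ≡ + 4 ℤ.* D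
    Δ≡D⊎4D with D-cases
    ... | inj₁ (_ , Δ≡D) = inj₁ Δ≡D
    ... | inj₂ (k , A≡ , D≡ , _) = inj₂ (≡.trans (≡.cong (λ t → t ℤ.* t ℤ.+ + 4 ℤ.* B) A≡)
          (≡.trans (solve 2 (λ k b → k :* con (+ 2) :* (k :* con (+ 2)) :+ con (+ 4) :* b := con (+ 4) :* (k :* k :+ b)) ≡.refl k B) (≡.cong (+ 4 ℤ.*_) (≡.sym D≡))))

    module Odd (p≢2 : p ≢ 2) where
      3≤p : 3 ℕ.≤ p
      3≤p = ℕₚ.≤∧≢⇒< (prime>1 pp) (λ e → p≢2 (≡.sym e))

      p∤2 : ¬ (+ p ∣ᶻ + 2)
      p∤2 d = ℕₚ.<⇒≱ 3≤p (ℕᵈ.∣⇒≤ (∣ᶻ⇒∣ {p} {+ 2} d))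

      p∤4 : ¬ (+ p ∣ᶻ + 4)
      p∤4 d with euclidᶻ pp (+ 2) (+ 2) d
      ... | inj₁ e = p∤2 e
      ... | inj₂ e = p∤2 e

      p∣4*⇒p∣ : ∀ z → + p ∣ᶻ + 4 ℤ.* z → + p ∣ᶻ z
      p∣4*⇒p∣ z d with euclidᶻ pp (+ 4) z d
      ... | inj₁ e = ⊥-elim (p∤4 e)
      ... | inj₂ e = e

      p∣Δ⇒p∣D : + p ∣ᶻ Δ → + p ∣ᶻ D
      p∣Δ⇒p∣D d with Δ≡D⊎4D
      ... | inj₁ e = ≡.subst (+ p ∣ᶻ_) e d
      ... | inj₂ e = p∣4*⇒p∣ D (≡.subst (+ p ∣ᶻ_) e d)

      p²∤Δ : ∀ t → Δ ≢ t ℤ.* + p ℤ.* + p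
      p²∤Δ t e with Δ≡D⊎4D
      ... | inj₁ Δ≡D = p²∤D t (≡.trans (≡.sym Δ≡D) e)
      ... | inj₂ Δ≡4D with p∣4*⇒p∣ D (ℤˢ.divides (t ℤ.* + p) (≡.trans (≡.sym Δ≡4D) e))
      ... | ℤˢ.divides u D≡ with p∣4*⇒p∣ u (ℤˢ.divides t (ℤₚ.*-cancelʳ-≡ (+ 4 ℤ.* u) (t ℤ.* + p) (+ p) {{Prm.prime⇒nonZero pp}}
          (≡.trans (ℤₚ.*-assoc (+ 4) u (+ p)) (≡.trans (≡.cong (+ 4 ℤ.*_) (≡.sym D≡)) (≡.trans (≡.sym Δ≡4D) e)))))
      ... | ℤˢ.divides w u≡ = p²∤D w (≡.trans D≡ (≡.cong (ℤ._* + p) u≡))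

      p∤a : ¬ (+ p ∣ᶻ B) → + p ∣ᶻ Δ → ¬ (+ p ∣ᶻ A)
      p∤a p∤b p∣Δ p∣a = p∤b (p∣4*⇒p∣ B (ℤˢ.∣m+n∣m⇒∣n p∣Δ (ℤˢ.∣m⇒∣m*n A p∣a)))

    -- Says that `ℤ[ω] / p` is a field, in the form in which inverses are computed from norms.
    InertNorm : Set
    InertNorm = ∀ c d → + p ∣ᶻ Quadratic.norm A B c d → (+ p ∣ᶻ c) × (+ p ∣ᶻ d)

    private
      norm : ℤ → ℤ → ℤ
      norm = Quadratic.norm A B

      from-p∣d : ∀ c d → + p ∣ᶻ norm c d → + p ∣ᶻ d → (+ p ∣ᶻ c) × (+ p ∣ᶻ d)
      from-p∣d c d p∣n p∣d = euclid² pp c (≡.subst (+ p ∣ᶻ_)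
          (solve 4 (λ a b c d → (c :* c :+ a :* (c :* d) :- b :* (d :* d)) :- d :* (a :* c :- b :* d) := c :* c) ≡.refl A B c d)
          (ℤˢ.∣m∣n⇒∣m-n p∣n (ℤˢ.∣m⇒∣m*n (A ℤ.* c ℤ.- B ℤ.* d) p∣d))) , p∣d

    -- Multiplying `x² ≡ 𝒟 d²` by the square of an inverse of `d` would exhibit `𝒟` as a square
    -- modulo `p`.
    no-square : legendre (𝒟 a b) p ≢ + 1 → ¬ (+ p ∣ᶻ D) → ∀ x d → ¬ (+ p ∣ᶻ d) → ¬ (+ p ∣ᶻ x ℤ.* x ℤ.- D ℤ.* (d ℤ.* d))
    no-square δ≢1 p∤D x d p∤d p∣ = contradict p pp ≡.refl
      where
      inverse = inverse-mod-prime pp d p∤d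
      u y : ℤ
      u = proj₁ inverse
      y = x ℤ.* u
      p∣y²-D : + p ∣ᶻ + (ℤ.∣ y ∣ ℕ.* ℤ.∣ y ∣) ℤ.- D
      p∣y²-D = ≡.subst (+ p ∣ᶻ_) (≡.trans
        (solve 4 (λ x d u D → (x :* x :- D :* (d :* d)) :* (u :* u) :+ (D :* (d :* u :+ con (+ 1))) :* (d :* u :- con (+ 1)) := (x :* u) :* (x :* u) :- D) ≡.refl x d u D)
        (≡.cong (ℤ._- D) (square-abs y)))
        (ℤˢ.∣m∣n⇒∣m+n (ℤˢ.∣m⇒∣m*n (u ℤ.* u) p∣) (ℤˢ.∣n⇒∣m*n (D ℤ.* (d ℤ.* u ℤ.+ + 1)) (proj₂ inverse)))
        where
        square-abs : ∀ y → y ℤ.* y ≡ + (ℤ.∣ y ∣ ℕ.* ℤ.∣ y ∣)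
        square-abs (+ n) = ≡.sym (ℤₚ.pos-* n n)
        square-abs -[1+ n ] = ≡.refl
      contradict : ∀ q → Prime q → p ≡ q → ⊥
      contradict zero qq _ = Prm.¬prime[0] qq
      contradict (suc q) qq e = δ≢1 (≡.trans (≡.cong (legendre (𝒟 a b)) e) (legendre-residue (𝒟 a b) q ℤ.∣ y ∣
        (λ d → p∤D (≡.subst (λ n → + n ∣ᶻ D) (≡.sym e) (∣⇒∣ᶻ d)))
        (congruent⇒%≡ (suc q) (ℤ.∣ y ∣ ℕ.* ℤ.∣ y ∣) (𝒟 a b) (≡.subst (λ n → + n ∣ᶻ + (ℤ.∣ y ∣ ℕ.* ℤ.∣ y ∣) ℤ.- D) e p∣y²-D))))

    -- 4 norm (c, d) = (2c + ad)² - Δ d², and for a = 2k, norm (c, d) = (c + kd)² - 𝒟 d².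
    inert-odd : legendre (𝒟 a b) p ≢ + 1 → ¬ (+ p ∣ᶻ Δ) → InertNorm
    inert-odd δ≢1 p∤Δ c d p∣n with p ∣ᶻ? d
    ... | yes p∣d = from-p∣d c d p∣n p∣d
    ... | no p∤d with D-cases
    ... | inj₁ (_ , Δ≡D) = ⊥-elim (no-square δ≢1 (λ e → p∤Δ (p∣D⇒p∣Δ e)) (+ 2 ℤ.* c ℤ.+ A ℤ.* d) d p∤d
            (≡.subst (+ p ∣ᶻ_) (≡.trans (solve 4 (λ a b c d → con (+ 4) :* (c :* c :+ a :* (c :* d) :- b :* (d :* d))
                := (con (+ 2) :* c :+ a :* d) :* (con (+ 2) :* c :+ a :* d) :- (a :* a :+ con (+ 4) :* b) :* (d :* d)) ≡.refl A B c d)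
              (≡.cong (λ t → (+ 2 ℤ.* c ℤ.+ A ℤ.* d) ℤ.* (+ 2 ℤ.* c ℤ.+ A ℤ.* d) ℤ.- t ℤ.* (d ℤ.* d)) Δ≡D)) (ℤˢ.∣n⇒∣m*n (+ 4) p∣n)))
    ... | inj₂ (k , A≡ , D≡ , _) = ⊥-elim (no-square δ≢1 (λ e → p∤Δ (p∣D⇒p∣Δ e)) (c ℤ.+ k ℤ.* d) d p∤d
            (≡.subst (+ p ∣ᶻ_) (≡.trans (≡.cong (λ t → c ℤ.* c ℤ.+ t ℤ.* (c ℤ.* d) ℤ.- B ℤ.* (d ℤ.* d)) A≡) (≡.trans
              (solve 4 (λ k b c d → c :* c :+ k :* con (+ 2) :* (c :* d) :- b :* (d :* d) := (c :+ k :* d) :* (c :+ k :* d) :- (k :* k :+ b) :* (d :* d)) ≡.refl k B c d)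
              (≡.cong (λ t → (c ℤ.+ k ℤ.* d) ℤ.* (c ℤ.+ k ℤ.* d) ℤ.- t ℤ.* (d ℤ.* d)) (≡.sym D≡)))) p∣n))

    -- For odd `a` and `b` the norm is `c² + c d + d²` modulo 2, which is even only when `c` and `d`
    -- both are.
    inert-2 : p ≡ 2 → ¬ (+ p ∣ᶻ A) → ¬ (+ p ∣ᶻ B) → InertNorm
    inert-2 p≡2 p∤a p∤b c d p∣n with p ∣ᶻ? d
    ... | yes p∣d = from-p∣d c d p∣n p∣d
    ... | no p∤d with p ∣ᶻ? c
    ... | yes p∣c = ⊥-elim (both (euclidᶻ pp B (d ℤ.* d) (≡.subst (+ p ∣ᶻ_)
              (solve 4 (λ a b c d → c :* (c :+ a :* d) :- (c :* c :+ a :* (c :* d) :- b :* (d :* d)) := b :* (d :* d)) ≡.refl A B c d)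
              (ℤˢ.∣m∣n⇒∣m-n (ℤˢ.∣m⇒∣m*n (c ℤ.+ A ℤ.* d) p∣c) p∣n))))
      where
      both : + p ∣ᶻ B ⊎ + p ∣ᶻ d ℤ.* d → ⊥
      both (inj₁ e) = p∤b e
      both (inj₂ e) = p∤d (euclid² pp d e)
    ... | no p∤c = ⊥-elim (p∤c (euclid² pp c (≡.subst (+ p ∣ᶻ_)
              (solve 4 (λ a b c d → (c :* c :+ a :* (c :* d) :- b :* (d :* d)) :- d :* (a :* c :- b :* d) := c :* c) ≡.refl A B c d)
              (ℤˢ.∣m∣n⇒∣m-n p∣n (ℤˢ.∣n⇒∣m*n d even)))))
      where
      odd* : ∀ x y → ¬ (+ p ∣ᶻ x) → ¬ (+ p ∣ᶻ y) → ¬ (+ p ∣ᶻ x ℤ.* y)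
      odd* x y p∤x p∤y e with euclidᶻ pp x y e
      ... | inj₁ e' = p∤x e'
      ... | inj₂ e' = p∤y e'
      even : + p ∣ᶻ A ℤ.* c ℤ.- B ℤ.* d
      even = ≡.subst (λ n → + n ∣ᶻ A ℤ.* c ℤ.- B ℤ.* d) (≡.sym p≡2) (odd-odd (A ℤ.* c) (B ℤ.* d)
        (λ e → odd* A c p∤a p∤c (≡.subst (λ n → + n ∣ᶻ A ℤ.* c) (≡.sym p≡2) e))
        (λ e → odd* B d p∤b p∤d (≡.subst (λ n → + n ∣ᶻ B ℤ.* d) (≡.sym p≡2) e)))

fermat-ℤ : ∀ {p} → Prime p → ∀ k z → Σ ℤ λ t → z ℤ.^ (p ℕ.^ k) ≡ z ℤ.+ + p ℤ.* t
fermat-ℤ {p} pp k z = convert (C.fixed-ι k z)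
  where
  module Qp = Congruence ℤ-ring (+ p)
  module C = CharP (Quot ℤ-ring (+ p)) pp (CommutativeRing.trans (Quot ℤ-ring (+ p)) (Qp.≈⇒≈/ (ι-ℤ (+ p))) Qp.a≈/0) using (fixed-ι)
  ^≡ : ∀ n → Kit._^_ ℤ-ring z n ≡ z ℤ.^ n
  ^≡ zero = ≡.refl
  ^≡ (suc n) = ≡.cong (z ℤ.*_) (^≡ n)
  convert : Congruent ℤ-ring (+ p) (Kit._^_ ℤ-ring (Kit.ι ℤ-ring z) (p ℕ.^ k)) (Kit.ι ℤ-ring z) → Σ ℤ λ t → z ℤ.^ (p ℕ.^ k) ≡ z ℤ.+ + p ℤ.* t
  convert (by t e) = t , ≡.trans (≡.sym (^≡ (p ℕ.^ k))) (≡.trans (≡.cong (λ y → Kit._^_ ℤ-ring y (p ℕ.^ k)) (≡.sym (ι-ℤ z)))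
    (≡.trans e (≡.cong (λ y → y ℤ.+ + p ℤ.* t) (ι-ℤ z))))

-- Double roots at primes dividing the discriminant

module Ramified (a b : ℕ) (1≤a : 1 ℕ.≤ a) (1≤b : 1 ℕ.≤ b) (4∤a : ¬ (4 ℕᵈ.∣ a)) (squarefree-b : SquareFree b) (squarefree-𝒟 : SquareFree (𝒟 a b)) where
  open Hypotheses a b 1≤a 1≤b 4∤a squarefree-b squarefree-𝒟
  open Data.Integer.Solver.+-*-Solver

  -- a lift of the double root of X² - aX - b modulo p
  DoubleRoot : ℕ → ℕ → Set
  DoubleRoot p k = Σ ℤ λ r → Σ ℤ λ c → Σ ℤ λ v → ¬ (+ p ∣ᶻ r) × ¬ (+ p ∣ᶻ v) ×
    (+ 2 ℤ.* r ℤ.^ (p ℕ.^ k) ℤ.- A ≡ + p ℤ.* c) ×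
    (r ℤ.^ (p ℕ.^ k) ℤ.* r ℤ.^ (p ℕ.^ k) ℤ.- A ℤ.* r ℤ.^ (p ℕ.^ k) ℤ.- B ≡ + p ℤ.* v)

  -- Here `a = 2h` with `h` odd and `b = 1 + 2j`, so 1 is the double root and `f(1) = -2 (h + j)`
  -- for `f(X) = X² - aX - b`. If `h + j` were even, `𝒟 = h² + b = (h - 1)² + 2 (h + j)` would be
  -- divisible by 4.
  double-root-2 : ¬ (+ 2 ∣ᶻ B) → + 2 ∣ᶻ Δ → ∀ k → DoubleRoot 2 k
  double-root-2 2∤b 2∣Δ k with D-cases | 2∤⇒odd B 2∤b
  ... | inj₁ (2∤A , _) | _ = ⊥-elim (2∤A (euclid² Prm.prime[2] A (≡.subst (+ 2 ∣ᶻ_) (solve 2 (λ a b → a :* a :+ con (+ 4) :* b :- con (+ 4) :* b := a :* a) ≡.refl A B)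
        (ℤˢ.∣m∣n⇒∣m-n 2∣Δ (ℤˢ.∣m⇒∣m*n B (ℤˢ.divides (+ 2) ≡.refl))))))
  ... | inj₂ (h , A≡ , D≡ , 2∤h) | j , B≡ = + 1 , + 1 ℤ.- h , ℤ.- (h ℤ.+ j) , prime∤1 Prm.prime[2] , 2∤v ,
        ≡.trans (≡.cong₂ (λ x y → + 2 ℤ.* x ℤ.- y) (ℤₚ.^-zeroˡ (2 ℕ.^ k)) A≡)
          (solve 1 (λ h → con (+ 2) :* con (+ 1) :- h :* con (+ 2) := con (+ 2) :* (con (+ 1) :- h)) ≡.refl h) ,
        ≡.trans (≡.cong (λ x → x ℤ.* x ℤ.- A ℤ.* x ℤ.- B) (ℤₚ.^-zeroˡ (2 ℕ.^ k))) (≡.trans (≡.cong₂ (λ x y → + 1 ℤ.* + 1 ℤ.- x ℤ.* + 1 ℤ.- y) A≡ B≡)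
          (solve 2 (λ h j → con (+ 1) :* con (+ 1) :- h :* con (+ 2) :* con (+ 1) :- (con (+ 1) :+ j :* con (+ 2)) := con (+ 2) :* (:- (h :+ j))) ≡.refl h j))
    where
    2∤v : ¬ (+ 2 ∣ᶻ ℤ.- (h ℤ.+ j))
    2∤v (ℤˢ.divides t e) with 2∤⇒odd h 2∤h
    ... | l , h≡ = At.p²∤D Prm.prime[2] (l ℤ.* l ℤ.- t) (≡.trans D≡ (≡.trans (≡.cong (λ y → h ℤ.* h ℤ.+ y) B≡)
          (≡.trans (solve 2 (λ h j → h :* h :+ (con (+ 1) :+ j :* con (+ 2)) := (h :- con (+ 1)) :* (h :- con (+ 1)) :- con (+ 2) :* (:- (h :+ j))) ≡.refl h j)
          (≡.trans (≡.cong₂ (λ x y → (x ℤ.- + 1) ℤ.* (x ℤ.- + 1) ℤ.- + 2 ℤ.* y) h≡ e)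
          (solve 2 (λ l t → (con (+ 1) :+ l :* con (+ 2) :- con (+ 1)) :* (con (+ 1) :+ l :* con (+ 2) :- con (+ 1)) :- con (+ 2) :* (t :* con (+ 2))
              := (l :* l :- t) :* con (+ 2) :* con (+ 2)) ≡.refl l t)))))

  -- The double root modulo `p` is `a / 2`, represented by `r = a (1 + h)`, and Fermat gives
  -- `w = r ^ (p ^ k) ≡ r`. From `4 f(w) = (2w - a)² - Δ` with `p ∣ 2w - a`, a factor `p²` in `f(w)`
  -- would force `p² ∣ Δ`, against the squarefreeness of `𝒟`.
  double-root-odd : ∀ {p} → Prime p → p ≢ 2 → ∀ h → p ≡ suc (h ℕ.+ h) → ¬ (+ p ∣ᶻ B) → + p ∣ᶻ Δ → ∀ k → DoubleRoot p k
  double-root-odd {p} pp p≢2 h p≡ p∤b p∣Δ k = r , c , v , p∤r , p∤v , trace , ≡.trans value≡ (ℤₚ.*-comm v (+ p))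
    where
    open At pp
    open Odd p≢2
    H r w t c V : ℤ
    H = + h
    r = A ℤ.* (+ 1 ℤ.+ H)
    w = r ℤ.^ (p ℕ.^ k)
    t = proj₁ (fermat-ℤ pp k r)
    c = A ℤ.+ + 2 ℤ.* t
    V = w ℤ.* w ℤ.- A ℤ.* w ℤ.- B
    +p≡ : + p ≡ + 1 ℤ.+ (H ℤ.+ H)
    +p≡ = ≡.trans (≡.cong (λ n → + n) p≡) (≡.trans (ℤₚ.pos-+ 1 (h ℕ.+ h)) (≡.cong (λ y → + 1 ℤ.+ y) (ℤₚ.pos-+ h h)))
    p∤r : ¬ (+ p ∣ᶻ r)
    p∤r d with euclidᶻ pp A (+ 1 ℤ.+ H) d
    ... | inj₁ e = p∤a p∤b p∣Δ e
    ... | inj₂ e = prime∤1 pp (≡.subst (+ p ∣ᶻ_) (≡.trans (≡.cong (λ y → + 2 ℤ.* (+ 1 ℤ.+ H) ℤ.- y) +p≡)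
          (solve 1 (λ h → con (+ 2) :* (con (+ 1) :+ h) :- (con (+ 1) :+ (h :+ h)) := con (+ 1)) ≡.refl H)) (ℤˢ.∣m∣n⇒∣m-n (ℤˢ.∣n⇒∣m*n (+ 2) e) ℤˢ.∣-refl))
    trace : + 2 ℤ.* w ℤ.- A ≡ + p ℤ.* c
    trace = ≡.trans (≡.cong (λ y → + 2 ℤ.* y ℤ.- A) (proj₂ (fermat-ℤ pp k r))) (≡.trans (≡.cong (λ y → + 2 ℤ.* (r ℤ.+ y ℤ.* t) ℤ.- A) +p≡)
      (≡.trans (solve 3 (λ a h t → con (+ 2) :* (a :* (con (+ 1) :+ h) :+ (con (+ 1) :+ (h :+ h)) :* t) :- a := (con (+ 1) :+ (h :+ h)) :* (a :+ con (+ 2) :* t)) ≡.refl A H t)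
        (≡.cong (ℤ._* c) (≡.sym +p≡))))
    4V≡ : + 4 ℤ.* V ≡ (+ p ℤ.* c) ℤ.* (+ p ℤ.* c) ℤ.- Δ
    4V≡ = ≡.trans (solve 3 (λ a b w → con (+ 4) :* (w :* w :- a :* w :- b) := (con (+ 2) :* w :- a) :* (con (+ 2) :* w :- a) :- (a :* a :+ con (+ 4) :* b)) ≡.refl A B w)
      (≡.cong (λ y → y ℤ.* y ℤ.- Δ) trace)
    p∣V : + p ∣ᶻ V
    p∣V = p∣4*⇒p∣ V (≡.subst (+ p ∣ᶻ_) (≡.sym 4V≡) (ℤˢ.∣m∣n⇒∣m-n (ℤˢ.∣m⇒∣m*n (+ p ℤ.* c) (ℤˢ.∣m⇒∣m*n c ℤˢ.∣-refl)) p∣Δ))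
    v : ℤ
    v = ℤˢ.quotient p∣V
    value≡ : V ≡ v ℤ.* + p
    value≡ = ℤˢ._∣_.equality p∣V
    p∤v : ¬ (+ p ∣ᶻ v)
    p∤v (ℤˢ.divides x e) = p²∤Δ (c ℤ.* c ℤ.- + 4 ℤ.* x) (≡.trans (solve 2 (λ u d → d := u :- (u :- d)) ≡.refl ((+ p ℤ.* c) ℤ.* (+ p ℤ.* c)) Δ)
      (≡.trans (≡.cong (λ y → (+ p ℤ.* c) ℤ.* (+ p ℤ.* c) ℤ.- y) (≡.trans (≡.sym 4V≡) (≡.cong (+ 4 ℤ.*_) (≡.trans value≡ (≡.cong (ℤ._* + p) e)))))
        (solve 3 (λ p c x → (p :* c) :* (p :* c) :- con (+ 4) :* (x :* p :* p) := (c :* c :- con (+ 4) :* x) :* p :* p) ≡.refl (+ p) c x)))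

  double-root : ∀ {p} → Prime p → ¬ (+ p ∣ᶻ B) → + p ∣ᶻ Δ → ∀ k → DoubleRoot p k
  double-root {p} pp p∤b p∣Δ k with p ℕ.≟ 2 | prime-parity pp
  ... | yes ≡.refl | _ = double-root-2 p∤b p∣Δ k
  ... | no p≢2 | inj₁ p≡2 = ⊥-elim (p≢2 p≡2)
  ... | no p≢2 | inj₂ (h , p≡) = double-root-odd pp p≢2 h p≡ p∤b p∣Δ k

-- The two implications

module Main (a b : ℕ) (1≤a : 1 ℕ.≤ a) (1≤b : 1 ℕ.≤ b) (4∤a : ¬ (4 ℕᵈ.∣ a)) (squarefree-b : SquareFree b) (squarefree-𝒟 : SquareFree (𝒟 a b))
  (s : ℕ) (1≤s : 1 ℕ.≤ s) (coprime : Cop.Coprime b s)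
  (δ≢1 : ∀ p → Prime p → 3 ℕ.≤ p → p ℕᵈ.∣ s → legendre (𝒟 a b) p ≢ + 1)
  (δ₃ : 3 ℕᵈ.∣ s → legendre (𝒟 a b) 3 ≡ ℤ.- (+ 1)) (n : ℕ) (1≤n : 1 ℕ.≤ n) where
  open Hypotheses a b 1≤a 1≤b 4∤a squarefree-b squarefree-𝒟 renaming (A to α; B to β)
  open Ramified a b 1≤a 1≤b 4∤a squarefree-b squarefree-𝒟 using (double-root)

  M : ℕ
  M = s ℕ.^ n

  1≤M : 1 ℕ.≤ M
  1≤M = ℕₚ.m^n>0 s {{ℕ.>-nonZero 1≤s}} n

  g : ℕ → ℤ
  g = ℱ a b s n

  open Trinomial α β M 1≤M using (N; M<N; 0<N; F; F-coeff; const-suc)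

  F≡g : ∀ k → coeff F k ≡ g k
  F≡g k = ≡.trans (F-coeff k) (go (k ℕ.≟ N) (k ℕ.≟ M) (k ℕ.≟ 0))
    where
    open Data.Integer.Solver.+-*-Solver
    open PolyZ
    N≡ : 2 ℕ.* M ≡ N
    N≡ = ≡.cong (M ℕ.+_) (ℕₚ.+-identityʳ M)
    ≡ᵇ-yes : ∀ m → k ≡ m → (k ℕ.≡ᵇ m) ≡ true
    ≡ᵇ-yes m ≡.refl = ≡ᵇ-refl k
      where
      ≡ᵇ-refl : ∀ k → (k ℕ.≡ᵇ k) ≡ true
      ≡ᵇ-refl zero = ≡.refl
      ≡ᵇ-refl (suc k) = ≡ᵇ-refl k
    ≡ᵇ-no : ∀ m → k ≢ m → (k ℕ.≡ᵇ m) ≡ false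
    ≡ᵇ-no m k≢m with k ℕ.≡ᵇ m in e
    ... | true = ⊥-elim (k≢m (ℕₚ.≡ᵇ⇒≡ k m (≡.subst Data.Bool.T (≡.sym e) tt)))
    ... | false = ≡.refl
    ite : Bool → Bool → Bool → ℤ
    ite u v w = if u then + 1 else if v then ℤ.- (+ a) else if w then ℤ.- (+ b) else + 0
    g≡ : ∀ u v w → (k ℕ.≡ᵇ 2 ℕ.* M) ≡ u → (k ℕ.≡ᵇ M) ≡ v → (k ℕ.≡ᵇ 0) ≡ w → ite u v w ≡ g k
    g≡ u v w ≡.refl ≡.refl ≡.refl = ≡.refl
    go : Dec (k ≡ N) → Dec (k ≡ M) → Dec (k ≡ 0) → coeff (x̂ P.^ N) k ℤ.- α ℤ.* coeff (x̂ P.^ M) k ℤ.- coeff (const β) k ≡ g k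
    go (yes k≡N) _ _ = ≡.trans (≡.cong₂ (λ u v → u ℤ.- α ℤ.* v ℤ.- coeff (const β) k) (≡.trans (≡.cong (coeff (x̂ P.^ N)) k≡N) (x^-top N))
        (x^-other M k (ℕₚ.<⇒≢ (≡.subst (M ℕ.<_) (≡.sym k≡N) M<N))))
      (≡.trans (≡.cong (λ w → + 1 ℤ.- α ℤ.* + 0 ℤ.- w) (const-suc β k (≡.subst (0 ℕ.<_) (≡.sym k≡N) 0<N)))
      (≡.trans (solve 1 (λ a → con (+ 1) :- a :* con (+ 0) :- con (+ 0) := con (+ 1)) ≡.refl α)
        (g≡ true (k ℕ.≡ᵇ M) (k ℕ.≡ᵇ 0) (≡ᵇ-yes (2 ℕ.* M) (≡.trans k≡N (≡.sym N≡))) ≡.refl ≡.refl)))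
    go (no k≢N) (yes k≡M) _ = ≡.trans (≡.cong₂ (λ u v → u ℤ.- α ℤ.* v ℤ.- coeff (const β) k) (x^-other N k (λ e → k≢N (≡.sym e)))
        (≡.trans (≡.cong (coeff (x̂ P.^ M)) k≡M) (x^-top M)))
      (≡.trans (≡.cong (λ w → + 0 ℤ.- α ℤ.* + 1 ℤ.- w) (const-suc β k (≡.subst (0 ℕ.<_) (≡.sym k≡M) 1≤M)))
      (≡.trans (solve 1 (λ a → con (+ 0) :- a :* con (+ 1) :- con (+ 0) := :- a) ≡.refl α)
        (g≡ false true (k ℕ.≡ᵇ 0) (≡ᵇ-no (2 ℕ.* M) (λ e → k≢N (≡.trans e N≡))) (≡ᵇ-yes M k≡M) ≡.refl)))
    go (no k≢N) (no k≢M) k≟0 = ≡.trans (≡.cong₂ (λ u v → u ℤ.- α ℤ.* v ℤ.- coeff (const β) k) (x^-other N k (λ e → k≢N (≡.sym e))) (x^-other M k (λ e → k≢M (≡.sym e))))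
      (≡.trans (solve 2 (λ a w → con (+ 0) :- a :* con (+ 0) :- w := :- w) ≡.refl α (coeff (const β) k)) (last k≟0))
      where
      last : Dec (k ≡ 0) → ℤ.- coeff (const β) k ≡ g k
      last (yes k≡0) = ≡.trans (≡.cong (λ j → ℤ.- coeff (const β) j) k≡0)
        (g≡ false false true (≡ᵇ-no (2 ℕ.* M) (λ e → k≢N (≡.trans e N≡))) (≡ᵇ-no M k≢M) (≡ᵇ-yes 0 k≡0))
      last (no k≢0) = ≡.trans (≡.cong (λ t → ℤ.- t) (const-suc β k (ℕₚ.n≢0⇒n>0 k≢0)))
        (g≡ false false false (≡ᵇ-no (2 ℕ.* M) (λ e → k≢N (≡.trans e N≡))) (≡ᵇ-no M k≢M) (≡ᵇ-no 0 k≢0))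

  p∣s⇒p∤b : ∀ {p} → Prime p → p ℕᵈ.∣ s → ¬ (+ p ∣ᶻ β)
  p∣s⇒p∤b pp p∣s p∣b = Prm.¬prime[1] (≡.subst Prime (coprime (∣ᶻ⇒∣ p∣b , p∣s)) pp)

  inert : ∀ {p} (pp : Prime p) → p ℕᵈ.∣ s → ¬ (+ p ∣ᶻ Δ) → At.InertNorm pp
  inert {p} pp p∣s p∤Δ with p ℕ.≟ 2
  ... | yes p≡2 = At.inert-2 pp p≡2 (λ p∣a → p∤Δ (ℤˢ.∣m∣n⇒∣m+n (ℤˢ.∣m⇒∣m*n α p∣a) (ℤˢ.∣m⇒∣m*n β (≡.subst (λ q → + q ∣ᶻ + 4) (≡.sym p≡2) (ℤˢ.divides (+ 2) ≡.refl)))))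
        (p∣s⇒p∤b pp p∣s)
  ... | no p≢2 = At.inert-odd pp (δ≢1 p pp (At.Odd.3≤p pp p≢2) p∣s) p∤Δ

  A : CRing
  A = TrinomialRing.A α β M 1≤M g F≡g

  -- The cases are the shapes of `X² - aX - b` modulo `p`: the square `X²` if `p` divides `a` and
  -- `b`; `X (X - a)` if it divides `b` but not `a`, where coprimality of `b` and `s` gives `p ∤ M`;
  -- a nonzero double root if `p ∣ Δ` and `p ∤ b`; distinct nonzero roots otherwise. In the last
  -- case a prime dividing `M` is inert, and `no-wss` makes `μ` a unit modulo `p`.
  local-data : (∀ p → Prime p → p ℕᵈ.∣ s → ¬ WallSunSun a b p) → ∀ {p} (pp : Prime p) → LocalCriterion.LocalData A pp
  local-data no-wss {p} pp = split (p ∣ᶻ? β) (p ∣ᶻ? α) (p ∣ᶻ? Δ) (p-free-part pp M 1≤M)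
    where
    open LocalDataOf A (TrinomialRing.θ α β M 1≤M g F≡g) (TrinomialRing.generated α β M 1≤M g F≡g) α β M 1≤M (TrinomialRing.root α β M 1≤M g F≡g) pp
      using (at-p∣a∣b; at-p∣b; at-ramified; at-unramified-outside)
    p∤M : + p ∣ᶻ β → ¬ (p ℕᵈ.∣ M)
    p∤M p∣b p∣M = p∣s⇒p∤b pp (prime∣^ pp s n p∣M) p∣b
    inside : ¬ (+ p ∣ᶻ β) → ¬ (+ p ∣ᶻ Δ) → ∀ k m → M ≡ m ℕ.* p ℕ.^ suc k → ¬ (p ℕᵈ.∣ m) → LocalCriterion.LocalData A pp
    inside p∤b p∤Δ k m M≡ = TrinomialRing.unramified-local-data α β M 1≤M g F≡g pp p∤b p∤Δ (inert pp p∣s p∤Δ)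
      (λ per → no-wss p pp p∣s (pp , Cop.sym (prime∤⇒coprime b pp λ d → p∤b (∣⇒∣ᶻ d)) , per)) k m M≡
      where
      p∣s : p ℕᵈ.∣ s
      p∣s = prime∣^ pp s n (ℕᵈ.∣-trans (ℕᵈ.m∣m*n (p ℕ.^ k)) (divides m M≡))
    split : Dec (+ p ∣ᶻ β) → Dec (+ p ∣ᶻ α) → Dec (+ p ∣ᶻ Δ) → (Σ ℕ λ k → Σ ℕ λ m → (M ≡ m ℕ.* p ℕ.^ k) × ¬ (p ℕᵈ.∣ m)) → LocalCriterion.LocalData A pp
    split (yes (ℤˢ.divides b' b≡)) (yes (ℤˢ.divides a' a≡)) _ _ = at-p∣a∣b a' b' a≡ b≡ (At.p∤b/p pp b' b≡)
    split (yes p∣b@(ℤˢ.divides b' b≡)) (no p∤a) _ _ = at-p∣b p∤a b' b≡ (At.p∤b/p pp b' b≡) (p∤M p∣b)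
    split (no p∤b) _ (yes p∣Δ) (k , m , M≡ , p∤m) =
      let r , c , v , p∤r , p∤v , trace , value = double-root pp p∤b p∣Δ k
      in at-ramified k m M≡ p∤m r c v p∤r p∤v trace value
    split (no p∤b) _ (no p∤Δ) (zero , m , M≡ , p∤m) = at-unramified-outside p∤b p∤Δ (λ d → p∤m (≡.subst (p ℕᵈ.∣_) (≡.trans M≡ (ℕₚ.*-identityʳ m)) d))
    split (no p∤b) _ (no p∤Δ) (suc k , m , M≡ , p∤m) = inside p∤b p∤Δ k m M≡ p∤m

  monogenic : (∀ p → Prime p → p ℕᵈ.∣ s → ¬ WallSunSun a b p) → Monogenic N g
  monogenic no-wss = TrinomialRing.monogenic α β M 1≤M g F≡g (local-data no-wss) r 1≤r r≡ no-unit
    where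
    r : ℕ
    r = M ℕ.* (b ℕ.* (a ℕ.* a ℕ.+ 4 ℕ.* b))
    1≤r : 1 ℕ.≤ r
    1≤r = ℕₚ.*-mono-≤ 1≤M (ℕₚ.*-mono-≤ 1≤b (ℕₚ.≤-trans (ℕₚ.*-mono-≤ 1≤a 1≤a) (ℕₚ.m≤m+n (a ℕ.* a) (4 ℕ.* b))))
    r≡ : + r ≡ + M ℤ.* (β ℤ.* (α ℤ.* α ℤ.+ + 4 ℤ.* β))
    r≡ = ≡.trans (ℤₚ.pos-* M (b ℕ.* (a ℕ.* a ℕ.+ 4 ℕ.* b))) (≡.cong (+ M ℤ.*_) (≡.trans (ℤₚ.pos-* b (a ℕ.* a ℕ.+ 4 ℕ.* b)) (≡.cong (β ℤ.*_) (≡.sym Δ≡))))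

  -- If `p ∤ Δ`, equal periods produce an integral element outside `A`. If `p ∣ Δ`, the
  -- contradiction does not involve monogenicity: equal periods are impossible for `p = 2` and for
  -- `p ≥ 5`, and `3 ∣ Δ` contradicts the value of the Legendre symbol at 3.
  not-wss : Monogenic N g → ∀ p → Prime p → p ℕᵈ.∣ s → ¬ WallSunSun a b p
  not-wss (_ , integral) p pp p∣s (_ , _ , per) = split (p ∣ᶻ? Δ)
    where
    p∤b : ¬ (+ p ∣ᶻ β)
    p∤b = p∣s⇒p∤b pp p∣s
    p∣M : p ℕᵈ.∣ M
    p∣M = ∣-^ n 1≤n
      where
      ∣-^ : ∀ n → 1 ℕ.≤ n → p ℕᵈ.∣ s ℕ.^ n
      ∣-^ (suc n) _ = ℕᵈ.∣m⇒∣m*n (s ℕ.^ n) p∣s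
    ramified-2 : p ≡ 2 → + p ∣ᶻ Δ → ⊥
    ramified-2 p≡2 p∣Δ = Quadratic.AtPrime.ramified-2 α β pp p≡2
      (euclid² pp α (≡.subst (+ p ∣ᶻ_) (solve 2 (λ a b → a :* a :+ con (+ 4) :* b :- con (+ 4) :* b := a :* a) ≡.refl α β)
        (ℤˢ.∣m∣n⇒∣m-n p∣Δ (ℤˢ.∣m⇒∣m*n β (≡.subst (λ q → + q ∣ᶻ + 4) (≡.sym p≡2) (ℤˢ.divides (+ 2) ≡.refl))))))
      (≡.subst (λ q → + q ∣ᶻ β ℤ.- + 1) (≡.sym p≡2) (odd-odd β (+ 1) (λ d → p∤b (≡.subst (λ q → + q ∣ᶻ β) (≡.sym p≡2) d)) (prime∤1 Prm.prime[2])))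
      (λ d → 4∤a (≡.subst (λ q → q ℕ.* q ℕᵈ.∣ a) p≡2 (∣ᶻ⇒∣ d))) per
      where open Data.Integer.Solver.+-*-Solver
    ramified-3 : p ≡ 3 → + p ∣ᶻ Δ → ⊥
    ramified-3 p≡3 p∣Δ = 0≢-1 (≡.trans (≡.sym (legendre-zero (𝒟 a b) 2 (≡.subst (ℕᵈ._∣ 𝒟 a b) p≡3 (∣ᶻ⇒∣ (At.Odd.p∣Δ⇒p∣D pp p≢2 p∣Δ))))) (δ₃ (≡.subst (ℕᵈ._∣ s) p≡3 p∣s)))
      where
      p≢2 : p ≢ 2
      p≢2 e with ≡.trans (≡.sym e) p≡3
      ... | ()
      0≢-1 : + 0 ≢ ℤ.- (+ 1)
      0≢-1 ()
    ramified : + p ∣ᶻ Δ → p ≡ 2 ⊎ (Σ ℕ λ h → p ≡ suc (h ℕ.+ h)) → ⊥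
    ramified p∣Δ (inj₁ p≡2) = ramified-2 p≡2 p∣Δ
    ramified p∣Δ (inj₂ (zero , p≡1)) = Prm.¬prime[1] (≡.subst Prime p≡1 pp)
    ramified p∣Δ (inj₂ (suc zero , p≡3)) = ramified-3 p≡3 p∣Δ
    ramified p∣Δ (inj₂ (h@(suc (suc _)) , p≡)) = Quadratic.AtPrime.RamifiedOdd.no-equal-periods α β pp h (s≤s (s≤s z≤n)) p≡ p∤b p∣Δ per
    split : Dec (+ p ∣ᶻ Δ) → ⊥
    split (yes p∣Δ) = ramified p∣Δ (prime-parity pp)
    split (no p∤Δ) = TrinomialRing.equal-periods-obstruction α β M 1≤M g F≡g pp p∤b p∤Δ p∣M per (λ c → Equivalence.to (integral c))

  conclusion : Monogenic (2 ℕ.* s ℕ.^ n) (ℱ a b s n) ⇔ (∀ p → Prime p → p ℕᵈ.∣ s → ¬ WallSunSun a b p)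
  conclusion = ≡.subst (λ N → Monogenic N g ⇔ (∀ p → Prime p → p ℕᵈ.∣ s → ¬ WallSunSun a b p)) (≡.cong (M ℕ.+_) (≡.sym (ℕₚ.+-identityʳ M)))
    (mk⇔ not-wss monogenic)

open import Data.Nat using (ℕ; _≤_; _^_; _*_)
open import Data.Nat.Divisibility using (_∣_)
open import Data.Nat.Coprimality using (Coprime)
open import Data.Integer using (ℤ; +_; -_)

theorem1p2 : (a b : ℕ) → 1 ≤ a → 1 ≤ b → ¬ (4 ∣ a) → SquareFree b → SquareFree (𝒟 a b) →
    (s : ℕ) → 1 ≤ s → Coprime b s →
    (∀ p → Prime p → 3 ≤ p → p ∣ s → legendre (𝒟 a b) p ≢ + 1) →
    (3 ∣ s → legendre (𝒟 a b) 3 ≡ - (+ 1)) →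
    (n : ℕ) → 1 ≤ n →
    Monogenic (2 * s ^ n) (ℱ a b s n) ⇔ (∀ p → Prime p → p ∣ s → ¬ WallSunSun a b p)
theorem1p2 a b 1≤a 1≤b 4∤a squarefree-b squarefree-𝒟 s 1≤s coprime δ≢1 δ₃ n 1≤n =
  Main.conclusion a b 1≤a 1≤b 4∤a squarefree-b squarefree-𝒟 s 1≤s coprime δ≢1 δ₃ n 1≤n
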